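{- Let $\lambda=\sum_i\lambda_i\Lambda_i$, $\mu=\sum_i\mu_i\Lambda_i$ with $\mu_i\le\lambda_i$ for all $i$, and let $c$ be a fixed inner corner of the shape $\lambda/\mu$. Define $\Xi(\cdot,c)$ on $\mathcal{U}_{(\lambda/\mu)}$ by $\Xi(w,c)=\mathrm{w}(\mathrm{SJDT}(T_w,c))$, where $T_w$ is the admissible skew tableau of shape $\lambda/\mu$ with reading $w$ (and $\Xi(0,c)=0$). Then $\Xi(\cdot,c)$ is a crystal isomorphism from $\mathcal{U}_{(\lambda/\mu)}$ to its image: it is injective and $\Xi(\tilde e_iw,c)=\tilde e_i\Xi(w,c)$, $\Xi(\tilde f_iw,c)=\tilde f_i\Xi(w,c)$ for all $w\in\mathcal{U}_{(\lambda/\mu)}$ and $i=1,\dots,n$.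
   Context: Alphabet $\mathcal{C}_n=\{1<\dots<n<\bar n<\dots<\bar 1\}$ (unbarred letters $\le n$, barred letters $\ge\bar n$), words $\mathcal{C}_n^*$. Kashiwara operators $\tilde e_i,\tilde f_i$ ($1\le i\le n$) of $U_q(\mathfrak{sp}_{2n})$: on letters $\tilde f_i(i)=i+1$, $\tilde f_i(\overline{i+1})=\bar i$ for $i<n$, $\tilde f_n(n)=\bar n$, $\tilde e_i$ inverse, other values $0$; on words via the signature rule (mark letters with $\tilde f_i\ne0$ by $+$, with $\tilde e_i\neq0$ by $-$, cancel adjacent $+-$ pairs repeatedly, $\tilde f_i$ acts on leftmost remaining $+$, $\tilde e_i$ on rightmost remaining $-$, result $0$ if none). Columns, admissibility, splitting: a column is a strictly increasing filling of a one-column diagram, read top to bottom as $\mathrm{w}(C)$. $C$ is admissible if for each $m\le n$ the number $N(m)$ of its letters $x$ with $x\le m$ or $x\ge\bar m$ is $\le m$. Split $(lC,rC)$: with $z_1>\dots>z_r$ the unbarred $z$ with $z,\bar z\in C$, $t_1$ the greatest unbarred letter $<z_1$ with $t_1,\bar t_1\notin C$, and $t_i$ the greatest unbarred letter $<\min(t_{i-1},z_i)$ with $t_i,\bar t_i\notin C$; $rC$ replaces each $\bar z_i$ by $\bar t_i$, $lC$ each $z_i$ by $t_i$ (reordering). $C^*=\Phi(C)$ is the column filled with the unbarred letters of $lC$ increasing followed by the barred letters of $rC$ increasing; $\Phi$ is a bijection from admissible onto coadmissible columns of the same height (coadmissible: for each pair $z,\bar z\in C$, the number of letters $x$ with $z\le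 x\le\bar z$ is $\le n-z+1$). For a non-admissible column all of whose proper subcolumns obtained by deleting the top or bottom box are admissible, the split is computed by the same algorithm in the enlarged alphabet $\{a_1<1<\dots<n<\bar n<\dots<\bar 1<\bar a_1\}$, $a_1$ being allowed as a value $t_i$. Skew tableaux: $Y_\lambda$ has $\lambda_i$ columns of height $i$, top aligned, heights weakly decreasing left to right. A skew tableau of shape $\lambda/\mu$ fills $Y_\lambda\setminus Y_\mu$ with strictly increasing columns; it is admissible if its columns are admissible and the rows of its split form (each column $C$ replaced by $lC\,rC$) weakly increase. Reading: columns from right to left, each top to bottom. $\mathcal{U}_{(\lambda/\mu)}$ is the set of readings of admissible skew tableaux of shape $\lambda/\mu$ (a union of connected components of the crystal graph). An inner corner is a box of $Y_\mu$ with neither the box below nor the box to its right in $Y_\mu$. Symplectic jeu de taquin (Sheats): $\mathrm{SJDT}(T,c)$ is computed by placing a puncture $*$ in $c$ and applying elementary steps; punctured columns are split ignoring $*$, which stays in place in both halves. Let $C_1$ be the column containing $*$ and $C_2$ the next column to its right; in the split form let $a,a'$ be the entries of $lC_1,rC_1$ just below $*$ and $b,b'$ the entries of $lC_2,rC_2$ in the row of $*$ (possibly absent). (1) If $b$ is absent or $a'\le b$: exchange $*$ with the entry just below it in $C_1$. (2) If $a$ is absent or $a'>b$: (i) if $b$ is barred, set $D_1=\Phi(C_1)$ with $*$ replaced by $b$ (a coadmissible column), $C_1'=\Phi^{ -1}(D_1)$, and $C_2'$ = $C_2$ with $b$ removed and $*$ placed in $b$'s box; (ii) if $b$ is unbarred,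 $C_1'$ = $C_1$ with $*$ replaced by $b$, $D_2=\Phi(C_2)$ with $b$ replaced by $*$, and $C_2'=\Phi^{ -1}(D_2)$ (puncture kept in its box). Steps are repeated until $*$ has no box below or to its right; its box is then removed, giving $T'$. Sheats proved this is well defined and that in the split form of $T'$ at most one column $C'_k$ contains $a_1$ (and then also $\bar a_1$). $\mathrm{SJDT}(T,c)=T'$ if $T'$ is admissible; otherwise it is the skew tableau obtained from $T'$ by removing the top and bottom boxes of $C'_k$ and filling the remaining boxes of that column with the word obtained from $\mathrm{w}(C'_k)$ by deleting $z,\bar z$, $z$ the smallest unbarred letter with $z,\bar z\in C'_k$ and $N(z)=z+1$. $\mathrm{SJDT}(T,c)$ is again an admissible skew tableau. -}

module Defs where

open import Data.Nat using (ℕ; zero; suc; _+_; _∸_; _≤_; _<ᵇ_; _≡ᵇ_; _≤ᵇ_; _⊔_; _⊓_)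
open import Data.Bool using (Bool; true; false; _∧_; _∨_; not; if_then_else_)
open import Data.List using (List; []; _∷_; _++_; length; map; concat; reverse; replicate; take; drop; zipWith; zip; last; mapMaybe)
open import Data.Maybe using (Maybe; just; nothing; _>>=_)
open import Data.Product using (Σ; _×_; _,_; proj₁; proj₂)
open import Data.Vec using (Vec; toList)
open import Relation.Binary.PropositionalEquality using (_≡_)

ball : {A : Set} → (A → Bool) → List A → Bool
ball p [] = true
ball p (x ∷ xs) = p x ∧ ball p xs

bany : {A : Set} → (A → Bool) → List A → Bool
bany p [] = false
bany p (x ∷ xs) = p x ∨ bany p xs

bfilter : {A : Set} → (A → Bool) → List A → List A
bfilter p [] = []
bfilter p (x ∷ xs) = if p x then x ∷ bfilter p xs else bfilter p xs

bcount : {A : Set} → (A → Bool) → List A → ℕ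
bcount p xs = length (bfilter p xs)

lookupM : {A : Set} → List A → ℕ → Maybe A
lookupM [] _ = nothing
lookupM (x ∷ xs) zero = just x
lookupM (x ∷ xs) (suc k) = lookupM xs k

headM : {A : Set} → List A → Maybe A
headM [] = nothing
headM (x ∷ _) = just x

insertAt : {A : Set} → ℕ → A → List A → List A
insertAt zero y xs = y ∷ xs
insertAt (suc k) y [] = y ∷ []
insertAt (suc k) y (x ∷ xs) = x ∷ insertAt k y xs

setAt : {A : Set} → ℕ → A → List A → List A
setAt _ y [] = []
setAt zero y (x ∷ xs) = y ∷ xs
setAt (suc k) y (x ∷ xs) = x ∷ setAt k y xs

updateAt : {A : Set} → ℕ → (A → Maybe A) → List A → Maybe (List A)
updateAt _ g [] = nothing
updateAt zero g (x ∷ xs) = Data.Maybe.map (_∷ xs) (g x)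
updateAt (suc k) g (x ∷ xs) = Data.Maybe.map (x ∷_) (updateAt k g xs)

upto : ℕ → List ℕ
upto zero = []
upto (suc n) = upto n ++ (suc n ∷ [])

-- The alphabet.  u i is the unbarred letter i, b i is the barred letter ī.
-- The alphabet C_n consists of u i, b i with 1 ≤ i ≤ n; the enlarged
-- alphabet adds a₁ = u 0 and ā₁ = b 0.
-- Order: u 0 < u 1 < ... < u n < b n < ... < b 1 < b 0.

data Letter : Set where
  u : ℕ → Letter
  b : ℕ → Letter

Word : Set
Word = List Letter

index : Letter → ℕ
index (u i) = i
index (b i) = i

isBarred : Letter → Bool
isBarred (u _) = false
isBarred (b _) = true

_<L_ : Letter → Letter → Bool
u i <L u j = i <ᵇ j
u _ <L b _ = true
b _ <L u _ = false
b i <L b j = j <ᵇ i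

_==L_ : Letter → Letter → Bool
u i ==L u j = i ≡ᵇ j
b i ==L b j = i ≡ᵇ j
u _ ==L b _ = false
b _ ==L u _ = false

_≤L_ : Letter → Letter → Bool
x ≤L y = (x <L y) ∨ (x ==L y)

inAlph : ℕ → Letter → Bool
inAlph n x = (1 ≤ᵇ index x) ∧ (index x ≤ᵇ n)

memL : Letter → List Letter → Bool
memL x C = bany (x ==L_) C

alphabet : ℕ → List Letter
alphabet n = map u (upto n) ++ reverse (map b (upto n))

fL : ℕ → ℕ → Letter → Maybe Letter
fL n i (u j) = if (j ≡ᵇ i) ∧ (i <ᵇ n) then just (u (suc i))
               else (if (j ≡ᵇ i) ∧ (i ≡ᵇ n) then just (b n) else nothing)
fL n i (b j) = if (j ≡ᵇ suc i) ∧ (i <ᵇ n) then just (b i) else nothing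

eL : ℕ → ℕ → Letter → Maybe Letter
eL n i (u j) = if (j ≡ᵇ suc i) ∧ (i <ᵇ n) then just (u i) else nothing
eL n i (b j) = if (j ≡ᵇ i) ∧ (i <ᵇ n) then just (b (suc i))
               else (if (j ≡ᵇ i) ∧ (i ≡ᵇ n) then just (u n) else nothing)

data Sign : Set where
  plus minus none : Sign

isJust : {A : Set} → Maybe A → Bool
isJust (just _) = true
isJust nothing = false

sign : ℕ → ℕ → Letter → Sign
sign n i x = if isJust (fL n i x) then plus else (if isJust (eL n i x) then minus else none)

-- scan k ps ms : left-to-right cancellation of adjacent (+,-) pairs.
-- ps = positions of still uncancelled + (most recent first),
-- ms = positions of uncancelled - (most recent first).
scan : List Sign → ℕ → List ℕ → List ℕ → List ℕ × List ℕ
scan [] k ps ms = ps , ms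
scan (plus ∷ s) k ps ms = scan s (suc k) (k ∷ ps) ms
scan (minus ∷ s) k [] ms = scan s (suc k) [] (k ∷ ms)
scan (minus ∷ s) k (_ ∷ ps) ms = scan s (suc k) ps ms
scan (none ∷ s) k ps ms = scan s (suc k) ps ms

reducedSig : ℕ → ℕ → Word → List ℕ × List ℕ
reducedSig n i w = scan (map (sign n i) w) 0 [] []

-- ẽ_i acts on the rightmost remaining -, f̃_i on the leftmost remaining +
-- (nothing encodes the result 0)
eW : ℕ → ℕ → Word → Maybe Word
eW n i w = headM (proj₂ (reducedSig n i w)) >>= λ k → updateAt k (eL n i) w

fW : ℕ → ℕ → Word → Maybe Word
fW n i w = last (proj₁ (reducedSig n i w)) >>= λ k → updateAt k (fL n i) w

Column : Set
Column = List Letter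

strictlyIncreasing : List Letter → Bool
strictlyIncreasing (x ∷ y ∷ xs) = (x <L y) ∧ strictlyIncreasing (y ∷ xs)
strictlyIncreasing _ = true

weaklyIncreasing : List Letter → Bool
weaklyIncreasing (x ∷ y ∷ xs) = (x ≤L y) ∧ weaklyIncreasing (y ∷ xs)
weaklyIncreasing _ = true

NN : Column → ℕ → ℕ
NN C m = bcount (λ x → (x ≤L u m) ∨ (b m ≤L x)) C

admissibleCol : ℕ → Column → Bool
admissibleCol n C = ball (λ m → NN C m ≤ᵇ m) (upto n)

insertL : Letter → List Letter → List Letter
insertL x [] = x ∷ []
insertL x (y ∷ ys) = if y <L x then y ∷ insertL x ys else x ∷ y ∷ ys

sortL : List Letter → List Letter
sortL [] = []
sortL (x ∷ xs) = insertL x (sortL xs)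

maxIdx : Column → ℕ
maxIdx C = Data.List.foldr (λ x m → index x ⊔ m) 0 C

zsOf : Column → List ℕ
zsOf C = bfilter (λ z → memL (u z) C ∧ memL (b z) C) (Data.List.downFrom (suc (maxIdx C)))

-- greatest k < m with p k (k = 0 stands for a₁); fallback 0
greatestBelow : (ℕ → Bool) → ℕ → ℕ
greatestBelow p zero = zero
greatestBelow p (suc m) = if p m then m else greatestBelow p m

freeIn : Column → ℕ → Bool
freeIn C k = not (memL (u k) C) ∧ not (memL (b k) C)

tsFrom : Column → ℕ → List ℕ → List ℕ
tsFrom C bound [] = []
tsFrom C bound (z ∷ zs) = greatestBelow (freeIn C) (bound ⊓ z) ∷ tsFrom C (greatestBelow (freeIn C) (bound ⊓ z)) zs

tsOf : Column → List ℕ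
tsOf C = tsFrom C (suc (maxIdx C)) (zsOf C)

replaceBy : List (Letter × Letter) → Letter → Letter
replaceBy [] x = x
replaceBy ((y , t) ∷ ps) x = if x ==L y then t else replaceBy ps x

lCol : Column → Column
lCol C = sortL (map (replaceBy (zip (map u (zsOf C)) (map u (tsOf C)))) C)

rCol : Column → Column
rCol C = sortL (map (replaceBy (zip (map b (zsOf C)) (map b (tsOf C)))) C)

Phi : Column → Column
Phi C = bfilter (λ x → not (isBarred x)) (lCol C) ++ bfilter isBarred (rCol C)

eqCol : Column → Column → Bool
eqCol [] [] = true
eqCol (x ∷ xs) (y ∷ ys) = (x ==L y) ∧ eqCol xs ys
eqCol _ _ = false

combos : {A : Set} → List A → ℕ → List (List A)
combos xs zero = [] ∷ []
combos [] (suc k) = []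
combos (x ∷ xs) (suc k) = map (x ∷_) (combos xs k) ++ combos xs (suc k)

-- Φ⁻¹(D): the admissible column C of C_n of the same height with Φ(C) = D
-- (found by exhaustive search; fallback D, never used for coadmissible D)
PhiInv : ℕ → Column → Column
PhiInv n D with bfilter (λ C → admissibleCol n C ∧ eqCol (Phi C) D) (combos (alphabet n) (length D))
... | [] = D
... | C ∷ _ = C

-- Shapes.  lam : Vec ℕ n with lam[i-1] = λ_i (coefficient of Λ_i).
-- Y_λ is given by its list of column heights, left to right (weakly decreasing).

colHeights : (n : ℕ) → Vec ℕ n → List ℕ
colHeights n lam = concat (reverse (zipWith (λ k l → replicate l k) (upto n) (toList lam)))

offsets : (n : ℕ) → Vec ℕ n → Vec ℕ n → List ℕ
offsets n lam mu = colHeights n mu ++ replicate (length (colHeights n lam) ∸ length (colHeights n mu)) 0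

-- box (row r, column j) ∈ Y given by column heights hs; rows 1-based, columns 0-based
inY : List ℕ → ℕ → ℕ → Bool
inY hs r j with lookupM hs j
... | nothing = false
... | just h = (1 ≤ᵇ r) ∧ (r ≤ᵇ h)

InnerCorner : (n : ℕ) → Vec ℕ n → Vec ℕ n → ℕ × ℕ → Set
InnerCorner n lam mu (r , j) =
  (inY (colHeights n mu) r j ≡ true) × (inY (colHeights n mu) (suc r) j ≡ false) × (inY (colHeights n mu) r (suc j) ≡ false)

-- Skew tableaux: list of columns (left to right), column j filling the
-- rows offset_j + 1 .. height_j of Y_λ.

SkewTableau : Set
SkewTableau = List Column

fits : List ℕ → List ℕ → SkewTableau → Bool
fits [] [] [] = true
fits (h ∷ hs) (g ∷ gs) (C ∷ Cs) = (length C ≡ᵇ (h ∸ g)) ∧ fits hs gs Cs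
fits _ _ _ = false

-- entry in row r (1-based) of a column with offset o
entryAt : {A : Set} → ℕ → List A → ℕ → Maybe A
entryAt o C r = if o <ᵇ r then lookupM C (r ∸ suc o) else nothing

splitForm : List ℕ → SkewTableau → List (ℕ × Column)
splitForm (g ∷ gs) (C ∷ Cs) = (g , lCol C) ∷ (g , rCol C) ∷ splitForm gs Cs
splitForm _ _ = []

rowOf : List (ℕ × Column) → ℕ → List Letter
rowOf sf r = mapMaybe (λ oc → entryAt (proj₁ oc) (proj₂ oc) r) sf

admissibleSkew : (n : ℕ) → Vec ℕ n → Vec ℕ n → SkewTableau → Bool
admissibleSkew n lam mu T =
  fits (colHeights n lam) (offsets n lam mu) T
  ∧ ball (λ C → ball (inAlph n) C ∧ strictlyIncreasing C ∧ admissibleCol n C) T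
  ∧ ball (λ r → weaklyIncreasing (rowOf (splitForm (offsets n lam mu) T) r)) (upto n)

reading : SkewTableau → Word
reading T = concat (reverse T)

InU : (n : ℕ) → Vec ℕ n → Vec ℕ n → Word → Set
InU n lam mu w = Σ SkewTableau (λ T → (admissibleSkew n lam mu T ≡ true) × (reading T ≡ w))

chunks : List ℕ → Word → List Word
chunks [] w = []
chunks (l ∷ ls) w = take l w ∷ chunks ls (drop l w)

tableauOf : (n : ℕ) → Vec ℕ n → Vec ℕ n → Word → SkewTableau
tableauOf n lam mu w = reverse (chunks (reverse (zipWith _∸_ (colHeights n lam) (offsets n lam mu))) w)

-- Symplectic jeu de taquin.  Cells: just x = letter x, nothing = puncture *.

Cell : Set
Cell = Maybe Letter

letters : List Cell → List Letter
letters = mapMaybe (λ c → c)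

punctPos : List Cell → ℕ
punctPos [] = zero
punctPos (nothing ∷ _) = zero
punctPos (just _ ∷ cs) = suc (punctPos cs)

posOf : Letter → List Letter → ℕ
posOf x [] = zero
posOf x (y ∷ ys) = if x ==L y then zero else suc (posOf x ys)

removeL : Letter → List Letter → List Letter
removeL x [] = []
removeL x (y ∷ ys) = if x ==L y then ys else y ∷ removeL x ys

fillPuncture : Letter → List Cell → List Cell
fillPuncture x [] = []
fillPuncture x (nothing ∷ cs) = just x ∷ cs
fillPuncture x (just y ∷ cs) = just y ∷ fillPuncture x cs

State : Set
State = List (ℕ × List Cell)

data StepResult : Set where
  done : StepResult
  next : State → ℕ → StepResult

sjdtStep : ℕ → State → ℕ → StepResult
sjdtStep n st j with lookupM st j
... | nothing = done
... | just (o₁ , cs₁) =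
  let C₁ = letters cs₁
      p  = punctPos cs₁
      r  = o₁ + suc p
      -- a, a' : entries of lC₁, rC₁ just below *
      a  = lookupM (lCol C₁) p
      a' = lookupM (rCol C₁) p
      bb : Maybe Letter
      bb = lookupM st (suc j) >>= λ oc → entryAt (proj₁ oc) (lCol (letters (proj₂ oc))) r
      C₂ : List Letter
      C₂ = Data.Maybe.maybe (λ oc → letters (proj₂ oc)) [] (lookupM st (suc j))
      o₂ = Data.Maybe.maybe proj₁ 0 (lookupM st (suc j))
      moveDown = setAt j (o₁ , insertAt (suc p) nothing (map just C₁)) st
      moveRight : Letter → StepResult
      moveRight y =
        if isBarred y
        then next (setAt (suc j) (o₂ , setAt (posOf y C₂) nothing (map just C₂))
                    (setAt j (o₁ , map just (PhiInv n (insertL y (Phi C₁)))) st)) (suc j)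
        else next (setAt (suc j) (o₂ , insertAt (posOf y (Phi C₂)) nothing
                                          (map just (PhiInv n (removeL y (Phi C₂)))))
                    (setAt j (o₁ , fillPuncture y cs₁) st)) (suc j)
  in caseAB a a' bb moveDown moveRight
  where
  caseAB : Maybe Letter → Maybe Letter → Maybe Letter → State → (Letter → StepResult) → StepResult
  caseAB nothing _ nothing _ _ = done
  caseAB (just _) _ nothing down _ = next down j
  caseAB nothing _ (just y) _ right = right y
  caseAB (just _) nothing (just y) _ right = right y
  caseAB (just _) (just x') (just y) down right = if x' ≤L y then next down j else right y

removePuncture : State → List (ℕ × Column)
removePuncture = map (λ oc → proj₁ oc , letters (proj₂ oc))

sjdtRun : ℕ → ℕ → State → ℕ → List (ℕ × Column)
sjdtRun n zero st j = removePuncture st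
sjdtRun n (suc k) st j with sjdtStep n st j
... | done = removePuncture st
... | next st' j' = sjdtRun n k st' j'

-- final correction of a column whose split contains a₁:
-- delete z, z̄ with z smallest unbarred, z, z̄ ∈ C and N(z) = z + 1,
-- removing the top and bottom boxes of the column
smallestBadZ : Column → Maybe ℕ
smallestBadZ C = headM (bfilter (λ z → memL (u z) C ∧ memL (b z) C ∧ (NN C z ≡ᵇ suc z)) (upto (maxIdx C)))

fixColumn : ℕ × Column → ℕ × Column
fixColumn (o , C) with memL (u 0) (lCol C) | smallestBadZ C
... | true | just z = suc o , removeL (b z) (removeL (u z) C)
... | _ | _ = o , C

puncture : ℕ → State → State
puncture j st with lookupM st j
... | nothing = st
... | just (o , cs) = setAt j (o ∸ 1 , nothing ∷ cs) st

SJDT : (n : ℕ) → Vec ℕ n → Vec ℕ n → ℕ × ℕ → SkewTableau → List (ℕ × Column)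
SJDT n lam mu (r , j) T =
  map fixColumn
    (sjdtRun n (suc (n + length T)) (puncture j (zip (offsets n lam mu) (map (map just) T))) j)

Xi : (n : ℕ) → Vec ℕ n → Vec ℕ n → ℕ × ℕ → Word → Word
Xi n lam mu c w = reading (map proj₂ (SJDT n lam mu c (tableauOf n lam mu w)))

-- A column is a pair of sets of indices, those of its unbarred and of its
-- barred letters, and a tableau is a tensor product of columns.  The maps Φ, Φ⁻¹,
-- the passage of the puncture to the next column and the final correction are
-- computed by scans of the index line with a finite state, while an operator
-- changes only two adjacent indices (or the last one).  Hence each of these maps
-- is equivariant as soon as the two steps of its scan at the window of the
-- operator, for every state, form a morphism of small crystals, which is a
-- finite check; admissibility and the row conditions are constant on components
-- for the same reason.  A slide moves the puncture down to the first row in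
-- which rC₁ fails to be at most lC₂ and crosses there, so it is a composite of
-- such maps.
-- Injectivity is an induction over the columns.  The deleted pair z, z̄ of the
-- correction can be put back, the lengths of the columns are known, and two
-- tableaux with the same image cross the same columns.  A crossing of two
-- admissible columns is injective because raising operators reduce this to
-- highest weight pairs, and these are determined by their heights and weight.
module Submission where

open import Defs
open import Data.Nat using (ℕ; zero; suc; _+_; _∸_; _⊓_; pred; _≤_; _<_; z≤n; s≤s; s≤s⁻¹; _≡ᵇ_; _<ᵇ_)
open import Data.Nat.ListAction using (sum)
open import Data.Nat.Properties
open import Data.Nat.Tactic.RingSolver using (solve-∀)
open import Data.Fin using (Fin)
open import Data.Bool using (Bool; true; false; T; _∧_; _∨_; not; if_then_else_)
open import Data.Bool.Properties using (∨-comm; ∨-identityʳ; ∨-zeroʳ)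
open import Data.List using (List; []; _∷_; _++_; length; map; zip; zipWith; mapMaybe; concat; reverse; replicate; downFrom; take; drop; last)
open import Data.List.Properties using (++-identityʳ; ++-assoc; ++-conicalʳ; ∷-injective; length-++; length-map; length-drop; length-take; map-++; map-∘; reverse-++; unfold-reverse; reverse-involutive; concat-++)
open import Data.List.Relation.Unary.All using (All; []; _∷_) renaming (map to mapAll; lookup to lookupAll; tabulate to tabulateAll)
open import Data.List.Relation.Unary.All.Properties using () renaming (++⁺ to All-++)
open import Data.List.Relation.Unary.Any using (here; there)
open import Data.List.Membership.Propositional using (_∈_)
open import Data.List.Membership.Propositional.Properties using (∈-++⁻; ∈-++⁺ˡ; ∈-++⁺ʳ; ∈-map⁺; ∈-map⁻)
open import Data.List.Relation.Binary.Permutation.Propositional using (_↭_; refl; prep; ↭-sym; ↭-trans; ↭-reflexive) renaming (swap to ↭swap; trans to ↭trans)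
open import Data.List.Relation.Binary.Permutation.Propositional.Properties using (++⁺; ++⁺ˡ; ++⁺ʳ; ++-comm; map⁺; ∈-resp-↭)
open import Data.Vec using (Vec; []; _∷_; _∷ʳ_; initLast; toList; fromList; lookup) renaming (replicate to vreplicate)
open import Data.Vec.Properties using (toList∘fromList)
open import Data.Maybe using (Maybe; just; nothing; _>>=_) renaming (map to mapM)
open import Data.Maybe.Properties using (just-injective)
open import Data.Product using (Σ; ∃; _×_; _,_; proj₁; proj₂)
open import Data.Sum using (_⊎_; inj₁; inj₂)
open import Data.Empty using (⊥; ⊥-elim)
open import Data.Unit using (⊤; tt)
open import Function using (id; _∘_; _∋_)
open import Relation.Binary.Definitions using (tri<; tri≈; tri>)
open import Relation.Binary.PropositionalEquality using (_≡_; _≢_; refl; cong; cong₂; sym; trans; subst; subst₂; module ≡-Reasoning)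

-- Crystals

record Crystal : Set₁ where
  no-eta-equality
  field
    Car : Set
    f e : Car → Maybe Car
    ε φ : Car → ℕ

open Crystal

mapM-∘ : {A B C : Set} {g : B → C} {h : A → B} (m : Maybe A) → mapM g (mapM h m) ≡ mapM (g ∘ h) m
mapM-∘ (just _) = refl
mapM-∘ nothing = refl

mapM-id : {A : Set} (m : Maybe A) → mapM id m ≡ m
mapM-id (just _) = refl
mapM-id nothing = refl

mapM-cong : {A B : Set} {g h : A → B} → (∀ a → g a ≡ h a) → (m : Maybe A) → mapM g m ≡ mapM h m
mapM-cong p (just a) = cong just (p a)
mapM-cong p nothing = refl

-- Being a morphism is a pointwise notion: the maps below respect the crystal
-- structure only on a domain that is itself stable under the operators.
record Mor (A B : Crystal) (g : Car A → Car B) (a : Car A) : Set where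
  constructor mor
  field
    f-eq : f B (g a) ≡ mapM g (f A a)
    e-eq : e B (g a) ≡ mapM g (e A a)
    ε-eq : ε B (g a) ≡ ε A a
    φ-eq : φ B (g a) ≡ φ A a

open Mor

record Inv (A : Crystal) {L : Set} (lab : Car A → L) (a : Car A) : Set where
  constructor inv
  field
    f-inv : mapM lab (f A a) ≡ mapM (λ _ → lab a) (f A a)
    e-inv : mapM lab (e A a) ≡ mapM (λ _ → lab a) (e A a)

open Inv

Mor-id : ∀ {A} a → Mor A A id a
Mor-id {A} a = mor (sym (mapM-id (f A a))) (sym (mapM-id (e A a))) refl refl

Mor-∘ : ∀ {A B C} {g : Car A → Car B} {h : Car B → Car C} {a} →
        Mor B C h (g a) → Mor A B g a → Mor A C (h ∘ g) a
Mor-∘ {A} {h = h} {a} q p = mor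
  (trans (f-eq q) (trans (cong (mapM h) (f-eq p)) (mapM-∘ (f A a))))
  (trans (e-eq q) (trans (cong (mapM h) (e-eq p)) (mapM-∘ (e A a))))
  (trans (ε-eq q) (ε-eq p)) (trans (φ-eq q) (φ-eq p))

Mor-ext : ∀ {A B} {g h : Car A → Car B} {a} → (∀ x → g x ≡ h x) → Mor A B g a → Mor A B h a
Mor-ext {A} {B} {a = a} eq p = mor
  (trans (cong (f B) (sym (eq a))) (trans (f-eq p) (mapM-cong eq (f A a))))
  (trans (cong (e B) (sym (eq a))) (trans (e-eq p) (mapM-cong eq (e A a))))
  (trans (cong (ε B) (sym (eq a))) (ε-eq p)) (trans (cong (φ B) (sym (eq a))) (φ-eq p))

Mor-along : ∀ {A' A B} {c : Car A' → Car A} {g : Car A → Car B} {a} →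
            Mor A' A c a → Mor A' B (g ∘ c) a → Mor A B g (c a)
Mor-along {A'} {g = g} {a} p q = mor
  (trans (f-eq q) (trans (sym (mapM-∘ (f A' a))) (cong (mapM g) (sym (f-eq p)))))
  (trans (e-eq q) (trans (sym (mapM-∘ (e A' a))) (cong (mapM g) (sym (e-eq p)))))
  (trans (ε-eq q) (sym (ε-eq p))) (trans (φ-eq q) (sym (φ-eq p)))

Mor-square : ∀ {A' A B' B} {c : Car A' → Car A} {g : Car A → Car B} {g' : Car A' → Car B'} {d : Car B' → Car B} {a} →
             (∀ x → d (g' x) ≡ g (c x)) →
             Mor A' A c a → Mor A' B' g' a → Mor B' B d (g' a) → Mor A B g (c a)
Mor-square eq p q r = Mor-along p (Mor-ext eq (Mor-∘ r q))

Inv-along : ∀ {A' A L} {c : Car A' → Car A} {lab : Car A → L} {a} →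
            Mor A' A c a → Inv A' (lab ∘ c) a → Inv A lab (c a)
Inv-along {A'} {A} {c = c} {lab} {a} p q = inv
  (trans (cong (mapM lab) (f-eq p)) (trans (mapM-∘ (f A' a)) (trans (f-inv q)
     (trans (sym (mapM-∘ (f A' a))) (cong (mapM (λ _ → lab (c a))) (sym (f-eq p)))))))
  (trans (cong (mapM lab) (e-eq p)) (trans (mapM-∘ (e A' a)) (trans (e-inv q)
     (trans (sym (mapM-∘ (e A' a))) (cong (mapM (λ _ → lab (c a))) (sym (e-eq p)))))))

Inv-pull : ∀ {A B L} {g : Car A → Car B} {lab : Car B → L} {a} →
           Mor A B g a → Inv B lab (g a) → Inv A (lab ∘ g) a
Inv-pull {A} {g = g} {lab} {a} p q = inv
  (trans (sym (mapM-∘ (f A a))) (trans (cong (mapM lab) (sym (f-eq p))) (trans (f-inv q)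
     (trans (cong (mapM (λ _ → lab (g a))) (f-eq p)) (mapM-∘ (f A a))))))
  (trans (sym (mapM-∘ (e A a))) (trans (cong (mapM lab) (sym (e-eq p))) (trans (e-inv q)
     (trans (cong (mapM (λ _ → lab (g a))) (e-eq p)) (mapM-∘ (e A a))))))

mapM-inv₁ : {A L : Set} {lab : A → L} {l : L} (m : Maybe A) {a' : A} →
            mapM lab m ≡ mapM (λ _ → l) m → m ≡ just a' → lab a' ≡ l
mapM-inv₁ (just _) refl refl = refl

Inv-f : ∀ {A L} {lab : Car A → L} {a a'} → Inv A lab a → f A a ≡ just a' → lab a' ≡ lab a
Inv-f {A} {a = a} i eq = mapM-inv₁ (f A a) (f-inv i) eq

Inv-e : ∀ {A L} {lab : Car A → L} {a a'} → Inv A lab a → e A a ≡ just a' → lab a' ≡ lab a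
Inv-e {A} {a = a} i eq = mapM-inv₁ (e A a) (e-inv i) eq

Inv-intro : ∀ {A L} {lab : Car A → L} {a} → (∀ {a'} → f A a ≡ just a' → lab a' ≡ lab a) →
            (∀ {a'} → e A a ≡ just a' → lab a' ≡ lab a) → Inv A lab a
Inv-intro {A} {lab = lab} {a} p q = inv (go (f A a) p) (go (e A a) q)
  where
  go : (m : Maybe (Car A)) → (∀ {a'} → m ≡ just a' → lab a' ≡ lab a) → mapM lab m ≡ mapM (λ _ → lab a) m
  go (just x) h = cong just (h refl)
  go nothing h = refl

Inv-map : ∀ {A L M} {lab : Car A → L} {a} (h : L → M) → Inv A lab a → Inv A (h ∘ lab) a
Inv-map {A} h i = Inv-intro {A} (λ eq → cong h (Inv-f i eq)) (λ eq → cong h (Inv-e i eq))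

Inv-bind : ∀ {A L M} {lab : Car A → L} {a} (h : L → Car A → M) → Inv A lab a → Inv A (h (lab a)) a →
           Inv A (λ x → h (lab x) x) a
Inv-bind {A} {lab = lab} {a} h i j = Inv-intro {A}
  (λ {a'} eq → trans (cong (λ l → h l a') (Inv-f i eq)) (Inv-f j eq))
  (λ {a'} eq → trans (cong (λ l → h l a') (Inv-e i eq)) (Inv-e j eq))

Mor-bind : ∀ {A B L} {lab : Car A → L} {a} (h : L → Car A → Car B) → Inv A lab a → Mor A B (h (lab a)) a →
           Mor A B (λ x → h (lab x) x) a
Mor-bind {A} {B} {L} {lab} {a} h i p = mor
  (trans (f-eq p) (go (f A a) (λ eq → Inv-f i eq)))
  (trans (e-eq p) (go (e A a) (λ eq → Inv-e i eq))) (ε-eq p) (φ-eq p)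
  where
  go : (m : Maybe (Car A)) → (∀ {a'} → m ≡ just a' → lab a' ≡ lab a) →
       mapM (h (lab a)) m ≡ mapM (λ x → h (lab x) x) m
  go (just x) hyp = cong (λ l → just (h l x)) (sym (hyp refl))
  go nothing hyp = refl

Mor-on : ∀ {A B L} {lab : Car A → L} {g h : Car A → Car B} {a} → Inv A lab a →
         (∀ x → lab x ≡ lab a → g x ≡ h x) → Mor A B g a → Mor A B h a
Mor-on {A} {B} {lab = lab} {g} {h} {a} i eq p = mor
  (trans (cong (f B) (sym (eq a refl))) (trans (f-eq p) (go (f A a) (λ q → Inv-f i q))))
  (trans (cong (e B) (sym (eq a refl))) (trans (e-eq p) (go (e A a) (λ q → Inv-e i q))))
  (trans (cong (ε B) (sym (eq a refl))) (ε-eq p)) (trans (cong (φ B) (sym (eq a refl))) (φ-eq p))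
  where
  go : (m : Maybe (Car A)) → (∀ {a'} → m ≡ just a' → lab a' ≡ lab a) → mapM g m ≡ mapM h m
  go (just x) hyp = cong just (eq x (hyp refl))
  go nothing hyp = refl

pick : {A : Set} → ℕ → A → A → A
pick zero x y = y
pick (suc _) x y = x

infixr 5 _⊗_

_⊗_ : Crystal → Crystal → Crystal
(A ⊗ B) .Car = Car A × Car B
(A ⊗ B) .f (a , a') = pick (φ A a ∸ ε B a') (mapM (_, a') (f A a)) (mapM (a ,_) (f B a'))
(A ⊗ B) .e (a , a') = pick (ε B a' ∸ φ A a) (mapM (a ,_) (e B a')) (mapM (_, a') (e A a))
(A ⊗ B) .ε (a , a') = ε A a + (ε B a' ∸ φ A a)
(A ⊗ B) .φ (a , a') = φ B a' + (φ A a ∸ ε B a')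

pick-map : {A B : Set} (g : A → B) (k : ℕ) {x y : Maybe A} → mapM g (pick k x y) ≡ pick k (mapM g x) (mapM g y)
pick-map g zero = refl
pick-map g (suc k) = refl

infixr 5 _⊗ᵐ_

_⊗ᵐ_ : {A B C D : Set} → (A → C) → (B → D) → A × B → C × D
(g ⊗ᵐ h) (a , a') = g a , h a'

Mor-⊗ : ∀ {A B C D} {g : Car A → Car C} {h : Car B → Car D} {a a'} →
        Mor A C g a → Mor B D h a' → Mor (A ⊗ B) (C ⊗ D) (g ⊗ᵐ h) (a , a')
Mor-⊗ {A} {B} {C} {D} {g} {h} {a} {a'} p q = mor fe ee
  (cong₂ _+_ (ε-eq p) (cong₂ _∸_ (ε-eq q) (φ-eq p)))
  (cong₂ _+_ (φ-eq q) (cong₂ _∸_ (φ-eq p) (ε-eq q)))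
  where
  left : (m : Maybe (Car A)) → mapM (_, h a') (mapM g m) ≡ mapM (g ⊗ᵐ h) (mapM (_, a') m)
  left m = trans (mapM-∘ m) (sym (mapM-∘ m))
  right : (m : Maybe (Car B)) → mapM (g a ,_) (mapM h m) ≡ mapM (g ⊗ᵐ h) (mapM (a ,_) m)
  right m = trans (mapM-∘ m) (sym (mapM-∘ m))
  fe : f (C ⊗ D) (g a , h a') ≡ mapM (g ⊗ᵐ h) (f (A ⊗ B) (a , a'))
  fe rewrite ε-eq q | φ-eq p | f-eq p | f-eq q | left (f A a) | right (f B a') =
    sym (pick-map (g ⊗ᵐ h) (φ A a ∸ ε B a'))
  ee : e (C ⊗ D) (g a , h a') ≡ mapM (g ⊗ᵐ h) (e (A ⊗ B) (a , a'))
  ee rewrite ε-eq q | φ-eq p | e-eq p | e-eq q | left (e A a) | right (e B a') =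
    sym (pick-map (g ⊗ᵐ h) (ε B a' ∸ φ A a))

Inv-⊗ˡ : ∀ {A B L} {lab : Car A → L} {a a'} → Inv A lab a → Inv (A ⊗ B) (lab ∘ proj₁) (a , a')
Inv-⊗ˡ {A} {B} {a = a} {a'} i = inv (go (φ A a ∸ ε B a') (f A a) (f B a') (f-inv i)) (go' (ε B a' ∸ φ A a) (e A a) (e B a') (e-inv i))
  where
  go : ∀ {lab} {l} k (m : Maybe (Car A)) (m' : Maybe (Car B)) → mapM lab m ≡ mapM (λ _ → lab a) m →
       mapM (lab ∘ proj₁) (pick k (mapM (_, a') m) (mapM (a ,_) m')) ≡ mapM (λ _ → lab a) (pick k (mapM (_, l) m) (mapM (a ,_) m'))
  go zero m (just x) p = refl
  go zero m nothing p = refl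
  go (suc k) (just x) m' p = p
  go (suc k) nothing m' p = refl
  go' : ∀ {lab} {l} k (m : Maybe (Car A)) (m' : Maybe (Car B)) → mapM lab m ≡ mapM (λ _ → lab a) m →
       mapM (lab ∘ proj₁) (pick k (mapM (a ,_) m') (mapM (_, a') m)) ≡ mapM (λ _ → lab a) (pick k (mapM (a ,_) m') (mapM (_, l) m))
  go' (suc k) m (just x) p = refl
  go' (suc k) m nothing p = refl
  go' zero (just x) m' p = p
  go' zero nothing m' p = refl

Inv-⊗ʳ : ∀ {A B L} {lab : Car B → L} {a a'} → Inv B lab a' → Inv (A ⊗ B) (lab ∘ proj₂) (a , a')
Inv-⊗ʳ {A} {B} {lab = lab} {a} {a'} i = Inv-intro {A ⊗ B}
  (λ eq → go (φ A a ∸ ε B a') (f A a) (f B a') (Inv-f i) eq)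
  (λ eq → go' (ε B a' ∸ φ A a) (e A a) (e B a') (Inv-e i) eq)
  where
  go : ∀ k (m : Maybe (Car A)) (m' : Maybe (Car B)) → (∀ {x} → m' ≡ just x → lab x ≡ lab a') →
       ∀ {x} → pick k (mapM (_, a') m) (mapM (a ,_) m') ≡ just x → lab (proj₂ x) ≡ lab a'
  go zero m (just x) p refl = p refl
  go (suc k) (just x) m' p refl = refl
  go' : ∀ k (m : Maybe (Car A)) (m' : Maybe (Car B)) → (∀ {x} → m' ≡ just x → lab x ≡ lab a') →
       ∀ {x} → pick k (mapM (a ,_) m') (mapM (_, a') m) ≡ just x → lab (proj₂ x) ≡ lab a'
  go' (suc k) m (just x) p refl = p refl
  go' zero (just x) m' p refl = refl

+-∸-split : ∀ x y z → (x + y) ∸ z ≡ (x ∸ z) + (y ∸ (z ∸ x))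
+-∸-split zero y zero = refl
+-∸-split zero y (suc z) = refl
+-∸-split (suc x) y zero = refl
+-∸-split (suc x) y (suc z) = +-∸-split x y z

assocR : {A B C : Set} → (A × B) × C → A × (B × C)
assocR ((a , a') , a'') = a , (a' , a'')

assocL : {A B C : Set} → A × (B × C) → (A × B) × C
assocL (a , (a' , a'')) = (a , a') , a''

∸-disjoint : ∀ m k → m ∸ k ≡ 0 ⊎ k ∸ m ≡ 0
∸-disjoint zero k = inj₁ (0∸n≡0 k)
∸-disjoint (suc m) zero = inj₂ refl
∸-disjoint (suc m) (suc k) = ∸-disjoint m k

pick-assoc : {T : Set} (y r q : ℕ) (P Q R : T) → q ≡ 0 ⊎ r ≡ 0 →
  pick (y ∸ r) P (pick q Q R) ≡ pick (q + (y ∸ r)) (pick y P Q) R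
pick-assoc zero r zero P Q R _ rewrite 0∸n≡0 r = refl
pick-assoc zero r (suc q) P Q R _ rewrite 0∸n≡0 r = refl
pick-assoc (suc y) r zero P Q R _ with suc y ∸ r
... | zero = refl
... | suc _ = refl
pick-assoc (suc y) .0 (suc q) P Q R (inj₂ refl) = refl

Mor-assocR : ∀ {A B C} (x : (Car A × Car B) × Car C) → Mor ((A ⊗ B) ⊗ C) (A ⊗ (B ⊗ C)) assocR x
Mor-assocR {A} {B} {C} ((a , a') , a'') = mor fe ee εe φe
  where
  fa = mapM (_, (a' , a'')) (f A a)
  fb = mapM (λ z → a , (z , a'')) (f B a')
  fc = mapM (λ z → a , (a' , z)) (f C a'')
  ea = mapM (_, (a' , a'')) (e A a)
  eb = mapM (λ z → a , (z , a'')) (e B a')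
  ec = mapM (λ z → a , (a' , z)) (e C a'')
  q = φ B a' ∸ ε C a''
  r = ε C a'' ∸ φ B a'
  y = φ A a ∸ ε B a'
  y' = ε B a' ∸ φ A a
  fe : f (A ⊗ (B ⊗ C)) (a , (a' , a'')) ≡ mapM assocR (f ((A ⊗ B) ⊗ C) ((a , a') , a''))
  fe = begin
    pick (φ A a ∸ (ε B a' + r)) fa (mapM (a ,_) (pick q (mapM (_, a'') (f B a')) (mapM (a' ,_) (f C a''))))
      ≡⟨ cong (pick (φ A a ∸ (ε B a' + r)) fa) (trans (pick-map (a ,_) q) (cong₂ (pick q) (mapM-∘ (f B a')) (mapM-∘ (f C a'')))) ⟩
    pick (φ A a ∸ (ε B a' + r)) fa (pick q fb fc)
      ≡⟨ cong (λ z → pick z fa (pick q fb fc)) (sym (∸-+-assoc (φ A a) (ε B a') r)) ⟩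
    pick (y ∸ r) fa (pick q fb fc)
      ≡⟨ pick-assoc y r q fa fb fc (∸-disjoint (φ B a') (ε C a'')) ⟩
    pick (q + (y ∸ r)) (pick y fa fb) fc
      ≡⟨ cong (λ z → pick z (pick y fa fb) fc) (sym (+-∸-split (φ B a') y (ε C a''))) ⟩
    pick ((φ B a' + y) ∸ ε C a'') (pick y fa fb) fc
      ≡⟨ cong₂ (pick ((φ B a' + y) ∸ ε C a''))
           (sym (trans (cong (mapM assocR) (pick-map (_, a'') y)) (trans (pick-map assocR y)
             (cong₂ (pick y) (trans (cong (mapM assocR) (mapM-∘ (f A a))) (mapM-∘ (f A a))) (trans (cong (mapM assocR) (mapM-∘ (f B a'))) (mapM-∘ (f B a')))))))
           (sym (mapM-∘ (f C a''))) ⟩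
    pick ((φ B a' + y) ∸ ε C a'') (mapM assocR (mapM (_, a'') (pick y (mapM (_, a') (f A a)) (mapM (a ,_) (f B a'))))) (mapM assocR (mapM ((a , a') ,_) (f C a'')))
      ≡⟨ sym (pick-map assocR ((φ B a' + y) ∸ ε C a'')) ⟩
    mapM assocR (f ((A ⊗ B) ⊗ C) ((a , a') , a'')) ∎
    where open ≡-Reasoning
  ee : e (A ⊗ (B ⊗ C)) (a , (a' , a'')) ≡ mapM assocR (e ((A ⊗ B) ⊗ C) ((a , a') , a''))
  ee = begin
    pick ((ε B a' + r) ∸ φ A a) (mapM (a ,_) (pick r (mapM (a' ,_) (e C a'')) (mapM (_, a'') (e B a')))) ea
      ≡⟨ cong (λ z → pick ((ε B a' + r) ∸ φ A a) z ea) (trans (pick-map (a ,_) r) (cong₂ (pick r) (mapM-∘ (e C a'')) (mapM-∘ (e B a')))) ⟩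
    pick ((ε B a' + r) ∸ φ A a) (pick r ec eb) ea
      ≡⟨ cong (λ z → pick z (pick r ec eb) ea) (+-∸-split (ε B a') r (φ A a)) ⟩
    pick (y' + (r ∸ y)) (pick r ec eb) ea
      ≡⟨ sym (pick-assoc r y y' ec eb ea (∸-disjoint (ε B a') (φ A a))) ⟩
    pick (r ∸ y) ec (pick y' eb ea)
      ≡⟨ cong (λ z → pick z ec (pick y' eb ea)) (∸-+-assoc (ε C a'') (φ B a') y) ⟩
    pick (ε C a'' ∸ (φ B a' + y)) ec (pick y' eb ea)
      ≡⟨ cong₂ (pick (ε C a'' ∸ (φ B a' + y))) (sym (mapM-∘ (e C a'')))
           (sym (trans (cong (mapM assocR) (pick-map (_, a'') y')) (trans (pick-map assocR y')
             (cong₂ (pick y') (trans (cong (mapM assocR) (mapM-∘ (e B a'))) (mapM-∘ (e B a'))) (trans (cong (mapM assocR) (mapM-∘ (e A a))) (mapM-∘ (e A a))))))) ⟩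
    pick (ε C a'' ∸ (φ B a' + y)) (mapM assocR (mapM ((a , a') ,_) (e C a''))) (mapM assocR (mapM (_, a'') (pick y' (mapM (a ,_) (e B a')) (mapM (_, a') (e A a)))))
      ≡⟨ sym (pick-map assocR (ε C a'' ∸ (φ B a' + y))) ⟩
    mapM assocR (e ((A ⊗ B) ⊗ C) ((a , a') , a'')) ∎
    where open ≡-Reasoning
  εe : ε A a + ((ε B a' + r) ∸ φ A a) ≡ (ε A a + y') + (ε C a'' ∸ (φ B a' + y))
  εe = trans (cong (ε A a +_) (trans (+-∸-split (ε B a') r (φ A a)) (cong (y' +_) (∸-+-assoc (ε C a'') (φ B a') y))))
             (sym (+-assoc (ε A a) y' _))
  φe : (φ C a'' + q) + (φ A a ∸ (ε B a' + r)) ≡ φ C a'' + ((φ B a' + y) ∸ ε C a'')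
  φe = trans (+-assoc (φ C a'') q _) (cong (φ C a'' +_) (trans (cong (q +_) (sym (∸-+-assoc (φ A a) (ε B a') r)))
             (sym (+-∸-split (φ B a') y (ε C a'')))))

Mor-inverse : ∀ {A B} {g : Car A → Car B} {h : Car B → Car A} {a} → (∀ x → h (g x) ≡ x) →
              Mor A B g a → Mor B A h (g a)
Mor-inverse {A} {h = h} {a} hg p = Mor-along p (Mor-ext (λ x → sym (hg x)) (Mor-id {A} a))

Mor-assocL : ∀ {A B C} (x : Car A × (Car B × Car C)) → Mor (A ⊗ (B ⊗ C)) ((A ⊗ B) ⊗ C) assocL x
Mor-assocL {A} {B} {C} (a , (a' , a'')) = Mor-inverse {A = (A ⊗ B) ⊗ C} {A ⊗ (B ⊗ C)} (λ _ → refl) (Mor-assocR ((a , a') , a''))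

focus : {A B C D : Set} → (A × B) × (C × D) → A × ((B × C) × D)
focus ((a , a') , (c , d)) = a , ((a' , c) , d)

unfocus : {A B C D : Set} → A × ((B × C) × D) → (A × B) × (C × D)
unfocus (a , ((a' , c) , d)) = (a , a') , (c , d)

Mor-focus : ∀ {A B C D} x → Mor ((A ⊗ B) ⊗ (C ⊗ D)) (A ⊗ ((B ⊗ C) ⊗ D)) focus x
Mor-focus {A} {B} {C} {D} ((a , a') , (c , d)) =
  Mor-∘ (Mor-⊗ (Mor-id {A} a) (Mor-assocL {B} {C} {D} (a' , (c , d)))) (Mor-assocR {A} {B} {C ⊗ D} ((a , a') , (c , d)))

Mor-unfocus : ∀ {A B C D} x → Mor (A ⊗ ((B ⊗ C) ⊗ D)) ((A ⊗ B) ⊗ (C ⊗ D)) unfocus x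
Mor-unfocus {A} {B} {C} {D} (a , ((a' , c) , d)) =
  Mor-inverse {A = (A ⊗ B) ⊗ (C ⊗ D)} {A ⊗ ((B ⊗ C) ⊗ D)} (λ _ → refl) (Mor-focus ((a , a') , (c , d)))

pattern ok = mor refl refl refl refl

pattern ik = inv refl refl

-- Columns as pairs of sets

Bits : ℕ → Set
Bits = Vec Bool

lower raise : ∀ {n} → ℕ → Bits n → Maybe (Bits n)
lower k [] = nothing
lower zero (x ∷ []) = nothing
lower zero (true ∷ false ∷ s) = just (false ∷ true ∷ s)
lower zero (true ∷ true ∷ s) = nothing
lower zero (false ∷ y ∷ s) = nothing
lower (suc k) (x ∷ s) = mapM (x ∷_) (lower k s)
raise k [] = nothing
raise zero (x ∷ []) = nothing
raise zero (false ∷ true ∷ s) = just (true ∷ false ∷ s)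
raise zero (false ∷ false ∷ s) = nothing
raise zero (true ∷ y ∷ s) = nothing
raise (suc k) (x ∷ s) = mapM (x ∷_) (raise k s)

canLower canRaise : ∀ {n} → ℕ → Bits n → ℕ
canLower k [] = 0
canLower zero (x ∷ []) = 0
canLower zero (true ∷ false ∷ s) = 1
canLower zero (true ∷ true ∷ s) = 0
canLower zero (false ∷ y ∷ s) = 0
canLower (suc k) (x ∷ s) = canLower k s
canRaise k [] = 0
canRaise zero (x ∷ []) = 0
canRaise zero (false ∷ true ∷ s) = 1
canRaise zero (false ∷ false ∷ s) = 0
canRaise zero (true ∷ y ∷ s) = 0
canRaise (suc k) (x ∷ s) = canRaise k s

-- Sets of unbarred (𝕌) and barred (𝔹) letters under the operators that
-- exchange the letters in positions k and k + 1 (indices k + 1 and k + 2).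
𝕌 𝔹 : ℕ → ℕ → Crystal
𝕌 n k .Car = Bits n
𝕌 n k .f = lower k
𝕌 n k .e = raise k
𝕌 n k .ε = canRaise k
𝕌 n k .φ = canLower k
𝔹 n k .Car = Bits n
𝔹 n k .f = raise k
𝔹 n k .e = lower k
𝔹 n k .ε = canLower k
𝔹 n k .φ = canRaise k

𝕌-∷ : ∀ {n k} x (s : Bits n) → Mor (𝕌 n k) (𝕌 (suc n) (suc k)) (x ∷_) s
𝕌-∷ x s = ok

𝔹-∷ : ∀ {n k} x (s : Bits n) → Mor (𝔹 n k) (𝔹 (suc n) (suc k)) (x ∷_) s
𝔹-∷ x s = ok

Window : Set
Window = Bool × Bool

wlower wraise : Window → Maybe Window
wlower (true , false) = just (false , true)
wlower (true , true) = nothing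
wlower (false , y) = nothing
wraise (false , true) = just (true , false)
wraise (false , false) = nothing
wraise (true , y) = nothing

wcanLower wcanRaise : Window → ℕ
wcanLower (true , false) = 1
wcanLower (true , true) = 0
wcanLower (false , y) = 0
wcanRaise (false , true) = 1
wcanRaise (false , false) = 0
wcanRaise (true , y) = 0

𝕎𝕌 𝕎𝔹 : Crystal
𝕎𝕌 .Car = Window
𝕎𝕌 .f = wlower
𝕎𝕌 .e = wraise
𝕎𝕌 .ε = wcanRaise
𝕎𝕌 .φ = wcanLower
𝕎𝔹 .Car = Window
𝕎𝔹 .f = wraise
𝕎𝔹 .e = wlower
𝕎𝔹 .ε = wcanLower
𝕎𝔹 .φ = wcanRaise

embed : ∀ {n} → Bits n → Window → Bits (suc (suc n))
embed s (x , y) = x ∷ y ∷ s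

𝕌-embed : ∀ {n} (s : Bits n) w → Mor 𝕎𝕌 (𝕌 (suc (suc n)) 0) (embed s) w
𝕌-embed s (true , true) = ok
𝕌-embed s (true , false) = ok
𝕌-embed s (false , true) = ok
𝕌-embed s (false , false) = ok

𝔹-embed : ∀ {n} (s : Bits n) w → Mor 𝕎𝔹 (𝔹 (suc (suc n)) 0) (embed s) w
𝔹-embed s (true , true) = ok
𝔹-embed s (true , false) = ok
𝔹-embed s (false , true) = ok
𝔹-embed s (false , false) = ok

all₄ : {P : Window → Window → Set} →
  P (true , true) (true , true) → P (true , true) (true , false) → P (true , true) (false , true) → P (true , true) (false , false) →
  P (true , false) (true , true) → P (true , false) (true , false) → P (true , false) (false , true) → P (true , false) (false , false) →
  P (false , true) (true , true) → P (false , true) (true , false) → P (false , true) (false , true) → P (false , true) (false , false) →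
  P (false , false) (true , true) → P (false , false) (true , false) → P (false , false) (false , true) → P (false , false) (false , false) →
  ∀ v w → P v w
all₄ a _ _ _ _ _ _ _ _ _ _ _ _ _ _ _ (true , true) (true , true) = a
all₄ _ a _ _ _ _ _ _ _ _ _ _ _ _ _ _ (true , true) (true , false) = a
all₄ _ _ a _ _ _ _ _ _ _ _ _ _ _ _ _ (true , true) (false , true) = a
all₄ _ _ _ a _ _ _ _ _ _ _ _ _ _ _ _ (true , true) (false , false) = a
all₄ _ _ _ _ a _ _ _ _ _ _ _ _ _ _ _ (true , false) (true , true) = a
all₄ _ _ _ _ _ a _ _ _ _ _ _ _ _ _ _ (true , false) (true , false) = a
all₄ _ _ _ _ _ _ a _ _ _ _ _ _ _ _ _ (true , false) (false , true) = a
all₄ _ _ _ _ _ _ _ a _ _ _ _ _ _ _ _ (true , false) (false , false) = a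
all₄ _ _ _ _ _ _ _ _ a _ _ _ _ _ _ _ (false , true) (true , true) = a
all₄ _ _ _ _ _ _ _ _ _ a _ _ _ _ _ _ (false , true) (true , false) = a
all₄ _ _ _ _ _ _ _ _ _ _ a _ _ _ _ _ (false , true) (false , true) = a
all₄ _ _ _ _ _ _ _ _ _ _ _ a _ _ _ _ (false , true) (false , false) = a
all₄ _ _ _ _ _ _ _ _ _ _ _ _ a _ _ _ (false , false) (true , true) = a
all₄ _ _ _ _ _ _ _ _ _ _ _ _ _ a _ _ (false , false) (true , false) = a
all₄ _ _ _ _ _ _ _ _ _ _ _ _ _ _ a _ (false , false) (false , true) = a
all₄ _ _ _ _ _ _ _ _ _ _ _ _ _ _ _ a (false , false) (false , false) = a

-- One step of the scan behind the splitting: p counts the letters z with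
-- z and z̄ present that still look for a free t; ub and bb are the new entries.
pst : Bool → Bool → ℕ → ℕ
pst true true p = suc p
pst true false p = p
pst false true p = p
pst false false p = pred p

ub bb : Bool → Bool → ℕ → Bool
ub true true p = false
ub true false p = true
ub false true p = false
ub false false zero = false
ub false false (suc p) = true
bb true true p = false
bb true false p = false
bb false true p = true
bb false false zero = false
bb false false (suc p) = true

pend : ∀ {n} → ℕ → Bits n → Bits n → ℕ
pend p [] [] = p
pend p (x ∷ us) (y ∷ bs) = pst x y (pend p us bs)

uS bS : ∀ {n} → ℕ → Bits n → Bits n → Bits n
uS p [] [] = []
uS p (x ∷ us) (y ∷ bs) = ub x y (pend p us bs) ∷ uS p us bs
bS p [] [] = []
bS p (x ∷ us) (y ∷ bs) = bb x y (pend p us bs) ∷ bS p us bs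

qend : ∀ {n} → ℕ → Bits n → Bits n → ℕ
qend q [] [] = q
qend q (x ∷ us) (y ∷ bs) = qend (pst x y q) us bs

uI bI : ∀ {n} → ℕ → Bits n → Bits n → Bits n
uI q [] [] = []
uI q (x ∷ us) (y ∷ bs) = ub x y q ∷ uI (pst x y q) us bs
bI q [] [] = []
bI q (x ∷ us) (y ∷ bs) = bb x y q ∷ bI (pst x y q) us bs

Col : ℕ → Set
Col n = Bits n × Bits n

Φ : ∀ {n} → ℕ → Col n → Col n
Φ p (us , bs) = bS p us bs , uS p us bs

Φ⁻¹ : ∀ {n} → ℕ → Col n → Col n
Φ⁻¹ q (bs , us) = uI q us bs , bI q us bs

Pend : ∀ {n} → ℕ → Col n → ℕ
Pend p (us , bs) = pend p us bs

step-inverse-u : ∀ x y p → ub (ub x y p) (bb x y p) (pst x y p) ≡ x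
step-inverse-u true true p = refl
step-inverse-u true false p = refl
step-inverse-u false true p = refl
step-inverse-u false false zero = refl
step-inverse-u false false (suc p) = refl

step-inverse-b : ∀ x y p → bb (ub x y p) (bb x y p) (pst x y p) ≡ y
step-inverse-b true true p = refl
step-inverse-b true false p = refl
step-inverse-b false true p = refl
step-inverse-b false false zero = refl
step-inverse-b false false (suc p) = refl

step-inverse-p : ∀ x y p → pst (ub x y p) (bb x y p) (pst x y p) ≡ p
step-inverse-p true true p = refl
step-inverse-p true false p = refl
step-inverse-p false true p = refl
step-inverse-p false false zero = refl
step-inverse-p false false (suc p) = refl

uI-uS : ∀ {n} p (us bs : Bits n) → uI (pend p us bs) (uS p us bs) (bS p us bs) ≡ us
uI-uS p [] [] = refl
uI-uS p (x ∷ us) (y ∷ bs) rewrite step-inverse-u x y (pend p us bs) | step-inverse-p x y (pend p us bs) = cong (x ∷_) (uI-uS p us bs)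

bI-bS : ∀ {n} p (us bs : Bits n) → bI (pend p us bs) (uS p us bs) (bS p us bs) ≡ bs
bI-bS p [] [] = refl
bI-bS p (x ∷ us) (y ∷ bs) rewrite step-inverse-b x y (pend p us bs) | step-inverse-p x y (pend p us bs) = cong (y ∷_) (bI-bS p us bs)

qend-Φ : ∀ {n} p (us bs : Bits n) → qend (pend p us bs) (uS p us bs) (bS p us bs) ≡ p
qend-Φ p [] [] = refl
qend-Φ p (x ∷ us) (y ∷ bs) rewrite step-inverse-p x y (pend p us bs) = qend-Φ p us bs

pend-I : ∀ {n} q (us bs : Bits n) → pend (qend q us bs) (uI q us bs) (bI q us bs) ≡ q
pend-I q [] [] = refl
pend-I q (x ∷ us) (y ∷ bs) rewrite pend-I (pst x y q) us bs = step-inverse-p x y q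

uS-I : ∀ {n} q (us bs : Bits n) → uS (qend q us bs) (uI q us bs) (bI q us bs) ≡ us
uS-I q [] [] = refl
uS-I q (x ∷ us) (y ∷ bs) rewrite pend-I (pst x y q) us bs = cong₂ _∷_ (step-inverse-u x y q) (uS-I (pst x y q) us bs)

bS-I : ∀ {n} q (us bs : Bits n) → bS (qend q us bs) (uI q us bs) (bI q us bs) ≡ bs
bS-I q [] [] = refl
bS-I q (x ∷ us) (y ∷ bs) rewrite pend-I (pst x y q) us bs = cong₂ _∷_ (step-inverse-b x y q) (bS-I (pst x y q) us bs)

wΦ : ℕ → Window × Window → Window × Window
wΦ p ((x , y) , (x' , y')) = (bb x x' (pst y y' p) , bb y y' p) , (ub x x' (pst y y' p) , ub y y' p)

wΦ⁻¹ : ℕ → Window × Window → Window × Window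
wΦ⁻¹ q ((x' , y') , (x , y)) = (ub x x' q , ub y y' (pst x x' q)) , (bb x x' q , bb y y' (pst x x' q))

wΦ-mor : ∀ p v w → Mor (𝕎𝕌 ⊗ 𝕎𝔹) (𝕎𝔹 ⊗ 𝕎𝕌) (wΦ p) (v , w)
wΦ-mor 0 = all₄ ok ok ok ok ok ok ok ok ok ok ok ok ok ok ok ok
wΦ-mor 1 = all₄ ok ok ok ok ok ok ok ok ok ok ok ok ok ok ok ok
wΦ-mor (suc (suc p)) = all₄ ok ok ok ok ok ok ok ok ok ok ok ok ok ok ok ok

wΦ-pend : ∀ p v w → Inv (𝕎𝕌 ⊗ 𝕎𝔹) (λ { ((x , y) , (x' , y')) → pst x x' (pst y y' p) }) (v , w)
wΦ-pend 0 = all₄ ik ik ik ik ik ik ik ik ik ik ik ik ik ik ik ik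
wΦ-pend 1 = all₄ ik ik ik ik ik ik ik ik ik ik ik ik ik ik ik ik
wΦ-pend (suc (suc p)) = all₄ ik ik ik ik ik ik ik ik ik ik ik ik ik ik ik ik

wΦ⁻¹-mor : ∀ p v w → Mor (𝕎𝔹 ⊗ 𝕎𝕌) (𝕎𝕌 ⊗ 𝕎𝔹) (wΦ⁻¹ p) (v , w)
wΦ⁻¹-mor 0 = all₄ ok ok ok ok ok ok ok ok ok ok ok ok ok ok ok ok
wΦ⁻¹-mor 1 = all₄ ok ok ok ok ok ok ok ok ok ok ok ok ok ok ok ok
wΦ⁻¹-mor (suc (suc p)) = all₄ ok ok ok ok ok ok ok ok ok ok ok ok ok ok ok ok

wq : ℕ → Window × Window → ℕ
wq q ((x' , y') , (x , y)) = pst y y' (pst x x' q)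

wΦ⁻¹-inv : ∀ p v w → Inv (𝕎𝔹 ⊗ 𝕎𝕌) (wq p) (v , w)
wΦ⁻¹-inv 0 = all₄ ik ik ik ik ik ik ik ik ik ik ik ik ik ik ik ik
wΦ⁻¹-inv 1 = all₄ ik ik ik ik ik ik ik ik ik ik ik ik ik ik ik ik
wΦ⁻¹-inv (suc (suc p)) = all₄ ik ik ik ik ik ik ik ik ik ik ik ik ik ik ik ik

pend-inv : ∀ {n} k p (us bs : Bits n) → Inv (𝕌 n k ⊗ 𝔹 n k) (Pend p) (us , bs)
pend-inv k p [] [] = ik
pend-inv zero p (x ∷ []) (y ∷ []) = ik
pend-inv zero p (x ∷ x' ∷ us) (y ∷ y' ∷ bs) =
  Inv-along {c = embed us ⊗ᵐ embed bs} (Mor-⊗ (𝕌-embed us (x , x')) (𝔹-embed bs (y , y')))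
    (wΦ-pend (pend p us bs) (x , x') (y , y'))
pend-inv (suc k) p (x ∷ us) (y ∷ bs) =
  Inv-along {c = (x ∷_) ⊗ᵐ (y ∷_)} (Mor-⊗ (𝕌-∷ x us) (𝔹-∷ y bs)) (Inv-map (pst x y) (pend-inv k p us bs))

Φ-mor : ∀ {n} k p (us bs : Bits n) → Mor (𝕌 n k ⊗ 𝔹 n k) (𝔹 n k ⊗ 𝕌 n k) (Φ p) (us , bs)
Φ-mor k p [] [] = ok
Φ-mor zero p (x ∷ []) (y ∷ []) = ok
Φ-mor {suc (suc n)} zero p (x ∷ x' ∷ us) (y ∷ y' ∷ bs) =
  Mor-square {c = embed us ⊗ᵐ embed bs} {Φ p} {wΦ (pend p us bs)} {embed (bS p us bs) ⊗ᵐ embed (uS p us bs)} (λ _ → refl)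
    (Mor-⊗ {𝕎𝕌} {𝕎𝔹} {𝕌 _ 0} {𝔹 _ 0} (𝕌-embed us (x , x')) (𝔹-embed bs (y , y')))
    (wΦ-mor (pend p us bs) (x , x') (y , y'))
    (Mor-⊗ {𝕎𝔹} {𝕎𝕌} {𝔹 _ 0} {𝕌 _ 0} (𝔹-embed _ _) (𝕌-embed _ _))
Φ-mor {suc n} (suc k) p (x ∷ us) (y ∷ bs) =
  Mor-along {c = (x ∷_) ⊗ᵐ (y ∷_)} (Mor-⊗ (𝕌-∷ x us) (𝔹-∷ y bs))
    (Mor-bind {lab = Pend p} (λ l c → (bb x y l ∷ proj₁ (Φ p c)) , (ub x y l ∷ proj₂ (Φ p c))) (pend-inv k p us bs)
      (Mor-∘ (Mor-⊗ {g = bb x y (pend p us bs) ∷_} {ub x y (pend p us bs) ∷_} (𝔹-∷ _ _) (𝕌-∷ _ _)) (Φ-mor k p us bs)))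

Φ⁻¹-mor : ∀ {n} k q (bs us : Bits n) → Mor (𝔹 n k ⊗ 𝕌 n k) (𝕌 n k ⊗ 𝔹 n k) (Φ⁻¹ q) (bs , us)
Φ⁻¹-mor k q [] [] = ok
Φ⁻¹-mor zero q (y ∷ []) (x ∷ []) = ok
Φ⁻¹-mor zero q (y ∷ y' ∷ bs) (x ∷ x' ∷ us) =
  Mor-along {c = embed bs ⊗ᵐ embed us} (Mor-⊗ (𝔹-embed bs (y , y')) (𝕌-embed us (x , x')))
    (Mor-bind {lab = wq q} (λ l w → (embed (uI l us bs) ⊗ᵐ embed (bI l us bs)) (wΦ⁻¹ q w)) (wΦ⁻¹-inv q (y , y') (x , x'))
      (Mor-∘ (Mor-⊗ {g = embed (uI (wq q ((y , y') , (x , x'))) us bs)} {embed (bI (wq q ((y , y') , (x , x'))) us bs)}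
               (𝕌-embed _ _) (𝔹-embed _ _))
             (wΦ⁻¹-mor q (y , y') (x , x'))))
Φ⁻¹-mor {suc n} (suc k) q (y ∷ bs) (x ∷ us) =
  Mor-along {c = (y ∷_) ⊗ᵐ (x ∷_)} (Mor-⊗ (𝔹-∷ y bs) (𝕌-∷ x us))
    (Mor-∘ (Mor-⊗ {g = ub x y q ∷_} {bb x y q ∷_} (𝕌-∷ _ _) (𝔹-∷ _ _)) (Φ⁻¹-mor k (pst x y q) bs us))

-- Crossings

-- State of the walk that compares lC₂ with rC₁ letter by letter: opn k means
-- that k + 1 more letters of lC₂ than of rC₁ are missing for the crossing,
-- clo g that the crossing letter is already found and the current gap is g,
-- over that the gap has become negative.
data Walk : Set where
  over : Walk
  opn clo : ℕ → Walk

step : Walk → Bool → Bool → Walk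
step over _ _ = over
step l true true = l
step l false false = l
step (opn zero) true false = clo zero
step (opn (suc k)) true false = opn k
step (clo zero) true false = over
step (clo (suc g)) true false = clo g
step (opn k) false true = opn (suc k)
step (clo g) false true = clo (suc g)

live : Walk → Bool
live over = false
live (opn _) = true
live (clo _) = true

sw₂ sw₁ : Walk → Bool → Bool → Bool
sw₂ (opn zero) true false = false
sw₂ _ x y = x
sw₁ (opn zero) true false = true
sw₁ _ x y = y

walkU walkB : ∀ {n} → Walk → Bits n → Bits n → Walk
walkU l [] [] = l
walkU l (x ∷ s) (y ∷ t) = walkU (step l x y) s t
walkB l [] [] = l
walkB l (x ∷ s) (y ∷ t) = step (walkB l s t) x y

swapU₂ swapU₁ swapB₂ swapB₁ : ∀ {n} → Walk → Bits n → Bits n → Bits n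
swapU₂ l [] [] = []
swapU₂ l (x ∷ s) (y ∷ t) = sw₂ l x y ∷ swapU₂ (step l x y) s t
swapU₁ l [] [] = []
swapU₁ l (x ∷ s) (y ∷ t) = sw₁ l x y ∷ swapU₁ (step l x y) s t
swapB₂ l [] [] = []
swapB₂ l (x ∷ s) (y ∷ t) = sw₂ (walkB l s t) x y ∷ swapB₂ l s t
swapB₁ l [] [] = []
swapB₁ l (x ∷ s) (y ∷ t) = sw₁ (walkB l s t) x y ∷ swapB₁ l s t

WalkU WalkB : ∀ {n} → Walk → Bits n × Bits n → Walk
WalkU l (s , t) = walkU l s t
WalkB l (s , t) = walkB l s t

SwapU SwapB : ∀ {n} → Walk → Bits n × Bits n → Bits n × Bits n
SwapU l (s , t) = swapU₂ l s t , swapU₁ l s t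
SwapB l (s , t) = swapB₂ l s t , swapB₁ l s t

wWalkU wWalkB : Walk → Window × Window → Walk
wWalkU l ((x , y) , (x' , y')) = step (step l x x') y y'
wWalkB l ((x , y) , (x' , y')) = step (step l y y') x x'

wSwapU wSwapB : Walk → Window × Window → Window × Window
wSwapU l ((x , y) , (x' , y')) = (sw₂ l x x' , sw₂ (step l x x') y y') , (sw₁ l x x' , sw₁ (step l x x') y y')
wSwapB l ((x , y) , (x' , y')) = (sw₂ (step l y y') x x' , sw₂ l y y') , (sw₁ (step l y y') x x' , sw₁ l y y')

live-step : ∀ l x y → live (step l x y) ≡ true → live l ≡ true
live-step over x y ()
live-step (opn k) x y _ = refl
live-step (clo k) x y _ = refl

live-walkU : ∀ {n} l (s t : Bits n) → live (walkU l s t) ≡ true → live l ≡ true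
live-walkU l [] [] h = h
live-walkU l (x ∷ s) (y ∷ t) h = live-step l x y (live-walkU (step l x y) s t h)

live-walkB : ∀ {n} l (s t : Bits n) → live (walkB l s t) ≡ true → live l ≡ true
live-walkB l [] [] h = h
live-walkB l (x ∷ s) (y ∷ t) h = live-walkB l s t (live-step (walkB l s t) x y h)

wWalkU-inv : ∀ l v w → Inv (𝕎𝕌 ⊗ 𝕎𝕌) (wWalkU l) (v , w)
wWalkU-inv over = all₄ ik ik ik ik ik ik ik ik ik ik ik ik ik ik ik ik
wWalkU-inv (opn 0) = all₄ ik ik ik ik ik ik ik ik ik ik ik ik ik ik ik ik
wWalkU-inv (opn 1) = all₄ ik ik ik ik ik ik ik ik ik ik ik ik ik ik ik ik
wWalkU-inv (opn (suc (suc k))) = all₄ ik ik ik ik ik ik ik ik ik ik ik ik ik ik ik ik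
wWalkU-inv (clo 0) = all₄ ik ik ik ik ik ik ik ik ik ik ik ik ik ik ik ik
wWalkU-inv (clo 1) = all₄ ik ik ik ik ik ik ik ik ik ik ik ik ik ik ik ik
wWalkU-inv (clo (suc (suc k))) = all₄ ik ik ik ik ik ik ik ik ik ik ik ik ik ik ik ik

wWalkB-inv : ∀ l v w → Inv (𝕎𝔹 ⊗ 𝕎𝔹) (wWalkB l) (v , w)
wWalkB-inv over = all₄ ik ik ik ik ik ik ik ik ik ik ik ik ik ik ik ik
wWalkB-inv (opn 0) = all₄ ik ik ik ik ik ik ik ik ik ik ik ik ik ik ik ik
wWalkB-inv (opn 1) = all₄ ik ik ik ik ik ik ik ik ik ik ik ik ik ik ik ik
wWalkB-inv (opn (suc (suc k))) = all₄ ik ik ik ik ik ik ik ik ik ik ik ik ik ik ik ik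
wWalkB-inv (clo 0) = all₄ ik ik ik ik ik ik ik ik ik ik ik ik ik ik ik ik
wWalkB-inv (clo 1) = all₄ ik ik ik ik ik ik ik ik ik ik ik ik ik ik ik ik
wWalkB-inv (clo (suc (suc k))) = all₄ ik ik ik ik ik ik ik ik ik ik ik ik ik ik ik ik

wSwapU-mor : ∀ l v w → live (wWalkU l (v , w)) ≡ true → Mor (𝕎𝕌 ⊗ 𝕎𝕌) (𝕎𝕌 ⊗ 𝕎𝕌) (wSwapU l) (v , w)
wSwapU-mor over v w ()
wSwapU-mor (opn 0) = all₄ (λ _ → ok) (λ _ → ok) (λ _ → ok) (λ ()) (λ _ → ok) (λ _ → ok) (λ _ → ok) (λ _ → ok) (λ _ → ok) (λ _ → ok) (λ _ → ok) (λ _ → ok) (λ _ → ok) (λ _ → ok) (λ _ → ok) (λ _ → ok)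
wSwapU-mor (opn 1) = all₄ (λ _ → ok) (λ _ → ok) (λ _ → ok) (λ _ → ok) (λ _ → ok) (λ _ → ok) (λ _ → ok) (λ _ → ok) (λ _ → ok) (λ _ → ok) (λ _ → ok) (λ _ → ok) (λ _ → ok) (λ _ → ok) (λ _ → ok) (λ _ → ok)
wSwapU-mor (opn (suc (suc k))) = all₄ (λ _ → ok) (λ _ → ok) (λ _ → ok) (λ _ → ok) (λ _ → ok) (λ _ → ok) (λ _ → ok) (λ _ → ok) (λ _ → ok) (λ _ → ok) (λ _ → ok) (λ _ → ok) (λ _ → ok) (λ _ → ok) (λ _ → ok) (λ _ → ok)
wSwapU-mor (clo 0) = all₄ (λ _ → ok) (λ _ → ok) (λ _ → ok) (λ _ → ok) (λ _ → ok) (λ _ → ok) (λ _ → ok) (λ _ → ok) (λ _ → ok) (λ _ → ok) (λ _ → ok) (λ _ → ok) (λ _ → ok) (λ _ → ok) (λ _ → ok) (λ _ → ok)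
wSwapU-mor (clo 1) = all₄ (λ _ → ok) (λ _ → ok) (λ _ → ok) (λ _ → ok) (λ _ → ok) (λ _ → ok) (λ _ → ok) (λ _ → ok) (λ _ → ok) (λ _ → ok) (λ _ → ok) (λ _ → ok) (λ _ → ok) (λ _ → ok) (λ _ → ok) (λ _ → ok)
wSwapU-mor (clo (suc (suc k))) = all₄ (λ _ → ok) (λ _ → ok) (λ _ → ok) (λ _ → ok) (λ _ → ok) (λ _ → ok) (λ _ → ok) (λ _ → ok) (λ _ → ok) (λ _ → ok) (λ _ → ok) (λ _ → ok) (λ _ → ok) (λ _ → ok) (λ _ → ok) (λ _ → ok)

wSwapB-mor : ∀ l v w → live (wWalkB l (v , w)) ≡ true → Mor (𝕎𝔹 ⊗ 𝕎𝔹) (𝕎𝔹 ⊗ 𝕎𝔹) (wSwapB l) (v , w)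
wSwapB-mor over v w ()
wSwapB-mor (opn 0) = all₄ (λ _ → ok) (λ _ → ok) (λ _ → ok) (λ ()) (λ _ → ok) (λ _ → ok) (λ _ → ok) (λ _ → ok) (λ _ → ok) (λ _ → ok) (λ _ → ok) (λ _ → ok) (λ _ → ok) (λ _ → ok) (λ _ → ok) (λ _ → ok)
wSwapB-mor (opn 1) = all₄ (λ _ → ok) (λ _ → ok) (λ _ → ok) (λ _ → ok) (λ _ → ok) (λ _ → ok) (λ _ → ok) (λ _ → ok) (λ _ → ok) (λ _ → ok) (λ _ → ok) (λ _ → ok) (λ _ → ok) (λ _ → ok) (λ _ → ok) (λ _ → ok)
wSwapB-mor (opn (suc (suc k))) = all₄ (λ _ → ok) (λ _ → ok) (λ _ → ok) (λ _ → ok) (λ _ → ok) (λ _ → ok) (λ _ → ok) (λ _ → ok) (λ _ → ok) (λ _ → ok) (λ _ → ok) (λ _ → ok) (λ _ → ok) (λ _ → ok) (λ _ → ok) (λ _ → ok)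
wSwapB-mor (clo 0) = all₄ (λ _ → ok) (λ _ → ok) (λ _ → ok) (λ _ → ok) (λ _ → ok) (λ _ → ok) (λ _ → ok) (λ _ → ok) (λ _ → ok) (λ _ → ok) (λ _ → ok) (λ _ → ok) (λ _ → ok) (λ _ → ok) (λ _ → ok) (λ _ → ok)
wSwapB-mor (clo 1) = all₄ (λ _ → ok) (λ _ → ok) (λ _ → ok) (λ _ → ok) (λ _ → ok) (λ _ → ok) (λ _ → ok) (λ _ → ok) (λ _ → ok) (λ _ → ok) (λ _ → ok) (λ _ → ok) (λ _ → ok) (λ _ → ok) (λ _ → ok) (λ _ → ok)
wSwapB-mor (clo (suc (suc k))) = all₄ (λ _ → ok) (λ _ → ok) (λ _ → ok) (λ _ → ok) (λ _ → ok) (λ _ → ok) (λ _ → ok) (λ _ → ok) (λ _ → ok) (λ _ → ok) (λ _ → ok) (λ _ → ok) (λ _ → ok) (λ _ → ok) (λ _ → ok) (λ _ → ok)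

walkU-inv : ∀ {n} k l (s t : Bits n) → Inv (𝕌 n k ⊗ 𝕌 n k) (WalkU l) (s , t)
walkU-inv k l [] [] = ik
walkU-inv zero l (x ∷ []) (y ∷ []) = ik
walkU-inv zero l (x ∷ x' ∷ s) (y ∷ y' ∷ t) =
  Inv-along {c = embed s ⊗ᵐ embed t} (Mor-⊗ (𝕌-embed s (x , x')) (𝕌-embed t (y , y')))
    (Inv-map (λ m → walkU m s t) (wWalkU-inv l (x , x') (y , y')))
walkU-inv (suc k) l (x ∷ s) (y ∷ t) =
  Inv-along {c = (x ∷_) ⊗ᵐ (y ∷_)} (Mor-⊗ (𝕌-∷ x s) (𝕌-∷ y t)) (walkU-inv k (step l x y) s t)

walkB-inv : ∀ {n} k l (s t : Bits n) → Inv (𝔹 n k ⊗ 𝔹 n k) (WalkB l) (s , t)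
walkB-inv k l [] [] = ik
walkB-inv zero l (x ∷ []) (y ∷ []) = ik
walkB-inv zero l (x ∷ x' ∷ s) (y ∷ y' ∷ t) =
  Inv-along {c = embed s ⊗ᵐ embed t} (Mor-⊗ (𝔹-embed s (x , x')) (𝔹-embed t (y , y')))
    (wWalkB-inv (walkB l s t) (x , x') (y , y'))
walkB-inv (suc k) l (x ∷ s) (y ∷ t) =
  Inv-along {c = (x ∷_) ⊗ᵐ (y ∷_)} (Mor-⊗ (𝔹-∷ x s) (𝔹-∷ y t)) (Inv-map (λ m → step m x y) (walkB-inv k l s t))

swapU-mor : ∀ {n} k l (s t : Bits n) → live (walkU l s t) ≡ true → Mor (𝕌 n k ⊗ 𝕌 n k) (𝕌 n k ⊗ 𝕌 n k) (SwapU l) (s , t)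
swapU-mor k l [] [] h = ok
swapU-mor zero l (x ∷ []) (y ∷ []) h = ok
swapU-mor zero l (x ∷ x' ∷ s) (y ∷ y' ∷ t) h =
  Mor-along {c = embed s ⊗ᵐ embed t} (Mor-⊗ (𝕌-embed s (x , x')) (𝕌-embed t (y , y')))
    (Mor-bind {lab = wWalkU l} (λ m w → (embed (swapU₂ m s t) ⊗ᵐ embed (swapU₁ m s t)) (wSwapU l w)) (wWalkU-inv l (x , x') (y , y'))
      (Mor-∘ (Mor-⊗ {g = embed (swapU₂ (wWalkU l ((x , x') , (y , y'))) s t)} {embed (swapU₁ (wWalkU l ((x , x') , (y , y'))) s t)}
               (𝕌-embed _ _) (𝕌-embed _ _))
             (wSwapU-mor l (x , x') (y , y') (live-walkU _ s t h))))
swapU-mor (suc k) l (x ∷ s) (y ∷ t) h =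
  Mor-along {c = (x ∷_) ⊗ᵐ (y ∷_)} (Mor-⊗ (𝕌-∷ x s) (𝕌-∷ y t))
    (Mor-∘ (Mor-⊗ {g = sw₂ l x y ∷_} {sw₁ l x y ∷_} (𝕌-∷ _ _) (𝕌-∷ _ _)) (swapU-mor k (step l x y) s t h))

swapB-mor : ∀ {n} k l (s t : Bits n) → live (walkB l s t) ≡ true → Mor (𝔹 n k ⊗ 𝔹 n k) (𝔹 n k ⊗ 𝔹 n k) (SwapB l) (s , t)
swapB-mor k l [] [] h = ok
swapB-mor zero l (x ∷ []) (y ∷ []) h = ok
swapB-mor zero l (x ∷ x' ∷ s) (y ∷ y' ∷ t) h =
  Mor-square {c = embed s ⊗ᵐ embed t} {SwapB l} {wSwapB (walkB l s t)} {embed (swapB₂ l s t) ⊗ᵐ embed (swapB₁ l s t)} (λ _ → refl)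
    (Mor-⊗ (𝔹-embed s (x , x')) (𝔹-embed t (y , y')))
    (wSwapB-mor (walkB l s t) (x , x') (y , y') h)
    (Mor-⊗ (𝔹-embed _ _) (𝔹-embed _ _))
swapB-mor (suc k) l (x ∷ s) (y ∷ t) h =
  Mor-along {c = (x ∷_) ⊗ᵐ (y ∷_)} (Mor-⊗ (𝔹-∷ x s) (𝔹-∷ y t))
    (Mor-bind {lab = WalkB l} (λ m c → (sw₂ m x y ∷ proj₁ (SwapB l c)) , (sw₁ m x y ∷ proj₂ (SwapB l c))) (walkB-inv k l s t)
      (Mor-∘ (Mor-⊗ {g = sw₂ (walkB l s t) x y ∷_} {sw₁ (walkB l s t) x y ∷_} (𝔹-∷ _ _) (𝔹-∷ _ _))
             (swapB-mor k l s t (live-step _ x y h))))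

-- The two columns (C₂ , C₁); walkA is the comparison of the unbarred letters
-- of lC₂ and rC₁, walkZ that of all letters.
walkA walkZ : ∀ {n} → ℕ → Col n × Col n → Walk
walkA k ((us₂ , bs₂) , (us₁ , bs₁)) = walkU (opn k) (uS 0 us₂ bs₂) us₁
walkZ k ((us₂ , bs₂) , (us₁ , bs₁)) = walkB (walkU (opn k) (uS 0 us₂ bs₂) us₁) bs₂ (bS 0 us₁ bs₁)

ontoU ontoB : ∀ {n} → Walk → Col n × Col n → Col n × Col n
ontoU l = (Φ⁻¹ 0 ⊗ᵐ id) ∘ unfocus ∘ (id ⊗ᵐ (SwapU l ⊗ᵐ id)) ∘ focus ∘ (Φ 0 ⊗ᵐ id)
ontoB l = (id ⊗ᵐ Φ⁻¹ 0) ∘ unfocus ∘ (id ⊗ᵐ (SwapB l ⊗ᵐ id)) ∘ focus ∘ (id ⊗ᵐ Φ 0)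

cross : ∀ {n} → ℕ → Col n × Col n → Col n × Col n
cross k c with walkA k c
... | clo _ = ontoU (opn k) c
... | l = ontoB l c

ℂ : ℕ → ℕ → Crystal
ℂ n k = 𝕌 n k ⊗ 𝔹 n k

side : ∀ {n} (k : ℕ) (c₂ c₁ : Col n) → Mor (ℂ n k ⊗ ℂ n k) (𝔹 n k ⊗ ((𝕌 n k ⊗ 𝕌 n k) ⊗ 𝔹 n k)) (focus ∘ (Φ 0 ⊗ᵐ id)) (c₂ , c₁)
side {n} k c₂ c₁ = Mor-∘ (Mor-focus {𝔹 n k} {𝕌 n k} {𝕌 n k} {𝔹 n k} (Φ 0 c₂ , c₁)) (Mor-⊗ (Φ-mor k 0 _ _) (Mor-id {ℂ n k} c₁))

side' : ∀ {n} (k : ℕ) (c₂ c₁ : Col n) → Mor (ℂ n k ⊗ ℂ n k) (𝕌 n k ⊗ ((𝔹 n k ⊗ 𝔹 n k) ⊗ 𝕌 n k)) (focus ∘ (id ⊗ᵐ Φ 0)) (c₂ , c₁)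
side' {n} k c₂ c₁ = Mor-∘ (Mor-focus {𝕌 n k} {𝔹 n k} {𝔹 n k} {𝕌 n k} (c₂ , Φ 0 c₁)) (Mor-⊗ (Mor-id {ℂ n k} c₂) (Φ-mor k 0 _ _))

walkA-inv : ∀ {n} k m (c : Col n × Col n) → Inv (ℂ n k ⊗ ℂ n k) (walkA m) c
walkA-inv {n} k m (c₂ , c₁) = Inv-pull (side k c₂ c₁) (Inv-⊗ʳ {𝔹 n k} (Inv-⊗ˡ {𝕌 n k ⊗ 𝕌 n k} {𝔹 n k} (walkU-inv k (opn m) _ _)))

walkZ-inv : ∀ {n} k m (c : Col n × Col n) → Inv (ℂ n k ⊗ ℂ n k) (walkZ m) c
walkZ-inv {n} k m (c₂ , c₁) =
  Inv-bind (λ l c → WalkB l (proj₁ (proj₂ ((focus ∘ (id ⊗ᵐ Φ 0)) c)))) (walkA-inv k m (c₂ , c₁))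
    (Inv-pull (side' k c₂ c₁) (Inv-⊗ʳ {𝕌 n k} (Inv-⊗ˡ {𝔹 n k ⊗ 𝔹 n k} {𝕌 n k} (walkB-inv k _ _ _))))

cross-mor : ∀ {n} k m (c : Col n × Col n) → live (walkZ m c) ≡ true → Mor (ℂ n k ⊗ ℂ n k) (ℂ n k ⊗ ℂ n k) (cross m) c
cross-mor {n} k m c@(c₂@(us₂ , bs₂) , c₁@(us₁ , bs₁)) h =
  Mor-ext cross-G (Mor-bind G (walkA-inv k m c) (go (walkA m c) refl))
  where
  G : Walk → Col n × Col n → Col n × Col n
  G (clo _) = ontoU (opn m)
  G (opn j) = ontoB (opn j)
  G over = ontoB over
  cross-G : ∀ x → G (walkA m x) x ≡ cross m x
  cross-G x with walkA m x
  ... | over = refl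
  ... | opn _ = refl
  ... | clo _ = refl
  viaB : ∀ l → walkA m c ≡ l → Mor (ℂ n k ⊗ ℂ n k) (ℂ n k ⊗ ℂ n k) (ontoB l) c
  viaB l eq = Mor-∘ (Mor-⊗ (Mor-id {ℂ n k} _) (Φ⁻¹-mor k 0 _ _))
    (Mor-∘ (Mor-unfocus {𝕌 n k} {𝔹 n k} {𝔹 n k} {𝕌 n k} _)
      (Mor-∘ (Mor-⊗ (Mor-id {𝕌 n k} _) (Mor-⊗ (swapB-mor k l bs₂ _ (subst (λ z → live (walkB z bs₂ _) ≡ true) eq h)) (Mor-id {𝕌 n k} _)))
        (side' k c₂ c₁)))
  go : ∀ l → walkA m c ≡ l → Mor (ℂ n k ⊗ ℂ n k) (ℂ n k ⊗ ℂ n k) (G l) c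
  go over eq = viaB over eq
  go (opn j) eq = viaB (opn j) eq
  go (clo g) eq = Mor-∘ (Mor-⊗ (Φ⁻¹-mor k 0 _ _) (Mor-id {ℂ n k} _))
    (Mor-∘ (Mor-unfocus {𝔹 n k} {𝕌 n k} {𝕌 n k} {𝔹 n k} _)
      (Mor-∘ (Mor-⊗ (Mor-id {𝔹 n k} _) (Mor-⊗ (swapU-mor k (opn m) _ us₁ (live-walkB _ bs₂ _ h)) (Mor-id {𝔹 n k} _)))
        (side k c₂ c₁)))

lowerLast raiseLast : ∀ {n} → Bits n → Bits n → Maybe (Col n)
lowerLast [] [] = nothing
lowerLast (x ∷ us@(_ ∷ _)) (y ∷ bs@(_ ∷ _)) = mapM ((x ∷_) ⊗ᵐ (y ∷_)) (lowerLast us bs)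
lowerLast (true ∷ []) (false ∷ []) = just (false ∷ [] , true ∷ [])
lowerLast (true ∷ []) (true ∷ []) = nothing
lowerLast (false ∷ []) (y ∷ []) = nothing
raiseLast [] [] = nothing
raiseLast (x ∷ us@(_ ∷ _)) (y ∷ bs@(_ ∷ _)) = mapM ((x ∷_) ⊗ᵐ (y ∷_)) (raiseLast us bs)
raiseLast (false ∷ []) (true ∷ []) = just (true ∷ [] , false ∷ [])
raiseLast (false ∷ []) (false ∷ []) = nothing
raiseLast (true ∷ []) (y ∷ []) = nothing

canLowerLast canRaiseLast : ∀ {n} → Bits n → Bits n → ℕ
canLowerLast [] [] = 0
canLowerLast (x ∷ []) (y ∷ []) = wcanLower (x , y)
canLowerLast (x ∷ us@(_ ∷ _)) (y ∷ bs@(_ ∷ _)) = canLowerLast us bs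
canRaiseLast [] [] = 0
canRaiseLast (x ∷ []) (y ∷ []) = wcanRaise (x , y)
canRaiseLast (x ∷ us@(_ ∷ _)) (y ∷ bs@(_ ∷ _)) = canRaiseLast us bs

-- The operators that exchange n and n̄.
𝕃 : ℕ → Crystal
𝕃 n .Car = Col n
𝕃 n .f (us , bs) = lowerLast us bs
𝕃 n .e (us , bs) = raiseLast us bs
𝕃 n .ε (us , bs) = canRaiseLast us bs
𝕃 n .φ (us , bs) = canLowerLast us bs

𝕃-∷ : ∀ {n} x y (us bs : Bits (suc n)) → Mor (𝕃 (suc n)) (𝕃 (suc (suc n))) ((x ∷_) ⊗ᵐ (y ∷_)) (us , bs)
𝕃-∷ x y (_ ∷ _) (_ ∷ _) = ok

snoc : ∀ {n} → Col n → Window → Col (suc n)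
snoc (us , bs) (x , y) = us ∷ʳ x , bs ∷ʳ y

𝕃-snoc : ∀ {n} (c : Col n) w → Mor 𝕎𝕌 (𝕃 (suc n)) (snoc c) w
𝕃-snoc ([] , []) (true , true) = ok
𝕃-snoc ([] , []) (true , false) = ok
𝕃-snoc ([] , []) (false , true) = ok
𝕃-snoc ([] , []) (false , false) = ok
𝕃-snoc (a ∷ us , d ∷ bs) (x , y) = Mor-∘ (𝕃-∷ a d _ _) (𝕃-snoc (us , bs) (x , y))

pend-snoc : ∀ {n} p (us bs : Bits n) x y → pend p (us ∷ʳ x) (bs ∷ʳ y) ≡ pend (pst x y p) us bs
pend-snoc p [] [] x y = refl
pend-snoc p (a ∷ us) (d ∷ bs) x y = cong (pst a d) (pend-snoc p us bs x y)

uS-snoc : ∀ {n} p (us bs : Bits n) x y → uS p (us ∷ʳ x) (bs ∷ʳ y) ≡ uS (pst x y p) us bs ∷ʳ ub x y p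
uS-snoc p [] [] x y = refl
uS-snoc p (a ∷ us) (d ∷ bs) x y = cong₂ _∷_ (cong (ub a d) (pend-snoc p us bs x y)) (uS-snoc p us bs x y)

bS-snoc : ∀ {n} p (us bs : Bits n) x y → bS p (us ∷ʳ x) (bs ∷ʳ y) ≡ bS (pst x y p) us bs ∷ʳ bb x y p
bS-snoc p [] [] x y = refl
bS-snoc p (a ∷ us) (d ∷ bs) x y = cong₂ _∷_ (cong (bb a d) (pend-snoc p us bs x y)) (bS-snoc p us bs x y)

uI-snoc : ∀ {n} q (us bs : Bits n) x y → uI q (us ∷ʳ x) (bs ∷ʳ y) ≡ uI q us bs ∷ʳ ub x y (qend q us bs)
uI-snoc q [] [] x y = refl
uI-snoc q (a ∷ us) (d ∷ bs) x y = cong (ub a d q ∷_) (uI-snoc (pst a d q) us bs x y)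

bI-snoc : ∀ {n} q (us bs : Bits n) x y → bI q (us ∷ʳ x) (bs ∷ʳ y) ≡ bI q us bs ∷ʳ bb x y (qend q us bs)
bI-snoc q [] [] x y = refl
bI-snoc q (a ∷ us) (d ∷ bs) x y = cong (bb a d q ∷_) (bI-snoc (pst a d q) us bs x y)

walkU-snoc : ∀ {n} l (s t : Bits n) x y → walkU l (s ∷ʳ x) (t ∷ʳ y) ≡ step (walkU l s t) x y
walkU-snoc l [] [] x y = refl
walkU-snoc l (a ∷ s) (d ∷ t) x y = walkU-snoc (step l a d) s t x y

walkB-snoc : ∀ {n} l (s t : Bits n) x y → walkB l (s ∷ʳ x) (t ∷ʳ y) ≡ walkB (step l x y) s t
walkB-snoc l [] [] x y = refl
walkB-snoc l (a ∷ s) (d ∷ t) x y = cong (λ m → step m a d) (walkB-snoc l s t x y)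

swapU₂-snoc : ∀ {n} l (s t : Bits n) x y → swapU₂ l (s ∷ʳ x) (t ∷ʳ y) ≡ swapU₂ l s t ∷ʳ sw₂ (walkU l s t) x y
swapU₂-snoc l [] [] x y = refl
swapU₂-snoc l (a ∷ s) (d ∷ t) x y = cong (_ ∷_) (swapU₂-snoc (step l a d) s t x y)

swapU₁-snoc : ∀ {n} l (s t : Bits n) x y → swapU₁ l (s ∷ʳ x) (t ∷ʳ y) ≡ swapU₁ l s t ∷ʳ sw₁ (walkU l s t) x y
swapU₁-snoc l [] [] x y = refl
swapU₁-snoc l (a ∷ s) (d ∷ t) x y = cong (_ ∷_) (swapU₁-snoc (step l a d) s t x y)

swapB₂-snoc : ∀ {n} l (s t : Bits n) x y → swapB₂ l (s ∷ʳ x) (t ∷ʳ y) ≡ swapB₂ (step l x y) s t ∷ʳ sw₂ l x y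
swapB₂-snoc l [] [] x y = refl
swapB₂-snoc l (a ∷ s) (d ∷ t) x y = cong₂ _∷_ (cong (λ m → sw₂ m a d) (walkB-snoc l s t x y)) (swapB₂-snoc l s t x y)

swapB₁-snoc : ∀ {n} l (s t : Bits n) x y → swapB₁ l (s ∷ʳ x) (t ∷ʳ y) ≡ swapB₁ (step l x y) s t ∷ʳ sw₁ l x y
swapB₁-snoc l [] [] x y = refl
swapB₁-snoc l (a ∷ s) (d ∷ t) x y = cong₂ _∷_ (cong (λ m → sw₁ m a d) (walkB-snoc l s t x y)) (swapB₁-snoc l s t x y)

data Closed : Walk → Set where
  over-closed : Closed over
  clo-closed : ∀ {g} → Closed (clo g)

step-closed : ∀ {l} x y → Closed l → Closed (step l x y)
step-closed x y over-closed = over-closed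
step-closed true true clo-closed = clo-closed
step-closed false false clo-closed = clo-closed
step-closed {clo zero} true false clo-closed = over-closed
step-closed {clo (suc g)} true false clo-closed = clo-closed
step-closed false true clo-closed = clo-closed

walkU-closed : ∀ {n l} (s t : Bits n) → Closed l → Closed (walkU l s t)
walkU-closed [] [] c = c
walkU-closed (x ∷ s) (y ∷ t) c = walkU-closed s t (step-closed x y c)

walkB-closed : ∀ {n l} (s t : Bits n) → Closed l → Closed (walkB l s t)
walkB-closed [] [] c = c
walkB-closed (x ∷ s) (y ∷ t) c = step-closed x y (walkB-closed s t c)

sw-closed : ∀ {l} x y → Closed l → sw₂ l x y ≡ x × sw₁ l x y ≡ y
sw-closed x y over-closed = refl , refl
sw-closed x y clo-closed = refl , refl

sw-open : ∀ l x y {j} → step l x y ≡ opn j → sw₂ l x y ≡ x × sw₁ l x y ≡ y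
sw-open over x y ()
sw-open (opn zero) true true h = refl , refl
sw-open (opn zero) false y h = refl , refl
sw-open (opn (suc k)) x y h = refl , refl
sw-open (clo g) x y h = refl , refl

swapB-closed : ∀ {n l} (s t : Bits n) → Closed l → swapB₂ l s t ≡ s × swapB₁ l s t ≡ t
swapB-closed [] [] c = refl , refl
swapB-closed (x ∷ s) (y ∷ t) c with sw-closed x y (walkB-closed s t c) | swapB-closed s t c
... | p , q | p' , q' = cong₂ _∷_ p p' , cong₂ _∷_ q q'

swapU-closed : ∀ {n l} (s t : Bits n) → Closed l → swapU₂ l s t ≡ s × swapU₁ l s t ≡ t
swapU-closed [] [] c = refl , refl
swapU-closed {l = l} (x ∷ s) (y ∷ t) c with sw-closed x y c | swapU-closed s t (step-closed x y c)
... | p , q | p' , q' = cong₂ _∷_ p p' , cong₂ _∷_ q q'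

walkU-open : ∀ {n l} (s t : Bits n) {j} → walkU l s t ≡ opn j → swapU₂ l s t ≡ s × swapU₁ l s t ≡ t
walkU-open [] [] h = refl , refl
walkU-open {l = l} (x ∷ s) (y ∷ t) h with step l x y in eq
... | opn k with sw-open l x y eq | walkU-open s t h
...   | p , q | p' , q' = cong₂ _∷_ p p' , cong₂ _∷_ q q'
walkU-open {l = l} (x ∷ s) (y ∷ t) h | over with walkU-closed s t over-closed
... | c rewrite h with c
... | ()
walkU-open {l = l} (x ∷ s) (y ∷ t) h | clo g with walkU-closed {l = clo g} s t clo-closed
... | c rewrite h with c
... | ()

cross-clo : ∀ {n} m (c : Col n × Col n) {g} → walkA m c ≡ clo g → cross m c ≡ ontoU (opn m) c
cross-clo m c h with walkA m c
cross-clo m c refl | _ = refl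

cross-opn : ∀ {n} m (c : Col n × Col n) {j} → walkA m c ≡ opn j → cross m c ≡ ontoB (opn j) c
cross-opn m c h with walkA m c
cross-opn m c refl | _ = refl

wpst : Window → ℕ
wpst (x , y) = pst x y 0

κ : ℕ → Window → Window
κ q (x , y) = ub (ub x y 0) (bb x y 0) q , bb (ub x y 0) (bb x y 0) q

κ-mor : ∀ q w → Mor 𝕎𝕌 𝕎𝕌 (κ q) w
κ-mor zero (true , true) = ok
κ-mor zero (true , false) = ok
κ-mor zero (false , true) = ok
κ-mor zero (false , false) = ok
κ-mor (suc q) (true , true) = ok
κ-mor (suc q) (true , false) = ok
κ-mor (suc q) (false , true) = ok
κ-mor (suc q) (false , false) = ok

wpst-inv : ∀ w → Inv 𝕎𝕌 wpst w
wpst-inv (true , true) = ik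
wpst-inv (true , false) = ik
wpst-inv (false , true) = ik
wpst-inv (false , false) = ik

wWalkZ : Walk → Window × Window → Walk
wWalkZ l ((x₂ , y₂) , (x₁ , y₁)) = step (step l (ub x₂ y₂ 0) x₁) y₂ (bb x₁ y₁ 0)

wWalkZ-inv : ∀ l v w → Inv (𝕎𝕌 ⊗ 𝕎𝕌) (wWalkZ l) (v , w)
wWalkZ-inv over = all₄ ik ik ik ik ik ik ik ik ik ik ik ik ik ik ik ik
wWalkZ-inv (opn 0) = all₄ ik ik ik ik ik ik ik ik ik ik ik ik ik ik ik ik
wWalkZ-inv (opn 1) = all₄ ik ik ik ik ik ik ik ik ik ik ik ik ik ik ik ik
wWalkZ-inv (opn (suc (suc k))) = all₄ ik ik ik ik ik ik ik ik ik ik ik ik ik ik ik ik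
wWalkZ-inv (clo 0) = all₄ ik ik ik ik ik ik ik ik ik ik ik ik ik ik ik ik
wWalkZ-inv (clo 1) = all₄ ik ik ik ik ik ik ik ik ik ik ik ik ik ik ik ik
wWalkZ-inv (clo (suc (suc k))) = all₄ ik ik ik ik ik ik ik ik ik ik ik ik ik ik ik ik

-- The effect of a crossing that takes place at the letters n and n̄.
wHit : Window × Window → Window × Window
wHit ((true , false) , (false , false)) = (false , false) , (true , false)
wHit ((false , true) , (false , false)) = (false , false) , (false , true)
wHit ((true , true) , (false , false)) = (true , false) , (false , true)
wHit ((true , false) , (false , true)) = (false , false) , (true , true)
wHit vw = vw

wHit-mor : ∀ {g} v w → wWalkZ (opn 0) (v , w) ≡ clo g → Mor (𝕎𝕌 ⊗ 𝕎𝕌) (𝕎𝕌 ⊗ 𝕎𝕌) wHit (v , w)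
wHit-mor = all₄ (λ ()) (λ ()) (λ ()) (λ _ → ok) (λ ()) (λ ()) (λ _ → ok) (λ _ → ok) (λ ()) (λ ()) (λ ()) (λ _ → ok) (λ ()) (λ ()) (λ ()) (λ ())

wHit-zero : ∀ j {g} v w → wWalkZ (opn j) (v , w) ≡ clo g → j ≡ 0
wHit-zero zero v w h = refl
wHit-zero (suc zero) = all₄ (λ ()) (λ ()) (λ ()) (λ ()) (λ ()) (λ ()) (λ ()) (λ ()) (λ ()) (λ ()) (λ ()) (λ ()) (λ ()) (λ ()) (λ ()) (λ ())
wHit-zero (suc (suc j)) = all₄ (λ ()) (λ ()) (λ ()) (λ ()) (λ ()) (λ ()) (λ ()) (λ ()) (λ ()) (λ ()) (λ ()) (λ ()) (λ ()) (λ ()) (λ ()) (λ ())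

ontoU-snoc : ∀ {n} l (us₂ bs₂ us₁ bs₁ : Bits n) x₂ y₂ x₁ y₁ →
  let S = uS (pst x₂ y₂ 0) us₂ bs₂
      B = bS (pst x₂ y₂ 0) us₂ bs₂
      S' = swapU₂ l S us₁
      z = sw₂ (walkU l S us₁) (ub x₂ y₂ 0) x₁
      q = qend 0 S' B
  in ontoU l (snoc (us₂ , bs₂) (x₂ , y₂) , snoc (us₁ , bs₁) (x₁ , y₁)) ≡
     (snoc (uI 0 S' B , bI 0 S' B) (ub z (bb x₂ y₂ 0) q , bb z (bb x₂ y₂ 0) q) ,
      snoc (swapU₁ l S us₁ , bs₁) (sw₁ (walkU l S us₁) (ub x₂ y₂ 0) x₁ , y₁))
ontoU-snoc l us₂ bs₂ us₁ bs₁ x₂ y₂ x₁ y₁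
  rewrite uS-snoc 0 us₂ bs₂ x₂ y₂ | bS-snoc 0 us₂ bs₂ x₂ y₂
        | swapU₂-snoc l (uS (pst x₂ y₂ 0) us₂ bs₂) us₁ (ub x₂ y₂ 0) x₁
        | swapU₁-snoc l (uS (pst x₂ y₂ 0) us₂ bs₂) us₁ (ub x₂ y₂ 0) x₁
        | uI-snoc 0 (swapU₂ l (uS (pst x₂ y₂ 0) us₂ bs₂) us₁) (bS (pst x₂ y₂ 0) us₂ bs₂)
            (sw₂ (walkU l (uS (pst x₂ y₂ 0) us₂ bs₂) us₁) (ub x₂ y₂ 0) x₁) (bb x₂ y₂ 0)
        | bI-snoc 0 (swapU₂ l (uS (pst x₂ y₂ 0) us₂ bs₂) us₁) (bS (pst x₂ y₂ 0) us₂ bs₂)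
            (sw₂ (walkU l (uS (pst x₂ y₂ 0) us₂ bs₂) us₁) (ub x₂ y₂ 0) x₁) (bb x₂ y₂ 0) = refl

ontoB-snoc : ∀ {n} l (us₂ bs₂ us₁ bs₁ : Bits n) x₂ y₂ x₁ y₁ →
  let S = uS (pst x₁ y₁ 0) us₁ bs₁
      B = bS (pst x₁ y₁ 0) us₁ bs₁
      l' = step l y₂ (bb x₁ y₁ 0)
      B' = swapB₁ l' bs₂ B
      z = sw₁ l y₂ (bb x₁ y₁ 0)
      q = qend 0 S B'
  in ontoB l (snoc (us₂ , bs₂) (x₂ , y₂) , snoc (us₁ , bs₁) (x₁ , y₁)) ≡
     (snoc (us₂ , swapB₂ l' bs₂ B) (x₂ , sw₂ l y₂ (bb x₁ y₁ 0)) ,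
      snoc (uI 0 S B' , bI 0 S B') (ub (ub x₁ y₁ 0) z q , bb (ub x₁ y₁ 0) z q))
ontoB-snoc l us₂ bs₂ us₁ bs₁ x₂ y₂ x₁ y₁
  rewrite uS-snoc 0 us₁ bs₁ x₁ y₁ | bS-snoc 0 us₁ bs₁ x₁ y₁
        | swapB₂-snoc l bs₂ (bS (pst x₁ y₁ 0) us₁ bs₁) y₂ (bb x₁ y₁ 0)
        | swapB₁-snoc l bs₂ (bS (pst x₁ y₁ 0) us₁ bs₁) y₂ (bb x₁ y₁ 0)
        | uI-snoc 0 (uS (pst x₁ y₁ 0) us₁ bs₁) (swapB₁ (step l y₂ (bb x₁ y₁ 0)) bs₂ (bS (pst x₁ y₁ 0) us₁ bs₁))
            (ub x₁ y₁ 0) (sw₁ l y₂ (bb x₁ y₁ 0))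
        | bI-snoc 0 (uS (pst x₁ y₁ 0) us₁ bs₁) (swapB₁ (step l y₂ (bb x₁ y₁ 0)) bs₂ (bS (pst x₁ y₁ 0) us₁ bs₁))
            (ub x₁ y₁ 0) (sw₁ l y₂ (bb x₁ y₁ 0)) = refl

Φ⁻¹-Φ : ∀ {n} (us bs : Bits n) → pend 0 us bs ≡ 0 →
        (uI 0 (uS 0 us bs) (bS 0 us bs) ≡ us) × (bI 0 (uS 0 us bs) (bS 0 us bs) ≡ bs) × (qend 0 (uS 0 us bs) (bS 0 us bs) ≡ 0)
Φ⁻¹-Φ us bs h = subst (λ q → uI q S B ≡ us) h (uI-uS 0 us bs) , subst (λ q → bI q S B ≡ bs) h (bI-bS 0 us bs) ,
                subst (λ q → qend q S B ≡ 0) h (qend-Φ 0 us bs)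
  where S = uS 0 us bs
        B = bS 0 us bs

module _ {n : ℕ} (m : ℕ) (us₂ bs₂ us₁ bs₁ : Bits n) where
  private
    c : Window × Window → Col (suc n) × Col (suc n)
    c = snoc (us₂ , bs₂) ⊗ᵐ snoc (us₁ , bs₁)

    L₀ : ℕ → Walk
    L₀ p = walkU (opn m) (uS p us₂ bs₂) us₁

    walkA-snoc : ∀ x₂ y₂ x₁ y₁ → walkA m (c ((x₂ , y₂) , (x₁ , y₁))) ≡ step (L₀ (pst x₂ y₂ 0)) (ub x₂ y₂ 0) x₁
    walkA-snoc x₂ y₂ x₁ y₁ rewrite uS-snoc 0 us₂ bs₂ x₂ y₂ = walkU-snoc (opn m) (uS (pst x₂ y₂ 0) us₂ bs₂) us₁ (ub x₂ y₂ 0) x₁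

    walkZ-snoc : ∀ x₂ y₂ x₁ y₁ → walkZ m (c ((x₂ , y₂) , (x₁ , y₁))) ≡
      walkB (wWalkZ (L₀ (pst x₂ y₂ 0)) ((x₂ , y₂) , (x₁ , y₁))) bs₂ (bS (pst x₁ y₁ 0) us₁ bs₁)
    walkZ-snoc x₂ y₂ x₁ y₁ rewrite bS-snoc 0 us₁ bs₁ x₁ y₁ | walkA-snoc x₂ y₂ x₁ y₁ =
      walkB-snoc _ bs₂ (bS (pst x₁ y₁ 0) us₁ bs₁) y₂ (bb x₁ y₁ 0)

    c-mor : ∀ v w → Mor (𝕎𝕌 ⊗ 𝕎𝕌) (𝕃 (suc n) ⊗ 𝕃 (suc n)) c (v , w)
    c-mor v w = Mor-⊗ (𝕃-snoc (us₂ , bs₂) v) (𝕃-snoc (us₁ , bs₁) w)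

    Lab : Set
    Lab = (ℕ × ℕ) × Walk

    lab : Window × Window → Lab
    lab (v , w) = (wpst v , wpst w) , wWalkZ (L₀ (wpst v)) (v , w)

    lab-inv : ∀ v w → Inv (𝕎𝕌 ⊗ 𝕎𝕌) lab (v , w)
    lab-inv v w =
      Inv-bind {lab = λ x → wpst (proj₁ x)} (λ p x → (p , wpst (proj₂ x)) , wWalkZ (L₀ p) x) (Inv-⊗ˡ {𝕎𝕌} {𝕎𝕌} (wpst-inv v))
        (Inv-bind {lab = λ x → wpst (proj₂ x)} (λ q x → (wpst v , q) , wWalkZ (L₀ (wpst v)) x) (Inv-⊗ʳ {𝕎𝕌} {𝕎𝕌} (wpst-inv w))
          (Inv-map (λ l → (wpst v , wpst w) , l) (wWalkZ-inv (L₀ (wpst v)) v w)))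

  walkZ-last-inv : ∀ v w → Inv (𝕃 (suc n) ⊗ 𝕃 (suc n)) (walkZ m) (c (v , w))
  walkZ-last-inv v w = Inv-along (c-mor v w)
    (Inv-intro {𝕎𝕌 ⊗ 𝕎𝕌} (λ eq → go (Inv-f (lab-inv v w) eq)) (λ eq → go (Inv-e (lab-inv v w) eq)))
    where
    go : ∀ {x} → lab x ≡ lab (v , w) → walkZ m (c x) ≡ walkZ m (c (v , w))
    go {(x₂ , y₂) , (x₁ , y₁)} eq = trans (walkZ-snoc x₂ y₂ x₁ y₁)
      (trans (cong (λ (l : Lab) → walkB (proj₂ l) bs₂ (bS (proj₂ (proj₁ l)) us₁ bs₁)) eq) (sym (walkZ-snoc _ _ _ _)))

  private
    crossW-clo : ∀ {g} p x → L₀ p ≡ clo g → live (wWalkZ (clo g) x) ≡ true → wpst (proj₁ x) ≡ p →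
      cross m (c x) ≡
        (snoc (Φ⁻¹ 0 (bS p us₂ bs₂ , swapU₂ (opn m) (uS p us₂ bs₂) us₁)) ⊗ᵐ snoc (swapU₁ (opn m) (uS p us₂ bs₂) us₁ , bs₁))
        ((κ (qend 0 (swapU₂ (opn m) (uS p us₂ bs₂) us₁) (bS p us₂ bs₂)) ⊗ᵐ id) x)
    crossW-clo {g} p x@((x₂ , y₂) , (x₁ , y₁)) h lv refl =
      trans (cross-clo m (c x) {proj₁ A} (trans (walkA-snoc x₂ y₂ x₁ y₁) (trans (cong (λ l → step l (ub x₂ y₂ 0) x₁) h) (proj₂ A))))
        (trans (ontoU-snoc (opn m) us₂ bs₂ us₁ bs₁ x₂ y₂ x₁ y₁)
          (cong (λ l → (snoc (Φ⁻¹ 0 (bS p us₂ bs₂ , swapU₂ (opn m) (uS p us₂ bs₂) us₁)) (ub (sw₂ l (ub x₂ y₂ 0) x₁) (bb x₂ y₂ 0) Q , bb (sw₂ l (ub x₂ y₂ 0) x₁) (bb x₂ y₂ 0) Q)) ,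
                       snoc (swapU₁ (opn m) (uS p us₂ bs₂) us₁ , bs₁) (sw₁ l (ub x₂ y₂ 0) x₁ , y₁)) h))
      where
      Q = qend 0 (swapU₂ (opn m) (uS p us₂ bs₂) us₁) (bS p us₂ bs₂)
      find : ∀ {l} → Closed l → live l ≡ true → Σ ℕ λ g' → l ≡ clo g'
      find clo-closed _ = _ , refl
      A = find (step-closed {clo g} (ub x₂ y₂ 0) x₁ clo-closed) (live-step _ y₂ (bb x₁ y₁ 0) lv)

    crossW-opn : ∀ {j i} p q x → L₀ p ≡ opn j → wWalkZ (opn j) x ≡ opn i → wpst (proj₁ x) ≡ p → wpst (proj₂ x) ≡ q →
      cross m (c x) ≡
        (snoc (us₂ , swapB₂ (opn i) bs₂ (bS q us₁ bs₁)) ⊗ᵐ snoc (Φ⁻¹ 0 (swapB₁ (opn i) bs₂ (bS q us₁ bs₁) , uS q us₁ bs₁)))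
        ((id ⊗ᵐ κ (qend 0 (uS q us₁ bs₁) (swapB₁ (opn i) bs₂ (bS q us₁ bs₁)))) x)
    crossW-opn {j} {i} p q x@((x₂ , y₂) , (x₁ , y₁)) h hz refl refl =
      trans (cross-opn m (c x) (trans (walkA-snoc x₂ y₂ x₁ y₁) (trans (cong (λ l → step l (ub x₂ y₂ 0) x₁) h) (proj₂ A))))
        (trans (ontoB-snoc (opn (proj₁ A)) us₂ bs₂ us₁ bs₁ x₂ y₂ x₁ y₁) (fin (step (opn (proj₁ A)) y₂ (bb x₁ y₁ 0)) refl))
      where
      S = uS q us₁ bs₁
      B = bS q us₁ bs₁
      find : ∀ l → step l y₂ (bb x₁ y₁ 0) ≡ opn i → Σ ℕ λ k → l ≡ opn k
      find over ()
      find (opn k) _ = k , refl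
      find (clo g) h' with step-closed {clo g} y₂ (bb x₁ y₁ 0) clo-closed
      ... | cl rewrite h' with cl
      ... | ()
      A = find (step (opn j) (ub x₂ y₂ 0) x₁) hz
      fin : ∀ l' → step (opn (proj₁ A)) y₂ (bb x₁ y₁ 0) ≡ l' →
        (snoc (us₂ , swapB₂ l' bs₂ B) (x₂ , sw₂ (opn (proj₁ A)) y₂ (bb x₁ y₁ 0)) ,
         snoc (uI 0 S (swapB₁ l' bs₂ B) , bI 0 S (swapB₁ l' bs₂ B))
           (ub (ub x₁ y₁ 0) (sw₁ (opn (proj₁ A)) y₂ (bb x₁ y₁ 0)) (qend 0 S (swapB₁ l' bs₂ B)) ,
            bb (ub x₁ y₁ 0) (sw₁ (opn (proj₁ A)) y₂ (bb x₁ y₁ 0)) (qend 0 S (swapB₁ l' bs₂ B))))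
        ≡ (snoc (us₂ , swapB₂ (opn i) bs₂ B) ⊗ᵐ snoc (Φ⁻¹ 0 (swapB₁ (opn i) bs₂ B , S)))
          ((id ⊗ᵐ κ (qend 0 S (swapB₁ (opn i) bs₂ B))) x)
      fin l' eq with trans (sym eq) (subst (λ l → step l y₂ (bb x₁ y₁ 0) ≡ opn i) (proj₂ A) hz)
      ... | refl with sw-open (opn (proj₁ A)) y₂ (bb x₁ y₁ 0) eq
      ... | e₂ , e₁ rewrite e₂ | e₁ = refl

    crossW-hit : ∀ v w → L₀ (wpst v) ≡ opn 0 → ∀ {g} → wWalkZ (opn 0) (v , w) ≡ clo g →
      pend (wpst v) us₂ bs₂ ≡ 0 → pend (wpst w) us₁ bs₁ ≡ 0 → cross m (c (v , w)) ≡ c (wHit (v , w))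
    crossW-hit = all₄
      (λ _ ()) (λ _ ()) (λ _ ()) x-n (λ _ ()) (λ _ ()) u-b u-n (λ _ ()) (λ _ ()) (λ _ ()) b-n (λ _ ()) (λ _ ()) (λ _ ()) (λ _ ())
      where
      Hit : Window → Window → Set
      Hit v w = L₀ (wpst v) ≡ opn 0 → ∀ {g} → wWalkZ (opn 0) (v , w) ≡ clo g →
        pend (wpst v) us₂ bs₂ ≡ 0 → pend (wpst w) us₁ bs₁ ≡ 0 → cross m (c (v , w)) ≡ c (wHit (v , w))
      barred : pend 0 us₁ bs₁ ≡ 0 → ∀ x₂ →
        ontoB (opn 0) (c ((x₂ , true) , (false , false))) ≡ c ((x₂ , false) , (false , true))
      barred a₁ x₂ = trans (ontoB-snoc (opn 0) us₂ bs₂ us₁ bs₁ x₂ true false false) fin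
        where
        fin : (snoc (us₂ , swapB₂ (clo 0) bs₂ (bS 0 us₁ bs₁)) (x₂ , false) ,
               snoc (Φ⁻¹ 0 (swapB₁ (clo 0) bs₂ (bS 0 us₁ bs₁) , uS 0 us₁ bs₁)) (false , true)) ≡ c ((x₂ , false) , (false , true))
        fin rewrite proj₁ (swapB-closed {l = clo 0} bs₂ (bS 0 us₁ bs₁) clo-closed) | proj₂ (swapB-closed {l = clo 0} bs₂ (bS 0 us₁ bs₁) clo-closed)
          | proj₁ (Φ⁻¹-Φ us₁ bs₁ a₁) | proj₁ (proj₂ (Φ⁻¹-Φ us₁ bs₁ a₁)) = refl
      unbarred : pend 0 us₂ bs₂ ≡ 0 → L₀ 0 ≡ opn 0 → ∀ y₁ →
        ontoU (opn m) (c ((true , false) , (false , y₁))) ≡ c ((false , false) , (true , y₁))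
      unbarred a₂ h y₁ = trans (ontoU-snoc (opn m) us₂ bs₂ us₁ bs₁ true false false y₁) fin
        where
        S = uS 0 us₂ bs₂
        fin : (snoc (Φ⁻¹ 0 (bS 0 us₂ bs₂ , swapU₂ (opn m) S us₁))
                 (ub (sw₂ (L₀ 0) true false) false (qend 0 (swapU₂ (opn m) S us₁) (bS 0 us₂ bs₂)) ,
                  bb (sw₂ (L₀ 0) true false) false (qend 0 (swapU₂ (opn m) S us₁) (bS 0 us₂ bs₂))) ,
               snoc (swapU₁ (opn m) S us₁ , bs₁) (sw₁ (L₀ 0) true false , y₁)) ≡ c ((false , false) , (true , y₁))
        fin rewrite proj₁ (walkU-open S us₁ h) | proj₂ (walkU-open S us₁ h) | h
          | proj₁ (Φ⁻¹-Φ us₂ bs₂ a₂) | proj₁ (proj₂ (Φ⁻¹-Φ us₂ bs₂ a₂)) | proj₂ (proj₂ (Φ⁻¹-Φ us₂ bs₂ a₂)) = refl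
      x-n : Hit (true , true) (false , false)
      x-n h _ a₂ a₁ = trans (cross-opn m _ {0} (trans (walkA-snoc true true false false) (cong (λ l → step l false false) h))) (barred a₁ true)
      b-n : Hit (false , true) (false , false)
      b-n h _ a₂ a₁ = trans (cross-opn m _ {0} (trans (walkA-snoc false true false false) (cong (λ l → step l false false) h))) (barred a₁ false)
      u-n : Hit (true , false) (false , false)
      u-n h _ a₂ a₁ = trans (cross-clo m _ {0} (trans (walkA-snoc true false false false) (cong (λ l → step l true false) h))) (unbarred a₂ h false)
      u-b : Hit (true , false) (false , true)
      u-b h _ a₂ a₁ = trans (cross-clo m _ {0} (trans (walkA-snoc true false false true) (cong (λ l → step l true false) h))) (unbarred a₂ h true)

  cross-last-mor : ∀ v w → pend (wpst v) us₂ bs₂ ≡ 0 → pend (wpst w) us₁ bs₁ ≡ 0 → live (walkZ m (c (v , w))) ≡ true →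
    Mor (𝕃 (suc n) ⊗ 𝕃 (suc n)) (𝕃 (suc n) ⊗ 𝕃 (suc n)) (cross m) (c (v , w))
  cross-last-mor v w a₂ a₁ lv = Mor-along (c-mor v w) (go (L₀ (wpst v)) refl (wWalkZ (L₀ (wpst v)) (v , w)) refl)
    where
    p = wpst v
    q = wpst w
    lvz : live (wWalkZ (L₀ p) (v , w)) ≡ true
    lvz = live-walkB _ bs₂ _ (trans (cong live (sym (walkZ-snoc _ _ _ _))) lv)
    go : ∀ l → L₀ p ≡ l → ∀ z → wWalkZ (L₀ p) (v , w) ≡ z → Mor (𝕎𝕌 ⊗ 𝕎𝕌) (𝕃 (suc n) ⊗ 𝕃 (suc n)) (cross m ∘ c) (v , w)
    go over h z hz with trans (sym lvz) (cong (λ l → live (wWalkZ l (v , w))) h)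
    ... | ()
    go (clo g) h z hz = Mor-on (lab-inv v w)
      (λ x eq → sym (crossW-clo p x h (trans (cong (λ l → live (wWalkZ l x)) (sym (trans (cong L₀ (cong (proj₁ ∘ proj₁) eq)) h))) (trans (cong (live ∘ proj₂) eq) lvz)) (cong (proj₁ ∘ proj₁) eq)))
      (Mor-∘ (Mor-⊗ (𝕃-snoc _ _) (𝕃-snoc _ _)) (Mor-⊗ {𝕎𝕌} {𝕎𝕌} {𝕎𝕌} {𝕎𝕌} (κ-mor _ v) (Mor-id {𝕎𝕌} w)))
    go (opn j) h over hz with trans (sym lvz) (cong live hz)
    ... | ()
    go (opn j) h (opn i) hz = Mor-on (lab-inv v w)
      (λ x eq → sym (crossW-opn p q x h (trans (cong (λ l → wWalkZ l x) (sym (trans (cong L₀ (cong (proj₁ ∘ proj₁) eq)) h))) (trans (cong proj₂ eq) hz))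
                       (cong (proj₁ ∘ proj₁) eq) (cong (proj₂ ∘ proj₁) eq)))
      (Mor-∘ (Mor-⊗ (𝕃-snoc _ _) (𝕃-snoc _ _)) (Mor-⊗ {𝕎𝕌} {𝕎𝕌} {𝕎𝕌} {𝕎𝕌} (Mor-id {𝕎𝕌} v) (κ-mor _ w)))
    go (opn j) h (clo g) hz with wHit-zero j v w (trans (cong (λ l → wWalkZ l (v , w)) (sym h)) hz)
    ... | refl = Mor-on (lab-inv v w)
      (λ x eq → sym (crossW-hit (proj₁ x) (proj₂ x) (trans (cong L₀ (cong (proj₁ ∘ proj₁) eq)) h)
                  (trans (cong (λ l → wWalkZ l x) (sym (trans (cong L₀ (cong (proj₁ ∘ proj₁) eq)) h))) (trans (cong proj₂ eq) hz))
                  (trans (cong (λ z → pend z us₂ bs₂) (cong (proj₁ ∘ proj₁) eq)) a₂) (trans (cong (λ z → pend z us₁ bs₁) (cong (proj₂ ∘ proj₁) eq)) a₁)))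
      (Mor-∘ (c-mor _ _) (wHit-mor v w (trans (cong (λ l → wWalkZ l (v , w)) (sym h)) hz)))

-- Tableaux and the final correction

-- Operators: just k exchanges the letters with indices k + 1 and k + 2,
-- nothing exchanges n and n̄.
Op : Set
Op = Maybe ℕ

𝕂 : ℕ → Op → Crystal
𝕂 n o .Car = Col n
𝕂 n (just k) .f = ℂ n k .f
𝕂 n nothing .f = 𝕃 n .f
𝕂 n (just k) .e = ℂ n k .e
𝕂 n nothing .e = 𝕃 n .e
𝕂 n (just k) .ε = ℂ n k .ε
𝕂 n nothing .ε = 𝕃 n .ε
𝕂 n (just k) .φ = ℂ n k .φ
𝕂 n nothing .φ = 𝕃 n .φ

module _ {n k : ℕ} where
  toℂ : (c : Col n) → Mor (𝕂 n (just k)) (ℂ n k) id c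
  toℂ c = mor (sym (mapM-id _)) (sym (mapM-id _)) refl refl
  fromℂ : (c : Col n) → Mor (ℂ n k) (𝕂 n (just k)) id c
  fromℂ c = mor (sym (mapM-id _)) (sym (mapM-id _)) refl refl
  to𝕃 : (c : Col n) → Mor (𝕂 n nothing) (𝕃 n) id c
  to𝕃 c = mor (sym (mapM-id _)) (sym (mapM-id _)) refl refl
  from𝕃 : (c : Col n) → Mor (𝕃 n) (𝕂 n nothing) id c
  from𝕃 c = mor (sym (mapM-id _)) (sym (mapM-id _)) refl refl

adm : ∀ {n} → Col n → Set
adm c = Pend 0 c ≡ 0

data InitLast : ∀ {n} → Col (suc n) → Set where
  il : ∀ {n} (c : Col n) w → InitLast (snoc c w)

initLastC : ∀ {n} (c : Col (suc n)) → InitLast c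
initLastC (us , bs) with initLast us | initLast bs
... | (us' , x , refl) | (bs' , y , refl) = il (us' , bs') (x , y)

cross-𝕂 : ∀ {n} o m (c : Col n × Col n) → adm (proj₁ c) → adm (proj₂ c) → live (walkZ m c) ≡ true →
          Mor (𝕂 n o ⊗ 𝕂 n o) (𝕂 n o ⊗ 𝕂 n o) (cross m) c
cross-𝕂 {n} (just k) m (c₂ , c₁) a₂ a₁ h =
  Mor-∘ (Mor-⊗ (fromℂ _) (fromℂ _)) (Mor-∘ (cross-mor k m (c₂ , c₁) h) (Mor-⊗ (toℂ {k = k} c₂) (toℂ c₁)))
cross-𝕂 {zero} nothing m (([] , []) , ([] , [])) a₂ a₁ h = ok
cross-𝕂 {suc n} nothing m (c₂ , c₁) a₂ a₁ h with initLastC c₂ | initLastC c₁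
... | il (us₂ , bs₂) (x₂ , y₂) | il (us₁ , bs₁) (x₁ , y₁) =
  Mor-∘ (Mor-⊗ (from𝕃 {k = 0} _) (from𝕃 {k = 0} _))
    (Mor-∘ (cross-last-mor m us₂ bs₂ us₁ bs₁ (x₂ , y₂) (x₁ , y₁)
              (trans (sym (pend-snoc 0 us₂ bs₂ x₂ y₂)) a₂) (trans (sym (pend-snoc 0 us₁ bs₁ x₁ y₁)) a₁) h)
           (Mor-⊗ (to𝕃 {k = 0} _) (to𝕃 {k = 0} _)))

walkZ-𝕂 : ∀ {n} o m (c : Col n × Col n) → Inv (𝕂 n o ⊗ 𝕂 n o) (walkZ m) c
walkZ-𝕂 {n} (just k) m (c₂ , c₁) = Inv-pull {g = id ⊗ᵐ id} {walkZ m} (Mor-⊗ (toℂ {k = k} c₂) (toℂ c₁)) (walkZ-inv k m (c₂ , c₁))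
walkZ-𝕂 {zero} nothing m (([] , []) , ([] , [])) = ik
walkZ-𝕂 {suc n} nothing m (c₂ , c₁) with initLastC c₂ | initLastC c₁
... | il (us₂ , bs₂) (x₂ , y₂) | il (us₁ , bs₁) (x₁ , y₁) =
  Inv-pull {g = id ⊗ᵐ id} {walkZ m} (Mor-⊗ (to𝕃 {k = 0} _) (to𝕃 {k = 0} _)) (walkZ-last-inv m us₂ bs₂ us₁ bs₁ (x₂ , y₂) (x₁ , y₁))

Pend-𝕂 : ∀ {n} o (c : Col n) → Inv (𝕂 n o) (Pend 0) c
Pend-𝕂 {n} (just k) (us , bs) = Inv-pull {g = id} {Pend 0} (toℂ {k = k} (us , bs)) (pend-inv k 0 us bs)
Pend-𝕂 {zero} nothing ([] , []) = ik
Pend-𝕂 {suc n} nothing c with initLastC c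
... | il (us , bs) (x , y) = Inv-pull {g = id} {Pend 0} (to𝕃 {k = 0} _)
  (Inv-along (𝕃-snoc (us , bs) (x , y)) (Inv-intro {𝕎𝕌} (λ eq → go (Inv-f (wpst-inv (x , y)) eq)) (λ eq → go (Inv-e (wpst-inv (x , y)) eq))))
  where
  go : ∀ {w} → wpst w ≡ wpst (x , y) → Pend 0 (snoc (us , bs) w) ≡ Pend 0 (snoc (us , bs) (x , y))
  go {x' , y'} eq = trans (pend-snoc 0 us bs x' y') (trans (cong (λ p → pend p us bs) eq) (sym (pend-snoc 0 us bs x y)))

-- Deletion of the pair z, z̄ with z minimal such that N(z) = z + 1; the state
-- counts the free indices minus the pairs met so far, nothing: already deleted.
fixStep : Maybe ℕ → Bool → Bool → Maybe ℕ
fixStep nothing _ _ = nothing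
fixStep (just q) false false = just (suc q)
fixStep (just q) true false = just q
fixStep (just q) false true = just q
fixStep (just zero) true true = nothing
fixStep (just (suc q)) true true = just q

fixBit : Maybe ℕ → Bool → Bool → Bool
fixBit (just zero) true true = false
fixBit _ x y = x

fixU fixB : ∀ {n} → Maybe ℕ → Bits n → Bits n → Bits n
fixU q [] [] = []
fixU q (x ∷ us) (y ∷ bs) = fixBit q x y ∷ fixU (fixStep q x y) us bs
fixB q [] [] = []
fixB q (x ∷ us) (y ∷ bs) = fixBit q y x ∷ fixB (fixStep q x y) us bs

Fix : ∀ {n} → Maybe ℕ → Col n → Col n
Fix q (us , bs) = fixU q us bs , fixB q us bs

fixed : ∀ {n} → Col n → Col n
fixed = Fix (just 0)

wFixStep : Maybe ℕ → Window × Window → Maybe ℕ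
wFixStep q ((x , y) , (x' , y')) = fixStep (fixStep q x x') y y'

wFix : Maybe ℕ → Window × Window → Window × Window
wFix q ((x , y) , (x' , y')) = (fixBit q x x' , fixBit (fixStep q x x') y y') , (fixBit q x' x , fixBit (fixStep q x x') y' y)

wFixStep-inv : ∀ q p v w → pst (proj₁ v) (proj₁ w) (pst (proj₂ v) (proj₂ w) p) ≤ suc q →
  Inv (𝕎𝕌 ⊗ 𝕎𝔹) (wFixStep (just q)) (v , w)
wFixStep-inv 0 p = all₄ (λ { (s≤s ()) }) (λ _ → ik) (λ _ → ik) (λ _ → ik) (λ _ → ik) (λ _ → ik) (λ _ → ik) (λ _ → ik) (λ _ → ik) (λ _ → ik) (λ _ → ik) (λ _ → ik) (λ _ → ik) (λ _ → ik) (λ _ → ik) (λ _ → ik)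
wFixStep-inv 1 p = all₄ (λ _ → ik) (λ _ → ik) (λ _ → ik) (λ _ → ik) (λ _ → ik) (λ _ → ik) (λ _ → ik) (λ _ → ik) (λ _ → ik) (λ _ → ik) (λ _ → ik) (λ _ → ik) (λ _ → ik) (λ _ → ik) (λ _ → ik) (λ _ → ik)
wFixStep-inv (suc (suc q)) p = all₄ (λ _ → ik) (λ _ → ik) (λ _ → ik) (λ _ → ik) (λ _ → ik) (λ _ → ik) (λ _ → ik) (λ _ → ik) (λ _ → ik) (λ _ → ik) (λ _ → ik) (λ _ → ik) (λ _ → ik) (λ _ → ik) (λ _ → ik) (λ _ → ik)

wFix-mor : ∀ q p v w → pst (proj₁ v) (proj₁ w) (pst (proj₂ v) (proj₂ w) p) ≤ suc q →
  Mor (𝕎𝕌 ⊗ 𝕎𝔹) (𝕎𝕌 ⊗ 𝕎𝔹) (wFix (just q)) (v , w)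
wFix-mor 0 p = all₄ (λ { (s≤s ()) }) (λ _ → ok) (λ _ → ok) (λ _ → ok) (λ _ → ok) (λ _ → ok) (λ _ → ok) (λ _ → ok) (λ _ → ok) (λ _ → ok) (λ _ → ok) (λ _ → ok) (λ _ → ok) (λ _ → ok) (λ _ → ok) (λ _ → ok)
wFix-mor 1 p = all₄ (λ _ → ok) (λ _ → ok) (λ _ → ok) (λ _ → ok) (λ _ → ok) (λ _ → ok) (λ _ → ok) (λ _ → ok) (λ _ → ok) (λ _ → ok) (λ _ → ok) (λ _ → ok) (λ _ → ok) (λ _ → ok) (λ _ → ok) (λ _ → ok)
wFix-mor (suc (suc q)) p = all₄ (λ _ → ok) (λ _ → ok) (λ _ → ok) (λ _ → ok) (λ _ → ok) (λ _ → ok) (λ _ → ok) (λ _ → ok) (λ _ → ok) (λ _ → ok) (λ _ → ok) (λ _ → ok) (λ _ → ok) (λ _ → ok) (λ _ → ok) (λ _ → ok)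

Fix-nothing : ∀ {n} (us bs : Bits n) → Fix nothing (us , bs) ≡ (us , bs)
Fix-nothing [] [] = refl
Fix-nothing (x ∷ us) (y ∷ bs) = cong ((x ∷_) ⊗ᵐ (y ∷_)) (Fix-nothing us bs)

-- The hypothesis of the fix: at most one letter z remains unmatched.
fits₁ : ∀ {n} → Maybe ℕ → Bits n → Bits n → Set
fits₁ nothing us bs = ⊤
fits₁ (just q) us bs = pend 0 us bs ≤ suc q

pred-≤ : ∀ {p q} → pred p ≤ q → p ≤ suc q
pred-≤ {zero} h = z≤n
pred-≤ {suc p} h = s≤s h

fits₁-tail : ∀ {n} q x y (us bs : Bits n) → fits₁ q (x ∷ us) (y ∷ bs) → fits₁ (fixStep q x y) us bs
fits₁-tail nothing x y us bs h = tt
fits₁-tail (just zero) true true us bs h = tt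
fits₁-tail (just (suc q)) true true us bs (s≤s h) = h
fits₁-tail (just q) true false us bs h = h
fits₁-tail (just q) false true us bs h = h
fits₁-tail (just q) false false us bs h = pred-≤ h

Fix-mor : ∀ {n} k q (us bs : Bits n) → fits₁ q us bs → Mor (ℂ n k) (ℂ n k) (Fix q) (us , bs)
Fix-mor {n} k nothing us bs h = Mor-ext (λ { (a , d) → sym (Fix-nothing a d) }) (Mor-id {ℂ n k} (us , bs))
Fix-mor k (just q) [] [] h = ok
Fix-mor zero (just q) (x ∷ []) (y ∷ []) h = ok
Fix-mor zero (just q) (x ∷ x' ∷ us) (y ∷ y' ∷ bs) h =
  Mor-along {c = embed us ⊗ᵐ embed bs} (Mor-⊗ (𝕌-embed us (x , x')) (𝔹-embed bs (y , y')))
    (Mor-bind {lab = wFixStep (just q)} (λ l w → (embed (fixU l us bs) ⊗ᵐ embed (fixB l us bs)) (wFix (just q) w))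
      (wFixStep-inv q (pend 0 us bs) (x , x') (y , y') h)
      (Mor-∘ (Mor-⊗ {g = embed (fixU (wFixStep (just q) ((x , x') , (y , y'))) us bs)} {embed (fixB (wFixStep (just q) ((x , x') , (y , y'))) us bs)}
               (𝕌-embed _ _) (𝔹-embed _ _))
             (wFix-mor q (pend 0 us bs) (x , x') (y , y') h)))
Fix-mor (suc k) (just q) (x ∷ us) (y ∷ bs) h =
  Mor-along {c = (x ∷_) ⊗ᵐ (y ∷_)} (Mor-⊗ (𝕌-∷ x us) (𝔹-∷ y bs))
    (Mor-∘ (Mor-⊗ {g = fixBit (just q) x y ∷_} {fixBit (just q) y x ∷_} (𝕌-∷ _ _) (𝔹-∷ _ _))
           (Fix-mor k (fixStep (just q) x y) us bs (fits₁-tail (just q) x y us bs h)))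

Fix-last : ∀ {n} q (us bs : Bits n) → Mor (𝕃 n) (𝕃 n) (Fix q) (us , bs)
Fix-last q [] [] = ok
Fix-last nothing (true ∷ []) (true ∷ []) = ok
Fix-last (just zero) (true ∷ []) (true ∷ []) = ok
Fix-last (just (suc q)) (true ∷ []) (true ∷ []) = ok
Fix-last nothing (true ∷ []) (false ∷ []) = ok
Fix-last (just zero) (true ∷ []) (false ∷ []) = ok
Fix-last (just (suc q)) (true ∷ []) (false ∷ []) = ok
Fix-last nothing (false ∷ []) (true ∷ []) = ok
Fix-last (just zero) (false ∷ []) (true ∷ []) = ok
Fix-last (just (suc q)) (false ∷ []) (true ∷ []) = ok
Fix-last nothing (false ∷ []) (false ∷ []) = ok
Fix-last (just zero) (false ∷ []) (false ∷ []) = ok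
Fix-last (just (suc q)) (false ∷ []) (false ∷ []) = ok
Fix-last q (x ∷ us@(_ ∷ _)) (y ∷ bs@(_ ∷ _)) =
  Mor-along (𝕃-∷ x y us bs) (Mor-∘ (𝕃-∷ (fixBit q x y) (fixBit q y x) _ _) (Fix-last (fixStep q x y) us bs))

fixed-𝕂 : ∀ {n} o (c : Col n) → Pend 0 c ≤ 1 → Mor (𝕂 n o) (𝕂 n o) fixed c
fixed-𝕂 (just k) (us , bs) h = Mor-∘ (fromℂ _) (Mor-∘ (Fix-mor k (just 0) us bs h) (toℂ {k = k} _))
fixed-𝕂 nothing (us , bs) h = Mor-∘ (from𝕃 {k = 0} _) (Mor-∘ (Fix-last (just 0) us bs) (to𝕃 {k = 0} _))

-- A tableau with m columns; the leftmost column is the outermost component,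
-- so that the nesting follows the reading word.
Tab : ℕ → ℕ → Set
Tab n zero = ⊤
Tab n (suc m) = Tab n m × Col n

𝕋 : ℕ → Op → ℕ → Crystal
𝕋 n o m .Car = Tab n m
𝕋 n o zero .f _ = nothing
𝕋 n o (suc m) .f = (𝕋 n o m ⊗ 𝕂 n o) .f
𝕋 n o zero .e _ = nothing
𝕋 n o (suc m) .e = (𝕋 n o m ⊗ 𝕂 n o) .e
𝕋 n o zero .ε _ = 0
𝕋 n o (suc m) .ε = (𝕋 n o m ⊗ 𝕂 n o) .ε
𝕋 n o zero .φ _ = 0
𝕋 n o (suc m) .φ = (𝕋 n o m ⊗ 𝕂 n o) .φ

-- Moves of single letters

bit : Bool → ℕ
bit true = 1
bit false = 0

count : ∀ {n} → Bits n → ℕ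
count [] = 0
count (x ∷ s) = bit x + count s

opn≢Closed : ∀ {l k} → l ≡ opn k → Closed l → ⊥
opn≢Closed refl ()

open? : ∀ l → Closed l ⊎ ∃ λ k → l ≡ opn k
open? over = inj₁ over-closed
open? (clo g) = inj₁ clo-closed
open? (opn k) = inj₂ (k , refl)

step-count : ∀ k x y {k'} → step (opn k) x y ≡ opn k' → k' + bit x ≡ k + bit y
step-count k true true refl = refl
step-count k false false refl = refl
step-count zero true false ()
step-count (suc k) true false refl = solve-suc k
  where
  solve-suc : ∀ k → k + 1 ≡ suc k + 0
  solve-suc = solve-∀
step-count k false true refl = solve-suc k
  where
  solve-suc : ∀ k → suc k + 0 ≡ k + 1
  solve-suc = solve-∀

walkU-count : ∀ {n} k (s t : Bits n) {k'} → walkU (opn k) s t ≡ opn k' → k' + count s ≡ k + count t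
walkU-count k [] [] refl = refl
walkU-count k (x ∷ s) (y ∷ t) {k'} h with open? (step (opn k) x y)
... | inj₁ cl = ⊥-elim (opn≢Closed h (walkU-closed s t cl))
... | inj₂ (i , eq) = begin
    k' + (bit x + count s) ≡⟨ swap k' (bit x) (count s) ⟩
    bit x + (k' + count s) ≡⟨ cong (bit x +_) (walkU-count i s t (trans (cong (λ l → walkU l s t) (sym eq)) h)) ⟩
    bit x + (i + count t) ≡⟨ swap' (bit x) i (count t) ⟩
    (i + bit x) + count t ≡⟨ cong (_+ count t) (step-count k x y eq) ⟩
    (k + bit y) + count t ≡⟨ +-assoc k (bit y) (count t) ⟩
    k + (bit y + count t) ∎
  where
  open ≡-Reasoning
  swap : ∀ a b' c → a + (b' + c) ≡ b' + (a + c)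
  swap = solve-∀
  swap' : ∀ a b' c → a + (b' + c) ≡ (b' + a) + c
  swap' = solve-∀

walkB-count : ∀ {n} k (s t : Bits n) {k'} → walkB (opn k) s t ≡ opn k' → k' + count s ≡ k + count t
walkB-count k [] [] refl = refl
walkB-count k (x ∷ s) (y ∷ t) {k'} h with open? (walkB (opn k) s t)
... | inj₁ cl = ⊥-elim (opn≢Closed h (step-closed x y cl))
... | inj₂ (i , eq) = begin
    k' + (bit x + count s) ≡⟨ sym (+-assoc k' (bit x) (count s)) ⟩
    (k' + bit x) + count s ≡⟨ cong (_+ count s) (step-count i x y (trans (cong (λ l → step l x y) (sym eq)) h)) ⟩
    (i + bit y) + count s ≡⟨ swap i (bit y) (count s) ⟩
    bit y + (i + count s) ≡⟨ cong (bit y +_) (walkB-count k s t eq) ⟩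
    bit y + (k + count t) ≡⟨ swap' (bit y) k (count t) ⟩
    k + (bit y + count t) ∎
  where
  open ≡-Reasoning
  swap : ∀ a b' c → (a + b') + c ≡ b' + (a + c)
  swap = solve-∀
  swap' : ∀ a b' c → a + (b' + c) ≡ b' + (a + c)
  swap' = solve-∀

walkB-open : ∀ {n k} (s t : Bits n) {j} → walkB (opn k) s t ≡ opn j → swapB₂ (opn k) s t ≡ s × swapB₁ (opn k) s t ≡ t
walkB-open [] [] h = refl , refl
walkB-open {k = k} (x ∷ s) (y ∷ t) h with open? (walkB (opn k) s t)
... | inj₁ cl = ⊥-elim (opn≢Closed h (step-closed x y cl))
... | inj₂ (i , eq) with walkB-open s t eq | sw-open (opn i) x y (trans (cong (λ l → step l x y) (sym eq)) h)
... | p₂ , p₁ | q₂ , q₁ = cong₂ _∷_ (trans (cong (λ l → sw₂ l x y) eq) q₂) p₂ , cong₂ _∷_ (trans (cong (λ l → sw₁ l x y) eq) q₁) p₁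

-- A letter moves from the first to the second set; the numbers count the
-- elements of both sets that precede it (Move: from below, MoveT: from above).
data Move : ∀ {n} → ℕ → ℕ → (s t s' t' : Bits n) → Set where
  here : ∀ {n} {s t : Bits n} → Move 0 0 (true ∷ s) (false ∷ t) (false ∷ s) (true ∷ t)
  there : ∀ {n i j} {s t s' t' : Bits n} x y → Move i j s t s' t' → Move (bit x + i) (bit y + j) (x ∷ s) (y ∷ t) (x ∷ s') (y ∷ t')

data MoveT : ∀ {n} → ℕ → ℕ → (s t s' t' : Bits n) → Set where
  here : ∀ {n} {s t : Bits n} → MoveT (count s) (count t) (true ∷ s) (false ∷ t) (false ∷ s) (true ∷ t)
  there : ∀ {n i j} {s t s' t' : Bits n} x y → MoveT i j s t s' t' → MoveT i j (x ∷ s) (y ∷ t) (x ∷ s') (y ∷ t')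

data Drop : ∀ {n} → ℕ → (s s' : Bits n) → Set where
  here : ∀ {n} {s : Bits n} → Drop 0 (true ∷ s) (false ∷ s)
  there : ∀ {n i} {s s' : Bits n} x → Drop i s s' → Drop (bit x + i) (x ∷ s) (x ∷ s')

data DropT : ∀ {n} → ℕ → (s s' : Bits n) → Set where
  here : ∀ {n} {s : Bits n} → DropT (count s) (true ∷ s) (false ∷ s)
  there : ∀ {n i} {s s' : Bits n} x → DropT i s s' → DropT i (x ∷ s) (x ∷ s')

Move-drop : ∀ {n i j} {s t s' t' : Bits n} → Move i j s t s' t' → Drop i s s'
Move-drop here = here
Move-drop (there x y m) = there x (Move-drop m)

MoveT-drop : ∀ {n i j} {s t s' t' : Bits n} → MoveT i j s t s' t' → DropT i s s'
MoveT-drop here = here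
MoveT-drop (there x y m) = there x (MoveT-drop m)

Move-resp : ∀ {n i i' j j'} {s t s' t' : Bits n} → i ≡ i' → j ≡ j' → Move i j s t s' t' → Move i' j' s t s' t'
Move-resp refl refl m = m

swapU-move : ∀ {n} k (s t : Bits n) → Closed (walkU (opn k) s t) →
  ∃ λ j → Move (k + j) j s t (swapU₂ (opn k) s t) (swapU₁ (opn k) s t)
swapU-move k [] [] ()
swapU-move zero (true ∷ s) (true ∷ t) cl with swapU-move zero s t cl
... | j , m = suc j , there true true m
swapU-move (suc k) (true ∷ s) (true ∷ t) cl with swapU-move (suc k) s t cl
... | j , m = suc j , Move-resp (cong suc (sym (+-suc k j))) refl (there true true m)
swapU-move zero (false ∷ s) (y ∷ t) cl = go y cl
  where
  go : ∀ y → Closed (walkU (step (opn zero) false y) s t) →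
       ∃ λ j → Move j j (false ∷ s) (y ∷ t) (swapU₂ (opn zero) (false ∷ s) (y ∷ t)) (swapU₁ (opn zero) (false ∷ s) (y ∷ t))
  go true cl with swapU-move 1 s t cl
  ... | j , m = suc j , there false true m
  go false cl with swapU-move 0 s t cl
  ... | j , m = j , there false false m
swapU-move (suc k) (false ∷ s) (true ∷ t) cl with swapU-move (suc (suc k)) s t cl
... | j , m = suc j , Move-resp (cong suc (sym (+-suc k j))) refl (there false true m)
swapU-move (suc k) (false ∷ s) (false ∷ t) cl with swapU-move (suc k) s t cl
... | j , m = j , there false false m
swapU-move zero (true ∷ s) (false ∷ t) cl with swapU-closed {l = clo 0} s t clo-closed
... | p₂ , p₁ rewrite p₂ | p₁ = 0 , here
swapU-move (suc k) (true ∷ s) (false ∷ t) cl with swapU-move k s t cl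
... | j , m = j , there true false m

closing : ∀ k x y → Closed (step (opn k) x y) → k ≡ 0 × x ≡ true × y ≡ false
closing k true true ()
closing k false false ()
closing zero true false cl = refl , refl , refl
closing (suc k) true false ()
closing zero false true ()
closing (suc k) false true ()

swapB-move : ∀ {n} k (s t : Bits n) → Closed (walkB (opn k) s t) →
  ∃ λ i → ∃ λ j → MoveT i j s t (swapB₂ (opn k) s t) (swapB₁ (opn k) s t) × i ≡ k + j
swapB-move k [] [] ()
swapB-move k (x ∷ s) (y ∷ t) cl with open? (walkB (opn k) s t)
... | inj₁ cl' with swapB-move k s t cl' | sw-closed x y cl'
...   | i , j , m , e | p₂ , p₁ rewrite p₂ | p₁ = i , j , there x y m , e
swapB-move k (x ∷ s) (y ∷ t) cl | inj₂ (k' , eq) with closing k' x y (subst (λ l → Closed (step l x y)) eq cl)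
...   | refl , refl , refl with walkB-open s t eq
...     | p₂ , p₁ rewrite p₂ | p₁ | eq = count s , count t , here , walkB-count k s t eq

-- How a removal in Φ(C) changes the raw column: here the scans with pending
-- numbers q + 1 and q are compared until they meet.
defect : ∀ {n} q (S B : Bits n) → qend (suc q) S B ≡ 0 →
  (∃ λ j → Drop j (uI (suc q) S B) (uI q S B) × q ≤ j) × qend q S B ≡ 0
defect q [] [] ()
defect q (true ∷ S) (true ∷ B) h with defect (suc q) S B h
... | (j , d , le) , e = (j , there false d , ≤-trans (n≤1+n q) le) , e
defect q (true ∷ S) (false ∷ B) h with defect q S B h
... | (j , d , le) , e = (suc j , there true d , m≤n⇒m≤1+n le) , e
defect q (false ∷ S) (true ∷ B) h with defect q S B h
... | (j , d , le) , e = (j , there false d , le) , e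
defect zero (false ∷ S) (false ∷ B) h = (0 , here , z≤n) , h
defect (suc q) (false ∷ S) (false ∷ B) h with defect q S B h
... | (j , d , le) , e = (suc j , there true d , s≤s le) , e

drop-uI : ∀ {n i} q {S S' : Bits n} (B : Bits n) → Drop i S S' → qend q S B ≡ 0 →
  (∃ λ j → Drop j (uI q S B) (uI q S' B) × i + q ≤ j) × qend q S' B ≡ 0
drop-uI q {true ∷ S} (true ∷ B) here h with defect q S B h
... | (j , d , le) , e = (j , there false d , le) , e
drop-uI zero {true ∷ S} (false ∷ B) here h = (0 , here , z≤n) , h
drop-uI (suc q) {true ∷ S} (false ∷ B) here h with defect q S B h
... | (j , d , le) , e = (suc j , there true d , s≤s le) , e
drop-uI q {true ∷ S} (true ∷ B) (there {i = i} true dr) h with drop-uI (suc q) B dr h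
... | (j , d , le) , e = (j , there false d , ≤-trans (≤-reflexive (sym (+-suc i q))) le) , e
drop-uI q {true ∷ S} (false ∷ B) (there true dr) h with drop-uI q B dr h
... | (j , d , le) , e = (suc j , there true d , s≤s le) , e
drop-uI q {false ∷ S} (true ∷ B) (there false dr) h with drop-uI q B dr h
... | (j , d , le) , e = (j , there false d , le) , e
drop-uI zero {false ∷ S} (false ∷ B) (there false dr) h with drop-uI zero B dr h
... | (j , d , le) , e = (j , there false d , le) , e
drop-uI (suc q) {false ∷ S} (false ∷ B) (there {i = i} false dr) h with drop-uI q B dr h
... | (j , d , le) , e = (suc j , there true d , ≤-trans (≤-reflexive (+-suc i q)) (s≤s le)) , e

count-bS : ∀ {n} (us bs : Bits n) → count (bS 0 us bs) + pend 0 us bs ≡ count bs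
count-bS [] [] = refl
count-bS (true ∷ us) (true ∷ bs) = trans (+-suc _ _) (cong suc (count-bS us bs))
count-bS (true ∷ us) (false ∷ bs) = count-bS us bs
count-bS (false ∷ us) (true ∷ bs) = cong suc (count-bS us bs)
count-bS (false ∷ us) (false ∷ bs) with pend 0 us bs | count-bS us bs
... | zero | e = e
... | suc p | e = trans (sym (+-suc _ _)) e

count-uS : ∀ {n} (us bs : Bits n) → count (uS 0 us bs) + pend 0 us bs ≡ count us
count-uS [] [] = refl
count-uS (true ∷ us) (true ∷ bs) = trans (+-suc _ _) (cong suc (count-uS us bs))
count-uS (true ∷ us) (false ∷ bs) = cong suc (count-uS us bs)
count-uS (false ∷ us) (true ∷ bs) = count-uS us bs
count-uS (false ∷ us) (false ∷ bs) with pend 0 us bs | count-uS us bs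
... | zero | e = e
... | suc p | e = trans (sym (+-suc _ _)) e

-- The same comparison for a barred letter removed from the raw column: the
-- scan of Φ either has absorbed the change or still carries it.
data BDrop {n : ℕ} (i : ℕ) : (B B' : Bits n) (p p' : ℕ) → Set where
  done : ∀ {j B B' p} → DropT j B B' → i ≤ j → BDrop i B B' p p
  carry : ∀ {B p} → i ≤ count B + p → BDrop i B B (suc p) p

bdrop-∷ : ∀ {n i} x y {B B' : Bits n} {p p'} → BDrop i B B' p p' →
          BDrop i (bb x y p ∷ B) (bb x y p' ∷ B') (pst x y p) (pst x y p')
bdrop-∷ x y (done {p = p} d le) = done (there (bb x y p) d) le
bdrop-∷ true true {B} (carry {p = p} le) = carry (≤-trans le (+-monoʳ-≤ (count B) (n≤1+n p)))
bdrop-∷ true false (carry le) = carry le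
bdrop-∷ false true (carry le) = carry (m≤n⇒m≤1+n le)
bdrop-∷ false false {B} (carry {p = zero} le) = done here (≤-trans le (≤-reflexive (+-identityʳ (count B))))
bdrop-∷ false false {B} (carry {p = suc p} le) = carry (≤-trans le (≤-reflexive (+-suc (count B) p)))

drop-bS : ∀ {n i} (us : Bits n) {bs bs' : Bits n} → DropT i bs bs' →
          BDrop i (bS 0 us bs) (bS 0 us bs') (pend 0 us bs) (pend 0 us bs')
drop-bS (true ∷ us) {true ∷ bs} here = carry (≤-reflexive (sym (count-bS us bs)))
drop-bS (false ∷ us) {true ∷ bs} here with pend 0 us bs | count-bS us bs
... | zero | e = done here (≤-reflexive (trans (sym e) (+-identityʳ _)))
... | suc p | e = carry (≤-reflexive (trans (sym e) (+-suc _ p)))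
drop-bS (x ∷ us) (there y d) = bdrop-∷ x y (drop-bS us d)

drop-bS-adm : ∀ {n i} (us : Bits n) {bs bs' : Bits n} → DropT i bs bs' → pend 0 us bs ≡ 0 →
              (∃ λ j → DropT j (bS 0 us bs) (bS 0 us bs') × i ≤ j) × pend 0 us bs' ≡ 0
drop-bS-adm us {bs} {bs'} d a = go (drop-bS us d) a
  where
  go : ∀ {n i p p'} {B B' : Bits n} → BDrop i B B' p p' → p ≡ 0 → (∃ λ j → DropT j B B' × i ≤ j) × p' ≡ 0
  go (done d le) a = (_ , d , le) , a
  go (carry _) ()

pend-insert : ∀ {n i j} {s s' t t' : Bits n} (bs : Bits n) → Move i j s t s' t' →
              pend 0 t' bs ≡ pend 0 t bs ⊎ pend 0 t' bs ≡ suc (pend 0 t bs)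
pend-insert (true ∷ bs) here = inj₂ refl
pend-insert {t = false ∷ t} (false ∷ bs) here with pend 0 t bs
... | zero = inj₁ refl
... | suc p = inj₂ refl
pend-insert (b' ∷ bs) (there x y m) with pend-insert bs m
pend-insert (b' ∷ bs) (there x y m) | inj₁ e = inj₁ (cong (pst y b') e)
pend-insert (true ∷ bs) (there x true m) | inj₂ e = inj₂ (cong suc e)
pend-insert (false ∷ bs) (there x true m) | inj₂ e = inj₂ e
pend-insert (true ∷ bs) (there x false m) | inj₂ e = inj₂ e
pend-insert {t = y ∷ t} {t' = y ∷ t'} (false ∷ bs) (there x false m) | inj₂ e with pend 0 t bs | pend 0 t' bs | e
... | zero | .1 | refl = inj₁ refl
... | suc p | .(suc (suc p)) | refl = inj₂ refl

uS-bs-disjoint : ∀ x y p → bit (ub x y p) + bit y ≤ 1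
uS-bs-disjoint true true p = ≤-refl
uS-bs-disjoint true false p = ≤-refl
uS-bs-disjoint false true p = ≤-refl
uS-bs-disjoint false false zero = z≤n
uS-bs-disjoint false false (suc p) = ≤-refl

+-interchange : ∀ a b' c d → (a + b') + (c + d) ≡ (a + c) + (b' + d)
+-interchange = solve-∀

count-l : ∀ {n} (us bs : Bits n) → count (uS 0 us bs) + count bs ≤ n
count-l [] [] = z≤n
count-l (x ∷ us) (y ∷ bs) = ≤-trans (≤-reflexive (+-interchange (bit (ub x y (pend 0 us bs))) _ (bit y) _))
  (+-mono-≤ (uS-bs-disjoint x y (pend 0 us bs)) (count-l us bs))

extra-pending : ∀ {n} q (S B : Bits n) → qend q S B ≡ 0 → qend (suc q) S B ≡ 0 ⊎ count (uI q S B) + count B ≡ n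
extra-pending q [] [] h = inj₂ refl
extra-pending q (true ∷ S) (true ∷ B) h with extra-pending (suc q) S B h
... | inj₁ e = inj₁ e
... | inj₂ e = inj₂ (trans (+-suc _ _) (cong suc e))
extra-pending q (true ∷ S) (false ∷ B) h with extra-pending q S B h
... | inj₁ e = inj₁ e
... | inj₂ e = inj₂ (cong suc e)
extra-pending q (false ∷ S) (true ∷ B) h with extra-pending q S B h
... | inj₁ e = inj₁ e
... | inj₂ e = inj₂ (trans (+-suc _ _) (cong suc e))
extra-pending zero (false ∷ S) (false ∷ B) h = inj₁ h
extra-pending (suc q) (false ∷ S) (false ∷ B) h with extra-pending q S B h
... | inj₁ e = inj₁ e
... | inj₂ e = inj₂ (cong suc e)

-- A barred letter b̄ can be inserted into Φ(C₁): otherwise rC₁ would meet every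
-- index ≥ b, and the gap could not close between b and b̄.
ub-barred : ∀ x p → ub x true p ≡ false
ub-barred true p = refl
ub-barred false p = refl

step-ft : ∀ k → step (opn k) false true ≡ opn (suc k)
step-ft zero = refl
step-ft (suc k) = refl

qend-insert : ∀ {n} q a (us₂ bs₂ S B : Bits n) {k} → walkU (opn a) (uS 0 us₂ bs₂) (uI q S B) ≡ opn k →
  Closed (walkB (opn k) bs₂ B) → qend q S B ≡ 0 → qend q S (swapB₁ (opn k) bs₂ B) ≡ 0
qend-insert q a [] [] [] [] h cl e = e
qend-insert q a (x₂ ∷ us₂) (y₂ ∷ bs₂) (s ∷ S) (b' ∷ B) {k} h cl e
  with open? (step (opn a) (ub x₂ y₂ (pend 0 us₂ bs₂)) (ub s b' q))
... | inj₁ cl' = ⊥-elim (opn≢Closed h (walkU-closed (uS 0 us₂ bs₂) (uI (pst s b' q) S B) cl'))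
... | inj₂ (a' , eq) with open? (walkB (opn k) bs₂ B)
... | inj₁ cl'' rewrite proj₂ (sw-closed y₂ b' cl'') =
  qend-insert (pst s b' q) a' us₂ bs₂ S B (trans (cong (λ l → walkU l (uS 0 us₂ bs₂) (uI (pst s b' q) S B)) (sym eq)) h) cl'' e
... | inj₂ (k' , eqB) with closing k' y₂ b' (subst (λ l → Closed (step l y₂ b')) eqB cl)
... | refl , refl , refl with walkB-open bs₂ B eqB
... | _ , p₁ rewrite p₁ | eqB | ub-barred x₂ (pend 0 us₂ bs₂) = go s q e h
  where
  full : ∀ q → walkU (opn (suc a)) (uS 0 us₂ bs₂) (uI q S B) ≡ opn k → count (uI q S B) + count B ≡ _ → ⊥
  full q hu f = <-irrefl refl (≤-trans (s≤s (m≤n+m _ a)) (≤-trans (≤-reflexive (sum₁ (walkU-count (suc a) (uS 0 us₂ bs₂) (uI q S B) hu) (walkB-count k bs₂ B eqB) f)) (count-l us₂ bs₂)))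
    where
    sum₁ : ∀ {cs ct cs' ct' n} → k + cs ≡ suc a + ct → 0 + cs' ≡ k + ct' → ct + ct' ≡ n → suc (a + n) ≡ cs + cs'
    sum₁ {cs} {ct} {cs'} {ct'} refl' refl'' refl = +-cancelˡ-≡ k _ _ (begin
      k + suc (a + (ct + ct')) ≡⟨ r₁ k a ct ct' ⟩
      (suc a + ct) + (k + ct') ≡⟨ cong₂ _+_ (sym refl') (sym refl'') ⟩
      (k + cs) + cs' ≡⟨ +-assoc k cs cs' ⟩
      k + (cs + cs') ∎)
      where
      open ≡-Reasoning
      r₁ : ∀ k a ct ct' → k + suc (a + (ct + ct')) ≡ (suc a + ct) + (k + ct')
      r₁ = solve-∀
  go : ∀ s q → qend (pst s false q) S B ≡ 0 → walkU (step (opn a) false (ub s false q)) (uS 0 us₂ bs₂) (uI (pst s false q) S B) ≡ opn k →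
       qend (pst s true q) S B ≡ 0
  go true q e h with extra-pending q S B e
  ... | inj₁ e' = e'
  ... | inj₂ f = ⊥-elim (full q (trans (cong (λ l → walkU l (uS 0 us₂ bs₂) (uI q S B)) (sym (step-ft a))) h) f)
  go false zero e h = e
  go false (suc q) e h with extra-pending q S B e
  ... | inj₁ e' = e'
  ... | inj₂ f = ⊥-elim (full q (trans (cong (λ l → walkU l (uS 0 us₂ bs₂) (uI q S B)) (sym (step-ft a))) h) f)

data Crossing {n : ℕ} (k : ℕ) : Col n × Col n → Col n × Col n → Set where
  viaU : ∀ {us₂ bs₂ us₁ bs₁ S' us₁' j} → Move (k + j) j (uS 0 us₂ bs₂) us₁ S' us₁' → qend 0 S' (bS 0 us₂ bs₂) ≡ 0 →
         Crossing k ((us₂ , bs₂) , (us₁ , bs₁)) (Φ⁻¹ 0 (bS 0 us₂ bs₂ , S') , (us₁' , bs₁))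
  viaB : ∀ {us₂ bs₂ us₁ bs₁ bs₂' B₁' i j} → MoveT i j bs₂ (bS 0 us₁ bs₁) bs₂' B₁' →
         count us₂ + i ≡ k + (count us₁ + j) → qend 0 (uS 0 us₁ bs₁) B₁' ≡ 0 →
         Crossing k ((us₂ , bs₂) , (us₁ , bs₁)) ((us₂ , bs₂') , Φ⁻¹ 0 (B₁' , uS 0 us₁ bs₁))

data CrossBy {n : ℕ} (k : ℕ) (c : Col n × Col n) : Set where
  byU : Closed (walkA k c) → cross k c ≡ ontoU (opn k) c → CrossBy k c
  byB : ∀ j → walkA k c ≡ opn j → cross k c ≡ ontoB (opn j) c → CrossBy k c

crossBy : ∀ {n} k (c : Col n × Col n) {g} → walkZ k c ≡ clo g → CrossBy k c
crossBy k c@((us₂ , bs₂) , (us₁ , bs₁)) h with walkA k c in eq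
... | clo g = byU (subst Closed (sym eq) clo-closed) (cross-clo k c eq)
... | opn j = byB j eq (cross-opn k c eq)
... | over with walkB over bs₂ (bS 0 us₁ bs₁) | live-walkB over bs₂ (bS 0 us₁ bs₁) | h
... | .(clo _) | lw | refl with lw refl
... | ()

crossing : ∀ {n} k (c : Col n × Col n) → adm (proj₁ c) → adm (proj₂ c) → ∀ {g} → walkZ k c ≡ clo g → Crossing k c (cross k c)
crossing k c@((us₂ , bs₂) , (us₁ , bs₁)) a₂ a₁ h with crossBy k c h
... | byU cl eq rewrite eq with swapU-move k (uS 0 us₂ bs₂) us₁ cl
...   | j , m = viaU m (proj₂ (drop-uI 0 (bS 0 us₂ bs₂) (Move-drop m) (proj₂ (proj₂ (Φ⁻¹-Φ us₂ bs₂ a₂)))))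
crossing k c@((us₂ , bs₂) , (us₁ , bs₁)) a₂ a₁ {g} h | byB k' wk eq rewrite eq with swapB-move k' bs₂ (bS 0 us₁ bs₁) clB
  where
  clB : Closed (walkB (opn k') bs₂ (bS 0 us₁ bs₁))
  clB = subst Closed (trans (sym h) (cong (λ l → walkB l bs₂ (bS 0 us₁ bs₁)) wk)) clo-closed
...   | i , j , m , e = viaB m pos (qend-insert 0 k us₂ bs₂ (uS 0 us₁ bs₁) (bS 0 us₁ bs₁) (trans (cong (walkU (opn k) (uS 0 us₂ bs₂)) (proj₁ (Φ⁻¹-Φ us₁ bs₁ a₁))) wk)
          (subst Closed (trans (sym h) (cong (λ l → walkB l bs₂ (bS 0 us₁ bs₁)) wk)) clo-closed) (proj₂ (proj₂ (Φ⁻¹-Φ us₁ bs₁ a₁))))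
  where
  pos : count us₂ + i ≡ k + (count us₁ + j)
  pos rewrite e = begin
    count us₂ + (k' + j) ≡⟨ cong (_+ (k' + j)) (sym (trans (sym (+-identityʳ _)) (trans (cong (count (uS 0 us₂ bs₂) +_) (sym a₂)) (count-uS us₂ bs₂)))) ⟩
    count (uS 0 us₂ bs₂) + (k' + j) ≡⟨ r₁ (count (uS 0 us₂ bs₂)) k' j ⟩
    (k' + count (uS 0 us₂ bs₂)) + j ≡⟨ cong (_+ j) (walkU-count k (uS 0 us₂ bs₂) us₁ wk) ⟩
    (k + count us₁) + j ≡⟨ +-assoc k (count us₁) j ⟩
    k + (count us₁ + j) ∎
    where
    open ≡-Reasoning
    r₁ : ∀ a b' c → a + (b' + c) ≡ (b' + a) + c
    r₁ = solve-∀

data Looser : Walk → Walk → Set where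
  opn-opn : ∀ {k} → Looser (opn (suc k)) (opn k)
  opn-clo : ∀ {k} → Looser (opn k) (clo k)

Looser-step : ∀ {l l'} x y {k} → Looser l l' → step l x y ≡ opn k → Looser (step l x y) (step l' x y)
Looser-step true true opn-opn h = opn-opn
Looser-step true true opn-clo h = opn-clo
Looser-step false false opn-opn h = opn-opn
Looser-step false false opn-clo h = opn-clo
Looser-step true false (opn-opn {zero}) h = opn-clo
Looser-step true false (opn-opn {suc k}) h = opn-opn
Looser-step true false (opn-clo {zero}) ()
Looser-step true false (opn-clo {suc k}) h = opn-clo
Looser-step false true opn-opn h = opn-opn
Looser-step false true (opn-clo {zero}) h = opn-clo
Looser-step false true (opn-clo {suc k}) h = opn-clo

opn-step : ∀ l x y {k} → step l x y ≡ opn k → ∃ λ j → l ≡ opn j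
opn-step l x y h with open? l
... | inj₂ p = p
... | inj₁ cl = ⊥-elim (opn≢Closed h (step-closed x y cl))

opn-walkU : ∀ {n} l (s t : Bits n) {k} → walkU l s t ≡ opn k → ∃ λ j → l ≡ opn j
opn-walkU l s t h with open? l
... | inj₂ p = p
... | inj₁ cl = ⊥-elim (opn≢Closed h (walkU-closed s t cl))

opn-walkB : ∀ {n} l (s t : Bits n) {k} → walkB l s t ≡ opn k → ∃ λ j → l ≡ opn j
opn-walkB l s t h with open? l
... | inj₂ p = p
... | inj₁ cl = ⊥-elim (opn≢Closed h (walkB-closed s t cl))

Looser-walkU : ∀ {n l l'} (s t : Bits n) {k} → Looser l l' → walkU l s t ≡ opn k → Looser (walkU l s t) (walkU l' s t)
Looser-walkU [] [] r h = r
Looser-walkU {l = l} (x ∷ s) (y ∷ t) r h = Looser-walkU s t (Looser-step x y r (proj₂ (opn-walkU (step l x y) s t h))) h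

Looser-walkB : ∀ {n l l'} (s t : Bits n) {k} → Looser l l' → walkB l s t ≡ opn k → Looser (walkB l s t) (walkB l' s t)
Looser-walkB [] [] r h = r
Looser-walkB {l = l} (x ∷ s) (y ∷ t) r h = Looser-step x y (Looser-walkB s t r (proj₂ (opn-step (walkB l s t) x y h))) h

Looser-drop-step : ∀ l x {k} → step l x true ≡ opn k → Looser (step l x true) (step l x false)
Looser-drop-step over true ()
Looser-drop-step over false ()
Looser-drop-step (opn zero) true h = opn-clo
Looser-drop-step (opn (suc k)) true h = opn-opn
Looser-drop-step (opn zero) false h = opn-opn
Looser-drop-step (opn (suc k)) false h = opn-opn
Looser-drop-step (clo g) true ()
Looser-drop-step (clo g) false ()

Looser-dropU : ∀ {n i} l (s : Bits n) {t t' : Bits n} {k} → Drop i t t' → walkU l s t ≡ opn k → Looser (walkU l s t) (walkU l s t')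
Looser-dropU l (x ∷ s) {true ∷ t} here h = Looser-walkU s t (Looser-drop-step l x (proj₂ (opn-walkU (step l x true) s t h))) h
Looser-dropU l (x ∷ s) (there y d) h = Looser-dropU (step l x y) s d h

Looser-dropB : ∀ {n i} l (s : Bits n) {t t' : Bits n} {k} → DropT i t t' → walkB l s t ≡ opn k → Looser (walkB l s t) (walkB l s t')
Looser-dropB l (x ∷ s) {true ∷ t} here h = Looser-drop-step (walkB l s t) x h
Looser-dropB l (x ∷ s) {y ∷ t} (there y d) h = Looser-step x y (Looser-dropB l s d (proj₂ (opn-step (walkB l s t) x y h))) h

Looser-live : ∀ {l l'} → Looser l l' → live l' ≡ true
Looser-live opn-opn = refl
Looser-live opn-clo = refl

-- rC' arises from rC by removing one letter that is preceded by at least i letters.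
data RDrop {n : ℕ} (i : ℕ) : Col n → Col n → Set where
  rdropU : ∀ {us bs us' bs' j} → Drop j us us' → i ≤ j → bS 0 us' bs' ≡ bS 0 us bs → RDrop i (us , bs) (us' , bs')
  rdropB : ∀ {us bs bs' j} → DropT j (bS 0 us bs) (bS 0 us bs') → i ≤ count us + j → RDrop i (us , bs) (us , bs')

Looser-start : ∀ {n} k (c : Col n × Col n) {j} → walkZ (suc k) c ≡ opn j → Looser (walkZ (suc k) c) (walkZ k c)
Looser-start k ((us₂ , bs₂) , (us₁ , bs₁)) h =
  Looser-walkB bs₂ (bS 0 us₁ bs₁) (Looser-walkU (uS 0 us₂ bs₂) us₁ opn-opn (proj₂ (opn-walkB _ bs₂ (bS 0 us₁ bs₁) h))) h

Looser-rdrop : ∀ {n i} k (c₂ : Col n) {c₁ c₁'} {j} → RDrop i c₁ c₁' → walkZ k (c₂ , c₁) ≡ opn j →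
               Looser (walkZ k (c₂ , c₁)) (walkZ k (c₂ , c₁'))
Looser-rdrop k (us₂ , bs₂) {us , bs} (rdropU d _ e) h rewrite e =
  Looser-walkB bs₂ (bS 0 us bs) (Looser-dropU (opn k) (uS 0 us₂ bs₂) d (proj₂ (opn-walkB _ bs₂ (bS 0 us bs) h))) h
Looser-rdrop k (us₂ , bs₂) {us , bs} (rdropB d _) h = Looser-dropB (walkU (opn k) (uS 0 us₂ bs₂) us) bs₂ d h

crossIndex : ∀ {n k} {c c' : Col n × Col n} → Crossing k c c' → ℕ
crossIndex {k = k} (viaU {j = j} _ _) = k + j
crossIndex (viaB {us₂ = us₂} {i = i} _ _ _) = count us₂ + i

crossing-rdrop : ∀ {n k} {c₂ c₁ c₂' c₁' : Col n} → adm c₂ → (x : Crossing k (c₂ , c₁) (c₂' , c₁')) →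
                 adm c₂' × RDrop (crossIndex x) c₂ c₂'
crossing-rdrop {k = k} a₂ (viaU {us₂} {bs₂} {S' = S'} {j = j₀} m q) with drop-uI 0 (bS 0 us₂ bs₂) (Move-drop m) (proj₂ (proj₂ (Φ⁻¹-Φ us₂ bs₂ a₂)))
... | (j , d , le) , _ =
  subst (λ z → pend z (uI 0 S' B) (bI 0 S' B) ≡ 0) q (pend-I 0 S' B) ,
  rdropU (subst (λ s → Drop j s (uI 0 S' B)) (proj₁ (Φ⁻¹-Φ us₂ bs₂ a₂)) d) (≤-trans (≤-reflexive (sym (+-identityʳ (k + j₀)))) le)
    (subst (λ z → bS z (uI 0 S' B) (bI 0 S' B) ≡ B) q (bS-I 0 S' B))
  where B = bS 0 us₂ bs₂
crossing-rdrop a₂ (viaB {us₂} {bs₂} m e q) with drop-bS-adm us₂ (MoveT-drop m) a₂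
... | (j , d , le) , a₂' = a₂' , rdropB d (+-monoʳ-≤ (count us₂) le)

crossing-pend : ∀ {n k} {c₂ c₁ c₂' c₁' : Col n} → adm c₁ → Crossing k (c₂ , c₁) (c₂' , c₁') → Pend 0 c₁' ≤ 1
crossing-pend a₁ (viaU {bs₁ = bs₁} m q) with pend-insert bs₁ m
... | inj₁ e = ≤-trans (≤-reflexive (trans e a₁)) z≤n
... | inj₂ e = ≤-reflexive (trans e (cong suc a₁))
crossing-pend a₁ (viaB {us₁ = us₁} {bs₁} {B₁' = B₁'} m e q) =
  ≤-trans (≤-reflexive (subst (λ z → pend z (uI 0 S B₁') (bI 0 S B₁') ≡ 0) q (pend-I 0 S B₁'))) z≤n
  where S = uS 0 us₁ bs₁

-- After a removal from rC₁ that left room for the crossing letter, the letter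
-- enters an admissible column: the removed index is free in the new column.
swap-pend : ∀ {n} l (s t bs : Bits n) → pend 0 t bs ≡ 0 → pred (pend 0 (swapU₁ l s t) bs) ≡ 0
swap-pend l s t bs a with open? l
... | inj₁ cl rewrite proj₂ (swapU-closed s t cl) | a = refl
... | inj₂ (k , refl) with open? (walkU (opn k) s t)
...   | inj₂ (_ , eq) rewrite proj₂ (walkU-open s t eq) | a = refl
...   | inj₁ cl with pend-insert bs (proj₂ (swapU-move k s t cl))
...     | inj₁ e rewrite e | a = refl
...     | inj₂ e rewrite e | a = refl

bb-true : ∀ y p → bb true y p ≡ false
bb-true true p = refl
bb-true false p = refl

bb-false : ∀ y p → bb false y p ≡ false → y ≡ false × p ≡ 0
bb-false false zero h = refl , refl

swap-after-drop : ∀ {n i j} l {s t t' bs bs' : Bits n} → Drop i t t' → bS 0 t' bs' ≡ bS 0 t bs →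
  walkU l s t ≡ opn j → pend 0 (swapU₁ l s t') bs' ≡ pend 0 t' bs'
swap-after-drop l {x ∷ s} {true ∷ t} {false ∷ t} {y ∷ bs} {y' ∷ bs'} here e h
  with bb-false y' (pend 0 t bs') (trans (cong Data.Vec.head e) (bb-true y (pend 0 t bs)))
... | refl , p0 = go l x
  where
  tail : ∀ l' → pred (pend 0 (swapU₁ l' s t) bs') ≡ pred (pend 0 t bs')
  tail l' = trans (swap-pend l' s t bs' p0) (sym (cong pred p0))
  swapped : ∀ l' → Closed l' → pst true false (pend 0 (swapU₁ l' s t) bs') ≡ pred (pend 0 t bs')
  swapped l' cl rewrite proj₂ (swapU-closed s t cl) | p0 = refl
  go : ∀ l x → pst (sw₁ l x false) false (pend 0 (swapU₁ (step l x false) s t) bs') ≡ pred (pend 0 t bs')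
  go (opn zero) true = swapped (clo 0) clo-closed
  go (opn zero) false = tail (opn zero)
  go (opn (suc k)) x = tail (step (opn (suc k)) x false)
  go over x = tail over
  go (clo g) x = tail (step (clo g) x false)
swap-after-drop l {x ∷ s} {y ∷ t} {y ∷ t'} {z ∷ bs} {z' ∷ bs'} (there y d) e h
  with opn-walkU (step l x y) s t h
... | k , eq rewrite proj₂ (sw-open l x y eq) = cong (pst y z') (swap-after-drop (step l x y) {s} d (cong Data.Vec.tail e) h)

middle-adm : ∀ {n i k j} {c₃ c₂ c₂' : Col n} → adm c₂' → RDrop i c₂ c₂' → walkZ k (c₃ , c₂) ≡ opn j →
             Closed (walkA k (c₃ , c₂')) → pend 0 (swapU₁ (opn k) (uS 0 (proj₁ c₃) (proj₂ c₃)) (proj₁ c₂')) (proj₂ c₂') ≡ 0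
middle-adm {k = k} {c₃ = us₃ , bs₃} {us , bs} a (rdropU d _ e) h cl =
  trans (swap-after-drop (opn k) {uS 0 us₃ bs₃} d e (proj₂ (opn-walkB _ bs₃ (bS 0 us bs) h))) a
middle-adm {k = k} {c₃ = us₃ , bs₃} {us , bs} a (rdropB d _) h cl = ⊥-elim (opn≢Closed (proj₂ (opn-walkB _ bs₃ (bS 0 us bs) h)) cl)

-- Slides

split𝕋 : ∀ {n o m} (t : Tab n (suc m)) → Mor (𝕋 n o (suc m)) (𝕋 n o m ⊗ 𝕂 n o) id t
split𝕋 t = mor (sym (mapM-id _)) (sym (mapM-id _)) refl refl

join𝕋 : ∀ {n o m} (t : Tab n (suc m)) → Mor (𝕋 n o m ⊗ 𝕂 n o) (𝕋 n o (suc m)) id t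
join𝕋 t = mor (sym (mapM-id _)) (sym (mapM-id _)) refl refl

whenClosed : {A : Set} → Walk → A → A → A
whenClosed (clo _) x y = x
whenClosed _ x y = y

-- The slide through the columns, starting with the puncture in the leftmost
-- one, which has offset o; the other columns have the offsets gs.
run : ∀ {n m} → ℕ → Vec ℕ m → Tab n (suc m) → Tab n (suc m)
run o [] t = t
run o (g ∷ gs) ((t , c₂) , c₁) = whenClosed (walkZ (o ∸ g) (c₂ , c₁))
  (run g gs (t , proj₁ (cross (o ∸ g) (c₂ , c₁))) , fixed (proj₂ (cross (o ∸ g) (c₂ , c₁)))) ((t , c₂) , c₁)

TabLabel : ℕ → Set
TabLabel zero = ℕ
TabLabel (suc m) = ℕ × Walk × TabLabel m

tabLabel : ∀ {n m} → ℕ → Vec ℕ m → Tab n (suc m) → TabLabel m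
tabLabel o [] (_ , c) = Pend 0 c
tabLabel o (g ∷ gs) ((t , c₂) , c₁) = Pend 0 c₁ , walkZ (o ∸ g) (c₂ , c₁) , tabLabel g gs (t , c₂)

GoodLabel : ∀ {m} → TabLabel m → Set
GoodLabel {zero} p = p ≡ 0
GoodLabel {suc m} (p , l , r) = p ≡ 0 × (∃ λ k → l ≡ opn k) × GoodLabel r

Good : ∀ {n m} → ℕ → Vec ℕ m → Tab n (suc m) → Set
Good o gs t = GoodLabel (tabLabel o gs t)

-- The tableaux with a puncture in the leftmost column.
Punctured : ∀ {n m} → ℕ → Vec ℕ m → Tab n (suc m) → Set
Punctured o [] (_ , c) = adm c
Punctured o (g ∷ gs) ((t , c₂) , c₁) = adm c₁ × live (walkZ (o ∸ g) (c₂ , c₁)) ≡ true × Good g gs (t , c₂)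

Inv-pair : ∀ {A L M} {l : Car A → L} {l' : Car A → M} {a} → Inv A l a → Inv A l' a → Inv A (λ x → l x , l' x) a
Inv-pair {A} {l' = l'} {a} i j = Inv-bind {A} (λ u' x → u' , l' x) i (Inv-map (_ ,_) j)

tabLabel-inv : ∀ {n m} op o (gs : Vec ℕ m) (t : Tab n (suc m)) → Inv (𝕋 n op (suc m)) (tabLabel o gs) t
tabLabel-inv {n} {zero} op o [] t@(_ , c) =
  Inv-pull {g = id} (split𝕋 {n} {op} {0} t) (Inv-⊗ʳ {𝕋 n op 0} {𝕂 n op} (Pend-𝕂 op c))
tabLabel-inv {n} {suc m} op o (g ∷ gs) t@((t' , c₂) , c₁) =
  Inv-pair (Inv-pull {g = id} (split𝕋 t) (Inv-⊗ʳ {𝕋 n op (suc m)} {𝕂 n op} (Pend-𝕂 op c₁)))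
    (Inv-pair
      (Inv-pull {g = id} {λ x → walkZ (o ∸ g) (proj₂ (proj₁ x) , proj₂ x)} (split𝕋 t)
        (Inv-pull {g = id ⊗ᵐ id} {λ x → walkZ (o ∸ g) (proj₂ (proj₁ x) , proj₂ x)} (Mor-⊗ (split𝕋 (t' , c₂)) (Mor-id {𝕂 n op} c₁))
          (Inv-pull {g = assocR} {λ x → walkZ (o ∸ g) (proj₂ x)} (Mor-assocR {𝕋 n op m} {𝕂 n op} {𝕂 n op} ((t' , c₂) , c₁))
            (Inv-⊗ʳ {𝕋 n op m} {𝕂 n op ⊗ 𝕂 n op} (walkZ-𝕂 op (o ∸ g) (c₂ , c₁))))))
      (Inv-pull {g = id} (split𝕋 t) (Inv-⊗ˡ {𝕋 n op (suc m)} {𝕂 n op} (tabLabel-inv op g gs (t' , c₂)))))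

Crossing-next : ∀ {n m g} (gs : Vec ℕ m) {t : Tab n m} {c₂ c₂' : Col n} {i} → Good g gs (t , c₂) → adm c₂' → RDrop i c₂ c₂' →
  Punctured g gs (t , c₂')
Crossing-next [] G a r = a
Crossing-next {g = g} (g' ∷ gs) {t , c₃} (_ , (k , eq) , G) a r = a , Looser-live (Looser-rdrop (g ∸ g') c₃ r eq) , G

cross-next : ∀ {n m} o g (gs : Vec ℕ m) (t : Tab n m) (c₂ c₁ : Col n) → adm c₁ → Good g gs (t , c₂) → ∀ {h} → walkZ (o ∸ g) (c₂ , c₁) ≡ clo h →
  Punctured g gs (t , proj₁ (cross (o ∸ g) (c₂ , c₁))) × Pend 0 (proj₂ (cross (o ∸ g) (c₂ , c₁))) ≤ 1
cross-next o g gs t c₂ c₁ a₁ G h = Crossing-next gs G (proj₁ R) (proj₂ R) , crossing-pend a₁ X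
  where
  a₂ : adm c₂
  a₂ = go gs t G
    where
    go : ∀ {m} (gs : Vec ℕ m) t → Good g gs (t , c₂) → adm c₂
    go [] t G = G
    go (_ ∷ _) (_ , _) G = proj₁ G
  X = crossing (o ∸ g) (c₂ , c₁) a₂ a₁ h
  R = crossing-rdrop a₂ X

Good-adm : ∀ {n m g} (gs : Vec ℕ m) {t : Tab n m} {c : Col n} → Good g gs (t , c) → adm c
Good-adm [] G = G
Good-adm (_ ∷ _) {_ , _} G = proj₁ G

run-mor : ∀ {n m} op o (gs : Vec ℕ m) (t : Tab n (suc m)) → Punctured o gs t → Mor (𝕋 n op (suc m)) (𝕋 n op (suc m)) (run o gs) t
run-mor {n} op o [] t p = Mor-id {𝕋 n op 1} t
run-mor {n} {suc m} op o (g ∷ gs) t@((t' , c₂) , c₁) (a₁ , lv , G) =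
  Mor-bind {lab = lab} (λ l x → whenClosed l (go x) x) lab-inv (branch (lab t) refl)
  where
  lab : Tab n (suc (suc m)) → Walk
  lab ((t , c₂) , c₁) = walkZ (o ∸ g) (c₂ , c₁)
  go : Tab n (suc (suc m)) → Tab n (suc (suc m))
  go = (run g gs ⊗ᵐ fixed) ∘ assocL ∘ (id ⊗ᵐ cross (o ∸ g)) ∘ assocR
  grouped : Mor (𝕋 n op (suc (suc m))) (𝕋 n op m ⊗ (𝕂 n op ⊗ 𝕂 n op)) assocR t
  grouped = Mor-∘ (Mor-assocR {𝕋 n op m} {𝕂 n op} {𝕂 n op} t) (Mor-∘ (Mor-⊗ (split𝕋 (t' , c₂)) (Mor-id {𝕂 n op} c₁)) (split𝕋 t))
  lab-inv : Inv (𝕋 n op (suc (suc m))) lab t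
  lab-inv = Inv-pull {lab = λ x → walkZ (o ∸ g) (proj₂ x)} grouped (Inv-⊗ʳ {𝕋 n op m} {𝕂 n op ⊗ 𝕂 n op} (walkZ-𝕂 op (o ∸ g) (c₂ , c₁)))
  branch : ∀ l → lab t ≡ l → Mor (𝕋 n op (suc (suc m))) (𝕋 n op (suc (suc m))) (λ x → whenClosed l (go x) x) t
  branch over eq = Mor-id {𝕋 n op (suc (suc m))} t
  branch (opn _) eq = Mor-id {𝕋 n op (suc (suc m))} t
  branch (clo _) eq with cross-next o g gs t' c₂ c₁ a₁ G eq
  ... | P , le = Mor-∘ (join𝕋 _)
    (Mor-∘ (Mor-⊗ {A = 𝕋 n op (suc m)} {𝕂 n op} (run-mor op g gs _ P) (fixed-𝕂 op _ le))
      (Mor-∘ (Mor-⊗ (join𝕋 _) (Mor-id {𝕂 n op} _))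
        (Mor-∘ (Mor-assocL {𝕋 n op m} {𝕂 n op} {𝕂 n op} _)
          (Mor-∘ (Mor-⊗ (Mor-id {𝕋 n op m} t') (cross-𝕂 op (o ∸ g) (c₂ , c₁) (Good-adm gs G) a₁ lv)) grouped))))

-- The slide from the corner at the bottom of column j (counted from 0).
slide : ∀ {n m} → ℕ → ℕ → Vec ℕ m → Tab n (suc m) → Tab n (suc m)
slide zero o gs t = run (o ∸ 1) gs t
slide (suc j) o [] t = t
slide (suc j) o (g ∷ gs) (t , c) = slide j g gs t , c

-- The inner corners of the inner shape with column heights o ∷ gs.
Corner : ∀ {m} → ℕ → ℕ → Vec ℕ m → Set
Corner zero o [] = 1 ≤ o
Corner zero o (g ∷ gs) = g < o
Corner (suc j) o [] = ⊥
Corner (suc j) o (g ∷ gs) = Corner j g gs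

corner-gap : ∀ {o g} → g < o → o ∸ g ≡ suc (o ∸ 1 ∸ g)
corner-gap {suc o} {zero} (s≤s le) = refl
corner-gap {suc (suc o)} {suc g} (s≤s le) = corner-gap {suc o} {g} le

Good-Punctured : ∀ {n m} o (gs : Vec ℕ m) (t : Tab n (suc m)) → Corner 0 o gs → Good o gs t → Punctured (o ∸ 1) gs t
Good-Punctured o [] t c G = G
Good-Punctured o (g ∷ gs) ((t , c₂) , c₁) c (a₁ , (k , eq) , G) =
  a₁ , Looser-live (Looser-start (o ∸ 1 ∸ g) (c₂ , c₁) (trans (cong (λ z → walkZ z (c₂ , c₁)) (sym (corner-gap c))) eq)) , G

slide-mor : ∀ {n m} op j o (gs : Vec ℕ m) (t : Tab n (suc m)) → Corner j o gs → Good o gs t →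
            Mor (𝕋 n op (suc m)) (𝕋 n op (suc m)) (slide j o gs) t
slide-mor op zero o gs t c G = run-mor op (o ∸ 1) gs t (Good-Punctured o gs t c G)
slide-mor {n} op (suc j) o (g ∷ gs) (t , c₁) c (_ , _ , G) =
  Mor-∘ (join𝕋 _) (Mor-∘ (Mor-⊗ {A = 𝕋 n op _} {𝕂 n op} {h = id} (slide-mor op j g gs t c G) (Mor-id {𝕂 n op} c₁)) (split𝕋 (t , c₁)))

Good-f : ∀ {n m} op o (gs : Vec ℕ m) (t : Tab n (suc m)) {t'} → Good o gs t → f (𝕋 n op (suc m)) t ≡ just t' → Good o gs t'
Good-f op o gs t G eq = subst GoodLabel (sym (Inv-f (tabLabel-inv op o gs t) eq)) G

Good-e : ∀ {n m} op o (gs : Vec ℕ m) (t : Tab n (suc m)) {t'} → Good o gs t → e (𝕋 n op (suc m)) t ≡ just t' → Good o gs t'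
Good-e op o gs t G eq = subst GoodLabel (sym (Inv-e (tabLabel-inv op o gs t) eq)) G

height : ∀ {n} → Col n → ℕ
height (us , bs) = count us + count bs

heights : ∀ {n m} → Tab n m → Vec ℕ m
heights {m = zero} tt = []
heights {m = suc m} (t , c) = height c ∷ heights t

count-lower : ∀ {n} k (s : Bits n) → Inv (𝕌 n k) count s
count-lower k [] = ik
count-lower zero (x ∷ []) = ik
count-lower zero (true ∷ true ∷ s) = ik
count-lower zero (true ∷ false ∷ s) = ik
count-lower zero (false ∷ true ∷ s) = ik
count-lower zero (false ∷ false ∷ s) = ik
count-lower (suc k) (x ∷ s) = Inv-along (𝕌-∷ x s) (Inv-map (bit x +_) (count-lower k s))

count-raise : ∀ {n} k (s : Bits n) → Inv (𝔹 n k) count s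
count-raise k s = inv (Inv.e-inv (count-lower k s)) (Inv.f-inv (count-lower k s))

height-last : ∀ {n} (us bs : Bits n) → Inv (𝕃 n) height (us , bs)
height-last [] [] = ik
height-last (true ∷ []) (true ∷ []) = ik
height-last (true ∷ []) (false ∷ []) = ik
height-last (false ∷ []) (true ∷ []) = ik
height-last (false ∷ []) (false ∷ []) = ik
height-last (x ∷ us@(_ ∷ _)) (y ∷ bs@(_ ∷ _)) =
  Inv-along (𝕃-∷ x y us bs) (subst-lab (λ { (s , t) → +-interchange (bit x) (bit y) (count s) (count t) }) (Inv-map ((bit x + bit y) +_) (height-last us bs)))
  where
  subst-lab : ∀ {A L} {l l' : Car A → L} {a} → (∀ x → l x ≡ l' x) → Inv A l a → Inv A l' a
  subst-lab {A} h i = Inv-intro {A} (λ eq → trans (sym (h _)) (trans (Inv-f i eq) (h _))) (λ eq → trans (sym (h _)) (trans (Inv-e i eq) (h _)))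

height-𝕂 : ∀ {n} o (c : Col n) → Inv (𝕂 n o) height c
height-𝕂 {n} (just k) (us , bs) = Inv-pull {g = id} (toℂ {k = k} (us , bs))
  (Inv-bind {lab = λ c → count (proj₁ c)} (λ h c → h + count (proj₂ c)) (Inv-⊗ˡ {𝕌 n k} {𝔹 n k} (count-lower k us))
    (Inv-map (count us +_) (Inv-⊗ʳ {𝕌 n k} {𝔹 n k} (count-raise k bs))))
height-𝕂 nothing (us , bs) = Inv-pull {g = id} (to𝕃 {k = 0} (us , bs)) (height-last us bs)

heights-inv : ∀ {n} op m (t : Tab n m) → Inv (𝕋 n op m) heights t
heights-inv op zero tt = ik
heights-inv {n} op (suc m) (t , c) = Inv-pull {g = id} {heights} (split𝕋 (t , c))
  (Inv-bind {lab = λ x → height (proj₂ x)} (λ h x → h ∷ heights (proj₁ x)) (Inv-⊗ʳ {𝕋 n op m} {𝕂 n op} (height-𝕂 op c))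
    (Inv-map (height c ∷_) (Inv-⊗ˡ {𝕋 n op m} {𝕂 n op} (heights-inv op m t))))

-- Words

𝕎 : ℕ → ℕ → Crystal
𝕎 n i .Car = Word
𝕎 n i .f = fW n i
𝕎 n i .e = eW n i
𝕎 n i .ε w = length (proj₂ (reducedSig n i w))
𝕎 n i .φ w = length (proj₁ (reducedSig n i w))

scanned : ℕ → List Sign → List ℕ × List ℕ
scanned k s = scan s k [] []

scan-at : ∀ s {k k' ps ms} → k ≡ k' → scan s k ps ms ≡ scan s k' ps ms
scan-at s refl = refl

scan-++ : ∀ s t k ps ms → scan (s ++ t) k ps ms ≡ scan t (k + length s) (proj₁ (scan s k ps ms)) (proj₂ (scan s k ps ms))
scan-++ [] t k ps ms = cong (λ z → scan t z ps ms) (sym (+-identityʳ k))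
scan-++ (plus ∷ s) t k ps ms = trans (scan-++ s t (suc k) (k ∷ ps) ms) (scan-at t (sym (+-suc k (length s))))
scan-++ (minus ∷ s) t k [] ms = trans (scan-++ s t (suc k) [] (k ∷ ms)) (scan-at t (sym (+-suc k (length s))))
scan-++ (minus ∷ s) t k (p ∷ ps) ms = trans (scan-++ s t (suc k) ps ms) (scan-at t (sym (+-suc k (length s))))
scan-++ (none ∷ s) t k ps ms = trans (scan-++ s t (suc k) ps ms) (scan-at t (sym (+-suc k (length s))))

take-take : {A : Set} (a c : ℕ) (xs : List A) → take (a ∸ c) (take a xs) ≡ take (a ∸ c) xs
take-take a zero xs = go a xs
  where
  go : {A : Set} (a : ℕ) (xs : List A) → take a (take a xs) ≡ take a xs
  go zero xs = refl
  go (suc a) [] = refl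
  go (suc a) (x ∷ xs) = cong (x ∷_) (go a xs)
take-take zero (suc c) xs = refl
take-take (suc a) (suc c) [] = refl
take-take (suc a) (suc c) (x ∷ xs) = trans (go (a ∸ c) a (x ∷ xs) (≤-trans (m∸n≤m a c) (n≤1+n a))) refl
  where
  go : {A : Set} (p q : ℕ) (xs : List A) → p ≤ suc q → take p (take (suc q) xs) ≡ take p xs
  go zero q xs h = refl
  go (suc p) q [] h = refl
  go (suc p) zero (x ∷ xs) (s≤s z≤n) = refl
  go (suc p) (suc q) (x ∷ xs) (s≤s h) = cong (x ∷_) (go p q xs h)

take-++ˡ : {A : Set} (a : ℕ) (xs ys : List A) → a ≤ length xs → take a (xs ++ ys) ≡ take a xs
take-++ˡ zero xs ys h = refl
take-++ˡ (suc a) (x ∷ xs) ys (s≤s h) = cong (x ∷_) (take-++ˡ a xs ys h)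

take-len : {A : Set} (xs : List A) → take (length xs) xs ≡ xs
take-len [] = refl
take-len (x ∷ xs) = cong (x ∷_) (take-len xs)

drop-len : {A : Set} (a : ℕ) → drop a ([] {A = A}) ≡ []
drop-len zero = refl
drop-len (suc a) = refl

resume : List ℕ × List ℕ → List ℕ → List ℕ → List ℕ × List ℕ
resume (P , M) ps ms = P ++ drop (length M) ps , take (length M ∸ length ps) M ++ ms

scan-resume : ∀ s k ps ms → scan s k ps ms ≡ resume (scanned k s) ps ms
scan-resume [] k ps ms rewrite 0∸n≡0 (length ps) = refl
scan-resume (plus ∷ s) k ps ms
  rewrite scan-resume s (suc k) (k ∷ ps) ms | scan-resume s (suc k) (k ∷ []) [] with scanned (suc k) s
... | (P , []) rewrite 0∸n≡0 (length ps) = cong (_, ms) (sym (++-assoc P (k ∷ []) ps))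
... | (P , M@(m ∷ M')) rewrite drop-len {ℕ} (length M') | ++-identityʳ P | ++-identityʳ (take (length M') M) =
  cong₂ _,_ (cong (λ z → P ++ drop z ps) (sym lt)) (cong (_++ ms) (trans (sym (take-take (length M') (length ps) M)) (cong (λ z → take (z ∸ length ps) (take (length M') M)) (sym lt))))
  where
  lt : length (take (length M') M) ≡ length M'
  lt = trans (length-take (length M') M) (m≤n⇒m⊓n≡m (n≤1+n (length M')))
scan-resume (minus ∷ s) k [] ms
  rewrite scan-resume s (suc k) [] (k ∷ ms) | scan-resume s (suc k) [] (k ∷ []) with scanned (suc k) s
... | (P , M) rewrite take-len M | drop-len {ℕ} (length M) | drop-len {ℕ} (length (M ++ k ∷ [])) | take-len (M ++ k ∷ []) =
  cong₂ _,_ (sym (++-identityʳ _)) (sym (++-assoc M (k ∷ []) ms))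
scan-resume (minus ∷ s) k (p ∷ ps) ms
  rewrite scan-resume s (suc k) ps ms | scan-resume s (suc k) [] (k ∷ []) with scanned (suc k) s
... | (P , M) rewrite take-len M | drop-len {ℕ} (length M) | length-++ M {k ∷ []} | +-comm (length M) 1 | ++-identityʳ P =
  cong (λ z → P ++ drop (length M) ps , z ++ ms) (sym (take-++ˡ (length M ∸ length ps) M (k ∷ []) (m∸n≤m (length M) (length ps))))
scan-resume (none ∷ s) k ps ms = scan-resume s (suc k) ps ms

scan-shift : ∀ d s k ps ms → scan s (d + k) (map (d +_) ps) (map (d +_) ms) ≡
             (map (d +_) (proj₁ (scan s k ps ms)) , map (d +_) (proj₂ (scan s k ps ms)))
scan-shift d [] k ps ms = refl
scan-shift d (plus ∷ s) k ps ms = trans (scan-at s (sym (+-suc d k))) (scan-shift d s (suc k) (k ∷ ps) ms)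
scan-shift d (minus ∷ s) k [] ms = trans (scan-at s (sym (+-suc d k))) (scan-shift d s (suc k) [] (k ∷ ms))
scan-shift d (minus ∷ s) k (p ∷ ps) ms = trans (scan-at s (sym (+-suc d k))) (scan-shift d s (suc k) ps ms)
scan-shift d (none ∷ s) k ps ms = trans (scan-at s (sym (+-suc d k))) (scan-shift d s (suc k) ps ms)

scan-bound : ∀ s k m ps ms → m ≡ k + length s → All (_< k) ps → All (_< k) ms →
             All (_< m) (proj₁ (scan s k ps ms)) × All (_< m) (proj₂ (scan s k ps ms))
scan-bound [] k m ps ms e hp hm rewrite e | +-identityʳ k = hp , hm
scan-bound (plus ∷ s) k m ps ms e hp hm = scan-bound s (suc k) m (k ∷ ps) ms (trans e (+-suc k (length s))) (≤-refl ∷ mapAll m≤n⇒m≤1+n hp) (mapAll m≤n⇒m≤1+n hm)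
scan-bound (minus ∷ s) k m [] ms e hp hm = scan-bound s (suc k) m [] (k ∷ ms) (trans e (+-suc k (length s))) [] (≤-refl ∷ mapAll m≤n⇒m≤1+n hm)
scan-bound (minus ∷ s) k m (p ∷ ps) ms e (_ ∷ hp) hm = scan-bound s (suc k) m ps ms (trans e (+-suc k (length s))) (mapAll m≤n⇒m≤1+n hp) (mapAll m≤n⇒m≤1+n hm)
scan-bound (none ∷ s) k m ps ms e hp hm = scan-bound s (suc k) m ps ms (trans e (+-suc k (length s))) (mapAll m≤n⇒m≤1+n hp) (mapAll m≤n⇒m≤1+n hm)

updateAt-right : {A : Set} (x : List A) (k : ℕ) (g : A → Maybe A) (y : List A) → updateAt (length x + k) g (x ++ y) ≡ mapM (x ++_) (updateAt k g y)
updateAt-right [] k g y = sym (mapM-id _)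
updateAt-right (a ∷ x) k g y = trans (cong (mapM (a ∷_)) (updateAt-right x k g y)) (mapM-∘ (updateAt k g y))

updateAt-left : {A : Set} (x : List A) (k : ℕ) (g : A → Maybe A) (y : List A) → k < length x → updateAt k g (x ++ y) ≡ mapM (_++ y) (updateAt k g x)
updateAt-left (a ∷ x) zero g y h with g a
... | just _ = refl
... | nothing = refl
updateAt-left (a ∷ x) (suc k) g y (s≤s h) = trans (cong (mapM (a ∷_)) (updateAt-left x k g y h)) (trans (mapM-∘ (updateAt k g x)) (sym (mapM-∘ (updateAt k g x))))

last-++ : {A : Set} (xs : List A) (y : A) (ys : List A) → last (xs ++ y ∷ ys) ≡ last (y ∷ ys)
last-++ [] y ys = refl
last-++ (x ∷ []) y ys = refl
last-++ (x ∷ x' ∷ xs) y ys = last-++ (x' ∷ xs) y ys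

last-map : {A B : Set} (g : A → B) (xs : List A) → last (map g xs) ≡ mapM g (last xs)
last-map g [] = refl
last-map g (x ∷ []) = refl
last-map g (x ∷ x' ∷ xs) = last-map g (x' ∷ xs)

last-drop : {A : Set} (a : ℕ) (xs : List A) {y : A} {ys : List A} → drop a xs ≡ y ∷ ys → last xs ≡ last (y ∷ ys)
last-drop zero xs e = cong last e
last-drop {A} (suc a) (x ∷ []) e rewrite drop-len {A} a with e
... | ()
last-drop (suc a) (x ∷ x' ∷ xs) e = last-drop a (x' ∷ xs) e

last-All : {A : Set} {P : A → Set} {xs : List A} {y : A} → All P xs → last xs ≡ just y → P y
last-All (p ∷ []) refl = p
last-All (_ ∷ p ∷ ps) e = last-All (p ∷ ps) e

sig : ℕ → ℕ → Word → List Sign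
sig n i = map (sign n i)

reducedSig-++ : ∀ n i x y → reducedSig n i (x ++ y) ≡
  resume (map (length x +_) (proj₁ (reducedSig n i y)) , map (length x +_) (proj₂ (reducedSig n i y))) (proj₁ (reducedSig n i x)) (proj₂ (reducedSig n i x))
reducedSig-++ n i x y rewrite map-++ (sign n i) x y | scan-++ (sig n i x) (sig n i y) 0 [] [] | length-map (sign n i) x
  | scan-resume (sig n i y) (length x) (proj₁ (reducedSig n i x)) (proj₂ (reducedSig n i x)) =
  cong (λ z → resume z (proj₁ (reducedSig n i x)) (proj₂ (reducedSig n i x)))
    (trans (cong (scanned' (sig n i y)) (sym (+-identityʳ (length x)))) (scan-shift (length x) (sig n i y) 0 [] []))
  where
  scanned' : List Sign → ℕ → List ℕ × List ℕ
  scanned' s k = scan s k [] []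

++-mor : ∀ n i (x y : Word) → Mor (𝕎 n i ⊗ 𝕎 n i) (𝕎 n i) (λ z → proj₁ z ++ proj₂ z) (x , y)
++-mor n i x y = mor fe ee εe φe
  where
  Px = proj₁ (reducedSig n i x)
  Mx = proj₂ (reducedSig n i x)
  Py = proj₁ (reducedSig n i y)
  My = proj₂ (reducedSig n i y)
  sh = map (length x +_)
  bounds = scan-bound (sig n i x) 0 (length x) [] [] (sym (length-map (sign n i) x)) [] []
  P≡ : proj₁ (reducedSig n i (x ++ y)) ≡ sh Py ++ drop (length My) Px
  P≡ = trans (cong proj₁ (reducedSig-++ n i x y)) (cong (λ z → sh Py ++ drop z Px) (length-map (length x +_) My))
  M≡ : proj₂ (reducedSig n i (x ++ y)) ≡ take (length My ∸ length Px) (sh My) ++ Mx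
  M≡ = trans (cong proj₂ (reducedSig-++ n i x y)) (cong (λ z → take (z ∸ length Px) (sh My) ++ Mx) (length-map (length x +_) My))
  φe : length (proj₁ (reducedSig n i (x ++ y))) ≡ length Py + (length Px ∸ length My)
  φe = trans (cong length P≡) (trans (length-++ (sh Py)) (cong₂ _+_ (length-map _ Py) (length-drop (length My) Px)))
  εe : length (proj₂ (reducedSig n i (x ++ y))) ≡ length Mx + (length My ∸ length Px)
  εe = trans (cong length M≡) (trans (length-++ (take (length My ∸ length Px) (sh My)))
    (trans (+-comm _ (length Mx)) (cong (length Mx +_) (trans (length-take (length My ∸ length Px) (sh My))
      (trans (cong (λ z → (length My ∸ length Px) ⊓ z) (length-map _ My)) (m≤n⇒m⊓n≡m (m∸n≤m (length My) (length Px))))))))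
  shifted : ∀ {g} (m : Maybe ℕ) → (mapM (length x +_) m >>= λ k → updateAt k g (x ++ y)) ≡ mapM (x ++_) (m >>= λ k → updateAt k g y)
  shifted {g} (just k) = updateAt-right x k g y
  shifted nothing = refl
  kept : ∀ {g} (m : Maybe ℕ) → (∀ {k} → m ≡ just k → k < length x) → (m >>= λ k → updateAt k g (x ++ y)) ≡ mapM (_++ y) (m >>= λ k → updateAt k g x)
  kept {g} (just k) h = updateAt-left x k g y (h refl)
  kept nothing h = refl
  fe : fW n i (x ++ y) ≡ mapM (λ z → proj₁ z ++ proj₂ z) (pick (length Px ∸ length My) (mapM (_, y) (fW n i x)) (mapM (x ,_) (fW n i y)))
  fe rewrite P≡ | sym (length-drop (length My) Px) with drop (length My) Px in eq
  ... | [] rewrite ++-identityʳ (sh Py) | last-map (length x +_) Py = trans (shifted (last Py)) (sym (mapM-∘ (fW n i y)))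
  ... | p ∷ ps rewrite last-++ (sh Py) p ps | sym (last-drop (length My) Px eq) =
    trans (kept (last Px) (last-All (proj₁ bounds))) (sym (mapM-∘ (fW n i x)))
  headM-shift : ∀ a (M : List ℕ) → headM (take (suc a) (sh M) ++ Mx) ≡ headM (sh M ++ Mx)
  headM-shift a [] = refl
  headM-shift a (m ∷ M) = refl
  headM-All : ∀ {P : ℕ → Set} {M : List ℕ} {k} → All P M → headM M ≡ just k → P k
  headM-All (p ∷ _) refl = p
  nonempty : ∀ a {M : List ℕ} → length M ∸ length Px ≡ suc a → headM (sh M ++ Mx) ≡ mapM (length x +_) (headM M)
  nonempty a {[]} h rewrite 0∸n≡0 (length Px) with h
  ... | ()
  nonempty a {m ∷ M} h = refl
  ee : eW n i (x ++ y) ≡ mapM (λ z → proj₁ z ++ proj₂ z) (pick (length My ∸ length Px) (mapM (x ,_) (eW n i y)) (mapM (_, y) (eW n i x)))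
  ee rewrite M≡ with length My ∸ length Px in eq
  ... | zero = trans (kept (headM Mx) (headM-All (proj₂ bounds))) (sym (mapM-∘ (eW n i x)))
  ... | suc a rewrite headM-shift a My | nonempty a {My} eq = trans (shifted (headM My)) (sym (mapM-∘ (eW n i y)))

opt : Bool → Letter → Word
opt true x = x ∷ []
opt false x = []

uL bL : ∀ {n} → ℕ → Bits n → Word
uL j [] = []
uL j (x ∷ s) = opt x (u j) ++ uL (suc j) s
bL j [] = []
bL j (y ∷ s) = bL (suc j) s ++ opt y (b j)

wd : ∀ {n} → Col n → Word
wd (us , bs) = uL 1 us ++ bL 1 bs

T-true : ∀ {x} → T x → x ≡ true
T-true {true} _ = refl

≡ᵇ-refl : ∀ m → (m ≡ᵇ m) ≡ true
≡ᵇ-refl m = T-true (≡⇒≡ᵇ m m refl)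

≢-≡ᵇ : ∀ m k → m ≢ k → (m ≡ᵇ k) ≡ false
≢-≡ᵇ m k h with m ≡ᵇ k in eq
... | false = refl
... | true = ⊥-elim (h (≡ᵇ⇒≡ m k (subst T (sym eq) tt)))

<-<ᵇ : ∀ {m k} → m < k → (m <ᵇ k) ≡ true
<-<ᵇ h = T-true (<⇒<ᵇ h)

≮-<ᵇ : ∀ {m k} → k ≤ m → (m <ᵇ k) ≡ false
≮-<ᵇ {m} {k} h with m <ᵇ k in eq
... | false = refl
... | true = ⊥-elim (<⇒≱ (<ᵇ⇒< m k (subst T (sym eq) tt)) h)

record Arrow (n i : ℕ) (p m : Letter) : Set where
  field
    plus-sign : sign n i p ≡ plus
    minus-sign : sign n i m ≡ minus
    f-letter : fL n i p ≡ just m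
    e-letter : eL n i m ≡ just p

arrow : ∀ {n i p m} → fL n i p ≡ just m → fL n i m ≡ nothing → eL n i m ≡ just p → Arrow n i p m
arrow {n} {i} {p} {m} a c d = record { plus-sign = pl ; minus-sign = mi ; f-letter = a ; e-letter = d }
  where
  pl : sign n i p ≡ plus
  pl rewrite a = refl
  mi : sign n i m ≡ minus
  mi rewrite c | d = refl

arrow-u : ∀ {n i} → i < n → Arrow n i (u i) (u (suc i))
arrow-u {n} {i} h = arrow a c d
  where
  a : fL n i (u i) ≡ just (u (suc i))
  a rewrite ≡ᵇ-refl i | <-<ᵇ h = refl
  c : fL n i (u (suc i)) ≡ nothing
  c rewrite ≢-≡ᵇ (suc i) i (λ e → 1+n≢n e) = refl
  d : eL n i (u (suc i)) ≡ just (u i)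
  d rewrite ≡ᵇ-refl i | <-<ᵇ h = refl

arrow-b : ∀ {n i} → i < n → Arrow n i (b (suc i)) (b i)
arrow-b {n} {i} h = arrow a c d
  where
  a : fL n i (b (suc i)) ≡ just (b i)
  a rewrite ≡ᵇ-refl i | <-<ᵇ h = refl
  c : fL n i (b i) ≡ nothing
  c rewrite ≢-≡ᵇ i (suc i) (λ e → 1+n≢n (sym e)) = refl
  d : eL n i (b i) ≡ just (b (suc i))
  d rewrite ≡ᵇ-refl i | <-<ᵇ h = refl

arrow-n : ∀ {n} → Arrow n n (u n) (b n)
arrow-n {n} = arrow a c d
  where
  a : fL n n (u n) ≡ just (b n)
  a rewrite ≡ᵇ-refl n | ≮-<ᵇ (≤-refl {n}) = refl
  c : fL n n (b n) ≡ nothing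
  c rewrite ≢-≡ᵇ n (suc n) (λ e → 1+n≢n (sym e)) = refl
  d : eL n n (b n) ≡ just (u n)
  d rewrite ≡ᵇ-refl n | ≮-<ᵇ (≤-refl {n}) = refl

letters₂ : Letter → Letter → Window → Word
letters₂ p m (x , y) = opt x p ++ opt y m

letters₂-mor : ∀ {n i p m} → Arrow n i p m → ∀ w → Mor 𝕎𝕌 (𝕎 n i) (letters₂ p m) w
letters₂-mor {n} {i} {p} {m} a (true , true) = mor fe ee εe φe
  where
  open Arrow a
  rs : reducedSig n i (p ∷ m ∷ []) ≡ ([] , [])
  rs rewrite plus-sign | minus-sign = refl
  fe : fW n i (p ∷ m ∷ []) ≡ nothing
  fe rewrite rs = refl
  ee : eW n i (p ∷ m ∷ []) ≡ nothing
  ee rewrite rs = refl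
  εe : length (proj₂ (reducedSig n i (p ∷ m ∷ []))) ≡ 0
  εe rewrite rs = refl
  φe : length (proj₁ (reducedSig n i (p ∷ m ∷ []))) ≡ 0
  φe rewrite rs = refl
letters₂-mor {n} {i} {p} {m} a (true , false) = mor fe ee εe φe
  where
  open Arrow a
  fe : fW n i (p ∷ []) ≡ just (m ∷ [])
  fe rewrite plus-sign | f-letter = refl
  ee : eW n i (p ∷ []) ≡ nothing
  ee rewrite plus-sign = refl
  εe : length (proj₂ (reducedSig n i (p ∷ []))) ≡ 0
  εe rewrite plus-sign = refl
  φe : length (proj₁ (reducedSig n i (p ∷ []))) ≡ 1
  φe rewrite plus-sign = refl
letters₂-mor {n} {i} {p} {m} a (false , true) = mor fe ee εe φe
  where
  open Arrow a
  fe : fW n i (m ∷ []) ≡ nothing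
  fe rewrite minus-sign = refl
  ee : eW n i (m ∷ []) ≡ just (p ∷ [])
  ee rewrite minus-sign | e-letter = refl
  εe : length (proj₂ (reducedSig n i (m ∷ []))) ≡ 1
  εe rewrite minus-sign = refl
  φe : length (proj₁ (reducedSig n i (m ∷ []))) ≡ 0
  φe rewrite minus-sign = refl
letters₂-mor a (false , false) = ok

Neutral : ℕ → ℕ → Word → Set
Neutral n i w = ∀ k → scan (sig n i w) k [] [] ≡ ([] , [])

neutral-∷ : ∀ {n i x w} → sign n i x ≡ none → Neutral n i w → Neutral n i (x ∷ w)
neutral-∷ s h k rewrite s = h (suc k)

neutral-++ : ∀ {n i} v {w} → Neutral n i v → Neutral n i w → Neutral n i (v ++ w)
neutral-++ {n} {i} v {w} h h' k rewrite Data.List.Properties.map-++ (sign n i) v w | scan-++ (sig n i v) (sig n i w) k [] [] | h k = h' _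

ε-zero : ∀ {n i} w → 𝕎 n i .ε w ≡ 0 → eW n i w ≡ nothing
ε-zero {n} {i} w h with proj₂ (reducedSig n i w)
... | [] = refl

φ-zero : ∀ {n i} w → 𝕎 n i .φ w ≡ 0 → fW n i w ≡ nothing
φ-zero {n} {i} w h with proj₁ (reducedSig n i w)
... | [] = refl

neutral-left : ∀ {n i} v → Neutral n i v → ∀ w → Mor (𝕎 n i) (𝕎 n i) (v ++_) w
neutral-left {n} {i} v h w = Mor-∘ (++-mor n i v w) insert
  where
  ev : eW n i v ≡ nothing
  ev rewrite h 0 = refl
  εv : 𝕎 n i .ε v ≡ 0
  εv rewrite h 0 = refl
  φv : 𝕎 n i .φ v ≡ 0
  φv rewrite h 0 = refl
  ee : pick (𝕎 n i .ε w) (mapM (v ,_) (eW n i w)) nothing ≡ mapM (v ,_) (eW n i w)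
  ee with 𝕎 n i .ε w in eq
  ... | suc _ = refl
  ... | zero = sym (cong (mapM (v ,_)) (ε-zero w eq))
  insert : Mor (𝕎 n i) (𝕎 n i ⊗ 𝕎 n i) (v ,_) w
  insert = mor
    (cong (λ z → pick z (mapM (_, w) (fW n i v)) (mapM (v ,_) (fW n i w))) (trans (cong (_∸ 𝕎 n i .ε w) φv) (0∸n≡0 (𝕎 n i .ε w))))
    (trans (cong₂ (λ z m → pick (𝕎 n i .ε w ∸ z) (mapM (v ,_) (eW n i w)) (mapM (_, w) m)) φv ev) ee)
    (cong₂ _+_ εv (cong (𝕎 n i .ε w ∸_) φv))
    (trans (cong (λ z → 𝕎 n i .φ w + (z ∸ 𝕎 n i .ε w)) φv) (trans (cong (𝕎 n i .φ w +_) (0∸n≡0 (𝕎 n i .ε w))) (+-identityʳ _)))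

neutral-right : ∀ {n i} v → Neutral n i v → ∀ w → Mor (𝕎 n i) (𝕎 n i) (_++ v) w
neutral-right {n} {i} v h w = Mor-∘ (++-mor n i w v) insert
  where
  fv : fW n i v ≡ nothing
  fv rewrite h 0 = refl
  εv : 𝕎 n i .ε v ≡ 0
  εv rewrite h 0 = refl
  φv : 𝕎 n i .φ v ≡ 0
  φv rewrite h 0 = refl
  fe : pick (𝕎 n i .φ w) (mapM (_, v) (fW n i w)) nothing ≡ mapM (_, v) (fW n i w)
  fe with 𝕎 n i .φ w in eq
  ... | suc _ = refl
  ... | zero = sym (cong (mapM (_, v)) (φ-zero w eq))
  insert : Mor (𝕎 n i) (𝕎 n i ⊗ 𝕎 n i) (_, v) w
  insert = mor
    (trans (cong₂ (λ z m → pick (𝕎 n i .φ w ∸ z) (mapM (_, v) (fW n i w)) (mapM (w ,_) m)) εv fv) fe)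
    (cong (λ z → pick z (mapM (w ,_) (eW n i v)) (mapM (_, v) (eW n i w))) (trans (cong (_∸ 𝕎 n i .φ w) εv) (0∸n≡0 (𝕎 n i .φ w))))
    (trans (cong (λ z → 𝕎 n i .ε w + (z ∸ 𝕎 n i .φ w)) εv) (trans (cong (𝕎 n i .ε w +_) (0∸n≡0 (𝕎 n i .φ w))) (+-identityʳ _)))
    (cong₂ _+_ φv (cong (𝕎 n i .φ w ∸_) εv))

sign-u : ∀ n i m → m ≢ i → m ≢ suc i → sign n i (u m) ≡ none
sign-u n i m h h' rewrite ≢-≡ᵇ m i h | ≢-≡ᵇ m (suc i) h' = refl

sign-b : ∀ n i m → m ≢ i → m ≢ suc i → sign n i (b m) ≡ none
sign-b n i m h h' rewrite ≢-≡ᵇ m i h | ≢-≡ᵇ m (suc i) h' = refl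

neutral-opt-u : ∀ {n i} x m → m ≢ i → m ≢ suc i → Neutral n i (opt x (u m))
neutral-opt-u {n} {i} true m h h' = neutral-∷ {n} {i} {u m} {[]} (sign-u n i m h h') (λ _ → refl)
neutral-opt-u false m h h' k = refl

neutral-opt-b : ∀ {n i} x m → m ≢ i → m ≢ suc i → Neutral n i (opt x (b m))
neutral-opt-b {n} {i} true m h h' = neutral-∷ {n} {i} {b m} {[]} (sign-b n i m h h') (λ _ → refl)
neutral-opt-b false m h h' k = refl

neutral-uL-above : ∀ {N n i} j (s : Bits n) → suc i < j → Neutral N i (uL j s)
neutral-uL-above j [] h k = refl
neutral-uL-above j (x ∷ s) h = neutral-++ (opt x (u j)) (neutral-opt-u x j (>⇒≢ (<-trans ≤-refl h)) (>⇒≢ h)) (neutral-uL-above (suc j) s (m≤n⇒m≤1+n h))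

neutral-bL-above : ∀ {N n i} j (s : Bits n) → suc i < j → Neutral N i (bL j s)
neutral-bL-above j [] h k = refl
neutral-bL-above j (x ∷ s) h = neutral-++ (bL (suc j) s) (neutral-bL-above (suc j) s (m≤n⇒m≤1+n h)) (neutral-opt-b x j (>⇒≢ (<-trans ≤-refl h)) (>⇒≢ h))

neutral-uL-below : ∀ {N n i} j (s : Bits n) → j + n ≤ i → Neutral N i (uL j s)
neutral-uL-below j [] h k = refl
neutral-uL-below {n = suc n} j (x ∷ s) h = neutral-++ (opt x (u j)) (neutral-opt-u x j (<⇒≢ lt) (<⇒≢ (m≤n⇒m≤1+n lt)))
  (neutral-uL-below (suc j) s (≤-trans (≤-reflexive (sym (+-suc j n))) h))
  where lt = ≤-trans (≤-trans (s≤s (m≤m+n j n)) (≤-reflexive (sym (+-suc j n)))) h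

neutral-bL-below : ∀ {N n i} j (s : Bits n) → j + n ≤ i → Neutral N i (bL j s)
neutral-bL-below j [] h k = refl
neutral-bL-below {n = suc n} j (x ∷ s) h = neutral-++ (bL (suc j) s) (neutral-bL-below (suc j) s (≤-trans (≤-reflexive (sym (+-suc j n))) h))
  (neutral-opt-b x j (<⇒≢ lt) (<⇒≢ (m≤n⇒m≤1+n lt)))
  where lt = ≤-trans (≤-trans (s≤s (m≤m+n j n)) (≤-reflexive (sym (+-suc j n)))) h

uL-mor : ∀ {N n} k j (s : Bits n) → suc k < n → j + k < N → Mor (𝕌 n k) (𝕎 N (j + k)) (uL j) s
uL-mor zero j [] () h'
uL-mor zero j (x ∷ []) (s≤s ()) h'
uL-mor {N} zero j (x ∷ y ∷ s) h h' rewrite +-identityʳ j =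
  Mor-along {c = embed s} (𝕌-embed s (x , y))
    (Mor-ext (λ { (x , y) → ++-assoc (opt x (u j)) (opt y (u (suc j))) (uL (suc (suc j)) s) })
      (Mor-∘ (neutral-right (uL (suc (suc j)) s) (neutral-uL-above _ s ≤-refl) _) (letters₂-mor (arrow-u h') (x , y))))
uL-mor {N} (suc k) j (x ∷ s) (s≤s h) h' rewrite +-suc j k =
  Mor-along {c = x ∷_} (𝕌-∷ x s) (Mor-∘ (neutral-left (opt x (u j)) (neutral-opt-u x j (<⇒≢ (s≤s (m≤m+n j k))) (<⇒≢ (m≤n⇒m≤1+n (s≤s (m≤m+n j k))))) _)
    (uL-mor k (suc j) s h h'))

flip-mor : ∀ w → Mor 𝕎𝔹 𝕎𝕌 (λ w → proj₂ w , proj₁ w) w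
flip-mor (true , true) = ok
flip-mor (true , false) = ok
flip-mor (false , true) = ok
flip-mor (false , false) = ok

bL-mor : ∀ {N n} k j (s : Bits n) → suc k < n → j + k < N → Mor (𝔹 n k) (𝕎 N (j + k)) (bL j) s
bL-mor zero j [] () h'
bL-mor zero j (x ∷ []) (s≤s ()) h'
bL-mor {N} zero j (x ∷ y ∷ s) h h' rewrite +-identityʳ j =
  Mor-along {c = embed s} (𝔹-embed s (x , y))
    (Mor-ext (λ { (x , y) → sym (++-assoc (bL (suc (suc j)) s) (opt y (b (suc j))) (opt x (b j))) })
      (Mor-∘ (neutral-left (bL (suc (suc j)) s) (neutral-bL-above _ s ≤-refl) _) (Mor-∘ (letters₂-mor (arrow-b h') (y , x)) (flip-mor (x , y)))))
bL-mor {N} (suc k) j (x ∷ s) (s≤s h) h' rewrite +-suc j k =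
  Mor-along {c = x ∷_} (𝔹-∷ x s) (Mor-∘ (neutral-right (opt x (b j)) (neutral-opt-b x j (<⇒≢ (s≤s (m≤m+n j k))) (<⇒≢ (m≤n⇒m≤1+n (s≤s (m≤m+n j k))))) _)
    (bL-mor k (suc j) s h h'))

uL-snoc : ∀ {n} j (s : Bits n) x → uL j (s ∷ʳ x) ≡ uL j s ++ opt x (u (j + n))
uL-snoc j [] x rewrite +-identityʳ j = ++-identityʳ _
uL-snoc {suc n} j (y ∷ s) x rewrite uL-snoc (suc j) s x | +-suc j n = sym (++-assoc (opt y (u j)) _ _)

bL-snoc : ∀ {n} j (s : Bits n) x → bL j (s ∷ʳ x) ≡ opt x (b (j + n)) ++ bL j s
bL-snoc j [] x rewrite +-identityʳ j = sym (++-identityʳ _)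
bL-snoc {suc n} j (y ∷ s) x rewrite bL-snoc (suc j) s x | +-suc j n = ++-assoc (opt x (b (suc (j + n)))) _ _

data IsOp (n i : ℕ) : Op → Set where
  inner : ∀ k → i ≡ suc k → i < n → IsOp n i (just k)
  outer : i ≡ n → 1 ≤ i → IsOp n i nothing

wd-mor : ∀ {n i op} → IsOp n i op → (c : Col n) → Mor (𝕂 n op) (𝕎 n i) wd c
wd-mor {n} (inner k refl lt) (us , bs) =
  Mor-∘ (++-mor n (suc k) (uL 1 us) (bL 1 bs)) (Mor-∘ (Mor-⊗ (uL-mor k 1 us lt lt) (bL-mor k 1 bs lt lt)) (toℂ {k = k} (us , bs)))
wd-mor {suc n} (outer refl _) c with initLastC c
... | il (us , bs) (x , y) = Mor-∘ {g = id} (Mor-along (𝕃-snoc (us , bs) (x , y))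
    (Mor-ext (λ { (x , y) → sym (shape x y) })
      (Mor-∘ (neutral-left (uL 1 us) (neutral-uL-below 1 us ≤-refl) _)
        (Mor-∘ (neutral-right (bL 1 bs) (neutral-bL-below 1 bs ≤-refl) _) (letters₂-mor arrow-n (x , y))))))
  (to𝕃 {k = 0} _)
  where
  shape : ∀ x y → uL 1 (us ∷ʳ x) ++ bL 1 (bs ∷ʳ y) ≡ uL 1 us ++ ((opt x (u (suc n)) ++ opt y (b (suc n))) ++ bL 1 bs)
  shape x y rewrite uL-snoc 1 us x | bL-snoc 1 bs y =
    trans (++-assoc (uL 1 us) (opt x (u (suc n))) _) (cong (uL 1 us ++_) (sym (++-assoc (opt x (u (suc n))) (opt y (b (suc n))) (bL 1 bs))))

tabWord : ∀ {n} m → Tab n m → Word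
tabWord zero tt = []
tabWord (suc m) (t , c) = tabWord m t ++ wd c

tabWord-mor : ∀ {n i op} → IsOp n i op → ∀ m (t : Tab n m) → Mor (𝕋 n op m) (𝕎 n i) (tabWord m) t
tabWord-mor o zero tt = ok
tabWord-mor {n} {i} {op} o (suc m) (t , c) =
  Mor-∘ {g = id} (Mor-∘ (++-mor n i (tabWord m t) (wd c)) (Mor-⊗ (tabWord-mor o m t) (wd-mor o c))) (split𝕋 (t , c))

-- Reading words of columns

data _≺_ : Letter → Letter → Set where
  u≺u : ∀ {i j} → i < j → u i ≺ u j
  u≺b : ∀ {i j} → u i ≺ b j
  b≺b : ∀ {i j} → j < i → b i ≺ b j

≺-trans : ∀ {x y z} → x ≺ y → y ≺ z → x ≺ z
≺-trans (u≺u p) (u≺u q) = u≺u (<-trans p q)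
≺-trans (u≺u p) u≺b = u≺b
≺-trans u≺b (b≺b q) = u≺b
≺-trans (b≺b p) (b≺b q) = b≺b (<-trans q p)

≺-irrefl : ∀ {x} → x ≺ x → ⊥
≺-irrefl (u≺u p) = <-irrefl refl p
≺-irrefl (b≺b p) = <-irrefl refl p

<ᵇ-true : ∀ {m k} → (m <ᵇ k) ≡ true → m < k
<ᵇ-true {m} {k} h = <ᵇ⇒< m k (subst T (sym h) tt)

<L-≺ : ∀ {x y} → (x <L y) ≡ true → x ≺ y
<L-≺ {u i} {u j} h = u≺u (<ᵇ-true h)
<L-≺ {u i} {b j} h = u≺b
<L-≺ {b i} {b j} h = b≺b (<ᵇ-true h)

≺-<L : ∀ {x y} → x ≺ y → (x <L y) ≡ true
≺-<L (u≺u p) = <-<ᵇ p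
≺-<L u≺b = refl
≺-<L (b≺b p) = <-<ᵇ p

data Tri (x y : Letter) : Set where
  less : x ≺ y → Tri x y
  equal : x ≡ y → Tri x y
  greater : y ≺ x → Tri x y

tri : ∀ x y → Tri x y
tri (u i) (u j) with <-cmp i j
... | tri< p _ _ = less (u≺u p)
... | tri≈ _ p _ = equal (cong u p)
... | tri> _ _ p = greater (u≺u p)
tri (u i) (b j) = less u≺b
tri (b i) (u j) = greater u≺b
tri (b i) (b j) with <-cmp i j
... | tri< p _ _ = greater (b≺b p)
... | tri≈ _ p _ = equal (cong b p)
... | tri> _ _ p = less (b≺b p)

⊀-<L : ∀ {x y} → (x ≺ y → ⊥) → (x <L y) ≡ false
⊀-<L {x} {y} h with x <L y in e
... | false = refl
... | true = ⊥-elim (h (<L-≺ e))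

==L-refl : ∀ x → (x ==L x) ≡ true
==L-refl (u i) = ≡ᵇ-refl i
==L-refl (b i) = ≡ᵇ-refl i

==L-≡ : ∀ {x y} → (x ==L y) ≡ true → x ≡ y
==L-≡ {u i} {u j} h = cong u (≡ᵇ⇒≡ i j (subst T (sym h) tt))
==L-≡ {b i} {b j} h = cong b (≡ᵇ⇒≡ i j (subst T (sym h) tt))

≢-==L : ∀ {x y} → x ≢ y → (x ==L y) ≡ false
≢-==L {x} {y} h with x ==L y in e
... | false = refl
... | true = ⊥-elim (h (==L-≡ e))

≺-≢ : ∀ {x y} → x ≺ y → x ≢ y
≺-≢ p refl = ≺-irrefl p

≻-≤L : ∀ {x y} → y ≺ x → (x ≤L y) ≡ false
≻-≤L p rewrite ⊀-<L (λ q → ≺-irrefl (≺-trans p q)) = ≢-==L (λ e → ≺-≢ p (sym e))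

≺-≤L : ∀ {x y} → x ≺ y → (x ≤L y) ≡ true
≺-≤L p rewrite ≺-<L p = refl

≤L-refl : ∀ x → (x ≤L x) ≡ true
≤L-refl x rewrite ⊀-<L (≺-irrefl {x}) = ==L-refl x

≤L-≻ : ∀ {x y} → (x ≤L y) ≡ true → y ≺ x → ⊥
≤L-≻ h p with trans (sym h) (≻-≤L p)
... | ()

data Sorted : List Letter → Set where
  [] : Sorted []
  _∷_ : ∀ {x xs} → All (x ≺_) xs → Sorted xs → Sorted (x ∷ xs)

∧-true : ∀ {x y} → (x ∧ y) ≡ true → x ≡ true × y ≡ true
∧-true {true} h = refl , h

increasing-sorted : ∀ C → strictlyIncreasing C ≡ true → Sorted C
increasing-sorted [] h = []
increasing-sorted (x ∷ []) h = [] ∷ []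
increasing-sorted (x ∷ C@(y ∷ _)) h = cons (<L-≺ (proj₁ (∧-true h))) (increasing-sorted C (proj₂ (∧-true h)))
  where
  cons : ∀ {y C} → x ≺ y → Sorted (y ∷ C) → Sorted (x ∷ y ∷ C)
  cons p (a ∷ s) = (p ∷ mapAll (≺-trans p) a) ∷ (a ∷ s)

Sorted-++ : ∀ {xs ys} → Sorted xs → Sorted ys → (∀ {x y} → x ∈ xs → y ∈ ys → x ≺ y) → Sorted (xs ++ ys)
Sorted-++ [] t h = t
Sorted-++ {x ∷ xs} {ys} (a ∷ s) t h = All-++ a (tabulateAll (λ m → h (here refl) m)) ∷ Sorted-++ s t (λ p q → h (there p) q)

Sorted-++⁻ : ∀ xs {ys} → Sorted (xs ++ ys) → ∀ {x y} → x ∈ xs → y ∈ ys → x ≺ y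
Sorted-++⁻ (x ∷ xs) (a ∷ s) (here refl) q = lookupAll a (∈-++⁺ʳ xs q)
Sorted-++⁻ (x ∷ xs) (a ∷ s) (there p) q = Sorted-++⁻ xs s p q

Sorted-tail : ∀ xs {ys} → Sorted (xs ++ ys) → Sorted ys
Sorted-tail [] s = s
Sorted-tail (x ∷ xs) (a ∷ s) = Sorted-tail xs s

insertL-min : ∀ x xs → All (x ≺_) xs → insertL x xs ≡ x ∷ xs
insertL-min x [] _ = refl
insertL-min x (y ∷ xs) (p ∷ _) rewrite ⊀-<L (λ q → ≺-irrefl (≺-trans p q)) = refl

sortL-sorted : ∀ {xs} → Sorted xs → sortL xs ≡ xs
sortL-sorted [] = refl
sortL-sorted {x ∷ xs} (a ∷ s) rewrite sortL-sorted s = insertL-min x xs a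

⊀-trans : ∀ {x y z} → (z <L y) ≡ false → z ≺ x → y ≺ x
⊀-trans {y = y} {z} e p with tri z y
... | less q with trans (sym e) (≺-<L q)
... | ()
⊀-trans e p | equal refl = p
⊀-trans e p | greater q = ≺-trans q p

insertL-comm : ∀ x y zs → insertL x (insertL y zs) ≡ insertL y (insertL x zs)
insertL-comm x y [] with tri x y
... | less p rewrite ≺-<L p | ⊀-<L (λ q → ≺-irrefl (≺-trans p q)) = refl
... | equal refl = refl
... | greater p rewrite ≺-<L p | ⊀-<L (λ q → ≺-irrefl (≺-trans p q)) = refl
insertL-comm x y (z ∷ zs) with z <L x in ex | z <L y in ey
... | true | true rewrite ex | ey = cong (z ∷_) (insertL-comm x y zs)
... | true | false rewrite ex | ey | ≺-<L {y} {x} (⊀-trans {x} {y} {z} ey (<L-≺ ex)) = refl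
... | false | true rewrite ex | ey | ≺-<L {x} {y} (⊀-trans {y} {x} {z} ex (<L-≺ ey)) = refl
... | false | false rewrite ex | ey with tri x y
... | less p rewrite ≺-<L p | ⊀-<L {y} {x} (λ q → ≺-irrefl (≺-trans p q)) = refl
... | equal refl = refl
... | greater p rewrite ≺-<L p | ⊀-<L {x} {y} (λ q → ≺-irrefl (≺-trans p q)) = refl

sortL-cong : ∀ {xs ys} → xs ↭ ys → sortL xs ≡ sortL ys
sortL-cong refl = refl
sortL-cong (prep x p) = cong (insertL x) (sortL-cong p)
sortL-cong (↭swap {ys = ys} x y p) = trans (cong (λ z → insertL x (insertL y z)) (sortL-cong p)) (insertL-comm x y (sortL ys))
sortL-cong (↭trans p q) = trans (sortL-cong p) (sortL-cong q)

insertL-↭ : ∀ x xs → insertL x xs ↭ x ∷ xs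
insertL-↭ x [] = refl
insertL-↭ x (y ∷ xs) with y <L x
... | true = ↭trans (prep y (insertL-↭ x xs)) (↭swap y x refl)
... | false = refl

sortL-↭ : ∀ xs → sortL xs ↭ xs
sortL-↭ [] = refl
sortL-↭ (x ∷ xs) = ↭trans (insertL-↭ x (sortL xs)) (prep x (sortL-↭ xs))

insertL-++ : ∀ {x} as cs → All (_≺ x) as → All (x ≺_) cs → insertL x (as ++ cs) ≡ as ++ x ∷ cs
insertL-++ {x} [] cs _ h = insertL-min x cs h
insertL-++ {x} (a ∷ as) cs (p ∷ ps) h rewrite ≺-<L p = cong (a ∷_) (insertL-++ as cs ps h)

removeL-++ : ∀ {x} as cs → All (_≺ x) as → removeL x (as ++ x ∷ cs) ≡ as ++ cs
removeL-++ {x} [] cs _ rewrite ==L-refl x = refl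
removeL-++ {x} (a ∷ as) cs (p ∷ ps) rewrite ≢-==L (λ e → ≺-≢ p (sym e)) = cong (a ∷_) (removeL-++ as cs ps)

posOf-++ : ∀ {x} as cs → All (_≺ x) as → posOf x (as ++ x ∷ cs) ≡ length as
posOf-++ {x} [] cs _ rewrite ==L-refl x = refl
posOf-++ {x} (a ∷ as) cs (p ∷ ps) rewrite ≢-==L (λ e → ≺-≢ p (sym e)) = cong suc (posOf-++ as cs ps)

∈-opt : ∀ {x l z} → z ∈ opt x l → z ≡ l × x ≡ true
∈-opt {true} (here p) = p , refl

∈-uL : ∀ {n} j (s : Bits n) {z} → z ∈ uL j s → ∃ λ i → z ≡ u i × j ≤ i × i < j + n
∈-uL {suc n} j (x ∷ s) m with ∈-++⁻ (opt x (u j)) m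
... | inj₁ p = j , proj₁ (∈-opt p) , ≤-refl , ≤-trans (s≤s (m≤m+n j n)) (≤-reflexive (sym (+-suc j n)))
... | inj₂ p with ∈-uL (suc j) s p
...   | i , e , h , h' = i , e , <⇒≤ h , ≤-trans h' (≤-reflexive (sym (+-suc j n)))

∈-bL : ∀ {n} j (s : Bits n) {z} → z ∈ bL j s → ∃ λ i → z ≡ b i × j ≤ i × i < j + n
∈-bL {suc n} j (x ∷ s) m with ∈-++⁻ (bL (suc j) s) m
... | inj₂ p = j , proj₁ (∈-opt p) , ≤-refl , ≤-trans (s≤s (m≤m+n j n)) (≤-reflexive (sym (+-suc j n)))
... | inj₁ p with ∈-bL (suc j) s p
...   | i , e , h , h' = i , e , <⇒≤ h , ≤-trans h' (≤-reflexive (sym (+-suc j n)))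

opt-sorted : ∀ x l → Sorted (opt x l)
opt-sorted true l = [] ∷ []
opt-sorted false l = []

uL-sorted : ∀ {n} j (s : Bits n) → Sorted (uL j s)
uL-sorted j [] = []
uL-sorted j (x ∷ s) = Sorted-++ (opt-sorted x (u j)) (uL-sorted (suc j) s) λ p q → go (∈-opt p) (∈-uL (suc j) s q)
  where
  go : ∀ {z w} → z ≡ u j × x ≡ true → (∃ λ i → w ≡ u i × suc j ≤ i × i < suc j + _) → z ≺ w
  go (refl , _) (i , refl , h , _) = u≺u h

bL-sorted : ∀ {n} j (s : Bits n) → Sorted (bL j s)
bL-sorted j [] = []
bL-sorted j (x ∷ s) = Sorted-++ (bL-sorted (suc j) s) (opt-sorted x (b j)) λ p q → go (∈-bL (suc j) s p) (∈-opt q)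
  where
  go : ∀ {z w} → (∃ λ i → z ≡ b i × suc j ≤ i × i < suc j + _) → w ≡ b j × x ≡ true → z ≺ w
  go (i , refl , h , _) (refl , _) = b≺b h

wd-sorted : ∀ {n} (c : Col n) → Sorted (wd c)
wd-sorted (us , bs) = Sorted-++ (uL-sorted 1 us) (bL-sorted 1 bs) λ p q → go (∈-uL 1 us p) (∈-bL 1 bs q)
  where
  go : ∀ {z w : Letter} {P Q : ℕ → Set} → (∃ λ i → z ≡ u i × P i) → (∃ λ i → w ≡ b i × Q i) → z ≺ w
  go (i , refl , _) (j , refl , _) = u≺b

length-opt : ∀ x l → length (opt x l) ≡ bit x
length-opt true l = refl
length-opt false l = refl

length-uL : ∀ {n} j (s : Bits n) → length (uL j s) ≡ count s
length-uL j [] = refl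
length-uL j (x ∷ s) = trans (length-++ (opt x (u j))) (cong₂ _+_ (length-opt x (u j)) (length-uL (suc j) s))

length-bL : ∀ {n} j (s : Bits n) → length (bL j s) ≡ count s
length-bL j [] = refl
length-bL j (x ∷ s) = trans (length-++ (bL (suc j) s)) (trans (+-comm (length (bL (suc j) s)) _) (cong₂ _+_ (length-opt x (b j)) (length-bL (suc j) s)))

length-wd : ∀ {n} (c : Col n) → length (wd c) ≡ height c
length-wd (us , bs) = trans (length-++ (uL 1 us)) (cong₂ _+_ (length-uL 1 us) (length-bL 1 bs))

head-u : ∀ {n} j (s t : Bits n) x y → opt x (u j) ++ uL (suc j) s ≡ opt y (u j) ++ uL (suc j) t → x ≡ y × uL (suc j) s ≡ uL (suc j) t
head-u j s t true true h = refl , cong (Data.List.drop 1) h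
head-u j s t false false h = refl , h
head-u j s t true false h with ∈-uL (suc j) t (subst (u j ∈_) h (here refl))
... | i , refl , p , _ = ⊥-elim (<-irrefl refl p)
head-u j s t false true h with ∈-uL (suc j) s (subst (u j ∈_) (sym h) (here refl))
... | i , refl , p , _ = ⊥-elim (<-irrefl refl p)

uL-injective : ∀ {n} j (s t : Bits n) → uL j s ≡ uL j t → s ≡ t
uL-injective j [] [] h = refl
uL-injective j (x ∷ s) (y ∷ t) h with head-u j s t x y h
... | refl , h' = cong (x ∷_) (uL-injective (suc j) s t h')

last-b : ∀ {n} j (s t : Bits n) x y → bL (suc j) s ++ opt x (b j) ≡ bL (suc j) t ++ opt y (b j) → x ≡ y × bL (suc j) s ≡ bL (suc j) t
last-b j s t true true h = refl , Data.List.Properties.++-cancelʳ (b j ∷ []) _ _ h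
last-b j s t false false h = refl , trans (sym (++-identityʳ _)) (trans h (++-identityʳ _))
last-b j s t true false h with ∈-bL (suc j) t (subst (b j ∈_) (trans h (++-identityʳ _)) (∈-++⁺ʳ (bL (suc j) s) (here refl)))
... | i , refl , p , _ = ⊥-elim (<-irrefl refl p)
last-b j s t false true h with ∈-bL (suc j) s (subst (b j ∈_) (trans (sym h) (++-identityʳ _)) (∈-++⁺ʳ (bL (suc j) t) (here refl)))
... | i , refl , p , _ = ⊥-elim (<-irrefl refl p)

bL-injective : ∀ {n} j (s t : Bits n) → bL j s ≡ bL j t → s ≡ t
bL-injective j [] [] h = refl
bL-injective j (x ∷ s) (y ∷ t) h with last-b j s t x y h
... | refl , h' = cong (x ∷_) (bL-injective (suc j) s t h')

unbarredPart : List Letter → List Letter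
unbarredPart = bfilter (λ x → Data.Bool.not (isBarred x))

barredPart : List Letter → List Letter
barredPart = bfilter isBarred

bfilter-++ : {A : Set} (p : A → Bool) (xs ys : List A) → bfilter p (xs ++ ys) ≡ bfilter p xs ++ bfilter p ys
bfilter-++ p [] ys = refl
bfilter-++ p (x ∷ xs) ys with p x
... | true = cong (x ∷_) (bfilter-++ p xs ys)
... | false = bfilter-++ p xs ys

bfilter-all : {A : Set} (p : A → Bool) (xs : List A) → (∀ {x} → x ∈ xs → p x ≡ true) → bfilter p xs ≡ xs
bfilter-all p [] h = refl
bfilter-all p (x ∷ xs) h rewrite h (here refl) = cong (x ∷_) (bfilter-all p xs (λ m → h (there m)))

bfilter-none : {A : Set} (p : A → Bool) (xs : List A) → (∀ {x} → x ∈ xs → p x ≡ false) → bfilter p xs ≡ []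
bfilter-none p [] h = refl
bfilter-none p (x ∷ xs) h rewrite h (here refl) = bfilter-none p xs (λ m → h (there m))

unbarred-wd : ∀ {n} (us bs : Bits n) → unbarredPart (wd (us , bs)) ≡ uL 1 us
unbarred-wd us bs = trans (bfilter-++ _ (uL 1 us) (bL 1 bs)) (trans (cong₂ _++_
  (bfilter-all _ (uL 1 us) (λ m → cong (λ x → Data.Bool.not (isBarred x)) (proj₁ (proj₂ (∈-uL 1 us m)))))
  (bfilter-none _ (bL 1 bs) (λ m → cong (λ x → Data.Bool.not (isBarred x)) (proj₁ (proj₂ (∈-bL 1 bs m)))))) (++-identityʳ _))

barred-wd : ∀ {n} (us bs : Bits n) → barredPart (wd (us , bs)) ≡ bL 1 bs
barred-wd us bs = trans (bfilter-++ _ (uL 1 us) (bL 1 bs)) (cong₂ _++_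
  (bfilter-none _ (uL 1 us) (λ m → cong isBarred (proj₁ (proj₂ (∈-uL 1 us m)))))
  (bfilter-all _ (bL 1 bs) (λ m → cong isBarred (proj₁ (proj₂ (∈-bL 1 bs m))))))

wd-injective : ∀ {n} (c d : Col n) → wd c ≡ wd d → c ≡ d
wd-injective (us , bs) (us' , bs') h = cong₂ _,_
  (uL-injective 1 us us' (trans (sym (unbarred-wd us bs)) (trans (cong unbarredPart h) (unbarred-wd us' bs'))))
  (bL-injective 1 bs bs' (trans (sym (barred-wd us bs)) (trans (cong barredPart h) (barred-wd us' bs'))))

has : ∀ {n} → ℕ → Bits n → ℕ → Bool
has j [] k = false
has j (x ∷ s) k = (x ∧ (k ≡ᵇ j)) ∨ has (suc j) s k

has-below : ∀ {n} j (s : Bits n) k → k < j → has j s k ≡ false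
has-below j [] k h = refl
has-below j (true ∷ s) k h rewrite ≢-≡ᵇ k j (<⇒≢ h) = has-below (suc j) s k (m≤n⇒m≤1+n h)
has-below j (false ∷ s) k h = has-below (suc j) s k (m≤n⇒m≤1+n h)

has-here : ∀ {n} j x (s : Bits n) → has j (x ∷ s) j ≡ x
has-here j true s rewrite ≡ᵇ-refl j = refl
has-here j false s = has-below (suc j) s j ≤-refl

has-there : ∀ {n} j x (s : Bits n) k → j < k → has j (x ∷ s) k ≡ has (suc j) s k
has-there j true s k h rewrite ≢-≡ᵇ k j (>⇒≢ h) = refl
has-there j false s k h = refl

bany-++ : {A : Set} (p : A → Bool) (xs ys : List A) → bany p (xs ++ ys) ≡ bany p xs ∨ bany p ys
bany-++ p [] ys = refl
bany-++ p (x ∷ xs) ys with p x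
... | true = refl
... | false = bany-++ p xs ys

memL-opt-u : ∀ k x j → memL (u k) (opt x (u j)) ≡ x ∧ (k ≡ᵇ j)
memL-opt-u k true j = ∨-identityʳ _
memL-opt-u k false j = refl

memL-opt-b : ∀ k x j → memL (b k) (opt x (b j)) ≡ x ∧ (k ≡ᵇ j)
memL-opt-b k true j = ∨-identityʳ _
memL-opt-b k false j = refl

memL-uL : ∀ {n} k j (s : Bits n) → memL (u k) (uL j s) ≡ has j s k
memL-uL k j [] = refl
memL-uL k j (x ∷ s) = trans (bany-++ _ (opt x (u j)) _) (cong₂ _∨_ (memL-opt-u k x j) (memL-uL k (suc j) s))

memL-bL : ∀ {n} k j (s : Bits n) → memL (b k) (bL j s) ≡ has j s k
memL-bL k j [] = refl
memL-bL k j (x ∷ s) = trans (bany-++ _ (bL (suc j) s) _) (trans (cong₂ _∨_ (memL-bL k (suc j) s) (memL-opt-b k x j)) (∨-comm _ (x ∧ (k ≡ᵇ j))))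

memL-∈ : ∀ {x} C → memL x C ≡ true → x ∈ C
memL-∈ {x} (y ∷ C) h with x ==L y in e
... | true = here (==L-≡ e)
... | false = there (memL-∈ C h)

∈-memL : ∀ {x C} → x ∈ C → memL x C ≡ true
∈-memL {x} (here refl) rewrite ==L-refl x = refl
∈-memL {x} {y ∷ C} (there m) rewrite ∈-memL m = ∨-zeroʳ _

∉-memL : ∀ {x C} → (x ∈ C → ⊥) → memL x C ≡ false
∉-memL {x} {C} h with memL x C in e
... | false = refl
... | true = ⊥-elim (h (memL-∈ C e))

u∉bL : ∀ {n k} j (s : Bits n) → u k ∈ bL j s → ⊥
u∉bL j s m with ∈-bL j s m
... | _ , () , _

b∉uL : ∀ {n k} j (s : Bits n) → b k ∈ uL j s → ⊥
b∉uL j s m with ∈-uL j s m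
... | _ , () , _

memL-wd-u : ∀ {n} k (us bs : Bits n) → memL (u k) (wd (us , bs)) ≡ has 1 us k
memL-wd-u k us bs rewrite bany-++ (u k ==L_) (uL 1 us) (bL 1 bs) | memL-uL k 1 us | ∉-memL (u∉bL {k = k} 1 bs) = ∨-identityʳ _

memL-wd-b : ∀ {n} k (us bs : Bits n) → memL (b k) (wd (us , bs)) ≡ has 1 bs k
memL-wd-b k us bs rewrite bany-++ (b k ==L_) (uL 1 us) (bL 1 bs) | ∉-memL (b∉uL {k = k} 1 us) = memL-bL k 1 bs

outStep : Bool → Bool → ℕ → (ℕ → List ℕ) → ℕ → List ℕ
outStep true _ m r k = r (suc k)
outStep false true m r zero = r 0
outStep false true m r (suc k) = m ∷ r k
outStep false false m r k = r k

-- The values t_i produced below m, when k letters z_i are still pending.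
outs : (ℕ → Bool) → (ℕ → Bool) → ℕ → ℕ → List ℕ
outs X F zero k = replicate k 0
outs X F (suc m) k = outStep (X m) (F m) m (outs X F m) k

module _ (C : Column) (X : ℕ → Bool) (X-not-free : ∀ k → X k ≡ true → freeIn C k ≡ false) where
  private
    F = freeIn C

  below-max : ℕ → List ℕ
  below-max m = bfilter X (downFrom m)

  below-max-< : ∀ m → All (_< m) (below-max m)
  below-max-< zero = []
  below-max-< (suc m) with X m
  ... | true = ≤-refl ∷ mapAll m≤n⇒m≤1+n (below-max-< m)
  ... | false = mapAll m≤n⇒m≤1+n (below-max-< m)

  bound-free : ∀ m l → F m ≡ false → All (m ≤_) l → ∀ zs → All (_≤ m) zs → tsFrom C (suc m) (l ++ zs) ≡ tsFrom C m (l ++ zs)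
  bound-free m [] f h [] _ = refl
  bound-free m [] f h (z ∷ zs) (p ∷ _) rewrite m≥n⇒m⊓n≡n p | m≥n⇒m⊓n≡n (m≤n⇒m≤1+n p) = refl
  bound-free m (z ∷ l) f (p ∷ h) zs _ with m≤n⇒m<n∨m≡n p
  ... | inj₁ q rewrite m≤n⇒m⊓n≡m p | m≤n⇒m⊓n≡m q | f = refl
  ... | inj₂ refl rewrite ⊓-idem m | m≥n⇒m⊓n≡n (n≤1+n m) = refl

  bound-small : ∀ m zs → All (_≤ m) zs → tsFrom C (suc m) zs ≡ tsFrom C m zs
  bound-small m [] _ = refl
  bound-small m (z ∷ zs) (p ∷ _) rewrite m≥n⇒m⊓n≡n p | m≥n⇒m⊓n≡n (m≤n⇒m≤1+n p) = refl

  tsFrom-outs : ∀ m l → All (m ≤_) l → tsFrom C m (l ++ below-max m) ≡ outs X F m (length l)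
  tsFrom-outs zero l h = go l
    where
    go : ∀ l → tsFrom C 0 (l ++ []) ≡ replicate (length l) 0
    go [] = refl
    go (z ∷ l) = cong (0 ∷_) (go l)
  tsFrom-outs (suc m) l h with X m in ex
  ... | true = trans (cong (tsFrom C (suc m)) (sym (++-assoc l (m ∷ []) (below-max m))))
      (trans (bound-free m (l ++ m ∷ []) (X-not-free m ex) all (below-max m) (mapAll <⇒≤ (below-max-< m)))
        (trans (tsFrom-outs m (l ++ m ∷ []) all)
          (cong (outs X F m) (trans (length-++ l) (+-comm (length l) 1)))))
    where
    all : All (m ≤_) (l ++ m ∷ [])
    all = All-++ (mapAll <⇒≤ h) (≤-refl ∷ [])
  ... | false with F m in ef
  ...   | false = trans (bound-free m l ef (mapAll <⇒≤ h) (below-max m) (mapAll <⇒≤ (below-max-< m))) (tsFrom-outs m l (mapAll <⇒≤ h))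
  tsFrom-outs (suc m) [] h | false | true = trans (bound-small m (below-max m) (mapAll <⇒≤ (below-max-< m))) (tsFrom-outs m [] [])
  tsFrom-outs (suc m) (z ∷ l) (p ∷ h) | false | true rewrite m≤n⇒m⊓n≡m p | ef = cong (m ∷_) (tsFrom-outs m l (mapAll <⇒≤ h))

  below-max-stable : ∀ d m → (∀ k → m ≤ k → X k ≡ false) → below-max (d + m) ≡ below-max m
  below-max-stable zero m h = refl
  below-max-stable (suc d) m h rewrite h (d + m) (m≤n+m m d) = below-max-stable d m h

  outs-stable : ∀ d m → (∀ k → m ≤ k → X k ≡ false) → outs X F (d + m) 0 ≡ outs X F m 0
  outs-stable zero m h = refl
  outs-stable (suc d) m h rewrite h (d + m) (m≤n+m m d) with F (d + m)
  ... | true = outs-stable d m h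
  ... | false = outs-stable d m h

Zs Ms : ∀ {n} → ℕ → Bits n → Bits n → List ℕ
Zs j [] [] = []
Zs j (true ∷ us) (true ∷ bs) = Zs (suc j) us bs ++ j ∷ []
Zs j (true ∷ us) (false ∷ bs) = Zs (suc j) us bs
Zs j (false ∷ us) (y ∷ bs) = Zs (suc j) us bs

matched : Bool → Bool → ℕ → ℕ → List ℕ
matched false false (suc p) j = j ∷ []
matched _ _ _ _ = []
Ms j [] [] = []
Ms j (x ∷ us) (y ∷ bs) = Ms (suc j) us bs ++ matched x y (pend 0 us bs) j

Zs-spec : ∀ {n} C X XF j (us bs : Bits n) → (∀ k → j ≤ k → X k ≡ has j us k ∧ has j bs k) →
          below-max C X XF (j + n) ≡ Zs j us bs ++ below-max C X XF j
Zs-spec C X XF j [] [] h rewrite +-identityʳ j = refl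
Zs-spec {suc n} C X XF j (x ∷ us) (y ∷ bs) h rewrite +-suc j n
  | Zs-spec C X XF (suc j) us bs (λ k le → trans (h k (<⇒≤ le)) (cong₂ _∧_ (has-there j x us k le) (has-there j y bs k le)))
  | trans (h j ≤-refl) (cong₂ _∧_ (has-here j x us) (has-here j y bs)) = go x y
  where
  go : ∀ x y → Zs (suc j) us bs ++ (if x ∧ y then j ∷ below-max C X XF j else below-max C X XF j) ≡ Zs j (x ∷ us) (y ∷ bs) ++ below-max C X XF j
  go true true = sym (++-assoc (Zs (suc j) us bs) (j ∷ []) _)
  go true false = refl
  go false y = refl

outs-spec : ∀ {n} X F j (us bs : Bits n) → (∀ k → j ≤ k → X k ≡ has j us k ∧ has j bs k) → (∀ k → j ≤ k → F k ≡ not (has j us k) ∧ not (has j bs k)) →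
            outs X F (j + n) 0 ≡ Ms j us bs ++ outs X F j (pend 0 us bs)
outs-spec X F j [] [] h h' rewrite +-identityʳ j = refl
outs-spec {suc n} X F j (x ∷ us) (y ∷ bs) h h' rewrite +-suc j n
  | outs-spec X F (suc j) us bs (λ k le → trans (h k (<⇒≤ le)) (cong₂ _∧_ (has-there j x us k le) (has-there j y bs k le)))
      (λ k le → trans (h' k (<⇒≤ le)) (cong₂ (λ p q → not p ∧ not q) (has-there j x us k le) (has-there j y bs k le)))
  | trans (h j ≤-refl) (cong₂ _∧_ (has-here j x us) (has-here j y bs))
  | trans (h' j ≤-refl) (cong₂ (λ p q → not p ∧ not q) (has-here j x us) (has-here j y bs)) =
  trans (cong (Ms (suc j) us bs ++_) (go x y (pend 0 us bs))) (sym (++-assoc (Ms (suc j) us bs) (matched x y (pend 0 us bs) j) _))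
  where
  go : ∀ x y p → outStep (x ∧ y) (not x ∧ not y) j (outs X F j) p ≡ matched x y p j ++ outs X F j (pst x y p)
  go true true p = refl
  go true false p = refl
  go false true p = refl
  go false false zero = refl
  go false false (suc p) = refl

maxIdx-≤ : ∀ {n} C → (∀ {x} → x ∈ C → index x ≤ n) → maxIdx C ≤ n
maxIdx-≤ [] h = z≤n
maxIdx-≤ (x ∷ C) h = ⊔-lub (h (here refl)) (maxIdx-≤ C (λ m → h (there m)))

∈-maxIdx : ∀ {x C} → x ∈ C → index x ≤ maxIdx C
∈-maxIdx {x} {_ ∷ C} (here refl) = m≤m⊔n (index x) (maxIdx C)
∈-maxIdx {x} {y ∷ C} (there m) = ≤-trans (∈-maxIdx m) (m≤n⊔m (index y) (maxIdx C))

wd-index : ∀ {n} (c : Col n) {x} → x ∈ wd c → 1 ≤ index x × index x ≤ n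
wd-index (us , bs) m with ∈-++⁻ (uL 1 us) m
... | inj₁ p with ∈-uL 1 us p
...   | i , refl , h , s≤s h' = h , h'
wd-index (us , bs) m | inj₂ p with ∈-bL 1 bs p
...   | i , refl , h , s≤s h' = h , h'

module _ {n : ℕ} (us bs : Bits n) where
  private
    C = wd (us , bs)
    X : ℕ → Bool
    X z = memL (u z) C ∧ memL (b z) C

    X≡ : ∀ k → X k ≡ has 1 us k ∧ has 1 bs k
    X≡ k = cong₂ _∧_ (memL-wd-u k us bs) (memL-wd-b k us bs)

    F≡ : ∀ k → freeIn C k ≡ not (has 1 us k) ∧ not (has 1 bs k)
    F≡ k = cong₂ (λ p q → not p ∧ not q) (memL-wd-u k us bs) (memL-wd-b k us bs)

    XF : ∀ k → X k ≡ true → freeIn C k ≡ false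
    XF k h with memL (u k) C
    ... | true = refl

    X-max : ∀ k → suc (maxIdx C) ≤ k → X k ≡ false
    X-max k h with memL (u k) C in e
    ... | false = refl
    ... | true = ⊥-elim (<⇒≱ h (∈-maxIdx {u k} (memL-∈ C e)))

    maxIdx≤n : suc (maxIdx C) ≤ suc n
    maxIdx≤n = s≤s (maxIdx-≤ C (λ m → proj₂ (wd-index (us , bs) m)))

    d : ℕ
    d = suc n ∸ suc (maxIdx C)

    d-eq : d + suc (maxIdx C) ≡ suc n
    d-eq = m∸n+n≡m maxIdx≤n

    X0 : X 0 ≡ false
    X0 = trans (X≡ 0) (cong (_∧ has 1 bs 0) (has-below 1 us 0 ≤-refl))

    F0 : freeIn C 0 ≡ true
    F0 = trans (F≡ 0) (cong₂ (λ p q → not p ∧ not q) (has-below 1 us 0 ≤-refl) (has-below 1 bs 0 ≤-refl))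

  zsOf-wd : zsOf C ≡ Zs 1 us bs
  zsOf-wd = trans (sym (below-max-stable C X XF d (suc (maxIdx C)) X-max)) (trans (cong (below-max C X XF) d-eq)
    (trans (Zs-spec C X XF 1 us bs (λ k _ → X≡ k)) (trans (cong (Zs 1 us bs ++_) (cong (λ z → if z then 0 ∷ [] else []) X0)) (++-identityʳ _))))

  tsOf-wd : tsOf C ≡ Ms 1 us bs ++ replicate (pend 0 us bs) 0
  tsOf-wd = trans (tsFrom-outs C X XF (suc (maxIdx C)) [] [])
    (trans (sym (outs-stable C X XF d (suc (maxIdx C)) X-max)) (trans (cong (λ z → outs X (freeIn C) z 0) d-eq)
      (trans (outs-spec X (freeIn C) 1 us bs (λ k _ → X≡ k) (λ k _ → F≡ k)) (cong (Ms 1 us bs ++_) (end (pend 0 us bs))))))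
    where
    end : ∀ p → outs X (freeIn C) 1 p ≡ replicate p 0
    end p rewrite X0 | F0 with p
    ... | zero = refl
    ... | suc _ = refl

tsFrom-length : ∀ C m zs → length (tsFrom C m zs) ≡ length zs
tsFrom-length C m [] = refl
tsFrom-length C m (z ∷ zs) = cong suc (tsFrom-length C _ zs)

only : ∀ {n} → Bits n → Bits n → Bits n
only [] [] = []
only (x ∷ s) (y ∷ t) = (x ∧ not y) ∷ only s t

pos : ∀ {n} → ℕ → Bits n → List ℕ
pos j [] = []
pos j (true ∷ s) = j ∷ pos (suc j) s
pos j (false ∷ s) = pos (suc j) s

pos-uL : ∀ {n} j (s : Bits n) → uL j s ≡ map u (pos j s)
pos-uL j [] = refl
pos-uL j (true ∷ s) = cong (u j ∷_) (pos-uL (suc j) s)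
pos-uL j (false ∷ s) = pos-uL (suc j) s

pos-bL : ∀ {n} j (s : Bits n) → bL j s ↭ map b (pos j s)
pos-bL j [] = refl
pos-bL j (true ∷ s) = ↭-trans (++-comm (bL (suc j) s) (b j ∷ [])) (prep (b j) (pos-bL (suc j) s))
pos-bL j (false ∷ s) = ↭-trans (↭-reflexive (++-identityʳ _)) (pos-bL (suc j) s)

append-last : ∀ (j : ℕ) {as : List ℕ} (xs : List ℕ) {ys : List ℕ} → as ↭ xs ++ ys → j ∷ as ↭ xs ++ (ys ++ j ∷ [])
append-last j {as} xs {ys} p = ↭-trans (prep j p) (↭-trans (++-comm (j ∷ []) (xs ++ ys)) (↭-reflexive (++-assoc xs ys (j ∷ []))))

pos-split : ∀ {n} j (us bs : Bits n) → pos j us ↭ pos j (only us bs) ++ Zs j us bs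
pos-split j [] [] = refl
pos-split j (true ∷ us) (true ∷ bs) = append-last j (pos (suc j) (only us bs)) (pos-split (suc j) us bs)
pos-split j (true ∷ us) (false ∷ bs) = prep j (pos-split (suc j) us bs)
pos-split j (false ∷ us) (y ∷ bs) = pos-split (suc j) us bs

pos-uS : ∀ {n} j (us bs : Bits n) → pos j (uS 0 us bs) ↭ pos j (only us bs) ++ Ms j us bs
pos-uS j [] [] = refl
pos-uS j (true ∷ us) (true ∷ bs) = ↭-trans (pos-uS (suc j) us bs) (↭-reflexive (cong (pos (suc j) (only us bs) ++_) (sym (++-identityʳ _))))
pos-uS j (true ∷ us) (false ∷ bs) = prep j (↭-trans (pos-uS (suc j) us bs) (↭-reflexive (cong (pos (suc j) (only us bs) ++_) (sym (++-identityʳ _)))))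
pos-uS j (false ∷ us) (true ∷ bs) = ↭-trans (pos-uS (suc j) us bs) (↭-reflexive (cong (pos (suc j) (only us bs) ++_) (sym (++-identityʳ _))))
pos-uS j (false ∷ us) (false ∷ bs) with pend 0 us bs
... | zero = ↭-trans (pos-uS (suc j) us bs) (↭-reflexive (cong (pos (suc j) (only us bs) ++_) (sym (++-identityʳ _))))
... | suc p = append-last j (pos (suc j) (only us bs)) (pos-uS (suc j) us bs)

pend-comm : ∀ {n} (us bs : Bits n) → pend 0 us bs ≡ pend 0 bs us
pend-comm [] [] = refl
pend-comm (x ∷ us) (y ∷ bs) rewrite pend-comm us bs = go x y (pend 0 bs us)
  where
  go : ∀ x y p → pst x y p ≡ pst y x p
  go true true p = refl
  go true false p = refl
  go false true p = refl
  go false false p = refl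

bS-comm : ∀ {n} (us bs : Bits n) → bS 0 us bs ≡ uS 0 bs us
bS-comm [] [] = refl
bS-comm (x ∷ us) (y ∷ bs) rewrite pend-comm us bs = cong₂ _∷_ (go x y (pend 0 bs us)) (bS-comm us bs)
  where
  go : ∀ x y p → bb x y p ≡ ub y x p
  go true true p = refl
  go true false p = refl
  go false true p = refl
  go false false zero = refl
  go false false (suc p) = refl

Zs-comm : ∀ {n} j (us bs : Bits n) → Zs j us bs ≡ Zs j bs us
Zs-comm j [] [] = refl
Zs-comm j (true ∷ us) (true ∷ bs) = cong (_++ j ∷ []) (Zs-comm (suc j) us bs)
Zs-comm j (true ∷ us) (false ∷ bs) = Zs-comm (suc j) us bs
Zs-comm j (false ∷ us) (true ∷ bs) = Zs-comm (suc j) us bs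
Zs-comm j (false ∷ us) (false ∷ bs) = Zs-comm (suc j) us bs

Ms-comm : ∀ {n} j (us bs : Bits n) → Ms j us bs ≡ Ms j bs us
Ms-comm j [] [] = refl
Ms-comm j (x ∷ us) (y ∷ bs) rewrite pend-comm us bs = cong₂ _++_ (Ms-comm (suc j) us bs) (go x y (pend 0 bs us))
  where
  go : ∀ x y p → matched x y p j ≡ matched y x p j
  go true true p = refl
  go true false p = refl
  go false true p = refl
  go false false zero = refl
  go false false (suc p) = refl

∈-Zs : ∀ {n} j (us bs : Bits n) {k} → k ∈ Zs j us bs → j ≤ k
∈-Zs j [] [] ()
∈-Zs j (true ∷ us) (true ∷ bs) m with ∈-++⁻ (Zs (suc j) us bs) m
... | inj₁ p = <⇒≤ (∈-Zs (suc j) us bs p)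
... | inj₂ (here refl) = ≤-refl
∈-Zs j (true ∷ us) (false ∷ bs) m = <⇒≤ (∈-Zs (suc j) us bs m)
∈-Zs j (false ∷ us) (y ∷ bs) m = <⇒≤ (∈-Zs (suc j) us bs m)

∈-pos : ∀ {n} j (s : Bits n) {k} → k ∈ pos j s → j ≤ k
∈-pos j (true ∷ s) (here refl) = ≤-refl
∈-pos j (true ∷ s) (there m) = <⇒≤ (∈-pos (suc j) s m)
∈-pos j (false ∷ s) m = <⇒≤ (∈-pos (suc j) s m)

data Distinct : List ℕ → Set where
  [] : Distinct []
  _∷_ : ∀ {z zs} → (z ∈ zs → ⊥) → Distinct zs → Distinct (z ∷ zs)

distinct-∷ʳ : ∀ zs j → Distinct zs → (∀ {k} → k ∈ zs → j < k) → Distinct (zs ++ j ∷ [])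
distinct-∷ʳ [] j d h = (λ ()) ∷ []
distinct-∷ʳ (z ∷ zs) j (p ∷ d) h = np ∷ distinct-∷ʳ zs j d (λ m → h (there m))
  where
  np : z ∈ zs ++ j ∷ [] → ⊥
  np m with ∈-++⁻ zs m
  ... | inj₁ q = p q
  ... | inj₂ (here refl) = <-irrefl refl (h (here refl))

Zs-distinct : ∀ {n} j (us bs : Bits n) → Distinct (Zs j us bs)
Zs-distinct j [] [] = []
Zs-distinct j (true ∷ us) (true ∷ bs) = distinct-∷ʳ _ j (Zs-distinct (suc j) us bs) (∈-Zs (suc j) us bs)
Zs-distinct j (true ∷ us) (false ∷ bs) = Zs-distinct (suc j) us bs
Zs-distinct j (false ∷ us) (y ∷ bs) = Zs-distinct (suc j) us bs

only-Zs-disjoint : ∀ {n} j (us bs : Bits n) {k} → k ∈ pos j (only us bs) → k ∈ Zs j us bs → ⊥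
only-Zs-disjoint j [] [] ()
only-Zs-disjoint j (true ∷ us) (true ∷ bs) m m' with ∈-++⁻ (Zs (suc j) us bs) m'
... | inj₁ q = only-Zs-disjoint (suc j) us bs m q
... | inj₂ (here refl) = <-irrefl refl (∈-pos (suc j) (only us bs) m)
only-Zs-disjoint j (true ∷ us) (false ∷ bs) (here refl) m' = <-irrefl refl (∈-Zs (suc j) us bs m')
only-Zs-disjoint j (true ∷ us) (false ∷ bs) (there m) m' = only-Zs-disjoint (suc j) us bs m m'
only-Zs-disjoint j (false ∷ us) (y ∷ bs) m m' = only-Zs-disjoint (suc j) us bs m m'

record Family (L : ℕ → Letter) : Set where
  field
    L-eq : ∀ i j → (L i ==L L j) ≡ (i ≡ᵇ j)

open Family

u-family : Family u
u-family .L-eq i j = refl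

b-family : Family b
b-family .L-eq i j = refl

module _ {L : ℕ → Letter} (fam : Family L) where
  replace-∉ : ∀ zs ts k → (k ∈ zs → ⊥) → replaceBy (zip (map L zs) (map L ts)) (L k) ≡ L k
  replace-∉ [] ts k h = refl
  replace-∉ (z ∷ zs) [] k h = refl
  replace-∉ (z ∷ zs) (t ∷ ts) k h rewrite L-eq fam k z | ≢-≡ᵇ k z (λ e → h (here e)) = replace-∉ zs ts k (λ m → h (there m))

  replace-all∉ : ∀ zs ts ks → (∀ {k} → k ∈ ks → k ∈ zs → ⊥) → map (replaceBy (zip (map L zs) (map L ts))) (map L ks) ≡ map L ks
  replace-all∉ zs ts [] h = refl
  replace-all∉ zs ts (k ∷ ks) h = cong₂ _∷_ (replace-∉ zs ts k (h (here refl))) (replace-all∉ zs ts ks (λ m → h (there m)))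

  replace-skip : ∀ z t ps ks → (z ∈ ks → ⊥) → map (replaceBy ((L z , L t) ∷ ps)) (map L ks) ≡ map (replaceBy ps) (map L ks)
  replace-skip z t ps [] h = refl
  replace-skip z t ps (k ∷ ks) h rewrite L-eq fam k z | ≢-≡ᵇ k z (λ e → h (here (sym e))) = cong (_ ∷_) (replace-skip z t ps ks (λ m → h (there m)))

  replace-zs : ∀ zs ts → Distinct zs → length ts ≡ length zs → map (replaceBy (zip (map L zs) (map L ts))) (map L zs) ≡ map L ts
  replace-zs [] [] d h = refl
  replace-zs (z ∷ zs) (t ∷ ts) (p ∷ d) h rewrite L-eq fam z z | ≡ᵇ-refl z =
    cong (L t ∷_) (trans (replace-skip z t (zip (map L zs) (map L ts)) zs p) (replace-zs zs ts d (suc-injective h)))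

  replaced : ∀ {n} (s t : Bits n) (as ts : List ℕ) → as ↭ pos 1 (only s t) ++ Zs 1 s t → length ts ≡ length (Zs 1 s t) →
             map (replaceBy (zip (map L (Zs 1 s t)) (map L ts))) (map L as) ↭ map L (pos 1 (only s t) ++ ts)
  replaced s t as ts p e = ↭-trans (map⁺ _ (map⁺ L p)) (↭-reflexive (trans (cong (map _) (map-++ L (pos 1 (only s t)) (Zs 1 s t)))
    (trans (map-++ _ (map L (pos 1 (only s t))) (map L (Zs 1 s t)))
      (trans (cong₂ _++_ (replace-all∉ (Zs 1 s t) ts (pos 1 (only s t)) (only-Zs-disjoint 1 s t)) (replace-zs (Zs 1 s t) ts (Zs-distinct 1 s t) e))
        (sym (map-++ L (pos 1 (only s t)) ts))))))

replace-u-b : ∀ zs ts xs → map (replaceBy (zip (map u zs) (map u ts))) (map b xs) ≡ map b xs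
replace-u-b zs ts [] = refl
replace-u-b zs ts (x ∷ xs) = cong₂ _∷_ (go zs ts) (replace-u-b zs ts xs)
  where
  go : ∀ zs ts → replaceBy (zip (map u zs) (map u ts)) (b x) ≡ b x
  go [] ts = refl
  go (z ∷ zs) [] = refl
  go (z ∷ zs) (t ∷ ts) = go zs ts

replace-b-u : ∀ zs ts xs → map (replaceBy (zip (map b zs) (map b ts))) (map u xs) ≡ map u xs
replace-b-u zs ts [] = refl
replace-b-u zs ts (x ∷ xs) = cong₂ _∷_ (go zs ts) (replace-b-u zs ts xs)
  where
  go : ∀ zs ts → replaceBy (zip (map b zs) (map b ts)) (u x) ≡ u x
  go [] ts = refl
  go (z ∷ zs) [] = refl
  go (z ∷ zs) (t ∷ ts) = go zs ts

wd-pos : ∀ {n} (us bs : Bits n) → wd (us , bs) ↭ map u (pos 1 us) ++ map b (pos 1 bs)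
wd-pos us bs = ++⁺ (↭-reflexive (pos-uL 1 us)) (pos-bL 1 bs)

module _ {n : ℕ} (us bs : Bits n) where
  private
    ts = Ms 1 us bs ++ replicate (pend 0 us bs) 0
    zs = Zs 1 us bs
    ts-length : length ts ≡ length zs
    ts-length = trans (cong length (sym (tsOf-wd us bs))) (trans (tsFrom-length (wd (us , bs)) _ (zsOf (wd (us , bs)))) (cong length (zsOf-wd us bs)))

  lCol-↭ : lCol (wd (us , bs)) ≡ sortL (map u (pos 1 (only us bs) ++ ts) ++ map b (pos 1 bs))
  lCol-↭ = trans (cong₂ (λ z t → sortL (map (replaceBy (zip (map u z) (map u t))) (wd (us , bs)))) (zsOf-wd us bs) (tsOf-wd us bs)) (sortL-cong (↭-trans (map⁺ _ (wd-pos us bs))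
    (↭-trans (↭-reflexive (map-++ _ (map u (pos 1 us)) (map b (pos 1 bs))))
      (++⁺ (replaced u-family us bs (pos 1 us) ts (pos-split 1 us bs) ts-length) (↭-reflexive (replace-u-b zs ts (pos 1 bs)))))))

  rCol-↭ : rCol (wd (us , bs)) ≡ sortL (map u (pos 1 us) ++ map b (pos 1 (only bs us) ++ ts))
  rCol-↭ = trans (cong₂ (λ z t → sortL (map (replaceBy (zip (map b z) (map b t))) (wd (us , bs)))) (zsOf-wd us bs) (tsOf-wd us bs)) (sortL-cong (↭-trans (map⁺ _ (wd-pos us bs))
    (↭-trans (↭-reflexive (map-++ _ (map u (pos 1 us)) (map b (pos 1 bs))))
      (++⁺ (↭-reflexive (replace-b-u zs ts (pos 1 us))) rb))))
    where
    rb : map (replaceBy (zip (map b zs) (map b ts))) (map b (pos 1 bs)) ↭ map b (pos 1 (only bs us) ++ ts)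
    rb rewrite Zs-comm 1 us bs = replaced b-family bs us (pos 1 bs) ts (pos-split 1 bs us) (trans ts-length (cong length (Zs-comm 1 us bs)))

  module _ (a : pend 0 us bs ≡ 0) where
    private
      ts≡ : ts ≡ Ms 1 us bs
      ts≡ = trans (cong (λ p → Ms 1 us bs ++ replicate p 0) a) (++-identityʳ _)

    lCol-wd : lCol (wd (us , bs)) ≡ wd (uS 0 us bs , bs)
    lCol-wd = trans lCol-↭ (trans (sortL-cong (↭-trans (++⁺ʳ (map b (pos 1 bs)) (map⁺ u
        (↭-trans (↭-reflexive (cong (pos 1 (only us bs) ++_) ts≡)) (↭-sym (pos-uS 1 us bs))))) (↭-sym (wd-pos (uS 0 us bs) bs))))
      (sortL-sorted (wd-sorted (uS 0 us bs , bs))))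

    rCol-wd : rCol (wd (us , bs)) ≡ wd (us , bS 0 us bs)
    rCol-wd = trans rCol-↭ (trans (sortL-cong (↭-trans (++⁺ˡ (map u (pos 1 us)) (map⁺ b
        (↭-trans (↭-reflexive (cong (pos 1 (only bs us) ++_) (trans ts≡ (Ms-comm 1 us bs))))
          (↭-trans (↭-sym (pos-uS 1 bs us)) (↭-reflexive (cong (pos 1) (sym (bS-comm us bs)))))))) (↭-sym (wd-pos us (bS 0 us bs)))))
      (sortL-sorted (wd-sorted (us , bS 0 us bs))))

    Phi-wd : Phi (wd (us , bs)) ≡ wd (uS 0 us bs , bS 0 us bs)
    Phi-wd rewrite lCol-wd | rCol-wd = cong₂ _++_ (unbarred-wd (uS 0 us bs) bs) (barred-wd us (bS 0 us bs))

  a₁∈lCol : ∀ {p} → pend 0 us bs ≡ suc p → memL (u 0) (lCol (wd (us , bs))) ≡ true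
  a₁∈lCol h rewrite lCol-↭ = ∈-memL (∈-resp-↭ (↭-sym (sortL-↭ _)) (∈-++⁺ˡ (∈-map⁺ u (∈-++⁺ʳ (pos 1 (only us bs)) (∈-++⁺ʳ (Ms 1 us bs) zero∈)))))
    where
    zero∈ : 0 ∈ replicate (pend 0 us bs) 0
    zero∈ rewrite h = here refl

data Sub : List Letter → List Letter → Set where
  [] : Sub [] []
  keep : ∀ {x xs ys} → Sub xs ys → Sub (x ∷ xs) (x ∷ ys)
  skip : ∀ {y xs ys} → Sub xs ys → Sub xs (y ∷ ys)

Sub-[] : ∀ ys → Sub [] ys
Sub-[] [] = []
Sub-[] (y ∷ ys) = skip (Sub-[] ys)

Sub-++ : ∀ {xs ys xs' ys'} → Sub xs ys → Sub xs' ys' → Sub (xs ++ xs') (ys ++ ys')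
Sub-++ [] t = t
Sub-++ (keep s) t = keep (Sub-++ s t)
Sub-++ (skip s) t = skip (Sub-++ s t)

Sub-split : ∀ {C} ys {ys'} → Sub C (ys ++ ys') → ∃ λ A → ∃ λ B → C ≡ A ++ B × Sub A ys × Sub B ys'
Sub-split [] s = [] , _ , refl , [] , s
Sub-split (y ∷ ys) (keep s) with Sub-split ys s
... | A , B , e , p , q = y ∷ A , B , cong (y ∷_) e , keep p , q
Sub-split (y ∷ ys) (skip s) with Sub-split ys s
... | A , B , e , p , q = A , B , e , skip p , q

Sub-opt : ∀ x l → Sub (opt x l) (l ∷ [])
Sub-opt true l = keep []
Sub-opt false l = skip []

opt-Sub : ∀ {A l} → Sub A (l ∷ []) → ∃ λ x → A ≡ opt x l
opt-Sub (keep []) = true , refl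
opt-Sub (skip []) = false , refl

full : ∀ n → Bits n
full n = vreplicate n true

Sub-uL : ∀ {n} j (s : Bits n) → Sub (uL j s) (uL j (full n))
Sub-uL j [] = []
Sub-uL j (x ∷ s) = Sub-++ (Sub-opt x (u j)) (Sub-uL (suc j) s)

Sub-bL : ∀ {n} j (s : Bits n) → Sub (bL j s) (bL j (full n))
Sub-bL j [] = []
Sub-bL j (x ∷ s) = Sub-++ (Sub-bL (suc j) s) (Sub-opt x (b j))

uL-Sub : ∀ n j {A} → Sub A (uL j (full n)) → ∃ λ (s : Bits n) → A ≡ uL j s
uL-Sub zero j [] = [] , refl
uL-Sub (suc n) j (keep s) with uL-Sub n (suc j) s
... | t , refl = true ∷ t , refl
uL-Sub (suc n) j (skip s) with uL-Sub n (suc j) s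
... | t , refl = false ∷ t , refl

bL-Sub : ∀ n j {A} → Sub A (bL j (full n)) → ∃ λ (s : Bits n) → A ≡ bL j s
bL-Sub zero j [] = [] , refl
bL-Sub (suc n) j s with Sub-split (bL (suc j) (full n)) s
... | A , B , refl , p , q with bL-Sub n (suc j) p | opt-Sub q
...   | t , refl | x , refl = x ∷ t , refl

wd-Sub : ∀ n {C} → Sub C (wd (full n , full n)) → ∃ λ (c : Col n) → C ≡ wd c
wd-Sub n s with Sub-split (uL 1 (full n)) s
... | A , B , refl , p , q with uL-Sub n 1 p | bL-Sub n 1 q
...   | t , refl | t' , refl = (t , t') , refl

full-∷ʳ : ∀ n → true ∷ full n ≡ full n ∷ʳ true
full-∷ʳ zero = refl
full-∷ʳ (suc n) = cong (true ∷_) (full-∷ʳ n)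

upto-uL : ∀ n → map u (upto n) ≡ uL 1 (full n)
upto-uL zero = refl
upto-uL (suc n) = trans (map-++ u (upto n) (suc n ∷ [])) (trans (cong (_++ u (suc n) ∷ []) (upto-uL n))
  (trans (sym (uL-snoc 1 (full n) true)) (cong (uL 1) (sym (full-∷ʳ n)))))

upto-bL : ∀ n → reverse (map b (upto n)) ≡ bL 1 (full n)
upto-bL zero = refl
upto-bL (suc n) = trans (cong reverse (map-++ b (upto n) (suc n ∷ []))) (trans (reverse-++ (map b (upto n)) (b (suc n) ∷ []))
  (trans (cong (b (suc n) ∷_) (upto-bL n)) (trans (sym (bL-snoc 1 (full n) true)) (cong (bL 1) (sym (full-∷ʳ n))))))

alphabet-wd : ∀ n → alphabet n ≡ wd (full n , full n)
alphabet-wd n = cong₂ _++_ (upto-uL n) (upto-bL n)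

combos-Sub : ∀ L k {C} → C ∈ combos L k → Sub C L
combos-Sub L zero (here refl) = Sub-[] L
combos-Sub (x ∷ L) (suc k) m with ∈-++⁻ (map (x ∷_) (combos L k)) m
... | inj₂ q = skip (combos-Sub L (suc k) q)
... | inj₁ q with ∈-map⁻ (x ∷_) q
...   | C , p , refl = keep (combos-Sub L k p)

Sub-combos : ∀ {L C} → Sub C L → C ∈ combos L (length C)
Sub-combos [] = here refl
Sub-combos (keep s) = ∈-++⁺ˡ (∈-map⁺ _ (Sub-combos s))
Sub-combos {y ∷ L} {[]} (skip s) = here refl
Sub-combos {y ∷ L} {x ∷ C} (skip s) = ∈-++⁺ʳ (map (y ∷_) (combos L (length C))) (Sub-combos s)

bfilter-sound : {A : Set} (p : A → Bool) (xs : List A) {x : A} → x ∈ bfilter p xs → x ∈ xs × p x ≡ true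
bfilter-sound p (y ∷ xs) m with p y in e
... | false = there (proj₁ (bfilter-sound p xs m)) , proj₂ (bfilter-sound p xs m)
bfilter-sound p (y ∷ xs) (here refl) | true = here refl , e
bfilter-sound p (y ∷ xs) (there m) | true = there (proj₁ (bfilter-sound p xs m)) , proj₂ (bfilter-sound p xs m)

bfilter-complete : {A : Set} (p : A → Bool) (xs : List A) {x : A} → x ∈ xs → p x ≡ true → x ∈ bfilter p xs
bfilter-complete p (y ∷ xs) (here refl) h rewrite h = here refl
bfilter-complete p (y ∷ xs) (there m) h with p y
... | true = there (bfilter-complete p xs m h)
... | false = bfilter-complete p xs m h

eqCol-≡ : ∀ C D → eqCol C D ≡ true → C ≡ D
eqCol-≡ [] [] h = refl
eqCol-≡ (x ∷ C) (y ∷ D) h = cong₂ _∷_ (==L-≡ (proj₁ (∧-true h))) (eqCol-≡ C D (proj₂ (∧-true h)))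

eqCol-refl : ∀ C → eqCol C C ≡ true
eqCol-refl [] = refl
eqCol-refl (x ∷ C) rewrite ==L-refl x = eqCol-refl C

upTo : ∀ {n} → ℕ → Bits n → ℕ
upTo zero s = 0
upTo (suc m) [] = 0
upTo (suc m) (x ∷ s) = bit x + upTo m s

upTo-pend : ∀ {n} q (us bs : Bits n) → pend 0 us bs ≤ q → ∀ m → upTo m us + upTo m bs ≤ m + q
upTo-pend q us bs h zero = z≤n
upTo-pend q [] [] h (suc m) = z≤n
upTo-pend (suc q) (true ∷ us) (true ∷ bs) (s≤s h) (suc m) rewrite +-suc (upTo m us) (upTo m bs) | +-suc m q = s≤s (s≤s (upTo-pend q us bs h m))
upTo-pend q (true ∷ us) (false ∷ bs) h (suc m) = s≤s (upTo-pend q us bs h m)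
upTo-pend q (false ∷ us) (true ∷ bs) h (suc m) rewrite +-suc (upTo m us) (upTo m bs) = s≤s (upTo-pend q us bs h m)
upTo-pend q (false ∷ us) (false ∷ bs) h (suc m) = ≤-trans (upTo-pend (suc q) us bs (pred-≤ h) m) (≤-reflexive (+-suc m q))

pend-upTo : ∀ {n} q (us bs : Bits n) → (∀ m → m ≤ n → upTo m us + upTo m bs ≤ m + q) → pend 0 us bs ≤ q
pend-upTo q [] [] h = z≤n
pend-upTo zero (true ∷ us) (true ∷ bs) h with h 1 (s≤s z≤n)
... | s≤s ()
pend-upTo (suc q) (true ∷ us) (true ∷ bs) h = s≤s (pend-upTo q us bs λ m le → s≤s⁻¹ (s≤s⁻¹ (≤-trans (≤-reflexive (cong suc (sym (+-suc (upTo m us) (upTo m bs))))) (≤-trans (h (suc m) (s≤s le)) (≤-reflexive (cong suc (+-suc m q)))))))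
pend-upTo q (true ∷ us) (false ∷ bs) h = pend-upTo q us bs λ m le → s≤s⁻¹ (h (suc m) (s≤s le))
pend-upTo q (false ∷ us) (true ∷ bs) h = pend-upTo q us bs λ m le → s≤s⁻¹ (≤-trans (≤-reflexive (sym (+-suc (upTo m us) (upTo m bs)))) (h (suc m) (s≤s le)))
pend-upTo q (false ∷ us) (false ∷ bs) h = pred-mono-≤ (pend-upTo (suc q) us bs λ m le → ≤-trans (h (suc m) (s≤s le)) (≤-reflexive (sym (+-suc m q))))

low : ℕ → Letter → Bool
low m x = (x ≤L u m) ∨ (b m ≤L x)

low-u : ∀ m k → low m (u k) ≡ (k <ᵇ m) ∨ (k ≡ᵇ m)
low-u m k = ∨-identityʳ _

low-index : ∀ m x → (index x ≤ m → low m x ≡ true) × (m < index x → low m x ≡ false)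
low-index m (u k) = (λ h → trans (low-u m k) (yes' h)) , (λ h → trans (low-u m k) (cong₂ _∨_ (≮-<ᵇ (<⇒≤ h)) (≢-≡ᵇ k m (>⇒≢ h))))
  where
  yes' : k ≤ m → (k <ᵇ m) ∨ (k ≡ᵇ m) ≡ true
  yes' h with m≤n⇒m<n∨m≡n h
  ... | inj₁ p rewrite <-<ᵇ p = refl
  ... | inj₂ refl rewrite ≡ᵇ-refl k = ∨-zeroʳ _
low-index m (b k) = yes' , (λ h → cong₂ _∨_ (≮-<ᵇ (<⇒≤ h)) (≢-≡ᵇ m k (<⇒≢ h)))
  where
  yes' : k ≤ m → (k <ᵇ m) ∨ (m ≡ᵇ k) ≡ true
  yes' h with m≤n⇒m<n∨m≡n h
  ... | inj₁ p rewrite <-<ᵇ p = refl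
  ... | inj₂ refl rewrite ≡ᵇ-refl k = ∨-zeroʳ _

bcount-++ : {A : Set} (p : A → Bool) (xs ys : List A) → bcount p (xs ++ ys) ≡ bcount p xs + bcount p ys
bcount-++ p xs ys = trans (cong length (bfilter-++ p xs ys)) (length-++ (bfilter p xs))

bcount-opt : ∀ m x l → index l ≤ m → bcount (low m) (opt x l) ≡ bit x
bcount-opt m true l h rewrite proj₁ (low-index m l) h = refl
bcount-opt m false l h = refl

bcount-uL : ∀ {n} j m (s : Bits n) → bcount (low (j + m)) (uL (suc j) s) ≡ upTo m s
bcount-uL j zero s = cong length (bfilter-none (low (j + 0)) (uL (suc j) s) (λ p → out (∈-uL (suc j) s p)))
  where
  out : ∀ {x} {Q : ℕ → Set} → (∃ λ i → x ≡ u i × suc j ≤ i × Q i) → low (j + 0) x ≡ false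
  out (i , refl , h , _) = proj₂ (low-index (j + 0) (u i)) (≤-trans (≤-reflexive (cong suc (+-identityʳ j))) h)
bcount-uL j (suc m) [] = refl
bcount-uL j (suc m) (x ∷ s) = trans (bcount-++ _ (opt x (u (suc j))) _)
  (cong₂ _+_ (bcount-opt (j + suc m) x (u (suc j)) (≤-trans (s≤s (m≤m+n j m)) (≤-reflexive (sym (+-suc j m)))))
    (trans (cong (λ z → bcount (low z) (uL (suc (suc j)) s)) (+-suc j m)) (bcount-uL (suc j) m s)))

bcount-bL : ∀ {n} j m (s : Bits n) → bcount (low (j + m)) (bL (suc j) s) ≡ upTo m s
bcount-bL j zero s = cong length (bfilter-none (low (j + 0)) (bL (suc j) s) (λ p → out (∈-bL (suc j) s p)))
  where
  out : ∀ {x} {Q : ℕ → Set} → (∃ λ i → x ≡ b i × suc j ≤ i × Q i) → low (j + 0) x ≡ false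
  out (i , refl , h , _) = proj₂ (low-index (j + 0) (b i)) (≤-trans (≤-reflexive (cong suc (+-identityʳ j))) h)
bcount-bL j (suc m) [] = refl
bcount-bL j (suc m) (x ∷ s) = trans (bcount-++ _ (bL (suc (suc j)) s) _) (trans (+-comm (bcount (low (j + suc m)) (bL (suc (suc j)) s)) _)
  (cong₂ _+_ (bcount-opt (j + suc m) x (b (suc j)) (≤-trans (s≤s (m≤m+n j m)) (≤-reflexive (sym (+-suc j m)))))
    (trans (cong (λ z → bcount (low z) (bL (suc (suc j)) s)) (+-suc j m)) (bcount-bL (suc j) m s))))

NN-wd : ∀ {n} m (us bs : Bits n) → NN (wd (us , bs)) m ≡ upTo m us + upTo m bs
NN-wd m us bs = trans (bcount-++ (low m) (uL 1 us) (bL 1 bs)) (cong₂ _+_ (bcount-uL 0 m us) (bcount-bL 0 m bs))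

∈-upto : ∀ n {m} → m ∈ upto n → 1 ≤ m × m ≤ n
∈-upto (suc n) p with ∈-++⁻ (upto n) p
... | inj₁ q = proj₁ (∈-upto n q) , m≤n⇒m≤1+n (proj₂ (∈-upto n q))
... | inj₂ (here refl) = s≤s z≤n , ≤-refl

upto-∈ : ∀ n {m} → 1 ≤ m → m ≤ n → m ∈ upto n
upto-∈ zero h h' = ⊥-elim (<⇒≱ h h')
upto-∈ (suc n) h h' with m≤n⇒m<n∨m≡n h'
... | inj₁ (s≤s p) = ∈-++⁺ˡ (upto-∈ n h p)
... | inj₂ refl = ∈-++⁺ʳ (upto n) (here refl)

ball-true : {A : Set} (p : A → Bool) (xs : List A) → ball p xs ≡ true → ∀ {x} → x ∈ xs → p x ≡ true
ball-true p (x ∷ xs) h (here refl) = proj₁ (∧-true h)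
ball-true p (x ∷ xs) h (there m) = ball-true p xs (proj₂ (∧-true h)) m

true-ball : {A : Set} (p : A → Bool) (xs : List A) → (∀ {x} → x ∈ xs → p x ≡ true) → ball p xs ≡ true
true-ball p [] h = refl
true-ball p (x ∷ xs) h rewrite h (here refl) = true-ball p xs (λ m → h (there m))

≤ᵇ-true : ∀ {m n} → (m Data.Nat.≤ᵇ n) ≡ true → m ≤ n
≤ᵇ-true {m} {n} h = ≤ᵇ⇒≤ m n (subst T (sym h) tt)

true-≤ᵇ : ∀ {m n} → m ≤ n → (m Data.Nat.≤ᵇ n) ≡ true
true-≤ᵇ h = T-true (≤⇒≤ᵇ h)

admissible-adm : ∀ {n} (c : Col n) → admissibleCol n (wd c) ≡ true → adm c
admissible-adm {n} (us , bs) h = n≤0⇒n≡0 (pend-upTo 0 us bs go)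
  where
  go : ∀ m → m ≤ n → upTo m us + upTo m bs ≤ m + 0
  go zero le = z≤n
  go (suc m) le = ≤-trans (≤-reflexive (sym (NN-wd (suc m) us bs))) (≤-trans (≤ᵇ-true (ball-true _ (upto n) h (upto-∈ n (s≤s z≤n) le))) (m≤m+n (suc m) 0))

adm-admissible : ∀ {n} (c : Col n) → adm c → admissibleCol n (wd c) ≡ true
adm-admissible {n} (us , bs) a = true-ball _ (upto n) λ {m} _ → true-≤ᵇ
  (≤-trans (≤-reflexive (NN-wd m us bs)) (≤-trans (upTo-pend 0 us bs (≤-reflexive a) m) (≤-reflexive (+-identityʳ m))))

PhiInv-spec : ∀ n D {C} → C ∈ bfilter (λ C → admissibleCol n C ∧ eqCol (Phi C) D) (combos (alphabet n) (length D)) →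
  PhiInv n D ∈ bfilter (λ C → admissibleCol n C ∧ eqCol (Phi C) D) (combos (alphabet n) (length D))
PhiInv-spec n D m with bfilter (λ C → admissibleCol n C ∧ eqCol (Phi C) D) (combos (alphabet n) (length D))
... | C ∷ Cs = here refl

Φ-height : ∀ {n} (us bs : Bits n) → adm (us , bs) → height (uS 0 us bs , bS 0 us bs) ≡ height (us , bs)
Φ-height us bs a = cong₂ _+_ (trans (sym (+-identityʳ _)) (trans (cong (count (uS 0 us bs) +_) (sym a)) (count-uS us bs)))
  (trans (sym (+-identityʳ _)) (trans (cong (count (bS 0 us bs) +_) (sym a)) (count-bS us bs)))

module _ {n : ℕ} (S B : Bits n) (q : qend 0 S B ≡ 0) where
  private
    P : Column → Bool
    P C = admissibleCol n C ∧ eqCol (Phi C) (wd (S , B))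
    L = combos (alphabet n) (length (wd (S , B)))
    c = Φ⁻¹ 0 (B , S)

  adm-Φ⁻¹ : adm c
  adm-Φ⁻¹ = subst (λ z → pend z (uI 0 S B) (bI 0 S B) ≡ 0) q (pend-I 0 S B)

  uS-Φ⁻¹ : uS 0 (proj₁ c) (proj₂ c) ≡ S
  uS-Φ⁻¹ = subst (λ z → uS z (uI 0 S B) (bI 0 S B) ≡ S) q (uS-I 0 S B)

  bS-Φ⁻¹ : bS 0 (proj₁ c) (proj₂ c) ≡ B
  bS-Φ⁻¹ = subst (λ z → bS z (uI 0 S B) (bI 0 S B) ≡ B) q (bS-I 0 S B)

  private
    Phi-c : Phi (wd c) ≡ wd (S , B)
    Phi-c = trans (Phi-wd (proj₁ c) (proj₂ c) adm-Φ⁻¹) (cong₂ (λ s t → wd (s , t)) uS-Φ⁻¹ bS-Φ⁻¹)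

    len : length (wd c) ≡ length (wd (S , B))
    len = trans (length-wd c) (trans (sym (Φ-height (proj₁ c) (proj₂ c) adm-Φ⁻¹)) (trans (cong₂ (λ s t → height (s , t)) uS-Φ⁻¹ bS-Φ⁻¹) (sym (length-wd (S , B)))))

    c∈L : wd c ∈ L
    c∈L = subst (λ k → wd c ∈ combos (alphabet n) k) len (Sub-combos (subst (Sub (wd c)) (sym (alphabet-wd n)) (Sub-++ (Sub-uL 1 (proj₁ c)) (Sub-bL 1 (proj₂ c)))))

    Pc : P (wd c) ≡ true
    Pc rewrite adm-admissible c adm-Φ⁻¹ | Phi-c = eqCol-refl (wd (S , B))

  PhiInv-wd : PhiInv n (wd (S , B)) ≡ wd c
  PhiInv-wd with bfilter-sound P L (PhiInv-spec n (wd (S , B)) (bfilter-complete P L c∈L Pc))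
  ... | m , h with wd-Sub n (subst (Sub _) (alphabet-wd n) (combos-Sub (alphabet n) (length (wd (S , B))) m))
  ... | (us , bs) , e = trans e (cong wd same)
    where
    h' : P (wd (us , bs)) ≡ true
    h' = subst (λ C → P C ≡ true) e h
    a : adm (us , bs)
    a = admissible-adm (us , bs) (proj₁ (∧-true h'))
    Φ≡ : (uS 0 us bs , bS 0 us bs) ≡ (S , B)
    Φ≡ = wd-injective _ _ (trans (sym (Phi-wd us bs a)) (eqCol-≡ _ _ (proj₂ (∧-true h'))))
    same : (us , bs) ≡ c
    same = trans (sym (cong₂ _,_ (proj₁ (Φ⁻¹-Φ us bs a)) (proj₁ (proj₂ (Φ⁻¹-Φ us bs a))))) (cong (λ z → Φ⁻¹ 0 (proj₂ z , proj₁ z)) Φ≡)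

sorted-Sub : ∀ L → Sorted L → ∀ C → Sorted C → (∀ {x} → x ∈ C → x ∈ L) → Sub C L
sorted-Sub L sL [] sC h = Sub-[] L
sorted-Sub [] sL (x ∷ C) sC h with h (here refl)
... | ()
sorted-Sub (l ∷ L) (al ∷ sL) (x ∷ C) (ax ∷ sC) h with h (here refl)
... | here refl = keep (sorted-Sub L sL C sC λ m → strict (lookupAll ax m) (h (there m)))
  where
  strict : ∀ {y} → l ≺ y → y ∈ l ∷ L → y ∈ L
  strict p (here refl) = ⊥-elim (≺-irrefl p)
  strict p (there m) = m
... | there x∈L = skip (sorted-Sub L sL (x ∷ C) (ax ∷ sC) λ { (here refl) → x∈L ; (there m) → strict (≺-trans (lookupAll al x∈L) (lookupAll ax m)) (h (there m)) })
  where
  strict : ∀ {y} → l ≺ y → y ∈ l ∷ L → y ∈ L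
  strict p (here refl) = ⊥-elim (≺-irrefl p)
  strict p (there m) = m

∈-alphabet : ∀ n x → inAlph n x ≡ true → x ∈ alphabet n
∈-alphabet n (u k) h = ∈-++⁺ˡ (∈-map⁺ u (upto-∈ n (≤ᵇ-true (proj₁ (∧-true {1 Data.Nat.≤ᵇ k} h))) (≤ᵇ-true (proj₂ (∧-true {1 Data.Nat.≤ᵇ k} h)))))
∈-alphabet n (b k) h = ∈-++⁺ʳ (map u (upto n)) (∈-reverse (∈-map⁺ b (upto-∈ n (≤ᵇ-true (proj₁ (∧-true {1 Data.Nat.≤ᵇ k} h))) (≤ᵇ-true (proj₂ (∧-true {1 Data.Nat.≤ᵇ k} h))))))
  where
  ∈-reverse : ∀ {x : Letter} {xs} → x ∈ xs → x ∈ reverse xs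
  ∈-reverse m = ∈-resp-↭ (↭-sym (Data.List.Relation.Binary.Permutation.Propositional.Properties.↭-reverse _)) m

decode : ∀ n C → ball (inAlph n) C ≡ true → strictlyIncreasing C ≡ true → ∃ λ (c : Col n) → C ≡ wd c
decode n C h s = wd-Sub n (sorted-Sub _ (wd-sorted (full n , full n)) C (increasing-sorted C s)
  (λ {x} m → subst (x ∈_) (alphabet-wd n) (∈-alphabet n x (ball-true _ C h m))))

-- Crossings on words

firstFail : List Letter → List Letter → Maybe (ℕ × Letter)
firstFail R [] = nothing
firstFail [] (l ∷ L) = just (0 , l)
firstFail (r ∷ R) (l ∷ L) = if r ≤L l then mapM (λ z → suc (proj₁ z) , proj₂ z) (firstFail R L) else just (0 , l)

shiftBy : ℕ → Maybe (ℕ × Letter) → Maybe (ℕ × Letter)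
shiftBy m = mapM (λ z → m + proj₁ z , proj₂ z)

shiftBy-0 : ∀ m → shiftBy 0 m ≡ m
shiftBy-0 (just _) = refl
shiftBy-0 nothing = refl

shiftBy-+ : ∀ a c m → shiftBy a (shiftBy c m) ≡ shiftBy (a + c) m
shiftBy-+ a c (just (p , y)) = cong (λ z → just (z , y)) (sym (+-assoc a c p))
shiftBy-+ a c nothing = refl

firstFail-min : ∀ r R k L → All (r ≺_) L → firstFail (r ∷ R) (drop k L) ≡ shiftBy 1 (firstFail R (drop (suc k) L))
firstFail-min r R zero [] _ = refl
firstFail-min r R zero (l ∷ L) (p ∷ _) rewrite ≺-≤L p = refl
firstFail-min r R (suc k) [] _ = refl
firstFail-min r R (suc k) (l ∷ L) (_ ∷ a) = firstFail-min r R k L a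

firstFail-step : ∀ k x y l L R {k'} → All (l ≺_) L → step (opn k) x y ≡ opn k' →
  firstFail (opt y l ++ R) (drop k (opt x l ++ L)) ≡ shiftBy (bit y) (firstFail R (drop k' L))
firstFail-step zero true true l L R a refl rewrite ≤L-refl l = refl
firstFail-step (suc k) true true l L R a refl = firstFail-min l R k L a
firstFail-step k false false l L R a refl = sym (shiftBy-0 _)
firstFail-step zero true false l L R a ()
firstFail-step (suc k) true false l L R a refl = sym (shiftBy-0 _)
firstFail-step k false true l L R a refl = firstFail-min l R k L a

firstFail-stop : ∀ l L R → All (l ≺_) R → firstFail R (l ∷ L) ≡ just (0 , l)
firstFail-stop l L [] _ = refl
firstFail-stop l L (r ∷ R) (p ∷ _) rewrite ≻-≤L p = refl

-- The letter y moves from X to Y; it is preceded by i letters in X and by p letters in Y.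
record Hit (y : Letter) (i p : ℕ) (X X' Y Y' : List Letter) : Set where
  constructor hit
  field
    {A₂ B₂ A₁ B₁} : List Letter
    X≡ : X ≡ A₂ ++ y ∷ B₂
    X'≡ : X' ≡ A₂ ++ B₂
    Y≡ : Y ≡ A₁ ++ B₁
    Y'≡ : Y' ≡ A₁ ++ y ∷ B₁
    i≡ : length A₂ ≡ i
    p≡ : length A₁ ≡ p

Hit-prefix : ∀ {y i p X X' Y Y'} P Q → Hit y i p X X' Y Y' → Hit y (length P + i) (length Q + p) (P ++ X) (P ++ X') (Q ++ Y) (Q ++ Y')
Hit-prefix P Q (hit {A₂} {B₂} {A₁} {B₁} refl refl refl refl refl refl) =
  hit (sym (++-assoc P A₂ _)) (sym (++-assoc P A₂ _)) (sym (++-assoc Q A₁ _)) (sym (++-assoc Q A₁ _)) (length-++ P) (length-++ Q)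

Hit-suffix : ∀ {y i p X X' Y Y'} P Q → Hit y i p X X' Y Y' → Hit y i p (X ++ P) (X' ++ P) (Y ++ Q) (Y' ++ Q)
Hit-suffix P Q (hit {A₂} {B₂} {A₁} {B₁} refl refl refl refl e e') =
  hit (++-assoc A₂ _ P) (++-assoc A₂ _ P) (++-assoc A₁ _ Q) (++-assoc A₁ _ Q) e e'

Hit-resp : ∀ {y i i' p p' X X' Y Y'} → i ≡ i' → p ≡ p' → Hit y i p X X' Y Y' → Hit y i' p' X X' Y Y'
Hit-resp refl refl h = h

all-after-u : ∀ {n} j (s : Bits n) L → All (λ x → isBarred x ≡ true) L → All (u j ≺_) (uL (suc j) s ++ L)
all-after-u j s L h = All-++ (tabulateAll (λ m → go (∈-uL (suc j) s m))) (mapAll barred h)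
  where
  go : ∀ {x} {Q : ℕ → Set} → (∃ λ i → x ≡ u i × suc j ≤ i × Q i) → u j ≺ x
  go (i , refl , h , _) = u≺u h
  barred : ∀ {x} → isBarred x ≡ true → u j ≺ x
  barred {b _} _ = u≺b

firstFail-U-open : ∀ {n} k j (s t : Bits n) L R {k'} → All (λ x → isBarred x ≡ true) L → walkU (opn k) s t ≡ opn k' →
  firstFail (uL j t ++ R) (drop k (uL j s ++ L)) ≡ shiftBy (count t) (firstFail R (drop k' L))
firstFail-U-open k j [] [] L R a refl = sym (shiftBy-0 _)
firstFail-U-open k j (x ∷ s) (y ∷ t) L R {k'} a h with opn-walkU (step (opn k) x y) s t h
... | k₁ , e rewrite ++-assoc (opt y (u j)) (uL (suc j) t) R | ++-assoc (opt x (u j)) (uL (suc j) s) L =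
  trans (firstFail-step k x y (u j) (uL (suc j) s ++ L) (uL (suc j) t ++ R) (all-after-u j s L a) e)
    (trans (cong (shiftBy (bit y)) (firstFail-U-open k₁ (suc j) s t L R a (trans (cong (λ l → walkU l s t) (sym e)) h))) (shiftBy-+ (bit y) (count t) (firstFail R (drop k' L))))

firstFail-U-closed : ∀ {n} k j (s t : Bits n) L R → All (λ x → isBarred x ≡ true) L → All (λ x → isBarred x ≡ true) R → Closed (walkU (opn k) s t) →
  ∃ λ y → ∃ λ p → firstFail (uL j t ++ R) (drop k (uL j s ++ L)) ≡ just (p , u y) ×
    Hit (u y) (k + p) p (uL j s) (uL j (swapU₂ (opn k) s t)) (uL j t) (uL j (swapU₁ (opn k) s t)) ×
    Move (k + p) p s t (swapU₂ (opn k) s t) (swapU₁ (opn k) s t)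
firstFail-U-closed k j [] [] L R a a' ()
firstFail-U-closed k j (x ∷ s) (y ∷ t) L R a a' cl rewrite ++-assoc (opt y (u j)) (uL (suc j) t) R | ++-assoc (opt x (u j)) (uL (suc j) s) L
  with open? (step (opn k) x y)
... | inj₁ cl' with closing k x y cl'
...   | refl , refl , refl = j , 0 , firstFail-stop (u j) (uL (suc j) s ++ L) (uL (suc j) t ++ R) (all-after-u j t R a') ,
        hit {A₂ = []} {A₁ = []} refl (cong (uL (suc j)) (proj₁ (swapU-closed {l = clo 0} s t clo-closed))) refl (cong (λ z → u j ∷ uL (suc j) z) (proj₂ (swapU-closed {l = clo 0} s t clo-closed))) refl refl ,
        subst₂ (λ s' t' → Move 0 0 (true ∷ s) (false ∷ t) (false ∷ s') (true ∷ t')) (sym (proj₁ (swapU-closed {l = clo 0} s t clo-closed))) (sym (proj₂ (swapU-closed {l = clo 0} s t clo-closed))) here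
firstFail-U-closed k j (x ∷ s) (y ∷ t) L R a a' cl | inj₂ (k₁ , e)
  with firstFail-U-closed k₁ (suc j) s t L R a a' (subst (λ l → Closed (walkU l s t)) e cl)
... | y' , p , f , h , m =
  y' , bit y + p ,
  trans (firstFail-step k x y (u j) (uL (suc j) s ++ L) (uL (suc j) t ++ R) (all-after-u j s L a) e) (cong (shiftBy (bit y)) f) ,
  subst (λ z → Hit (u y') (k + (bit y + p)) (bit y + p) (opt x (u j) ++ uL (suc j) s) (opt (sw₂ (opn k) x y) (u j) ++ uL (suc j) (swapU₂ z s t))
                 (opt y (u j) ++ uL (suc j) t) (opt (sw₁ (opn k) x y) (u j) ++ uL (suc j) (swapU₁ z s t))) (sym e) main ,
  subst (λ z → Move (k + (bit y + p)) (bit y + p) (x ∷ s) (y ∷ t) (sw₂ (opn k) x y ∷ swapU₂ z s t) (sw₁ (opn k) x y ∷ swapU₁ z s t)) (sym e) moved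
  where
  r₁ : ∀ a c d → a + (c + d) ≡ (c + a) + d
  r₁ = solve-∀
  moved : Move (k + (bit y + p)) (bit y + p) (x ∷ s) (y ∷ t) (sw₂ (opn k) x y ∷ swapU₂ (opn k₁) s t) (sw₁ (opn k) x y ∷ swapU₁ (opn k₁) s t)
  moved rewrite proj₁ (sw-open (opn k) x y e) | proj₂ (sw-open (opn k) x y e) =
    Move-resp (trans (r₁ (bit x) k₁ p) (trans (cong (_+ p) (step-count k x y e)) (+-assoc k (bit y) p))) refl (there x y m)
  main : Hit (u y') (k + (bit y + p)) (bit y + p) (opt x (u j) ++ uL (suc j) s) (opt (sw₂ (opn k) x y) (u j) ++ uL (suc j) (swapU₂ (opn k₁) s t))
                 (opt y (u j) ++ uL (suc j) t) (opt (sw₁ (opn k) x y) (u j) ++ uL (suc j) (swapU₁ (opn k₁) s t))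
  main rewrite proj₁ (sw-open (opn k) x y e) | proj₂ (sw-open (opn k) x y e) =
    Hit-resp (trans (cong (_+ (k₁ + p)) (length-opt x (u j))) (trans (r₁ (bit x) k₁ p) (trans (cong (_+ p) (step-count k x y e)) (+-assoc k (bit y) p))))
             (cong (_+ p) (length-opt y (u j)))
      (Hit-prefix (opt x (u j)) (opt y (u j)) h)

After : ℕ → List Letter → Set
After j = All (λ x → ∃ λ i → x ≡ b i × i < j)

After-≺ : ∀ {j L} → After j L → All (b j ≺_) L
After-≺ = mapAll (λ { (i , refl , h) → b≺b h })

After-opt : ∀ j x {L} → After j L → After (suc j) (opt x (b j) ++ L)
After-opt j true a = (j , refl , ≤-refl) ∷ mapAll (λ { (i , e , h) → i , e , m≤n⇒m≤1+n h }) a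
After-opt j false a = mapAll (λ { (i , e , h) → i , e , m≤n⇒m≤1+n h }) a

firstFail-B-open : ∀ {n} k j (s t : Bits n) L R {k'} → After j L → walkB (opn k) s t ≡ opn k' →
  firstFail (bL j t ++ R) (drop k (bL j s ++ L)) ≡ shiftBy (count t) (firstFail R (drop k' L))
firstFail-B-open k j [] [] L R a refl = sym (shiftBy-0 _)
firstFail-B-open k j (x ∷ s) (y ∷ t) L R {k'} a h with opn-step (walkB (opn k) s t) x y h
... | k₁ , e rewrite ++-assoc (bL (suc j) t) (opt y (b j)) R | ++-assoc (bL (suc j) s) (opt x (b j)) L | e =
  trans (firstFail-B-open k (suc j) s t (opt x (b j) ++ L) (opt y (b j) ++ R) (After-opt j x a) e)
    (trans (cong (shiftBy (count t)) (firstFail-step k₁ x y (b j) L R (After-≺ a) h)) (trans (shiftBy-+ (count t) (bit y) (firstFail R (drop k' L))) (cong (λ z → shiftBy z (firstFail R (drop k' L))) (+-comm (count t) (bit y)))))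

firstFail-B-closed : ∀ {n} k j (s t : Bits n) L R → After j L → After j R → Closed (walkB (opn k) s t) →
  ∃ λ y → ∃ λ p → firstFail (bL j t ++ R) (drop k (bL j s ++ L)) ≡ just (p , b y) ×
    Hit (b y) (k + p) p (bL j s) (bL j (swapB₂ (opn k) s t)) (bL j t) (bL j (swapB₁ (opn k) s t)) ×
    MoveT (k + p) p s t (swapB₂ (opn k) s t) (swapB₁ (opn k) s t)
firstFail-B-closed k j [] [] L R a a' ()
firstFail-B-closed k j (x ∷ s) (y ∷ t) L R a a' cl rewrite ++-assoc (bL (suc j) t) (opt y (b j)) R | ++-assoc (bL (suc j) s) (opt x (b j)) L
  with open? (walkB (opn k) s t)
... | inj₁ cl' with firstFail-B-closed k (suc j) s t (opt x (b j) ++ L) (opt y (b j) ++ R) (After-opt j x a) (After-opt j y a') cl'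
...   | y' , p , f , h , m rewrite proj₁ (sw-closed x y cl') | proj₂ (sw-closed x y cl') = y' , p , f , Hit-suffix (opt x (b j)) (opt y (b j)) h , there x y m
firstFail-B-closed k j (x ∷ s) (y ∷ t) L R a a' cl | inj₂ (k₁ , e) with closing k₁ x y (subst (λ l → Closed (step l x y)) e cl)
... | refl , refl , refl rewrite e | proj₁ (walkB-open s t e) | proj₂ (walkB-open s t e) =
  j , count t ,
  trans (firstFail-B-open k (suc j) s t (b j ∷ L) R (After-opt j true a) e)
    (trans (cong (shiftBy (count t)) (firstFail-stop (b j) L R (After-≺ a'))) (cong (λ z → just (z , b j)) (+-identityʳ (count t)))) ,
  hit {A₂ = bL (suc j) s} {[]} {bL (suc j) t} {[]} refl refl refl refl (trans (length-bL (suc j) s) (walkB-count k s t e)) (length-bL (suc j) t) ,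
  subst (λ z → MoveT z (count t) (true ∷ s) (false ∷ t) (false ∷ s) (true ∷ t)) (walkB-count k s t e) here

barred-bL : ∀ {n} j (s : Bits n) → All (λ x → isBarred x ≡ true) (bL j s)
barred-bL j s = tabulateAll (λ m → go (∈-bL j s m))
  where
  go : ∀ {x} {Q : ℕ → Set} → (∃ λ i → x ≡ b i × Q i) → isBarred x ≡ true
  go (i , refl , _) = refl

lCols rCols : ∀ {n} → Col n → Col n
lCols (us , bs) = uS 0 us bs , bs
rCols (us , bs) = us , bS 0 us bs

firstFail-B : ∀ {n} k (s t : Bits n) → firstFail (bL 1 t) (drop k (bL 1 s)) ≡ firstFail (bL 1 t ++ []) (drop k (bL 1 s ++ []))
firstFail-B k s t rewrite ++-identityʳ (bL 1 s) | ++-identityʳ (bL 1 t) = refl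

nothing-drop : ∀ k m → shiftBy m (firstFail [] (drop k [])) ≡ nothing
nothing-drop zero m = refl
nothing-drop (suc k) m = refl

firstFail-open : ∀ {n} k (c₂ c₁ : Col n) {j} → walkZ k (c₂ , c₁) ≡ opn j → firstFail (wd (rCols c₁)) (drop k (wd (lCols c₂))) ≡ nothing
firstFail-open k (us₂ , bs₂) (us₁ , bs₁) {j} h with opn-walkB (walkU (opn k) (uS 0 us₂ bs₂) us₁) bs₂ (bS 0 us₁ bs₁) h
... | k' , e = trans (firstFail-U-open k 1 (uS 0 us₂ bs₂) us₁ (bL 1 bs₂) (bL 1 (bS 0 us₁ bs₁)) (barred-bL 1 bs₂) e)
  (cong (shiftBy (count us₁)) (trans (firstFail-B k' bs₂ (bS 0 us₁ bs₁))
    (trans (firstFail-B-open k' 1 bs₂ (bS 0 us₁ bs₁) [] [] [] (trans (cong (λ l → walkB l bs₂ (bS 0 us₁ bs₁)) (sym e)) h)) (nothing-drop j (count (bS 0 us₁ bs₁))))))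

data WordCross {n : ℕ} (k : ℕ) (c₂ c₁ c₂' c₁' : Col n) : Set where
  crossU : ∀ y p {S'} → firstFail (wd (rCols c₁)) (drop k (wd (lCols c₂))) ≡ just (p , u y) →
    Hit (u y) (k + p) p (uL 1 (uS 0 (proj₁ c₂) (proj₂ c₂))) (uL 1 S') (uL 1 (proj₁ c₁)) (uL 1 (proj₁ c₁')) →
    proj₂ c₁' ≡ proj₂ c₁ → qend 0 S' (bS 0 (proj₁ c₂) (proj₂ c₂)) ≡ 0 → c₂' ≡ Φ⁻¹ 0 (bS 0 (proj₁ c₂) (proj₂ c₂) , S') →
    WordCross k c₂ c₁ c₂' c₁'
  crossB : ∀ y p i q {B'} → firstFail (wd (rCols c₁)) (drop k (wd (lCols c₂))) ≡ just (p , b y) →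
    Hit (b y) i q (bL 1 (proj₂ c₂)) (bL 1 (proj₂ c₂')) (bL 1 (bS 0 (proj₁ c₁) (proj₂ c₁))) (bL 1 B') →
    count (proj₁ c₂) + i ≡ k + p → proj₁ c₂' ≡ proj₁ c₂ → qend 0 (uS 0 (proj₁ c₁) (proj₂ c₁)) B' ≡ 0 → c₁' ≡ Φ⁻¹ 0 (B' , uS 0 (proj₁ c₁) (proj₂ c₁)) →
    WordCross k c₂ c₁ c₂' c₁'

count-uS-adm : ∀ {n} (us bs : Bits n) → pend 0 us bs ≡ 0 → count (uS 0 us bs) ≡ count us
count-uS-adm us bs a = trans (sym (+-identityʳ _)) (trans (cong (count (uS 0 us bs) +_) (sym a)) (count-uS us bs))

record CrossData {n : ℕ} (k : ℕ) (c₂ c₁ c₂' c₁' : Col n) : Set where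
  field
    words : WordCross k c₂ c₁ c₂' c₁'
    sets : Crossing k (c₂ , c₁) (c₂' , c₁')
    {position} : ℕ
    {letter} : Letter
    failure : firstFail (wd (rCols c₁)) (drop k (wd (lCols c₂))) ≡ just (position , letter)
    index≡ : crossIndex sets ≡ k + position

crossData : ∀ {n} k (c₂ c₁ : Col n) → adm c₂ → adm c₁ → ∀ {g} → walkZ k (c₂ , c₁) ≡ clo g →
            CrossData k c₂ c₁ (proj₁ (cross k (c₂ , c₁))) (proj₂ (cross k (c₂ , c₁)))
crossData k c₂@(us₂ , bs₂) c₁@(us₁ , bs₁) a₂ a₁ h with crossBy k (c₂ , c₁) h
... | byU cl ce rewrite ce with firstFail-U-closed k 1 (uS 0 us₂ bs₂) us₁ (bL 1 bs₂) (bL 1 (bS 0 us₁ bs₁)) (barred-bL 1 bs₂) (barred-bL 1 (bS 0 us₁ bs₁)) cl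
...   | y , p , f , ht , m = record { words = crossU y p f ht refl q refl ; sets = viaU m q ; failure = f ; index≡ = refl }
  where
  q = proj₂ (drop-uI 0 (bS 0 us₂ bs₂) (Move-drop m) (proj₂ (proj₂ (Φ⁻¹-Φ us₂ bs₂ a₂))))
crossData k c₂@(us₂ , bs₂) c₁@(us₁ , bs₁) a₂ a₁ {g} h | byB k' wk ce rewrite ce
  with firstFail-B-closed k' 1 bs₂ (bS 0 us₁ bs₁) [] [] [] [] (subst Closed (trans (sym h) (cong (λ l → walkB l bs₂ (bS 0 us₁ bs₁)) wk)) clo-closed)
... | y , p , f , ht , m = record { words = crossB y (count us₁ + p) (k' + p) p failure ht position refl q refl ; sets = viaB m position q ; failure = failure ; index≡ = position }
  where
  failure : firstFail (wd (rCols c₁)) (drop k (wd (lCols c₂))) ≡ just (count us₁ + p , b y)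
  failure = trans (firstFail-U-open k 1 (uS 0 us₂ bs₂) us₁ (bL 1 bs₂) (bL 1 (bS 0 us₁ bs₁)) (barred-bL 1 bs₂) wk)
    (cong (shiftBy (count us₁)) (trans (firstFail-B k' bs₂ (bS 0 us₁ bs₁)) f))
  q = qend-insert 0 k us₂ bs₂ (uS 0 us₁ bs₁) (bS 0 us₁ bs₁) (trans (cong (walkU (opn k) (uS 0 us₂ bs₂)) (proj₁ (Φ⁻¹-Φ us₁ bs₁ a₁))) wk)
    (subst Closed (trans (sym h) (cong (λ l → walkB l bs₂ (bS 0 us₁ bs₁)) wk)) clo-closed) (proj₂ (proj₂ (Φ⁻¹-Φ us₁ bs₁ a₁)))
  position : count us₂ + (k' + p) ≡ k + (count us₁ + p)
  position = trans (cong (_+ (k' + p)) (sym (count-uS-adm us₂ bs₂ a₂))) (trans (r₁ (count (uS 0 us₂ bs₂)) k' p)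
    (trans (cong (_+ p) (walkU-count k (uS 0 us₂ bs₂) us₁ wk)) (+-assoc k (count us₁) p)))
    where
    r₁ : ∀ a c d → a + (c + d) ≡ (c + a) + d
    r₁ = solve-∀

Move-count : ∀ {n i j} {s t s' t' : Bits n} → Move i j s t s' t' → count s ≡ suc (count s') × count t' ≡ suc (count t)
Move-count here = refl , refl
Move-count (there x y m) with Move-count m
... | p , q = trans (cong (bit x +_) p) (+-suc (bit x) _) , trans (cong (bit y +_) q) (+-suc (bit y) _)

MoveT-count : ∀ {n i j} {s t s' t' : Bits n} → MoveT i j s t s' t' → count s ≡ suc (count s') × count t' ≡ suc (count t)
MoveT-count here = refl , refl
MoveT-count (there x y m) with MoveT-count m
... | p , q = trans (cong (bit x +_) p) (+-suc (bit x) _) , trans (cong (bit y +_) q) (+-suc (bit y) _)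

height-Φ⁻¹ : ∀ {n} (S B : Bits n) → qend 0 S B ≡ 0 → height (Φ⁻¹ 0 (B , S)) ≡ count S + count B
height-Φ⁻¹ S B q = trans (sym (Φ-height (uI 0 S B) (bI 0 S B) (adm-Φ⁻¹ S B q))) (cong₂ (λ s t → count s + count t) (uS-Φ⁻¹ S B q) (bS-Φ⁻¹ S B q))

crossing-height : ∀ {n k} {c₂ c₁ c₂' c₁' : Col n} → adm c₂ → adm c₁ → Crossing k (c₂ , c₁) (c₂' , c₁') →
  height c₂ ≡ suc (height c₂') × height c₁' ≡ suc (height c₁)
crossing-height a₂ a₁ (viaU {us₂} {bs₂} {us₁} {bs₁} {S'} m q) with Move-count m
... | p , p' = trans (sym (Φ-height us₂ bs₂ a₂)) (trans (cong (_+ count (bS 0 us₂ bs₂)) p) (cong suc (sym (height-Φ⁻¹ S' _ q)))) , cong (_+ count bs₁) p'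
crossing-height a₂ a₁ (viaB {us₂} {bs₂} {us₁} {bs₁} {bs₂'} {B₁'} m e q) with MoveT-count m
... | p , p' = trans (cong (count us₂ +_) p) (+-suc (count us₂) (count bs₂')) ,
  trans (height-Φ⁻¹ (uS 0 us₁ bs₁) B₁' q) (trans (cong (count (uS 0 us₁ bs₁) +_) p') (trans (+-suc (count (uS 0 us₁ bs₁)) _) (cong suc (Φ-height us₁ bs₁ a₁))))

lookup-pre : {A : Set} (pre : List A) {x : A} {post : List A} → lookupM (pre ++ x ∷ post) (length pre) ≡ just x
lookup-pre [] = refl
lookup-pre (y ∷ pre) = lookup-pre pre

lookup-post : {A : Set} (pre : List A) {x : A} {post : List A} → lookupM (pre ++ x ∷ post) (suc (length pre)) ≡ headM post
lookup-post [] {post = []} = refl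
lookup-post [] {post = _ ∷ _} = refl
lookup-post (y ∷ pre) = lookup-post pre

setAt-pre : {A : Set} (pre : List A) {x z : A} {post : List A} → setAt (length pre) z (pre ++ x ∷ post) ≡ pre ++ z ∷ post
setAt-pre [] = refl
setAt-pre (y ∷ pre) = cong (y ∷_) (setAt-pre pre)

setAt-post : {A : Set} (pre : List A) {x y z : A} {post : List A} → setAt (suc (length pre)) z (pre ++ x ∷ y ∷ post) ≡ pre ++ x ∷ z ∷ post
setAt-post [] = refl
setAt-post (y ∷ pre) = cong (y ∷_) (setAt-post pre)

cells : ℕ → List Letter → List Cell
cells p C = insertAt p nothing (map just C)

letters-just : ∀ C → letters (map just C) ≡ C
letters-just [] = refl
letters-just (x ∷ C) = cong (x ∷_) (letters-just C)

letters-cells : ∀ p C → letters (cells p C) ≡ C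
letters-cells zero C = letters-just C
letters-cells (suc p) [] = refl
letters-cells (suc p) (x ∷ C) = cong (x ∷_) (letters-cells p C)

punct-cells : ∀ p C → p ≤ length C → punctPos (cells p C) ≡ p
punct-cells zero C h = refl
punct-cells (suc p) (x ∷ C) (s≤s h) = cong suc (punct-cells p C h)

fill-cells : ∀ y A B → fillPuncture y (cells (length A) (A ++ B)) ≡ map just (A ++ y ∷ B)
fill-cells y [] B = refl
fill-cells y (x ∷ A) B = cong (just x ∷_) (fill-cells y A B)

setAt-cells : ∀ y A B → setAt (length A) nothing (map just (A ++ y ∷ B)) ≡ cells (length A) (A ++ B)
setAt-cells y [] B = refl
setAt-cells y (x ∷ A) B = cong (just x ∷_) (setAt-cells y A B)

below* : ℕ → ℕ → State → Maybe Letter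
below* o p post = headM post >>= λ oc → entryAt (proj₁ oc) (lCol (letters (proj₂ oc))) (o + suc p)

module _ (n : ℕ) (pre : State) (o p : ℕ) (C : List Letter) (le : p ≤ length C) where

  step-done : ∀ post → lookupM (lCol C) p ≡ nothing → below* o p post ≡ nothing →
    sjdtStep n (pre ++ (o , cells p C) ∷ post) (length pre) ≡ done
  step-done post hl hb rewrite lookup-pre pre {o , cells p C} {post} | letters-cells p C | punct-cells p C le
    | lookup-post pre {o , cells p C} {post} | hl | hb = refl

  step-down : ∀ post {a a'} → lookupM (lCol C) p ≡ just a → lookupM (rCol C) p ≡ just a' →
    (∀ {y} → below* o p post ≡ just y → (a' ≤L y) ≡ true) →
    sjdtStep n (pre ++ (o , cells p C) ∷ post) (length pre) ≡ next (pre ++ (o , cells (suc p) C) ∷ post) (length pre)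
  step-down post hl hr hb with below* o p post in e
  ... | nothing rewrite lookup-pre pre {o , cells p C} {post} | letters-cells p C | punct-cells p C le
    | lookup-post pre {o , cells p C} {post} | hl | hr | e = cong (λ z → next z (length pre)) (setAt-pre pre)
  ... | just y rewrite lookup-pre pre {o , cells p C} {post} | letters-cells p C | punct-cells p C le
    | lookup-post pre {o , cells p C} {post} | hl | hr | e | hb refl = cong (λ z → next z (length pre)) (setAt-pre pre)

  data Stop : Letter → Set where
    bottom : ∀ {y} → lookupM (lCol C) p ≡ nothing → lookupM (rCol C) p ≡ nothing → Stop y
    larger : ∀ {y a a'} → lookupM (lCol C) p ≡ just a → lookupM (rCol C) p ≡ just a' → (a' ≤L y) ≡ false → Stop y

  step-right-u : ∀ o₂ cs₂ post v → Stop (u v) → below* o p ((o₂ , cs₂) ∷ post) ≡ just (u v) →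
    sjdtStep n (pre ++ (o , cells p C) ∷ (o₂ , cs₂) ∷ post) (length pre) ≡
    next (pre ++ (o , fillPuncture (u v) (cells p C)) ∷
           (o₂ , insertAt (posOf (u v) (Phi (letters cs₂))) nothing (map just (PhiInv n (removeL (u v) (Phi (letters cs₂)))))) ∷ post) (suc (length pre))
  step-right-u o₂ cs₂ post v (bottom hl hr) hb rewrite lookup-pre pre {o , cells p C} {(o₂ , cs₂) ∷ post} | letters-cells p C | punct-cells p C le
    | lookup-post pre {o , cells p C} {(o₂ , cs₂) ∷ post} | hl | hr | hb | setAt-pre pre {o , cells p C} {o , fillPuncture (u v) (cells p C)} {(o₂ , cs₂) ∷ post} =
    cong (λ z → next z (suc (length pre))) (setAt-post pre)
  step-right-u o₂ cs₂ post v (larger hl hr hc) hb rewrite lookup-pre pre {o , cells p C} {(o₂ , cs₂) ∷ post} | letters-cells p C | punct-cells p C le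
    | lookup-post pre {o , cells p C} {(o₂ , cs₂) ∷ post} | hl | hr | hb | hc | setAt-pre pre {o , cells p C} {o , fillPuncture (u v) (cells p C)} {(o₂ , cs₂) ∷ post} =
    cong (λ z → next z (suc (length pre))) (setAt-post pre)

  step-right-b : ∀ o₂ cs₂ post v → Stop (b v) → below* o p ((o₂ , cs₂) ∷ post) ≡ just (b v) →
    sjdtStep n (pre ++ (o , cells p C) ∷ (o₂ , cs₂) ∷ post) (length pre) ≡
    next (pre ++ (o , map just (PhiInv n (insertL (b v) (Phi C)))) ∷
           (o₂ , setAt (posOf (b v) (letters cs₂)) nothing (map just (letters cs₂))) ∷ post) (suc (length pre))
  step-right-b o₂ cs₂ post v (bottom hl hr) hb rewrite lookup-pre pre {o , cells p C} {(o₂ , cs₂) ∷ post} | letters-cells p C | punct-cells p C le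
    | lookup-post pre {o , cells p C} {(o₂ , cs₂) ∷ post} | hl | hr | hb | setAt-pre pre {o , cells p C} {o , map just (PhiInv n (insertL (b v) (Phi C)))} {(o₂ , cs₂) ∷ post} =
    cong (λ z → next z (suc (length pre))) (setAt-post pre)
  step-right-b o₂ cs₂ post v (larger hl hr hc) hb rewrite lookup-pre pre {o , cells p C} {(o₂ , cs₂) ∷ post} | letters-cells p C | punct-cells p C le
    | lookup-post pre {o , cells p C} {(o₂ , cs₂) ∷ post} | hl | hr | hb | hc | setAt-pre pre {o , cells p C} {o , map just (PhiInv n (insertL (b v) (Phi C)))} {(o₂ , cs₂) ∷ post} =
    cong (λ z → next z (suc (length pre))) (setAt-post pre)

mapM-just⁻ : ∀ {A B : Set} {g : A → B} (m : Maybe A) {z} → mapM g m ≡ just z → ∃ λ a → m ≡ just a × g a ≡ z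
mapM-just⁻ (just a) refl = a , refl , refl

mapM-nothing⁻ : ∀ {A B : Set} {g : A → B} (m : Maybe A) → mapM g m ≡ nothing → m ≡ nothing
mapM-nothing⁻ nothing h = refl

Below : List Letter → List Letter → ℕ → Set
Below R L s = ∃ λ r → ∃ λ l → lookupM R s ≡ just r × lookupM L s ≡ just l × (r ≤L l) ≡ true

firstFail-before : ∀ R L {q y s} → firstFail R L ≡ just (q , y) → s < q → Below R L s
firstFail-before [] (l ∷ L) refl ()
firstFail-before (r ∷ R) (l ∷ L) h lt with r ≤L l in e
firstFail-before (r ∷ R) (l ∷ L) refl () | false
firstFail-before (r ∷ R) (l ∷ L) {s = zero} h lt | true = r , l , refl , refl , e
firstFail-before (r ∷ R) (l ∷ L) {s = suc s} h lt | true with mapM-just⁻ (firstFail R L) h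
... | (q , y) , e' , refl = firstFail-before R L e' (s≤s⁻¹ lt)

firstFail-at : ∀ R L {q y} → firstFail R L ≡ just (q , y) →
  lookupM L q ≡ just y × (lookupM R q ≡ nothing ⊎ ∃ λ r → lookupM R q ≡ just r × (r ≤L y) ≡ false)
firstFail-at [] (l ∷ L) refl = refl , inj₁ refl
firstFail-at (r ∷ R) (l ∷ L) h with r ≤L l in e
firstFail-at (r ∷ R) (l ∷ L) refl | false = refl , inj₂ (r , refl , e)
firstFail-at (r ∷ R) (l ∷ L) h | true with mapM-just⁻ (firstFail R L) h
... | (q , y) , e' , refl = firstFail-at R L e'

firstFail-none : ∀ R L {s l} → firstFail R L ≡ nothing → lookupM L s ≡ just l → ∃ λ r → lookupM R s ≡ just r × (r ≤L l) ≡ true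
firstFail-none (r ∷ R) (l ∷ L) h hl with r ≤L l in e
firstFail-none (r ∷ R) (l ∷ L) () hl | false
firstFail-none (r ∷ R) (l ∷ L) {zero} h refl | true = r , refl , e
firstFail-none (r ∷ R) (l ∷ L) {suc s} h hl | true = firstFail-none R L (mapM-nothing⁻ (firstFail R L) h) hl

lookup-drop : {A : Set} (k : ℕ) (L : List A) (s : ℕ) → lookupM (drop k L) s ≡ lookupM L (k + s)
lookup-drop zero L s = refl
lookup-drop (suc k) [] s = refl
lookup-drop (suc k) (x ∷ L) s = lookup-drop k L s

lookup-just : {A : Set} (L : List A) {p : ℕ} → p < length L → ∃ λ x → lookupM L p ≡ just x
lookup-just (x ∷ L) {zero} h = x , refl
lookup-just (x ∷ L) {suc p} (s≤s h) = lookup-just L h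

lookup-nothing : {A : Set} (L : List A) {p : ℕ} → length L ≤ p → lookupM L p ≡ nothing
lookup-nothing [] h = refl
lookup-nothing (x ∷ L) {suc p} (s≤s h) = lookup-nothing L h

lookup-< : {A : Set} (L : List A) {p : ℕ} {x : A} → lookupM L p ≡ just x → p < length L
lookup-< (y ∷ L) {zero} h = s≤s z≤n
lookup-< (y ∷ L) {suc p} h = s≤s (lookup-< L h)

lookup-prefix : {A : Set} (P Q Q' : List A) {s : ℕ} → s < length P → lookupM (P ++ Q) s ≡ lookupM (P ++ Q') s
lookup-prefix (x ∷ P) Q Q' {zero} h = refl
lookup-prefix (x ∷ P) Q Q' {suc s} (s≤s h) = lookup-prefix P Q Q' h

data Removed (j : ℕ) (X X' : List Letter) : Set where
  removed : ∀ A {y B} → X ≡ A ++ y ∷ B → X' ≡ A ++ B → length A ≡ j → Removed j X X'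

Drop-uL : ∀ {n j} base {s s' : Bits n} → Drop j s s' → Removed j (uL base s) (uL base s')
Drop-uL base here = removed [] refl refl refl
Drop-uL base (there x d) with Drop-uL (suc base) d
... | removed A {y} {B} e e' h rewrite e | e' = removed (opt x (u base) ++ A) (sym (++-assoc (opt x (u base)) A (y ∷ B))) (sym (++-assoc (opt x (u base)) A B))
  (trans (length-++ (opt x (u base))) (cong₂ _+_ (length-opt x (u base)) h))

DropT-bL : ∀ {n j} base {s s' : Bits n} → DropT j s s' → Removed j (bL base s) (bL base s')
DropT-bL base {true ∷ s} here = removed (bL (suc base) s) {b base} {[]} refl refl (length-bL (suc base) s)
DropT-bL base (there x d) with DropT-bL (suc base) d
... | removed A {y} {B} e e' h rewrite e | e' = removed A (++-assoc A (y ∷ B) (opt x (b base))) (++-assoc A B (opt x (b base))) h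

rdrop-prefix : ∀ {n i s} {c c' : Col n} → RDrop i c c' → s < i → lookupM (wd (rCols c')) s ≡ lookupM (wd (rCols c)) s
rdrop-prefix {c = us , bs} {us' , bs'} (rdropU {j = j} d le e) lt with Drop-uL 1 d
... | removed A {y} {B} e₁ e₂ h rewrite e₁ | e₂ | e | ++-assoc A (y ∷ B) (bL 1 (bS 0 us bs)) | ++-assoc A B (bL 1 (bS 0 us bs)) =
  lookup-prefix A _ _ (≤-trans lt (≤-trans le (≤-reflexive (sym h))))
rdrop-prefix {c = us , bs} {_ , bs'} (rdropB {j = j} d le) lt with DropT-bL 1 d
... | removed A {y} {B} e₁ e₂ h rewrite e₁ | e₂ | sym (++-assoc (uL 1 us) A (y ∷ B)) | sym (++-assoc (uL 1 us) A B) =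
  lookup-prefix (uL 1 us ++ A) _ _ (≤-trans lt (≤-trans le (≤-reflexive (sym (trans (length-++ (uL 1 us)) (cong₂ _+_ (length-uL 1 us) h))))))

Sorted-before : ∀ P {x Q} → Sorted (P ++ x ∷ Q) → All (_≺ x) P
Sorted-before [] s = []
Sorted-before (p ∷ P) (a ∷ s) = lookupAll a (∈-++⁺ʳ P (here refl)) ∷ Sorted-before P s

fixBit-u : ∀ q x → fixBit (just q) x false ≡ x
fixBit-u zero true = refl
fixBit-u zero false = refl
fixBit-u (suc q) true = refl
fixBit-u (suc q) false = refl

fixBit-b : ∀ q y → fixBit (just q) false y ≡ false
fixBit-b zero y = refl
fixBit-b (suc q) y = refl

Fix-none : ∀ {n} q (us bs : Bits n) → pend 0 us bs ≤ q → fixU (just q) us bs ≡ us × fixB (just q) us bs ≡ bs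
Fix-none q [] [] h = refl , refl
Fix-none (suc q) (true ∷ us) (true ∷ bs) (s≤s h) with Fix-none q us bs h
... | e , e' = cong (true ∷_) e , cong (true ∷_) e'
Fix-none q (true ∷ us) (false ∷ bs) h with Fix-none q us bs h
... | e , e' = cong₂ _∷_ (fixBit-u q true) e , cong₂ _∷_ (fixBit-b q true) e'
Fix-none q (false ∷ us) (true ∷ bs) h with Fix-none q us bs h
... | e , e' = cong₂ _∷_ (fixBit-b q true) e , cong₂ _∷_ (fixBit-u q true) e'
Fix-none q (false ∷ us) (false ∷ bs) h with Fix-none (suc q) us bs (pred-≤ h)
... | e , e' = cong₂ _∷_ (fixBit-u q false) e , cong₂ _∷_ (fixBit-u q false) e'

fixed-adm : ∀ {n} (c : Col n) → adm c → fixed c ≡ c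
fixed-adm (us , bs) a with Fix-none 0 us bs (≤-reflexive a)
... | e , e' = cong₂ _,_ e e'

data Deleted (z : Letter) (X X' : List Letter) : Set where
  deleted : ∀ A {B} → X ≡ A ++ z ∷ B → X' ≡ A ++ B → Deleted z X X'

Deleted-prefix : ∀ {z X X'} P → Deleted z X X' → Deleted z (P ++ X) (P ++ X')
Deleted-prefix P (deleted A refl refl) = deleted (P ++ A) (sym (++-assoc P A _)) (sym (++-assoc P A _))

Deleted-suffix : ∀ {z X X'} P → Deleted z X X' → Deleted z (X ++ P) (X' ++ P)
Deleted-suffix P (deleted A {B} refl refl) = deleted A (++-assoc A _ P) (++-assoc A B P)

record Found {n : ℕ} (j q : ℕ) (us bs : Bits n) : Set where
  field
    i : ℕ
    i<n : i < n
    u-del : Deleted (u (j + i)) (uL j us) (uL j (fixU (just q) us bs))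
    b-del : Deleted (b (j + i)) (bL j bs) (bL j (fixB (just q) us bs))
    balance : upTo (suc i) us + upTo (suc i) bs ≡ suc (suc i) + q
    before : ∀ i' → i' < i → upTo (suc i') us + upTo (suc i') bs ≤ suc i' + q

transport : ∀ {n j q q'} x y x' y' (us bs us' bs' : Bits n) →
  fixU (just q') us bs ≡ us' → fixB (just q') us bs ≡ bs' → x ≡ x' → y ≡ y' → bit x + bit y + q' ≡ suc q →
  (F : Found (suc j) q' us bs) → (bit x + bit y ≤ suc q) →
  fixU (just q) (x ∷ us) (y ∷ bs) ≡ x' ∷ us' → fixB (just q) (x ∷ us) (y ∷ bs) ≡ y' ∷ bs' → Found j q (x ∷ us) (y ∷ bs)
transport {n} {j} {q} {q'} x y x' y' us bs us' bs' e e' refl refl h F le r r' = record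
  { i = suc F.i
  ; i<n = s≤s F.i<n
  ; u-del = subst (λ z → Deleted (u (j + suc F.i)) (opt x (u j) ++ uL (suc j) us) (uL j z)) (sym (trans r (cong (x ∷_) (sym e))))
      (Deleted-prefix (opt x (u j)) (subst (λ k → Deleted (u k) (uL (suc j) us) (uL (suc j) (fixU (just q') us bs))) (sym (+-suc j F.i)) F.u-del))
  ; b-del = subst (λ z → Deleted (b (j + suc F.i)) (bL (suc j) bs ++ opt y (b j)) (bL j z)) (sym (trans r' (cong (y ∷_) (sym e'))))
      (Deleted-suffix (opt y (b j)) (subst (λ k → Deleted (b k) (bL (suc j) bs) (bL (suc j) (fixB (just q') us bs))) (sym (+-suc j F.i)) F.b-del))
  ; balance = trans (+-interchange (bit x) (upTo (suc F.i) us) (bit y) (upTo (suc F.i) bs))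
      (trans (cong (bit x + bit y +_) F.balance) (trans (r₁ (bit x + bit y) (suc (suc F.i)) q') (trans (cong (suc (suc F.i) +_) h) (+-suc (suc (suc F.i)) q))))
  ; before = bf
  }
  where
  module F = Found F
  r₁ : ∀ a c d → a + (c + d) ≡ c + (a + d)
  r₁ = solve-∀
  bf : ∀ i' → i' < suc F.i → upTo (suc i') (x ∷ us) + upTo (suc i') (y ∷ bs) ≤ suc i' + q
  bf zero lt = ≤-trans (≤-reflexive (cong₂ _+_ (+-identityʳ (bit x)) (+-identityʳ (bit y)))) le
  bf (suc i') lt = ≤-trans (≤-reflexive (+-interchange (bit x) (upTo (suc i') us) (bit y) (upTo (suc i') bs)))
    (≤-trans (+-monoʳ-≤ (bit x + bit y) (F.before i' (s≤s⁻¹ lt)))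
      (≤-reflexive (trans (r₁ (bit x + bit y) (suc i') q') (trans (cong (suc i' +_) h) (+-suc (suc i') q)))))

Fix-found : ∀ {n} j q (us bs : Bits n) → pend 0 us bs ≡ suc q → Found j q us bs
Fix-found j q [] [] ()
Fix-found j zero (true ∷ us) (true ∷ bs) h = record
  { i = 0 ; i<n = s≤s z≤n
  ; u-del = subst (λ k → Deleted (u k) (u j ∷ uL (suc j) us) (uL (suc j) (fixU nothing us bs))) (sym (+-identityʳ j))
      (deleted [] refl (cong (uL (suc j)) (cong proj₁ (Fix-nothing us bs))))
  ; b-del = subst (λ k → Deleted (b k) (bL (suc j) bs ++ b j ∷ []) (bL (suc j) (fixB nothing us bs) ++ [])) (sym (+-identityʳ j))
      (deleted (bL (suc j) bs) refl (cong (λ z → bL (suc j) z ++ []) (cong proj₂ (Fix-nothing us bs))))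
  ; balance = refl ; before = λ _ () }
Fix-found j (suc q) (true ∷ us) (true ∷ bs) h =
  transport true true true true us bs _ _ refl refl refl refl refl (Fix-found (suc j) q us bs (suc-injective h)) (s≤s (s≤s z≤n)) refl refl
Fix-found j q (true ∷ us) (false ∷ bs) h =
  transport true false true false us bs _ _ refl refl refl refl refl (Fix-found (suc j) q us bs h) (s≤s z≤n)
    (cong (_∷ fixU (just q) us bs) (fixBit-u q true)) (cong (_∷ fixB (just q) us bs) (fixBit-b q true))
Fix-found j q (false ∷ us) (true ∷ bs) h =
  transport false true false true us bs _ _ refl refl refl refl refl (Fix-found (suc j) q us bs h) (s≤s z≤n)
    (cong (_∷ fixU (just q) us bs) (fixBit-b q true)) (cong (_∷ fixB (just q) us bs) (fixBit-u q true))
Fix-found j q (false ∷ us) (false ∷ bs) h with pend 0 us bs in e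
... | suc p = transport false false false false us bs _ _ refl refl refl refl refl (Fix-found (suc j) (suc q) us bs (trans e (cong suc h))) z≤n
    (cong (_∷ fixU (just (suc q)) us bs) (fixBit-u q false)) (cong (_∷ fixB (just (suc q)) us bs) (fixBit-u q false))

headM-upto : ∀ P M z → 1 ≤ z → z ≤ M → P z ≡ true → (∀ z' → 1 ≤ z' → z' < z → P z' ≡ false) → headM (bfilter P (upto M)) ≡ just z
headM-upto P zero z h le pz bz = ⊥-elim (<⇒≱ h le)
headM-upto P (suc M) z h le pz bz rewrite bfilter-++ P (upto M) (suc M ∷ []) with m≤n⇒m<n∨m≡n le
... | inj₁ lt = head-++ (headM-upto P M z h (s≤s⁻¹ lt) pz bz)
  where
  head-++ : ∀ {xs ys : List ℕ} → headM xs ≡ just z → headM (xs ++ ys) ≡ just z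
  head-++ {x ∷ xs} e = e
... | inj₂ refl rewrite bfilter-none P (upto M) (λ m → bz _ (proj₁ (∈-upto M m)) (s≤s (proj₂ (∈-upto M m)))) | pz = refl

bad : Column → ℕ → Bool
bad C z = memL (u z) C ∧ memL (b z) C ∧ (NN C z ≡ᵇ suc z)

module _ {n : ℕ} (o : ℕ) (us bs : Bits n) where
  private C = wd (us , bs)

  not-bad : ∀ z → NN C z ≤ z → bad C z ≡ false
  not-bad z h with memL (u z) C
  ... | false = refl
  ... | true with memL (b z) C
  ...   | false = refl
  ...   | true = ≢-≡ᵇ _ _ (<⇒≢ (s≤s h))

  smallest-adm : adm (us , bs) → smallestBadZ C ≡ nothing
  smallest-adm a = cong headM (bfilter-none (bad C) (upto (maxIdx C)) λ {z} _ →
    not-bad z (≤-trans (≤-reflexive (NN-wd z us bs)) (≤-trans (upTo-pend 0 us bs (≤-reflexive a) z) (≤-reflexive (+-identityʳ z)))))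

  fixColumn-adm : adm (us , bs) → proj₂ (fixColumn (o , C)) ≡ C
  fixColumn-adm a with memL (u 0) (lCol C) | smallestBadZ C | smallest-adm a
  ... | true | .nothing | refl = refl
  ... | false | .nothing | refl = refl

  fixColumn-pair : ∀ {z} → memL (u 0) (lCol C) ≡ true → smallestBadZ C ≡ just z → proj₂ (fixColumn (o , C)) ≡ removeL (b z) (removeL (u z) C)
  fixColumn-pair h h' with memL (u 0) (lCol C) | smallestBadZ C
  fixColumn-pair refl refl | .true | .(just _) = refl

  module _ (h : pend 0 us bs ≡ 1) where
    private
      F = Fix-found 1 0 us bs h
      open Found F
      z = suc i
      delete : ∀ A {B} A' {B'} → uL 1 us ≡ A ++ u z ∷ B → bL 1 bs ≡ A' ++ b z ∷ B' → removeL (b z) (removeL (u z) C) ≡ (A ++ B) ++ (A' ++ B')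
      delete A {B} A' {B'} e e' = trans (cong (λ x → removeL (b z) (removeL (u z) x)) C≡)
        (trans (cong (removeL (b z)) (removeL-++ A (B ++ (A' ++ b z ∷ B')) (Sorted-before A (subst Sorted C≡ (wd-sorted (us , bs))))))
          (trans (cong (removeL (b z)) shape) (trans (removeL-++ (A ++ (B ++ A')) B' small) (trans (++-assoc A (B ++ A') B') (trans (cong (A ++_) (++-assoc B A' B')) (sym (++-assoc A B _)))))))
        where
        C≡ : C ≡ A ++ u z ∷ (B ++ (A' ++ b z ∷ B'))
        C≡ = trans (cong₂ _++_ e e') (++-assoc A (u z ∷ B) _)
        shape : A ++ (B ++ (A' ++ b z ∷ B')) ≡ (A ++ (B ++ A')) ++ b z ∷ B'
        shape = trans (cong (A ++_) (sym (++-assoc B A' _))) (sym (++-assoc A (B ++ A') _))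
        big : All (_≺ b z) (A ++ u z ∷ (B ++ A'))
        big = Sorted-before (A ++ u z ∷ (B ++ A')) (subst Sorted (trans C≡ (trans (cong (λ x → A ++ u z ∷ x) (sym (++-assoc B A' _))) (sym (++-assoc A (u z ∷ (B ++ A')) _)))) (wd-sorted (us , bs)))
        small : All (_≺ b z) (A ++ (B ++ A'))
        small = tabulateAll λ m → lookupAll big (widen (∈-++⁻ A m))
          where
          widen : ∀ {x} → x ∈ A ⊎ x ∈ B ++ A' → x ∈ A ++ u z ∷ (B ++ A')
          widen (inj₁ m) = ∈-++⁺ˡ m
          widen (inj₂ m) = ∈-++⁺ʳ A (there m)

      uz∈ : u z ∈ C
      uz∈ with u-del
      ... | deleted A e _ = subst (λ x → u z ∈ x ++ bL 1 bs) (sym e) (∈-++⁺ˡ (∈-++⁺ʳ A (here refl)))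
      bz∈ : b z ∈ C
      bz∈ with b-del
      ... | deleted A e _ = subst (λ x → b z ∈ uL 1 us ++ x) (sym e) (∈-++⁺ʳ (uL 1 us) (∈-++⁺ʳ A (here refl)))

      bad-z : bad C z ≡ true
      bad-z rewrite ∈-memL uz∈ | ∈-memL bz∈ | NN-wd z us bs | balance | +-identityʳ i = ≡ᵇ-refl i

      smallest : smallestBadZ C ≡ just z
      smallest = headM-upto (bad C) (maxIdx C) z (s≤s z≤n) (∈-maxIdx uz∈) bad-z λ { (suc z') _ lt → not-bad (suc z')
        (≤-trans (≤-reflexive (NN-wd (suc z') us bs)) (≤-trans (before z' (s≤s⁻¹ lt)) (≤-reflexive (+-identityʳ (suc z'))))) }

    fixColumn-fixed : proj₂ (fixColumn (o , C)) ≡ wd (fixed (us , bs))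
    fixColumn-fixed with u-del | b-del
    ... | deleted A {B} e e₁ | deleted A' {B'} e' e₁' = trans (fixColumn-pair (a₁∈lCol us bs h) smallest)
      (trans (delete A {B} A' {B'} e e') (sym (cong₂ _++_ e₁ e₁')))

fixColumn-wd : ∀ {n} o (c : Col n) → Pend 0 c ≤ 1 → proj₂ (fixColumn (o , wd c)) ≡ wd (fixed c)
fixColumn-wd o c@(us , bs) h with pend 0 us bs in e
... | zero = trans (fixColumn-adm o us bs e) (cong wd (sym (fixed-adm c e)))
... | suc zero = fixColumn-fixed o us bs e
fixColumn-wd o c (s≤s ()) | suc (suc _)

-- The sliding algorithm

columns : ∀ {n} m → Tab n m → List Column
columns zero tt = []
columns (suc m) (t , c) = wd c ∷ columns m t

restCells : ∀ {n m} → Vec ℕ m → Tab n m → State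
restCells [] tt = []
restCells (g ∷ gs) (t , c) = (g , map just (wd c)) ∷ restCells gs t

finish : State → List Column
finish st = map (λ oc → proj₂ (fixColumn oc)) (removePuncture st)

finish-++ : ∀ st st' → finish (st ++ st') ≡ finish st ++ finish st'
finish-++ st st' = trans (cong (map _) (map-++ _ st st')) (map-++ _ (removePuncture st) (removePuncture st'))

Desc : ∀ {m} → ℕ → Vec ℕ m → Set
Desc o [] = ⊤
Desc o (g ∷ gs) = g ≤ o × Desc g gs

Fit : ∀ {n m} → Vec ℕ m → Tab n m → Set
Fit [] tt = ⊤
Fit {n} (g ∷ gs) (t , c) = g + height c ≤ n × Fit gs t

-- The puncture is not below the row in which the crossing takes place.
Above : ∀ {n m} → ℕ → ℕ → Vec ℕ m → Tab n m → Col n → Set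
Above p o [] t c₁ = ⊤
Above p o (g ∷ gs) (t , c₂) c₁ = ∀ {q y} → firstFail (wd (rCols c₁)) (drop (o ∸ g) (wd (lCols c₂))) ≡ just (q , y) → p ≤ q

finish-col : ∀ {n} o (c : Col n) → Pend 0 c ≤ 1 → finish ((o , map just (wd c)) ∷ []) ≡ wd (fixed c) ∷ []
finish-col o c h rewrite letters-just (wd c) = cong (_∷ []) (fixColumn-wd o c h)

finish-adm : ∀ {n} o p (c : Col n) → adm c → proj₂ (fixColumn (o , letters (cells p (wd c)))) ≡ wd c
finish-adm o p c a rewrite letters-cells p (wd c) = fixColumn-adm o (proj₁ c) (proj₂ c) a

finish-rest : ∀ {n m} g (gs : Vec ℕ m) (t : Tab n (suc m)) → Good g gs t → finish (restCells (g ∷ gs) t) ≡ columns (suc m) t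
finish-rest g [] (tt , c) a rewrite letters-just (wd c) = cong (_∷ []) (fixColumn-adm g (proj₁ c) (proj₂ c) a)
finish-rest g (g' ∷ gs) ((t , c₂) , c) (a , _ , G) = cong₂ _∷_ head (finish-rest g' gs (t , c₂) G)
  where
  head : proj₂ (fixColumn (g , letters (map just (wd c)))) ≡ wd c
  head rewrite letters-just (wd c) = fixColumn-adm g (proj₁ c) (proj₂ c) a

below*-rest : ∀ {n m} o p g (gs : Vec ℕ m) (t : Tab n m) (c₂ : Col n) → adm c₂ → g ≤ o →
  below* o p (restCells (g ∷ gs) (t , c₂)) ≡ lookupM (wd (lCols c₂)) ((o ∸ g) + p)
below*-rest o p g gs t c₂ a le rewrite letters-just (wd c₂) | lCol-wd (proj₁ c₂) (proj₂ c₂) a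
  | <-<ᵇ (≤-trans (s≤s le) (≤-trans (s≤s (m≤m+n o p)) (≤-reflexive (sym (+-suc o p))))) | +-suc o p | +-∸-comm p le = refl

wd-l-length : ∀ {n} (c : Col n) → adm c → length (wd (lCols c)) ≡ height c
wd-l-length (us , bs) a = trans (length-wd (lCols (us , bs))) (cong (_+ count bs) (count-uS-adm us bs a))

wd-r-length : ∀ {n} (c : Col n) → adm c → length (wd (rCols c)) ≡ height c
wd-r-length (us , bs) a = trans (length-wd (rCols (us , bs))) (cong (count us +_) (trans (sym (+-identityʳ _)) (trans (cong (count (bS 0 us bs) +_) (sym a)) (count-bS us bs))))

length-∷ʳ : {A : Set} (xs : List A) (x : A) → length (xs ++ x ∷ []) ≡ suc (length xs)
length-∷ʳ xs x = trans (length-++ xs) (+-comm (length xs) 1)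

module _ {n : ℕ} where
  module Column₁ (pre : State) (o p : ℕ) (c₁ : Col n) (a₁ : adm c₁) (le : p ≤ height c₁) where
    le' : p ≤ length (wd c₁)
    le' = ≤-trans le (≤-reflexive (sym (length-wd c₁)))
    l≡ : lCol (wd c₁) ≡ wd (lCols c₁)
    l≡ = lCol-wd (proj₁ c₁) (proj₂ c₁) a₁
    r≡ : rCol (wd c₁) ≡ wd (rCols c₁)
    r≡ = rCol-wd (proj₁ c₁) (proj₂ c₁) a₁
    l-just : p < height c₁ → ∃ λ x → lookupM (lCol (wd c₁)) p ≡ just x
    l-just h rewrite l≡ = lookup-just (wd (lCols c₁)) (≤-trans h (≤-reflexive (sym (wd-l-length c₁ a₁))))
    r-just : p < height c₁ → ∃ λ x → lookupM (rCol (wd c₁)) p ≡ just x × lookupM (wd (rCols c₁)) p ≡ just x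
    r-just h rewrite r≡ with lookup-just (wd (rCols c₁)) (≤-trans h (≤-reflexive (sym (wd-r-length c₁ a₁))))
    ... | x , e = x , e , e
    l-nothing : height c₁ ≤ p → lookupM (lCol (wd c₁)) p ≡ nothing
    l-nothing h rewrite l≡ = lookup-nothing (wd (lCols c₁)) (≤-trans (≤-reflexive (wd-l-length c₁ a₁)) h)
    r-nothing : height c₁ ≤ p → lookupM (rCol (wd c₁)) p ≡ nothing
    r-nothing h rewrite r≡ = lookup-nothing (wd (rCols c₁)) (≤-trans (≤-reflexive (wd-r-length c₁ a₁)) h)

    down : ∀ post → p < height c₁ → (∀ {y r} → below* o p post ≡ just y → lookupM (wd (rCols c₁)) p ≡ just r → (r ≤L y) ≡ true) →
      sjdtStep n (pre ++ (o , cells p (wd c₁)) ∷ post) (length pre) ≡ next (pre ++ (o , cells (suc p) (wd c₁)) ∷ post) (length pre)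
    down post h hb = step-down n pre o p (wd c₁) le' post (proj₂ (l-just h)) (proj₁ (proj₂ (r-just h))) (λ e → hb e (proj₂ (proj₂ (r-just h))))

    stuck : ∀ post → height c₁ ≤ p → below* o p post ≡ nothing → sjdtStep n (pre ++ (o , cells p (wd c₁)) ∷ post) (length pre) ≡ done
    stuck post h hb = step-done n pre o p (wd c₁) le' post (l-nothing h) hb

    stop : ∀ {y} → (lookupM (wd (rCols c₁)) p ≡ nothing ⊎ ∃ λ r → lookupM (wd (rCols c₁)) p ≡ just r × (r ≤L y) ≡ false) → Stop n pre o p (wd c₁) le' y
    stop (inj₁ e) with <-≤-connex p (height c₁)
    ... | inj₂ h = bottom (l-nothing h) (r-nothing h)
    ... | inj₁ h with r-just h
    ...   | x , _ , e' with trans (sym e) e'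
    ...   | ()
    stop (inj₂ (r , e , f)) = larger (proj₂ (l-just lt)) (trans (cong (λ z → lookupM z p) r≡) e) f
      where
      lt : p < height c₁
      lt = ≤-trans (lookup-< (wd (rCols c₁)) e) (≤-reflexive (wd-r-length c₁ a₁))

  run-step : ∀ fuel st j {st' j'} → sjdtStep n st j ≡ next st' j' → sjdtRun n (suc fuel) st j ≡ sjdtRun n fuel st' j'
  run-step fuel st j h rewrite h = refl

  run-done : ∀ fuel st j → sjdtStep n st j ≡ done → sjdtRun n (suc fuel) st j ≡ removePuncture st
  run-done fuel st j h rewrite h = refl

  crossed : ∀ {k} pre o p g (post : State) (c₂ c₁ c₂' c₁' : Col n) (a₂ : adm c₂) (a₁ : adm c₁) (le : p ≤ height c₁) →
    (x : WordCross k c₂ c₁ c₂' c₁') →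
    (∀ {y} → firstFail (wd (rCols c₁)) (drop k (wd (lCols c₂))) ≡ just (p , y) → Stop n pre o p (wd c₁) (Column₁.le' pre o p c₁ a₁ le) y × below* o p ((g , map just (wd c₂)) ∷ post) ≡ just y) →
    (∃ λ y → firstFail (wd (rCols c₁)) (drop k (wd (lCols c₂))) ≡ just (p , y)) →
    sjdtStep n (pre ++ (o , cells p (wd c₁)) ∷ (g , map just (wd c₂)) ∷ post) (length pre) ≡
      next (pre ++ (o , map just (wd c₁')) ∷ (g , cells (k + p) (wd c₂')) ∷ post) (suc (length pre)) × k + p ≤ height c₂'
  crossed {k} pre o p g post c₂@(us₂ , bs₂) c₁@(us₁ , bs₁) c₂' c₁'@(us₁' , .bs₁) a₂ a₁ le (crossU y p' {S'} f h refl q refl) hyp (y' , f')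
    with trans (sym f) f'
  ... | refl with hyp f
  ... | st , bl with h
  ... | hit {A₂} {B₂} {A₁} {B₁} X≡ X'≡ Y≡ Y'≡ i≡ p≡ = trans (step-right-u n pre o p (wd c₁) _ g (map just (wd c₂)) post y st bl)
      (cong₂ (λ z w → next (pre ++ (o , z) ∷ (g , w) ∷ post) (suc (length pre))) left right) , bound
    where
    B = bS 0 us₂ bs₂
    S = uS 0 us₂ bs₂
    left : fillPuncture (u y) (cells p (wd c₁)) ≡ map just (uL 1 us₁' ++ bL 1 bs₁)
    left = trans (cong₂ (λ q C → fillPuncture (u y) (cells q C)) (sym p≡) (trans (cong (_++ bL 1 bs₁) Y≡) (++-assoc A₁ B₁ (bL 1 bs₁))))
      (trans (fill-cells (u y) A₁ (B₁ ++ bL 1 bs₁)) (cong (map just) (trans (sym (++-assoc A₁ (u y ∷ B₁) (bL 1 bs₁))) (cong (_++ bL 1 bs₁) (sym Y'≡)))))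
    Phi≡ : Phi (letters (map just (wd c₂))) ≡ A₂ ++ u y ∷ (B₂ ++ bL 1 B)
    Phi≡ = trans (cong Phi (letters-just (wd c₂))) (trans (Phi-wd us₂ bs₂ a₂) (trans (cong (_++ bL 1 B) X≡) (++-assoc A₂ (u y ∷ B₂) (bL 1 B))))
    small : All (_≺ u y) A₂
    small = Sorted-before A₂ (subst Sorted X≡ (uL-sorted 1 S))
    wd' : A₂ ++ (B₂ ++ bL 1 B) ≡ wd (S' , B)
    wd' = trans (sym (++-assoc A₂ B₂ (bL 1 B))) (cong (_++ bL 1 B) (sym X'≡))
    right : insertAt (posOf (u y) (Phi (letters (map just (wd c₂))))) nothing (map just (PhiInv n (removeL (u y) (Phi (letters (map just (wd c₂))))))) ≡
            cells (k + p) (wd (Φ⁻¹ 0 (B , S')))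
    right = cong₂ (λ z w → insertAt z nothing (map just w)) (trans (cong (posOf (u y)) Phi≡) (trans (posOf-++ A₂ _ small) i≡))
      (trans (cong (λ z → PhiInv n (removeL (u y) z)) Phi≡) (trans (cong (PhiInv n) (trans (removeL-++ A₂ _ small) wd')) (PhiInv-wd S' B q)))
    bound : k + p ≤ height (Φ⁻¹ 0 (B , S'))
    bound = ≤-trans (≤-reflexive (sym i≡)) (≤-trans (≤-trans (m≤m+n (length A₂) (length (B₂ ++ bL 1 B))) (≤-reflexive (sym (length-++ A₂))))
      (≤-reflexive (trans (cong length wd') (trans (length-wd (S' , B)) (sym (height-Φ⁻¹ S' B q))))))
  crossed {k} pre o p g post c₂@(us₂ , bs₂) c₁@(us₁ , bs₁) c₂'@(.us₂ , bs₂') c₁' a₂ a₁ le (crossB y p' i q' {B'} f h e refl q refl) hyp (y' , f')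
    with trans (sym f) f'
  ... | refl with hyp f
  ... | st , bl with h
  ... | hit {A₂} {B₂} {A₁} {B₁} X≡ X'≡ Y≡ Y'≡ i≡ p≡ = trans (step-right-b n pre o p (wd c₁) _ g (map just (wd c₂)) post y st bl)
      (cong₂ (λ z w → next (pre ++ (o , z) ∷ (g , w) ∷ post) (suc (length pre))) left right) , bound
    where
    B = bS 0 us₁ bs₁
    S = uS 0 us₁ bs₁
    position : length (uL 1 us₂ ++ A₂) ≡ k + p
    position = trans (length-++ (uL 1 us₂)) (trans (cong₂ _+_ (length-uL 1 us₂) i≡) e)
    sortedA₁ : Sorted ((uL 1 S ++ A₁) ++ b y ∷ B₁)
    sortedA₁ = subst Sorted (trans (cong (uL 1 S ++_) Y'≡) (sym (++-assoc (uL 1 S) A₁ (b y ∷ B₁)))) (wd-sorted (S , B'))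
    left : map just (PhiInv n (insertL (b y) (Phi (wd c₁)))) ≡ map just (wd (Φ⁻¹ 0 (B' , S)))
    left = cong (map just) (trans (cong (λ z → PhiInv n (insertL (b y) z)) (trans (Phi-wd us₁ bs₁ a₁) (trans (cong (uL 1 S ++_) Y≡) (sym (++-assoc (uL 1 S) A₁ B₁)))))
      (trans (cong (PhiInv n) (trans (insertL-++ (uL 1 S ++ A₁) B₁ (Sorted-before (uL 1 S ++ A₁) sortedA₁) (first (Sorted-tail (uL 1 S ++ A₁) sortedA₁)))
        (trans (++-assoc (uL 1 S) A₁ (b y ∷ B₁)) (cong (uL 1 S ++_) (sym Y'≡))))) (PhiInv-wd S B' q)))
      where
      first : ∀ {x xs} → Sorted (x ∷ xs) → All (x ≺_) xs
      first (a ∷ _) = a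
    c₂≡ : wd c₂ ≡ (uL 1 us₂ ++ A₂) ++ b y ∷ B₂
    c₂≡ = trans (cong (uL 1 us₂ ++_) X≡) (sym (++-assoc (uL 1 us₂) A₂ (b y ∷ B₂)))
    c₂'≡ : wd c₂' ≡ (uL 1 us₂ ++ A₂) ++ B₂
    c₂'≡ = trans (cong (uL 1 us₂ ++_) X'≡) (sym (++-assoc (uL 1 us₂) A₂ B₂))
    right : setAt (posOf (b y) (letters (map just (wd c₂)))) nothing (map just (letters (map just (wd c₂)))) ≡ cells (k + p) (wd c₂')
    right = trans (cong (λ C → setAt (posOf (b y) C) nothing (map just C)) (trans (letters-just (wd c₂)) c₂≡))
      (trans (cong (λ z → setAt z nothing (map just ((uL 1 us₂ ++ A₂) ++ b y ∷ B₂))) (posOf-++ (uL 1 us₂ ++ A₂) B₂ (Sorted-before (uL 1 us₂ ++ A₂) (subst Sorted c₂≡ (wd-sorted c₂)))))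
        (trans (setAt-cells (b y) (uL 1 us₂ ++ A₂) B₂) (cong₂ cells position (sym c₂'≡))))
    bound : k + p ≤ height c₂'
    bound = ≤-trans (≤-reflexive (sym position)) (≤-trans (≤-trans (m≤m+n _ (length B₂)) (≤-reflexive (sym (length-++ (uL 1 us₂ ++ A₂))))) (≤-reflexive (trans (cong length (sym c₂'≡)) (length-wd c₂'))))

fuel-down : ∀ n q m fuel → q < n → (n ∸ q) + m < suc fuel → (n ∸ suc q) + m < fuel
fuel-down (suc n) zero m fuel lt h = s≤s⁻¹ h
fuel-down (suc n) (suc q) m fuel (s≤s lt) h = fuel-down n q m fuel lt h

adm-first : ∀ {n m} o (gs : Vec ℕ m) (t : Tab n m) c₁ → Punctured o gs (t , c₁) → adm c₁
adm-first o [] t c₁ P = P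
adm-first o (g ∷ gs) (t , c₂) c₁ P = proj₁ P

module _ {n : ℕ} where
  finish-stuck : ∀ {m} pre o p (gs : Vec ℕ m) (t : Tab n m) c₁ → Punctured o gs (t , c₁) →
    finish (pre ++ (o , cells p (wd c₁)) ∷ restCells gs t) ≡ finish pre ++ columns (suc m) (t , c₁)
  finish-stuck pre o p [] tt c₁ a = trans (finish-++ pre _) (cong (λ z → finish pre ++ z ∷ []) (finish-adm o p c₁ a))
  finish-stuck pre o p (g ∷ gs) (t , c₂) c₁ (a , _ , G) =
    trans (finish-++ pre _) (cong (finish pre ++_) (cong₂ _∷_ (finish-adm o p c₁ a) (finish-rest g gs (t , c₂) G)))

  run-open : ∀ {m} o g (gs : Vec ℕ m) (t : Tab n m) c₂ c₁ {j} → walkZ (o ∸ g) (c₂ , c₁) ≡ opn j → run o (g ∷ gs) ((t , c₂) , c₁) ≡ ((t , c₂) , c₁)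
  run-open o g gs t c₂ c₁ h rewrite h = refl

  run-clo : ∀ {m} o g (gs : Vec ℕ m) (t : Tab n m) c₂ c₁ {j} → walkZ (o ∸ g) (c₂ , c₁) ≡ clo j →
    run o (g ∷ gs) ((t , c₂) , c₁) ≡ (run g gs (t , proj₁ (cross (o ∸ g) (c₂ , c₁))) , fixed (proj₂ (cross (o ∸ g) (c₂ , c₁))))
  run-clo o g gs t c₂ c₁ h rewrite h = refl

  above-next : ∀ {m} g (gs : Vec ℕ m) (t : Tab n m) (c₂ c₂' : Col n) i → Good g gs (t , c₂) → RDrop i c₂ c₂' → Above i g gs t c₂'
  above-next g [] t c₂ c₂' i G r = tt
  above-next g (g' ∷ gs) (t , c₃) c₂ c₂' i (_ , (k , wz) , _) r {q} {y} f with <-≤-connex q i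
  ... | inj₂ le = le
  ... | inj₁ lt with firstFail-at (wd (rCols c₂')) (drop (g ∸ g') (wd (lCols c₃))) f
  ...   | hl , rest with firstFail-none (wd (rCols c₂)) (drop (g ∸ g') (wd (lCols c₃))) (firstFail-open (g ∸ g') c₃ c₂ wz) hl
  ...     | r' , e , le with trans (rdrop-prefix r lt) e
  ...       | e' with rest
  ...         | inj₁ no with trans (sym no) e'
  ...           | ()
  above-next g (g' ∷ gs) (t , c₃) c₂ c₂' i (_ , (k , wz) , _) r {q} {y} f | inj₁ lt | hl , rest | r' , e , le | e' | inj₂ (r'' , e'' , big) with trans (sym e'') e'
  ... | refl with trans (sym big) le
  ... | ()

  run-correct : ∀ {m} fuel pre o (gs : Vec ℕ m) (t : Tab n m) c₁ p → Punctured o gs (t , c₁) → Desc o gs → Fit gs t →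
    o + height c₁ ≤ n → p ≤ height c₁ → Above p o gs t c₁ → (n ∸ (o + p)) + m < fuel →
    map (λ oc → proj₂ (fixColumn oc)) (sjdtRun n fuel (pre ++ (o , cells p (wd c₁)) ∷ restCells gs t) (length pre)) ≡
    finish pre ++ columns (suc m) (run o gs (t , c₁))
  run-correct {m} (suc fuel) pre o gs t c₁ p P D F fit le A lt = go gs t P D F A lt
    where
    a₁ = adm-first o gs t c₁ P
    open Column₁ pre o p c₁ a₁ le
    bounded : p < height c₁ → suc (o + p) ≤ n
    bounded h = ≤-trans (≤-trans (≤-reflexive (sym (+-suc o p))) (+-monoʳ-≤ o h)) fit

    descend : ∀ {m} (gs : Vec ℕ m) (t : Tab n m) → Punctured o gs (t , c₁) → Desc o gs → Fit gs t → p < height c₁ → Above (suc p) o gs t c₁ →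
      (n ∸ (o + p)) + m < suc fuel →
      (∀ {y r} → below* o p (restCells gs t) ≡ just y → lookupM (wd (rCols c₁)) p ≡ just r → (r ≤L y) ≡ true) →
      map (λ oc → proj₂ (fixColumn oc)) (sjdtRun n (suc fuel) (pre ++ (o , cells p (wd c₁)) ∷ restCells gs t) (length pre)) ≡
      finish pre ++ columns (suc m) (run o gs (t , c₁))
    descend {m} gs t P D F h A lt hb = trans (cong (map (λ oc → proj₂ (fixColumn oc))) (run-step fuel (pre ++ (o , cells p (wd c₁)) ∷ restCells gs t) (length pre) (down (restCells gs t) h hb)))
      (run-correct fuel pre o gs t c₁ (suc p) P D F fit h A (subst (λ z → n ∸ z + m < fuel) (sym (+-suc o p)) (fuel-down n (o + p) m fuel (bounded h) lt)))

    halt : ∀ {m} (gs : Vec ℕ m) (t : Tab n m) → Punctured o gs (t , c₁) → height c₁ ≤ p → below* o p (restCells gs t) ≡ nothing →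
      run o gs (t , c₁) ≡ (t , c₁) →
      map (λ oc → proj₂ (fixColumn oc)) (sjdtRun n (suc fuel) (pre ++ (o , cells p (wd c₁)) ∷ restCells gs t) (length pre)) ≡
      finish pre ++ columns (suc m) (run o gs (t , c₁))
    halt gs t P h hb r = trans (cong (map (λ oc → proj₂ (fixColumn oc))) (run-done fuel (pre ++ (o , cells p (wd c₁)) ∷ restCells gs t) (length pre) (stuck (restCells gs t) h hb)))
      (trans (finish-stuck pre o p gs t c₁ P) (cong (λ z → finish pre ++ columns _ z) (sym r)))

    go : ∀ {m} (gs : Vec ℕ m) (t : Tab n m) → Punctured o gs (t , c₁) → Desc o gs → Fit gs t → Above p o gs t c₁ → (n ∸ (o + p)) + m < suc fuel →
      map (λ oc → proj₂ (fixColumn oc)) (sjdtRun n (suc fuel) (pre ++ (o , cells p (wd c₁)) ∷ restCells gs t) (length pre)) ≡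
      finish pre ++ columns (suc m) (run o gs (t , c₁))
    go [] tt P D F A lt with <-≤-connex p (height c₁)
    ... | inj₁ h = descend [] tt P D F h tt lt λ ()
    ... | inj₂ h = halt [] tt P h refl refl
    go {suc m} (g ∷ gs) (t , c₂) P@(_ , lv , G) D@(g≤o , D') F@(fit₂ , F') A lt = byWalk (walkZ (o ∸ g) (c₂ , c₁)) refl
      where
      a₂ = Good-adm gs G
      L = wd (lCols c₂)
      R = wd (rCols c₁)
      look : below* o p (restCells (g ∷ gs) (t , c₂)) ≡ lookupM (drop (o ∸ g) L) p
      look = trans (below*-rest o p g gs t c₂ a₂ g≤o) (sym (lookup-drop (o ∸ g) L p))
      Goal : Set
      Goal = map (λ oc → proj₂ (fixColumn oc)) (sjdtRun n (suc fuel) (pre ++ (o , cells p (wd c₁)) ∷ restCells (g ∷ gs) (t , c₂)) (length pre)) ≡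
        finish pre ++ columns (suc (suc m)) (run o (g ∷ gs) ((t , c₂) , c₁))
      same : ∀ {x y : Letter} {m : Maybe Letter} → m ≡ just x → m ≡ just y → x ≡ y
      same refl refl = refl
      byWalk : ∀ l → walkZ (o ∸ g) (c₂ , c₁) ≡ l → Goal
      byWalk over h with trans (sym lv) (cong live h)
      ... | ()
      byWalk (opn j) h with <-≤-connex p (height c₁)
      ... | inj₁ lt' = descend (g ∷ gs) (t , c₂) P D F lt' (λ f → clash (trans (sym noFail) f)) lt
          (λ e e' → let (r , er , rl) = firstFail-none R (drop (o ∸ g) L) noFail (trans (sym look) e) in subst (λ z → (z ≤L _) ≡ true) (same er e') rl)
        where
        noFail = firstFail-open (o ∸ g) c₂ c₁ h
        clash : ∀ {q : ℕ × Letter} {A : Set} → nothing ≡ just q → A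
        clash ()
      ... | inj₂ ge = halt (g ∷ gs) (t , c₂) P ge empty (run-open o g gs t c₂ c₁ h)
        where
        noFail = firstFail-open (o ∸ g) c₂ c₁ h
        empty : below* o p (restCells (g ∷ gs) (t , c₂)) ≡ nothing
        empty with lookupM (drop (o ∸ g) L) p in e
        ... | nothing = trans look e
        ... | just y with firstFail-none R (drop (o ∸ g) L) noFail e
        ...   | r , er , _ = ⊥-elim (<⇒≱ (≤-trans (lookup-< R er) (≤-reflexive (wd-r-length c₁ a₁))) ge)
      byWalk (clo j) h with m≤n⇒m<n∨m≡n (A (CrossData.failure (crossData (o ∸ g) c₂ c₁ a₂ a₁ h)))
      ... | inj₁ before = descend (g ∷ gs) (t , c₂) P D F lt' (λ f → subst (suc p ≤_) (cong proj₁ (just-injective (trans (sym failure) f))) before) lt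
          (λ e e' → let (r , l , er , el , rl) = firstFail-before R (drop (o ∸ g) L) failure before
                    in subst₂ (λ z w → (z ≤L w) ≡ true) (same er e') (same el (trans (sym look) e)) rl)
        where
        open CrossData (crossData (o ∸ g) c₂ c₁ a₂ a₁ h)
        lt' : p < height c₁
        lt' with firstFail-before R (drop (o ∸ g) L) failure before
        ... | r , l , er , _ = ≤-trans (lookup-< R er) (≤-reflexive (wd-r-length c₁ a₁))
      ... | inj₂ pe = trans (cong (map (λ oc → proj₂ (fixColumn oc))) (run-step fuel (pre ++ (o , cells p (wd c₁)) ∷ restCells (g ∷ gs) (t , c₂)) (length pre) (proj₁ moved)))
          (trans (trans (cong₂ (λ s q → map (λ oc → proj₂ (fixColumn oc)) (sjdtRun n fuel s q)) (sym (++-assoc pre ((o , map just (wd c₁')) ∷ []) _)) (sym (length-∷ʳ pre (o , map just (wd c₁')))))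
              (run-correct fuel (pre ++ (o , map just (wd c₁')) ∷ []) g gs t c₂' ((o ∸ g) + p) P' D' F' fit' (proj₂ moved) above fuel'))
            (trans (cong (_++ columns (suc m) (run g gs (t , c₂'))) (trans (finish-++ pre _) (cong (finish pre ++_) (finish-col o c₁' p≤1))))
              (trans (++-assoc (finish pre) (wd (fixed c₁') ∷ []) _) (cong (λ z → finish pre ++ columns (suc (suc m)) z) (sym (run-clo o g gs t c₂ c₁ h))))))
        where
        open CrossData (crossData (o ∸ g) c₂ c₁ a₂ a₁ h)
        c₂' = proj₁ (cross (o ∸ g) (c₂ , c₁))
        c₁' = proj₂ (cross (o ∸ g) (c₂ , c₁))
        failure' : firstFail R (drop (o ∸ g) L) ≡ just (p , letter)
        failure' = subst (λ z → firstFail R (drop (o ∸ g) L) ≡ just (z , letter)) (sym pe) failure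
        moved = crossed pre o p g (restCells gs t) c₂ c₁ c₂' c₁' a₂ a₁ le words
          (λ f → stop (proj₂ (firstFail-at R (drop (o ∸ g) L) f)) , trans look (proj₁ (firstFail-at R (drop (o ∸ g) L) f))) (letter , failure')
        N = cross-next o g gs t c₂ c₁ a₁ G h
        P' = proj₁ N
        p≤1 = proj₂ N
        fit' : g + height c₂' ≤ n
        fit' = ≤-trans (+-monoʳ-≤ g (≤-trans (n≤1+n (height c₂')) (≤-reflexive (sym (proj₁ (crossing-height a₂ a₁ sets)))))) fit₂
        above : Above ((o ∸ g) + p) g gs t c₂'
        above = subst (λ z → Above z g gs t c₂') (trans index≡ (cong ((o ∸ g) +_) (sym pe))) (above-next g gs t c₂ c₂' (crossIndex sets) G (proj₂ (crossing-rdrop a₂ sets)))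
        fuel' : (n ∸ (g + ((o ∸ g) + p))) + m < fuel
        fuel' = subst (λ z → (n ∸ z) + m < fuel) (trans (cong (_+ p) (sym (m+[n∸m]≡n g≤o))) (+-assoc g (o ∸ g) p))
          (s≤s⁻¹ (≤-trans (≤-reflexive (cong suc (sym (+-suc (n ∸ (o + p)) m)))) lt))

columns-word : ∀ {n} m (t : Tab n m) → reading (columns m t) ≡ tabWord m t
columns-word zero tt = refl
columns-word (suc m) (t , c) = trans (cong concat (unfold-reverse (wd c) (columns m t)))
  (trans (sym (concat-++ (reverse (columns m t)) (wd c ∷ []))) (cong₂ _++_ (columns-word m t) (++-identityʳ (wd c))))

chunks-++ : ∀ as bs x y → sum as ≡ length x → chunks (as ++ bs) (x ++ y) ≡ chunks as x ++ chunks bs y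
chunks-++ [] bs [] y e = refl
chunks-++ (a ∷ as) bs x y e = cong₂ _∷_ (take-++ a x (≤-trans (m≤m+n a (sum as)) (≤-reflexive e)))
  (trans (cong (chunks (as ++ bs)) (drop-++ a x (≤-trans (m≤m+n a (sum as)) (≤-reflexive e))))
    (chunks-++ as bs (drop a x) y (trans (sym (m+n∸m≡n a (sum as))) (trans (cong (_∸ a) e) (sym (Data.List.Properties.length-drop a x))))))
  where
  take-++ : ∀ a (x : Word) → a ≤ length x → take a (x ++ y) ≡ take a x
  take-++ zero x h = refl
  take-++ (suc a) (z ∷ x) (s≤s h) = cong (z ∷_) (take-++ a x h)
  drop-++ : ∀ a (x : Word) → a ≤ length x → drop a (x ++ y) ≡ drop a x ++ y
  drop-++ zero x h = refl
  drop-++ (suc a) (z ∷ x) (s≤s h) = drop-++ a x h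

sum-∷ʳ : ∀ xs y → sum (xs ++ y ∷ []) ≡ sum xs + y
sum-∷ʳ [] y = +-identityʳ y
sum-∷ʳ (x ∷ xs) y = trans (cong (x +_) (sum-∷ʳ xs y)) (sym (+-assoc x (sum xs) y))

heights-sum : ∀ {n} m (t : Tab n m) → sum (reverse (toList (heights t))) ≡ length (tabWord m t)
heights-sum zero tt = refl
heights-sum (suc m) (t , c) rewrite unfold-reverse (height c) (toList (heights t)) = trans (sum-∷ʳ (reverse (toList (heights t))) (height c))
  (trans (cong₂ _+_ (heights-sum m t) (sym (length-wd c))) (sym (length-++ (tabWord m t))))

take-all : ∀ (x : Word) a → length x ≡ a → take a x ≡ x
take-all [] zero e = refl
take-all (z ∷ x) (suc a) e = cong (z ∷_) (take-all x a (suc-injective e))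

chunks-columns : ∀ {n} m (t : Tab n m) → chunks (reverse (toList (heights t))) (tabWord m t) ≡ reverse (columns m t)
chunks-columns zero tt = refl
chunks-columns (suc m) (t , c) rewrite unfold-reverse (height c) (toList (heights t)) | unfold-reverse (wd c) (columns m t) =
  trans (chunks-++ (reverse (toList (heights t))) (height c ∷ []) (tabWord m t) (wd c) (heights-sum m t))
    (cong₂ (λ x y → x ++ y ∷ []) (chunks-columns m t) (take-all (wd c) (height c) (length-wd c)))

tableauOf-word : ∀ {n} lam mu m (t : Tab n m) → toList (heights t) ≡ zipWith _∸_ (colHeights n lam) (offsets n lam mu) → tableauOf n lam mu (tabWord m t) ≡ columns m t
tableauOf-word lam mu m t e rewrite sym e = trans (cong reverse (chunks-columns m t)) (reverse-involutive (columns m t))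

columns-length : ∀ {n} m (t : Tab n m) → length (columns m t) ≡ m
columns-length zero tt = refl
columns-length (suc m) (t , c) = cong suc (columns-length m t)

zip-cells : ∀ {n m} (gs : Vec ℕ m) (t : Tab n m) → zip (toList gs) (map (map just) (columns m t)) ≡ restCells gs t
zip-cells [] tt = refl
zip-cells (g ∷ gs) (t , c) = cong (_ ∷_) (zip-cells gs t)

puncture-pre : ∀ pre o cs post → puncture (length pre) (pre ++ (o , cs) ∷ post) ≡ pre ++ (o ∸ 1 , nothing ∷ cs) ∷ post
puncture-pre pre o cs post rewrite lookup-pre pre {o , cs} {post} = setAt-pre pre

slide-correct : ∀ {n m} fuel j pre o (gs : Vec ℕ m) (t : Tab n (suc m)) → Corner j o gs → Good o gs t → Desc o gs → Fit (o ∷ gs) t → n + suc m < fuel →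
  map (λ oc → proj₂ (fixColumn oc)) (sjdtRun n fuel (puncture (j + length pre) (pre ++ restCells (o ∷ gs) t)) (j + length pre)) ≡
  finish pre ++ columns (suc m) (slide j o gs t)
slide-correct {n} {m} fuel zero pre o gs (t , c₁) C G D (fit , F) lt rewrite puncture-pre pre o (map just (wd c₁)) (restCells gs t) =
  run-correct fuel pre (o ∸ 1) gs t c₁ 0 (Good-Punctured o gs (t , c₁) C G) (desc gs C D) F (≤-trans (+-monoˡ-≤ (height c₁) (m∸n≤m o 1)) fit) z≤n (above gs t)
    (≤-trans (s≤s (+-mono-≤ (m∸n≤m n (o ∸ 1 + 0)) (n≤1+n m))) lt)
  where
  desc : ∀ {m} (gs : Vec ℕ m) → Corner 0 o gs → Desc o gs → Desc (o ∸ 1) gs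
  desc [] C D = tt
  desc (g ∷ gs) C (_ , D) = pred-mono-≤ C , D
  above : ∀ {m} (gs : Vec ℕ m) (t : Tab n m) → Above 0 (o ∸ 1) gs t c₁
  above [] t = tt
  above (g ∷ gs) t _ = z≤n
slide-correct {n} {suc m} fuel (suc j) pre o (g ∷ gs) (t , c₁) C (a , _ , G) (_ , D) (_ , F) lt =
  trans (cong₂ (λ s q → map (λ oc → proj₂ (fixColumn oc)) (sjdtRun n fuel (puncture q s) q))
      (sym (++-assoc pre ((o , map just (wd c₁)) ∷ []) (restCells (g ∷ gs) t))) (sym (trans (cong (j +_) (length-∷ʳ pre (o , map just (wd c₁)))) (+-suc j (length pre)))))
    (trans (slide-correct fuel j (pre ++ (o , map just (wd c₁)) ∷ []) g gs t C G D F (≤-trans (s≤s (+-monoʳ-≤ n (n≤1+n (suc m)))) lt))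
      (trans (cong (_++ columns (suc m) (slide j g gs t)) (trans (finish-++ pre _) (cong (finish pre ++_) (trans (finish-col o c₁ (≤-trans (≤-reflexive a) z≤n)) (cong (λ z → wd z ∷ []) (fixed-adm c₁ a))))))
        (++-assoc (finish pre) (wd c₁ ∷ []) _)))

record Shape (n : ℕ) (lam mu : Vec ℕ n) (j : ℕ) {m : ℕ} (o : ℕ) (gs : Vec ℕ m) : Set where
  field
    offsets≡ : offsets n lam mu ≡ o ∷ toList gs
    corner : Corner j o gs
    desc : Desc o gs

module _ {n : ℕ} {lam mu : Vec ℕ n} {r j m o : ℕ} {gs : Vec ℕ m} (S : Shape n lam mu j o gs) where
  Xi-word : (t : Tab n (suc m)) → Good o gs t → Fit (o ∷ gs) t → toList (heights t) ≡ zipWith _∸_ (colHeights n lam) (offsets n lam mu) →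
    Xi n lam mu (r , j) (tabWord (suc m) t) ≡ tabWord (suc m) (slide j o gs t)
  Xi-word t G F h = trans (cong (λ T → reading (map proj₂ (SJDT n lam mu (r , j) T))) (tableauOf-word lam mu (suc m) t h))
    (trans (cong reading (trans (sym (map-∘ _)) (trans (cong₂ (λ gs' l → map (λ oc → proj₂ (fixColumn oc)) (sjdtRun n (suc (n + l)) (puncture j (zip gs' (map (map just) (columns (suc m) t)))) j)) offsets≡ (columns-length (suc m) t))
        (trans (cong₂ (λ st q → map (λ oc → proj₂ (fixColumn oc)) (sjdtRun n (suc (n + suc m)) (puncture q st) q)) (zip-cells (o ∷ gs) t) (sym (+-identityʳ j)))
          (slide-correct (suc (n + suc m)) j [] o gs t corner G desc F ≤-refl))))) (columns-word (suc m) (slide j o gs t)))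
    where open Shape S

-- Skew tableaux

Descending : List ℕ → Set
Descending [] = ⊤
Descending (x ∷ xs) = All (_≤ x) xs × Descending xs

Descending-++ : ∀ xs ys → Descending xs → Descending ys → (∀ {x y} → x ∈ xs → y ∈ ys → y ≤ x) → Descending (xs ++ ys)
Descending-++ [] ys d e h = e
Descending-++ (x ∷ xs) ys (a , d) e h = All-++ a (tabulateAll (λ m → h (here refl) m)) , Descending-++ xs ys d e (λ m m' → h (there m) m')

∈-replicate : ∀ {A : Set} l {k x : A} → x ∈ replicate l k → x ≡ k
∈-replicate (suc l) (here e) = e
∈-replicate (suc l) (there m) = ∈-replicate l m

Descending-replicate : ∀ l k → Descending (replicate l k)
Descending-replicate zero k = tt
Descending-replicate (suc l) k = tabulateAll (λ m → ≤-reflexive (∈-replicate l m)) , Descending-replicate l k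

bag : List ℕ → List ℕ → List ℕ
bag ks ls = concat (reverse (zipWith (λ k l → replicate l k) ks ls))

bag-∷ : ∀ k ks l ls → bag (k ∷ ks) (l ∷ ls) ≡ bag ks ls ++ replicate l k
bag-∷ k ks l ls = trans (cong concat (unfold-reverse (replicate l k) (zipWith (λ k l → replicate l k) ks ls)))
  (trans (sym (concat-++ (reverse (zipWith (λ k l → replicate l k) ks ls)) (replicate l k ∷ []))) (cong (bag ks ls ++_) (++-identityʳ _)))

∈-bag : ∀ ks ls {x} → x ∈ bag ks ls → x ∈ ks
∈-bag [] ls ()
∈-bag (k ∷ ks) [] ()
∈-bag (k ∷ ks) (l ∷ ls) {x} m with ∈-++⁻ (bag ks ls) (subst (x ∈_) (bag-∷ k ks l ls) m)
... | inj₁ p = there (∈-bag ks ls p)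
... | inj₂ p = here (∈-replicate l p)

data Ascending : List ℕ → Set where
  [] : Ascending []
  _∷_ : ∀ {k ks} → All (k ≤_) ks → Ascending ks → Ascending (k ∷ ks)

Ascending-∷ʳ : ∀ {ks k} → Ascending ks → All (_≤ k) ks → Ascending (ks ++ k ∷ [])
Ascending-∷ʳ [] [] = [] ∷ []
Ascending-∷ʳ (a ∷ s) (p ∷ ps) = All-++ a (p ∷ []) ∷ Ascending-∷ʳ s ps

upto-ascending : ∀ n → Ascending (upto n)
upto-ascending zero = []
upto-ascending (suc n) = Ascending-∷ʳ (upto-ascending n) (tabulateAll (λ m → m≤n⇒m≤1+n (proj₂ (∈-upto n m))))

bag-descending : ∀ ks ls → Ascending ks → Descending (bag ks ls)
bag-descending [] ls s = tt
bag-descending (k ∷ ks) [] s = tt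
bag-descending (k ∷ ks) (l ∷ ls) (a ∷ s) = subst Descending (sym (bag-∷ k ks l ls))
  (Descending-++ (bag ks ls) (replicate l k) (bag-descending ks ls s) (Descending-replicate l k)
    (λ m m' → ≤-trans (≤-reflexive (∈-replicate l m')) (lookupAll a (∈-bag ks ls m))))

colHeights-descending : ∀ n (lam : Vec ℕ n) → Descending (colHeights n lam)
colHeights-descending n lam = bag-descending (upto n) (toList lam) (upto-ascending n)

colHeights-≤ : ∀ n (lam : Vec ℕ n) {x} → x ∈ colHeights n lam → x ≤ n
colHeights-≤ n lam m = proj₂ (∈-upto n (∈-bag (upto n) (toList lam) m))

offsets-descending : ∀ n (lam mu : Vec ℕ n) → Descending (offsets n lam mu)
offsets-descending n lam mu = Descending-++ (colHeights n mu) _ (colHeights-descending n mu) (Descending-replicate d 0)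
  (λ _ m → ≤-trans (≤-reflexive (∈-replicate d m)) z≤n)
  where d = length (colHeights n lam) ∸ length (colHeights n mu)

offsets-≤ : ∀ n (lam mu : Vec ℕ n) {x} → x ∈ offsets n lam mu → x ≤ n
offsets-≤ n lam mu m with ∈-++⁻ (colHeights n mu) m
... | inj₁ p = colHeights-≤ n mu p
... | inj₂ p = ≤-trans (≤-reflexive (∈-replicate (length (colHeights n lam) ∸ length (colHeights n mu)) p)) z≤n

AdmTab : ∀ {n} m → Tab n m → Set
AdmTab zero tt = ⊤
AdmTab (suc m) (t , c) = adm c × AdmTab m t

columnOK : ℕ → Column → Bool
columnOK n C = ball (inAlph n) C ∧ strictlyIncreasing C ∧ admissibleCol n C

extract : ∀ n hs gs T → fits hs gs T ≡ true → ball (columnOK n) T ≡ true →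
  ∃ λ (t : Tab n (length gs)) → columns (length gs) t ≡ T × toList (heights t) ≡ zipWith _∸_ hs gs × AdmTab (length gs) t
extract n [] [] [] f h = tt , refl , refl , tt
extract n (h' ∷ hs) (g ∷ gs) (C ∷ T) f h with extract n hs gs T (proj₂ (∧-true {length C ≡ᵇ (h' ∸ g)} f)) (proj₂ (∧-true {columnOK n C} h))
... | t , e , e' , a with ∧-true {ball (inAlph n) C} (proj₁ (∧-true {columnOK n C} h))
... | al , h₂ with ∧-true {strictlyIncreasing C} h₂
... | si , ad with decode n C al si
... | c , refl = (t , c) , cong (wd c ∷_) e ,
  cong₂ _∷_ (trans (sym (length-wd c)) (≡ᵇ⇒≡ (length (wd c)) (h' ∸ g) (subst T' (sym (proj₁ (∧-true {length (wd c) ≡ᵇ (h' ∸ g)} f))) tt))) e' , admissible-adm c ad , a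
  where T' = Data.Bool.T

closed-fails : ∀ {n} k (c₂ c₁ : Col n) → Closed (walkZ k (c₂ , c₁)) → ∃ λ z → firstFail (wd (rCols c₁)) (drop k (wd (lCols c₂))) ≡ just z
closed-fails k (us₂ , bs₂) (us₁ , bs₁) cl with open? (walkU (opn k) (uS 0 us₂ bs₂) us₁)
... | inj₁ clU with firstFail-U-closed k 1 (uS 0 us₂ bs₂) us₁ (bL 1 bs₂) (bL 1 (bS 0 us₁ bs₁)) (barred-bL 1 bs₂) (barred-bL 1 (bS 0 us₁ bs₁)) clU
...   | y , p , f , _ = _ , f
closed-fails k (us₂ , bs₂) (us₁ , bs₁) cl | inj₂ (k' , wk)
  with firstFail-B-closed k' 1 bs₂ (bS 0 us₁ bs₁) [] [] [] [] (subst (λ l → Closed (walkB l bs₂ (bS 0 us₁ bs₁))) wk cl)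
... | y , p , f , _ = _ , trans (firstFail-U-open k 1 (uS 0 us₂ bs₂) us₁ (bL 1 bs₂) (bL 1 (bS 0 us₁ bs₁)) (barred-bL 1 bs₂) wk)
    (cong (shiftBy (count us₁)) (trans (cong₂ (λ s t → firstFail t (drop k' s)) (sym (++-identityʳ (bL 1 bs₂))) (sym (++-identityʳ (bL 1 (bS 0 us₁ bs₁))))) f))

weak-tail : ∀ x xs → weaklyIncreasing (x ∷ xs) ≡ true → weaklyIncreasing xs ≡ true
weak-tail x [] h = refl
weak-tail x (y ∷ xs) h = proj₂ (∧-true {x ≤L y} h)

weak-mapMaybe : ∀ {A : Set} (f : A → Maybe Letter) x xs → weaklyIncreasing (mapMaybe f (x ∷ xs)) ≡ true → weaklyIncreasing (mapMaybe f xs) ≡ true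
weak-mapMaybe f x xs h with f x
... | nothing = h
... | just y = weak-tail y (mapMaybe f xs) h

weak-adjacent : ∀ {A : Set} (f : A → Maybe Letter) x y xs {a c} → weaklyIncreasing (mapMaybe f (x ∷ y ∷ xs)) ≡ true → f x ≡ just a → f y ≡ just c → (a ≤L c) ≡ true
weak-adjacent f x y xs {a} {c} h e e' rewrite e | e' = proj₁ (∧-true {a ≤L c} h)

entry-just : ∀ {A : Set} o (C : List A) r p → r ≡ o + suc p → entryAt o C r ≡ lookupM C p
entry-just o C r p refl rewrite <-<ᵇ (≤-trans (s≤s (m≤m+n o p)) (≤-reflexive (sym (+-suc o p)))) | +-suc o p | m+n∸m≡n o p = refl

Rows : ∀ {n} m → Vec ℕ m → Tab n m → Set
Rows {n} m gs t = ∀ {r} → r ∈ upto n → weaklyIncreasing (rowOf (splitForm (toList gs) (columns m t)) r) ≡ true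

Rows-good : ∀ {n m} h hs o (gs : Vec ℕ m) (t : Tab n (suc m)) → AdmTab (suc m) t → Descending (h ∷ hs) → Descending (o ∷ toList gs) → h ≤ n →
  toList (heights t) ≡ zipWith _∸_ (h ∷ hs) (o ∷ toList gs) → Rows (suc m) (o ∷ gs) t → Good o gs t
Rows-good h hs o [] (tt , c) (a , _) d d' le e R = a
Rows-good h [] o (g ∷ gs) ((t , c₂) , c₁) (a , a') d d' le () R
Rows-good {n} {suc m} h (h₂ ∷ hs) o (g ∷ gs) ((t , c₂) , c₁) (a₁ , (a₂ , a')) ((h₂≤h ∷ _) , d) ((g≤o ∷ _) , d') le e R =
  a₁ , opened (open? (walkZ (o ∸ g) (c₂ , c₁))) ,
  Rows-good h₂ hs g gs (t , c₂) (a₂ , a') d d' (≤-trans h₂≤h le) (cong (drop 1) e)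
    (λ {r} m → weak-mapMaybe (entry r) (o , rCol (wd c₁)) right (weak-mapMaybe (entry r) (o , lCol (wd c₁)) ((o , rCol (wd c₁)) ∷ right) (R m)))
  where
  entry : ℕ → ℕ × Column → Maybe Letter
  entry r oc = entryAt (proj₁ oc) (proj₂ oc) r
  right : List (ℕ × Column)
  right = (g , lCol (wd c₂)) ∷ (g , rCol (wd c₂)) ∷ splitForm (toList gs) (columns m t)
  list-head : ∀ {x y : ℕ} {xs ys : List ℕ} → (x ∷ xs) ≡ (y ∷ ys) → x ≡ y
  list-head refl = refl
  height₁ : height c₁ ≡ h ∸ o
  height₁ = list-head e
  height₂ : height c₂ ≡ h₂ ∸ g
  height₂ = list-head (cong (drop 1) e)
  opened : Closed (walkZ (o ∸ g) (c₂ , c₁)) ⊎ (∃ λ k → walkZ (o ∸ g) (c₂ , c₁) ≡ opn k) → ∃ λ k → walkZ (o ∸ g) (c₂ , c₁) ≡ opn k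
  opened (inj₂ x) = x
  opened (inj₁ cl) with closed-fails (o ∸ g) c₂ c₁ cl
  ... | (p , y) , f with firstFail-at (wd (rCols c₁)) (drop (o ∸ g) (wd (lCols c₂))) f
  ... | hl , rest = ⊥-elim (contradict rest)
    where
    hL : lookupM (wd (lCols c₂)) ((o ∸ g) + p) ≡ just y
    hL = trans (sym (lookup-drop (o ∸ g) (wd (lCols c₂)) p)) hl
    row : o + p < h₂
    row = ≤-trans (≤-reflexive (cong suc (trans (cong (_+ p) (sym (m+[n∸m]≡n g≤o))) (+-assoc g (o ∸ g) p))))
      (m<n∸o⇒ g ((o ∸ g) + p) h₂ (≤-trans (lookup-< (wd (lCols c₂)) hL) (≤-reflexive (trans (wd-l-length c₂ a₂) height₂))))
      where
      m<n∸o⇒ : ∀ g q h → q < h ∸ g → g + q < h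
      m<n∸o⇒ zero q h lt = lt
      m<n∸o⇒ (suc g) q (suc h) lt = s≤s (m<n∸o⇒ g q h lt)
    row≤n : o + suc p ≤ n
    row≤n = ≤-trans (≤-reflexive (+-suc o p)) (≤-trans row (≤-trans h₂≤h le))
    contradict : lookupM (wd (rCols c₁)) p ≡ nothing ⊎ (∃ λ r → lookupM (wd (rCols c₁)) p ≡ just r × (r ≤L y) ≡ false) → ⊥
    contradict (inj₁ no) with lookup-just (wd (rCols c₁)) {p} (≤-trans (p<h∸o o p h (≤-trans row h₂≤h)) (≤-reflexive (sym (trans (wd-r-length c₁ a₁) height₁))))
      where
      p<h∸o : ∀ o p h → o + p < h → p < h ∸ o
      p<h∸o zero p h lt = lt
      p<h∸o (suc o) p (suc h) (s≤s lt) = p<h∸o o p h lt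
    ... | x , yes' with trans (sym no) yes'
    ... | ()
    contradict (inj₂ (r , hr , big)) with trans (sym big) (weak-adjacent (entry (o + suc p)) (o , rCol (wd c₁)) (g , lCol (wd c₂)) ((g , rCol (wd c₂)) ∷ splitForm (toList gs) (columns m t))
      (weak-mapMaybe (entry (o + suc p)) (o , lCol (wd c₁)) ((o , rCol (wd c₁)) ∷ right) (R (upto-∈ n (≤-trans (s≤s z≤n) (≤-reflexive (sym (+-suc o p)))) row≤n)))
      (trans (entry-just o (rCol (wd c₁)) (o + suc p) p refl) (trans (cong (λ z → lookupM z p) (rCol-wd (proj₁ c₁) (proj₂ c₁) a₁)) hr))
      (trans (entry-just g (lCol (wd c₂)) (o + suc p) ((o ∸ g) + p) shift) (trans (cong (λ z → lookupM z ((o ∸ g) + p)) (lCol-wd (proj₁ c₂) (proj₂ c₂) a₂)) hL)))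
      where
      shift : o + suc p ≡ g + suc ((o ∸ g) + p)
      shift = trans (cong (_+ suc p) (sym (m+[n∸m]≡n g≤o))) (trans (+-assoc g (o ∸ g) (suc p)) (cong (g +_) (+-suc (o ∸ g) p)))
    ... | ()

Descending-Desc : ∀ {m} o (gs : Vec ℕ m) → Descending (o ∷ toList gs) → Desc o gs
Descending-Desc o [] d = tt
Descending-Desc o (g ∷ gs) ((le ∷ _) , d) = le , Descending-Desc g gs d

heights-Fit : ∀ {n m} hs (gs : Vec ℕ m) (t : Tab n m) → (∀ {x} → x ∈ hs → x ≤ n) → (∀ {x} → x ∈ toList gs → x ≤ n) →
  toList (heights t) ≡ zipWith _∸_ hs (toList gs) → Fit gs t
heights-Fit hs [] tt h h' e = tt
heights-Fit [] (g ∷ gs) (t , c) h h' ()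
heights-Fit {n} (x ∷ hs) (g ∷ gs) (t , c) h h' e =
  ≤-trans (≤-reflexive (cong (g +_) (first e))) (bound (≤-total g x)) , heights-Fit hs gs t (λ m → h (there m)) (λ m → h' (there m)) (cong (drop 1) e)
  where
  first : ∀ {x y : ℕ} {xs ys : List ℕ} → (x ∷ xs) ≡ (y ∷ ys) → x ≡ y
  first refl = refl
  bound : g ≤ x ⊎ x ≤ g → g + (x ∸ g) ≤ n
  bound (inj₁ le) = ≤-trans (≤-reflexive (m+[n∸m]≡n le)) (h (here refl))
  bound (inj₂ ge) = ≤-trans (≤-reflexive (trans (cong (g +_) (m≤n⇒m∸n≡0 ge)) (+-identityʳ g))) (h' (here refl))

corner-lookup : ∀ {m} j o (gs : Vec ℕ m) {h} → lookupM (o ∷ toList gs) j ≡ just h → 1 ≤ h → (∀ {h'} → lookupM (o ∷ toList gs) (suc j) ≡ just h' → h' < h) → Corner j o gs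
corner-lookup zero o [] refl h1 h2 = h1
corner-lookup zero o (g ∷ gs) refl h1 h2 = h2 refl
corner-lookup (suc j) o [] () h1 h2
corner-lookup (suc j) o (g ∷ gs) e h1 h2 = corner-lookup j g gs e h1 h2

lookup-++ˡ : ∀ {A : Set} (xs ys : List A) {j x} → lookupM xs j ≡ just x → lookupM (xs ++ ys) j ≡ just x
lookup-++ˡ (x ∷ xs) ys {zero} h = h
lookup-++ˡ (x ∷ xs) ys {suc j} h = lookup-++ˡ xs ys h

lookup-++⁻ : ∀ {A : Set} (xs ys : List A) {j x} → lookupM (xs ++ ys) j ≡ just x → lookupM xs j ≡ just x ⊎ (lookupM xs j ≡ nothing × x ∈ ys)
lookup-++⁻ [] (y ∷ ys) {zero} refl = inj₂ (refl , here refl)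
lookup-++⁻ [] (y ∷ ys) {suc j} h with lookup-++⁻ [] ys {j} h
... | inj₂ (_ , m) = inj₂ (refl , there m)
lookup-++⁻ (x ∷ xs) ys {zero} h = inj₁ h
lookup-++⁻ (x ∷ xs) ys {suc j} h = lookup-++⁻ xs ys h

inY-just : ∀ hs r j → inY hs r j ≡ true → ∃ λ h → lookupM hs j ≡ just h × 1 ≤ r × r ≤ h
inY-just hs r j e with lookupM hs j
... | just h = h , refl , ≤ᵇ-true (proj₁ (∧-true {1 Data.Nat.≤ᵇ r} e)) , ≤ᵇ-true (proj₂ (∧-true {1 Data.Nat.≤ᵇ r} e))

inY-false : ∀ hs r j {h} → inY hs r j ≡ false → lookupM hs j ≡ just h → 1 ≤ r → h < r
inY-false hs r j {h} e l le with lookupM hs j | l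
... | just .h | refl with <-≤-connex h r
...   | inj₁ lt = lt
...   | inj₂ ge with trans (sym e) (cong₂ _∧_ (true-≤ᵇ le) (true-≤ᵇ ge))
...     | ()

record Prepared (n : ℕ) (lam mu : Vec ℕ n) (j : ℕ) : Set where
  field
    o : ℕ
    rest : List ℕ
    shape : Shape n lam mu j o (fromList rest)

  m : ℕ
  m = length rest
  gs : Vec ℕ m
  gs = fromList rest
  offs≡ : offsets n lam mu ≡ o ∷ rest
  offs≡ = trans (Shape.offsets≡ shape) (cong (o ∷_) (toList∘fromList rest))

prepare : ∀ n lam mu r j → InnerCorner n lam mu (r , j) → Prepared n lam mu j
prepare n lam mu r j (i₁ , i₂ , i₃) with inY-just (colHeights n mu) r j i₁
... | h , e , 1≤r , r≤h = go (offsets n lam mu) refl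
  where
  muH = colHeights n mu
  next< : ∀ {h'} → lookupM (offsets n lam mu) (suc j) ≡ just h' → h' < h
  next< l with lookup-++⁻ muH _ l
  ... | inj₁ l' = ≤-trans (inY-false muH r (suc j) i₃ l' 1≤r) r≤h
  ... | inj₂ (_ , z) = ≤-trans (s≤s (≤-reflexive (∈-replicate (length (colHeights n lam) ∸ length muH) z))) (≤-trans 1≤r r≤h)
  here≡ : lookupM (offsets n lam mu) j ≡ just h
  here≡ = lookup-++ˡ muH _ e
  go : ∀ L → offsets n lam mu ≡ L → Prepared n lam mu j
  go [] eq with trans (sym (cong (λ L → lookupM L j) eq)) here≡
  ... | ()
  go (o ∷ rest) eq = record { o = o ; rest = rest ; shape = record
    { offsets≡ = trans eq (cong (o ∷_) (sym (toList∘fromList rest)))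
    ; corner = corner-lookup j o (fromList rest) (subst (λ L → lookupM L j ≡ just h) eq' here≡) (≤-trans 1≤r r≤h) (λ l → next< (subst (λ L → lookupM L (suc j) ≡ just _) (sym eq') l))
    ; desc = Descending-Desc o (fromList rest) (subst Descending eq' (offsets-descending n lam mu)) } }
    where
    eq' : offsets n lam mu ≡ o ∷ toList (fromList rest)
    eq' = trans eq (cong (o ∷_) (sym (toList∘fromList rest)))

module _ {n : ℕ} {lam mu : Vec ℕ n} {j : ℕ} (P : Prepared n lam mu j) where
  open Prepared P

  record InShape (t : Tab n (suc m)) : Set where
    field
      good : Good o gs t
      fit : Fit (o ∷ gs) t
      heights≡ : toList (heights t) ≡ zipWith _∸_ (colHeights n lam) (offsets n lam mu)

  InU-tab : ∀ {w} → InU n lam mu w → ∃ λ (t : Tab n (suc m)) → InShape t × tabWord (suc m) t ≡ w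
  InU-tab {w} (T , ok' , rd) with ∧-true {fits (colHeights n lam) (offsets n lam mu) T} ok'
  ... | f , ok₂ with ∧-true {ball (columnOK n) T} ok₂
  ... | cols , rows = go (colHeights n lam) refl (extract n (colHeights n lam) (o ∷ rest) T (subst (λ L → fits (colHeights n lam) L T ≡ true) offs≡ f) cols)
    where
    tl : o ∷ rest ≡ o ∷ toList gs
    tl = cong (o ∷_) (sym (toList∘fromList rest))
    go : ∀ H → colHeights n lam ≡ H → (∃ λ (t : Tab n (suc m)) → columns (suc m) t ≡ T × toList (heights t) ≡ zipWith _∸_ (colHeights n lam) (o ∷ rest) × AdmTab (suc m) t) →
      ∃ λ (t : Tab n (suc m)) → InShape t × tabWord (suc m) t ≡ w
    go [] eq ((t , c) , e , e' , a) with trans e' (cong (λ H → zipWith _∸_ H (o ∷ rest)) eq)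
    ... | ()
    go (h ∷ hs) eq (t , e , e' , a) = t , record
      { good = Rows-good h hs o gs t a (subst Descending eq (colHeights-descending n lam))
          (subst Descending (trans offs≡ tl) (offsets-descending n lam mu)) (colHeights-≤ n lam (subst (h ∈_) (sym eq) (here refl)))
          (trans e' (cong₂ (zipWith _∸_) eq tl))
          (λ {r} m' → subst₂ (λ G C → weaklyIncreasing (rowOf (splitForm G C) r) ≡ true) (trans offs≡ tl) (sym e) (ball-true _ (upto n) rows m'))
      ; fit = heights-Fit (colHeights n lam) (o ∷ gs) t (colHeights-≤ n lam) (λ m' → offsets-≤ n lam mu (subst (_ ∈_) (sym (trans offs≡ tl)) m')) (trans e' (cong (zipWith _∸_ (colHeights n lam)) tl))
      ; heights≡ = trans e' (cong (zipWith _∸_ (colHeights n lam)) (sym offs≡)) }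
      , trans (sym (columns-word (suc m) t)) (trans (cong reading e) rd)

-- Injectivity

record Raised (A : Crystal) (weight : Car A → ℕ) (a a' : Car A) : Set where
  constructor raised
  field
    ε-suc : ε A a ≡ suc (ε A a')
    φ-suc : φ A a' ≡ suc (φ A a)
    f-back : f A a' ≡ just a
    lighter : weight a' < weight a

open Raised

record Normal (A : Crystal) (weight : Car A → ℕ) : Set where
  field
    e-zero : ∀ a → e A a ≡ nothing → ε A a ≡ 0
    e-raised : ∀ a {a'} → e A a ≡ just a' → Raised A weight a a'

open Normal

-- The weight sums the positions of the letters in the alphabet.
uWeight bWeight : ∀ {n} → ℕ → Bits n → ℕ
uWeight j [] = 0
uWeight j (true ∷ s) = j + uWeight (suc j) s
uWeight j (false ∷ s) = uWeight (suc j) s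
bWeight {zero} m [] = 0
bWeight {suc n} m (true ∷ s) = m + bWeight (pred m) s
bWeight {suc n} m (false ∷ s) = bWeight (pred m) s

𝕌-normal : ∀ n k j → Normal (𝕌 n k) (uWeight j)
𝕌-normal n k j = record { e-zero = ez n k ; e-raised = er n k j }
  where
  ez : ∀ n k (s : Bits n) → raise k s ≡ nothing → canRaise k s ≡ 0
  ez n k [] h = refl
  ez n zero (x ∷ []) h = refl
  ez n zero (true ∷ y ∷ s) h = refl
  ez n zero (false ∷ false ∷ s) h = refl
  ez (suc n) (suc k) (x ∷ s) h with raise k s | ez n k s
  ... | nothing | r = r refl
  er : ∀ n k j (s : Bits n) {s'} → raise k s ≡ just s' → Raised (𝕌 n k) (uWeight j) s s'
  er n zero j (false ∷ true ∷ s) refl = raised refl refl refl ≤-refl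
  er (suc n) (suc k) j (x ∷ s) h with raise k s | er n k (suc j) s
  er (suc n) (suc k) j (true ∷ s) refl | just s' | r with r refl
  ... | raised a c d w = raised a c (cong (mapM (true ∷_)) d) (≤-trans (≤-reflexive (sym (+-suc j _))) (+-monoʳ-≤ j w))
  er (suc n) (suc k) j (false ∷ s) refl | just s' | r with r refl
  ... | raised a c d w = raised a c (cong (mapM (false ∷_)) d) w

𝔹-normal : ∀ n k m → n ≤ m → Normal (𝔹 n k) (bWeight m)
𝔹-normal n k m le = record { e-zero = ez n k ; e-raised = er n k m le }
  where
  ez : ∀ n k (s : Bits n) → lower k s ≡ nothing → canLower k s ≡ 0
  ez n k [] h = refl
  ez n zero (x ∷ []) h = refl
  ez n zero (true ∷ true ∷ s) h = refl
  ez n zero (false ∷ y ∷ s) h = refl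
  ez (suc n) (suc k) (x ∷ s) h with lower k s | ez n k s
  ... | nothing | r = r refl
  er : ∀ n k m → n ≤ m → (s : Bits n) → ∀ {s'} → lower k s ≡ just s' → Raised (𝔹 n k) (bWeight m) s s'
  er (suc (suc n)) zero (suc m) le (true ∷ false ∷ s) refl = raised refl refl refl ≤-refl
  er (suc n) (suc k) (suc m) (s≤s le) (x ∷ s) h with lower k s | er n k m le s
  er (suc n) (suc k) (suc m) (s≤s le) (true ∷ s) refl | just s' | r with r refl
  ... | raised a c d w = raised a c (cong (mapM (true ∷_)) d) (≤-trans (≤-reflexive (sym (+-suc (suc m) _))) (+-monoʳ-≤ (suc m) w))
  er (suc n) (suc k) (suc m) (s≤s le) (false ∷ s) refl | just s' | r with r refl
  ... | raised a c d w = raised a c (cong (mapM (false ∷_)) d) w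

pairWeight : {A B : Set} → (A → ℕ) → (B → ℕ) → A × B → ℕ
pairWeight v w (a , c) = v a + w c

⊗-normal : ∀ {A B v w} → Normal A v → Normal B w → Normal (A ⊗ B) (pairWeight v w)
⊗-normal {A} {B} {v} {w} NA NB = record { e-zero = ez ; e-raised = er }
  where
  ez : ∀ x → e (A ⊗ B) x ≡ nothing → ε (A ⊗ B) x ≡ 0
  ez (a , c) h with ε B c ∸ φ A a in d
  ... | zero = trans (+-identityʳ _) (e-zero NA a (mapM-none (e A a) h))
    where
    mapM-none : ∀ {X Y : Set} {g : X → Y} (m : Maybe X) → mapM g m ≡ nothing → m ≡ nothing
    mapM-none nothing _ = refl
  ... | suc d' with e B c in eq
  ...   | nothing with trans (sym d) (trans (cong (_∸ φ A a) (e-zero NB c eq)) (0∸n≡0 (φ A a)))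
  ...     | ()
  er : ∀ x {x'} → e (A ⊗ B) x ≡ just x' → Raised (A ⊗ B) (pairWeight v w) x x'
  er (a , c) h with ε B c ∸ φ A a in d
  er (a , c) h | zero with e A a in eq
  er (a , c) refl | zero | just a' with e-raised NA a eq
  ... | raised e₁ e₂ e₃ e₄ = raised
    (trans (cong (ε A a +_) d) (trans (+-identityʳ _) (trans e₁ (cong suc (sym (trans (cong (ε A a' +_) small) (+-identityʳ _)))))))
    (trans (cong (λ z → φ B c + (z ∸ ε B c)) e₂) (trans (cong (φ B c +_) (+-∸-assoc 1 le)) (+-suc (φ B c) _)))
    (trans (cong (λ z → pick (z ∸ ε B c) (mapM (_, c) (f A a')) (mapM (a' ,_) (f B c))) e₂)
      (trans (cong (λ z → pick z (mapM (_, c) (f A a')) (mapM (a' ,_) (f B c))) (+-∸-assoc 1 le)) (cong (mapM (_, c)) e₃)))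
    (+-monoˡ-< (w c) e₄)
    where
    le : ε B c ≤ φ A a
    le = m∸n≡0⇒m≤n d
    small : ε B c ∸ φ A a' ≡ 0
    small = m≤n⇒m∸n≡0 (≤-trans le (≤-trans (n≤1+n _) (≤-reflexive (sym e₂))))
  er (a , c) h | suc d' with e B c in eq
  er (a , c) refl | suc d' | just c' with e-raised NB c eq
  ... | raised e₁ e₂ e₃ e₄ = raised
    (trans (cong (ε A a +_) (trans d (cong suc (sym d'≡)))) (+-suc (ε A a) _))
    (cong₂ _+_ e₂ (trans (m≤n⇒m∸n≡0 ge') (sym (m≤n⇒m∸n≡0 ge))))
    (trans (cong (λ z → pick z (mapM (_, c') (f A a)) (mapM (a ,_) (f B c'))) (m≤n⇒m∸n≡0 ge')) (cong (mapM (a ,_)) e₃))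
    (+-monoʳ-< (v a) e₄)
    where
    gt : φ A a < ε B c
    gt = m∸n≢0⇒n<m (λ z → 1+n≢0 (trans (sym d) z))
    ge' : φ A a ≤ ε B c'
    ge' = s≤s⁻¹ (≤-trans gt (≤-reflexive e₁))
    ge : φ A a ≤ ε B c
    ge = <⇒≤ gt
    d'≡ : ε B c' ∸ φ A a ≡ d'
    d'≡ = suc-injective (trans (sym (+-∸-assoc 1 ge')) (trans (cong (_∸ φ A a) (sym e₁)) d))

𝕃-normal : ∀ n j m → j + (n + n) ≤ m → Normal (𝕃 n) (pairWeight (uWeight j) (bWeight m))
𝕃-normal n j m le = record { e-zero = λ { (us , bs) → ez us bs } ; e-raised = λ { (us , bs) → er j m le us bs } }
  where
  ez : ∀ {n} (us bs : Bits n) → raiseLast us bs ≡ nothing → canRaiseLast us bs ≡ 0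
  ez [] [] h = refl
  ez (true ∷ []) (y ∷ []) h = refl
  ez (false ∷ []) (false ∷ []) h = refl
  ez (x ∷ us@(_ ∷ _)) (y ∷ bs@(_ ∷ _)) h with raiseLast us bs | ez us bs
  ... | nothing | r = r refl
  er : ∀ {n} j m → j + (n + n) ≤ m → (us bs : Bits n) → ∀ {c} → raiseLast us bs ≡ just c →
       Raised (𝕃 n) (pairWeight (uWeight j) (bWeight m)) (us , bs) c
  er j m le [] [] ()
  er j m le (true ∷ []) (y ∷ []) ()
  er j m le (false ∷ []) (false ∷ []) ()
  er j m le (false ∷ []) (true ∷ []) refl = raised refl refl refl
    (≤-trans (s≤s (≤-reflexive (trans (+-identityʳ _) (+-identityʳ j)))) (≤-trans (≤-trans (n≤1+n (suc j)) (≤-trans (≤-reflexive (+-comm 2 j)) le)) (≤-reflexive (sym (+-identityʳ m)))))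
  er {suc (suc n)} j zero le (x ∷ us@(_ ∷ _)) (y ∷ bs@(_ ∷ _)) h with trans (sym (+-suc j _)) (n≤0⇒n≡0 le)
  ... | ()
  er {suc (suc n)} j (suc m) le (x ∷ us@(_ ∷ _)) (y ∷ bs@(_ ∷ _)) h with raiseLast us bs | er (suc j) m (tail-le n j m le) us bs
    where
    tail-le : ∀ n j m → j + (suc (suc n) + suc (suc n)) ≤ suc m → suc j + (suc n + suc n) ≤ m
    tail-le n j m le = s≤s⁻¹ (≤-trans (≤-reflexive (r₁ j n)) le)
      where
      r₁ : ∀ j n → suc (suc j + (suc n + suc n)) ≡ j + (suc (suc n) + suc (suc n))
      r₁ = solve-∀
  er {suc (suc n)} j (suc m) le (x ∷ us@(_ ∷ _)) (y ∷ bs@(_ ∷ _)) refl | just (_ ∷ _ , _ ∷ _) | r with r refl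
  ... | raised a c d w = raised a c (cong (mapM _) d) (≤-trans (≤-reflexive (cong suc (weight-∷ x y _ _))) (≤-trans (≤-trans (≤-reflexive (sym (+-suc (shift x y) _))) (+-monoʳ-≤ (shift x y) w)) (≤-reflexive (sym (weight-∷ x y us bs)))))
    where
    shift : Bool → Bool → ℕ
    shift true true = j + suc m
    shift true false = j
    shift false true = suc m
    shift false false = 0
    weight-∷ : ∀ x y (s t : Bits (suc n)) → pairWeight (uWeight j) (bWeight (suc m)) (x ∷ s , y ∷ t) ≡ shift x y + pairWeight (uWeight (suc j)) (bWeight m) (s , t)
    weight-∷ true true s t = +-interchange j _ (suc m) _
    weight-∷ true false s t = +-assoc j _ _
    weight-∷ false true s t = r₂ (uWeight (suc j) s) (suc m) (bWeight m t)
      where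
      r₂ : ∀ a c d → a + (c + d) ≡ c + (a + d)
      r₂ = solve-∀
    weight-∷ false false s t = refl

colWeight : ∀ {n} → Col n → ℕ
colWeight {n} = pairWeight (uWeight 0) (bWeight (n + n))

𝕂-normal : ∀ n op → Normal (𝕂 n op) colWeight
𝕂-normal n (just k) = record
  { e-zero = e-zero N
  ; e-raised = λ a h → let r = e-raised N a h in raised (ε-suc r) (φ-suc r) (f-back r) (lighter r) }
  where N = ⊗-normal (𝕌-normal n k 0) (𝔹-normal n k (n + n) (m≤m+n n n))
𝕂-normal n nothing = record
  { e-zero = e-zero N
  ; e-raised = λ a h → let r = e-raised N a h in raised (ε-suc r) (φ-suc r) (f-back r) (lighter r) }
  where N = 𝕃-normal n 0 (n + n) ≤-refl

-- Operators beyond the range act trivially, so that finitely many have to be searched.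
canRaise-out : ∀ {n} k (s : Bits n) → n ≤ suc k → canRaise k s ≡ 0
canRaise-out k [] h = refl
canRaise-out zero (x ∷ []) h = refl
canRaise-out zero (x ∷ y ∷ s) (s≤s ())
canRaise-out (suc k) (x ∷ s) (s≤s h) = canRaise-out k s h

canLower-out : ∀ {n} k (s : Bits n) → n ≤ suc k → canLower k s ≡ 0
canLower-out k [] h = refl
canLower-out zero (x ∷ []) h = refl
canLower-out zero (x ∷ y ∷ s) (s≤s ())
canLower-out (suc k) (x ∷ s) (s≤s h) = canLower-out k s h

ε-out : ∀ {n} k (c : Col n) → n ≤ k → 𝕂 n (just k) .ε c ≡ 0
ε-out k (us , bs) h rewrite canRaise-out k us (m≤n⇒m≤1+n h) | canLower-out k bs (m≤n⇒m≤1+n h) = 0∸n≡0 (canLower k us)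

𝕂² : ℕ → Op → Crystal
𝕂² n op = 𝕂 n op ⊗ 𝕂 n op

pair-normal : ∀ n op → Normal (𝕂² n op) (pairWeight colWeight colWeight)
pair-normal n op = ⊗-normal (𝕂-normal n op) (𝕂-normal n op)

ε²-out : ∀ {n} k (c : Col n × Col n) → n ≤ k → 𝕂² n (just k) .ε c ≡ 0
ε²-out {n} k (c₂ , c₁) h = trans (cong₂ (λ z w → z + (w ∸ 𝕂 n (just k) .φ c₂)) (ε-out k c₂ h) (ε-out k c₁ h)) (0∸n≡0 (𝕂 n (just k) .φ c₂))

raisable : ∀ {n} (c : Col n × Col n) → (∃ λ op → ∃ λ c' → 𝕂² n op .e c ≡ just c') ⊎ (∀ op → 𝕂² n op .ε c ≡ 0)
raisable {n} c = combine (try nothing) (below n)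
  where
  Result : Set
  Result = ∃ λ op → ∃ λ c' → 𝕂² n op .e c ≡ just c'
  try : ∀ op → Result ⊎ 𝕂² n op .ε c ≡ 0
  try op with 𝕂² n op .e c in eq
  ... | just c' = inj₁ (op , c' , eq)
  ... | nothing = inj₂ (e-zero (pair-normal n op) c eq)
  below : ∀ m → Result ⊎ (∀ k → k < m → 𝕂² n (just k) .ε c ≡ 0)
  below zero = inj₂ λ _ ()
  below (suc m) with below m | try (just m)
  ... | inj₁ x | _ = inj₁ x
  ... | inj₂ h | inj₁ x = inj₁ x
  ... | inj₂ h | inj₂ z = inj₂ λ k lt → upper k (m≤n⇒m<n∨m≡n lt)
    where
    upper : ∀ k → suc k < suc m ⊎ suc k ≡ suc m → 𝕂² n (just k) .ε c ≡ 0
    upper k (inj₁ lt) = h k (s≤s⁻¹ lt)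
    upper k (inj₂ refl) = z
  combine : Result ⊎ 𝕂² n nothing .ε c ≡ 0 → Result ⊎ (∀ k → k < n → 𝕂² n (just k) .ε c ≡ 0) → Result ⊎ (∀ op → 𝕂² n op .ε c ≡ 0)
  combine (inj₁ x) _ = inj₁ x
  combine (inj₂ z) (inj₁ x) = inj₁ x
  combine (inj₂ z) (inj₂ h) = inj₂ λ { nothing → z ; (just k) → range k (<-≤-connex k n) }
    where
    range : ∀ k → k < n ⊎ n ≤ k → 𝕂² n (just k) .ε c ≡ 0
    range k (inj₁ lt) = h k lt
    range k (inj₂ ge) = ε²-out k c ge

top : ∀ {n} → ℕ → Bits n
top {zero} h = []
top {suc n} zero = false ∷ top zero
top {suc n} (suc h) = true ∷ top h

HW : ∀ {n} → Bits n → Bits n → Set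
HW {n} us bs = ∀ op → 𝕂 n op .ε (us , bs) ≡ 0

HW-tail : ∀ {n} x y (us bs : Bits n) → HW (x ∷ us) (y ∷ bs) → HW us bs
HW-tail x y us bs h (just k) = h (just (suc k))
HW-tail x y [] [] h nothing = refl
HW-tail x y (_ ∷ _) (_ ∷ _) h nothing = h nothing

HW-no-B : ∀ {n} (us bs : Bits n) → HW (false ∷ us) (true ∷ bs) → ⊥
HW-no-B [] [] h with h nothing
... | ()
HW-no-B (true ∷ us) (y ∷ bs) h with h (just 0)
... | ()
HW-no-B (false ∷ us) (false ∷ bs) h with h (just 0)
... | ()
HW-no-B (false ∷ us) (true ∷ bs) h = HW-no-B us bs (HW-tail false true _ _ h)

HW-all-N : ∀ {n} (us bs : Bits n) → HW (false ∷ us) (false ∷ bs) → us ≡ top 0 × bs ≡ top 0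
HW-all-N [] [] h = refl , refl
HW-all-N (true ∷ us) (y ∷ bs) h with h (just 0)
... | ()
HW-all-N (false ∷ us) (true ∷ bs) h = ⊥-elim (HW-no-B us bs (HW-tail false false _ _ h))
HW-all-N (false ∷ us) (false ∷ bs) h with HW-all-N us bs (HW-tail false false _ _ h)
... | p , q = cong (false ∷_) p , cong (false ∷_) q

count-top0 : ∀ n → count {n} (top 0) ≡ 0
count-top0 zero = refl
count-top0 (suc n) = count-top0 n

HW-shape : ∀ {n} (us bs : Bits n) → HW us bs → pend 0 us bs ≡ 0 → us ≡ top (count us) × bs ≡ top 0
HW-shape [] [] h a = refl , refl
HW-shape (true ∷ us) (false ∷ bs) h a with HW-shape us bs (HW-tail true false _ _ h) a
... | p , q = cong (true ∷_) p , cong (false ∷_) q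
HW-shape (false ∷ us) (true ∷ bs) h a = ⊥-elim (HW-no-B us bs h)
HW-shape {suc n} (false ∷ us) (false ∷ bs) h a with HW-all-N us bs h
... | refl , refl rewrite count-top0 n = refl , refl

-- Equality of the weights, with the terms moved so that no subtraction occurs.
data SameWeight : ∀ {n} → (us bs us' bs' : Bits n) → Set where
  [] : SameWeight [] [] [] []
  _∷_ : ∀ {n x y x' y'} {us bs us' bs' : Bits n} → bit x + bit y' ≡ bit x' + bit y → SameWeight us bs us' bs' →
        SameWeight (x ∷ us) (y ∷ bs) (x' ∷ us') (y' ∷ bs')

total : ∀ {n} → Bits n → Bits n → ℕ
total us bs = count us + count bs

total-∷ : ∀ {n} x y (us bs : Bits n) → total (x ∷ us) (y ∷ bs) ≡ (bit x + bit y) + total us bs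
total-∷ x y us bs = +-interchange (bit x) (count us) (bit y) (count bs)

total-tail : ∀ {n} x y (us bs us' bs' : Bits n) → total (x ∷ us) (y ∷ bs) ≡ total (x ∷ us') (y ∷ bs') → total us bs ≡ total us' bs'
total-tail x y us bs us' bs' e = +-cancelˡ-≡ (bit x + bit y) _ _ (trans (sym (total-∷ x y us bs)) (trans e (total-∷ x y us' bs')))

HW-unique : ∀ {n} (us bs us' bs' : Bits n) → HW us bs → HW us' bs' → SameWeight us bs us' bs' → total us bs ≡ total us' bs' → us ≡ us' × bs ≡ bs'
HW-unique [] [] [] [] h h' w e = refl , refl
HW-unique {suc n} (x ∷ us) (y ∷ bs) (x' ∷ us') (y' ∷ bs') h h' (p ∷ w) e = go x y x' y' h h' p e
  where
  rec : ∀ x y → HW (x ∷ us) (y ∷ bs) → HW (x ∷ us') (y ∷ bs') → total (x ∷ us) (y ∷ bs) ≡ total (x ∷ us') (y ∷ bs') → x ∷ us ≡ x ∷ us' × y ∷ bs ≡ y ∷ bs'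
  rec x y h h' e with HW-unique us bs us' bs' (HW-tail x y _ _ h) (HW-tail x y _ _ h') w (total-tail x y us bs us' bs' e)
  ... | refl , refl = refl , refl
  empty : ∀ (us bs : Bits n) → HW (false ∷ us) (false ∷ bs) → total us bs ≡ 0
  empty us bs h with HW-all-N us bs h
  ... | refl , refl = cong₂ _+_ (count-top0 n) (count-top0 n)
  go : ∀ x y x' y' → HW (x ∷ us) (y ∷ bs) → HW (x' ∷ us') (y' ∷ bs') → bit x + bit y' ≡ bit x' + bit y → total (x ∷ us) (y ∷ bs) ≡ total (x' ∷ us') (y' ∷ bs') →
       x ∷ us ≡ x' ∷ us' × y ∷ bs ≡ y' ∷ bs'
  go false true _ _ h h' p e = ⊥-elim (HW-no-B us bs h)
  go _ _ false true h h' p e = ⊥-elim (HW-no-B us' bs' h')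
  go true true true true h h' p e = rec true true h h' e
  go true false true false h h' p e = rec true false h h' e
  go false false false false h h' p e = rec false false h h' e
  go true true false false h h' p e with trans e (empty us' bs' h')
  ... | ()
  go false false true true h h' p e with trans (sym e) (empty us bs h)
  ... | ()
  go true true true false h h' () e
  go true false true true h h' () e
  go true false false false h h' () e
  go false false true false h h' () e

-- Columns that form a highest weight pair with the column 1 … h.
HWx : ∀ {n} → ℕ → Bits n → Bits n → Set
HWx {n} h us bs = ∀ op → 𝕂 n op .ε (us , bs) ≤ 𝕂 n op .φ (top h , top 0)

HWx-tail : ∀ {n} h x y (us bs : Bits n) → HWx (suc h) (x ∷ us) (y ∷ bs) → HWx h us bs
HWx-tail h x y us bs w (just k) = w (just (suc k))
HWx-tail h x y [] [] w nothing = z≤n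
HWx-tail zero x y (_ ∷ _) (_ ∷ _) w nothing = w nothing
HWx-tail (suc h) x y (_ ∷ _) (_ ∷ _) w nothing = w nothing

canLower-top0 : ∀ n k → canLower k (top {n} 0) ≡ 0
canLower-top0 zero k = refl
canLower-top0 (suc zero) zero = refl
canLower-top0 (suc (suc n)) zero = refl
canLower-top0 (suc n) (suc k) = canLower-top0 n k

canRaise-top0 : ∀ n k → canRaise k (top {n} 0) ≡ 0
canRaise-top0 zero k = refl
canRaise-top0 (suc zero) zero = refl
canRaise-top0 (suc (suc n)) zero = refl
canRaise-top0 (suc n) (suc k) = canRaise-top0 n k

canLowerLast-top0 : ∀ n → canLowerLast (top {n} 0) (top 0) ≡ 0
canLowerLast-top0 zero = refl
canLowerLast-top0 (suc zero) = refl
canLowerLast-top0 (suc (suc n)) = canLowerLast-top0 (suc n)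

HWx-HW : ∀ {n} (us bs : Bits n) → HWx 0 us bs → HW us bs
HWx-HW {n} us bs w (just k) = n≤0⇒n≡0 (≤-trans (w (just k)) (≤-reflexive φ0))
  where
  φ0 : canRaise k (top {n} 0) + (canLower k (top {n} 0) ∸ canLower k (top {n} 0)) ≡ 0
  φ0 rewrite canRaise-top0 n k | canLower-top0 n k = refl
HWx-HW {n} us bs w nothing = n≤0⇒n≡0 (≤-trans (w nothing) (≤-reflexive (canLowerLast-top0 n)))

cons-≡ : ∀ {n} x y {us us' bs bs' : Bits n} → us ≡ us' × bs ≡ bs' → x ∷ us ≡ x ∷ us' × y ∷ bs ≡ y ∷ bs'
cons-≡ x y (refl , refl) = refl , refl

-- Below a free index or a barred letter no pair z, z̄ can start within the first h indices.
after-free : ∀ {n} h y (us bs us' bs' : Bits n) → HWx (suc h) (false ∷ us) (y ∷ bs) → HWx (suc h) (false ∷ us') (y ∷ bs') →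
  SameWeight us bs us' bs' → total us bs ≡ total us' bs' → us ≡ us' × bs ≡ bs'
after-free zero y us bs us' bs' w w' s e =
  HW-unique us bs us' bs' (HWx-HW us bs (HWx-tail 0 false y us bs w)) (HWx-HW us' bs' (HWx-tail 0 false y us' bs' w')) s e
after-free (suc h) y [] [] [] [] w w' s e = refl , refl
after-free (suc h) y (x₁ ∷ us) (y₁ ∷ bs) (x₂ ∷ us') (y₂ ∷ bs') w w' (p ∷ s) e = go x₁ y₁ x₂ y₂ w w' p e
  where
  no-U : ∀ {us bs : Bits _} y y₁ → HWx (suc (suc h)) (false ∷ true ∷ us) (y ∷ y₁ ∷ bs) → ⊥
  no-U y y₁ w with w (just 0)
  ... | ()
  go : ∀ x₁ y₁ x₂ y₂ → HWx (suc (suc h)) (false ∷ x₁ ∷ us) (y ∷ y₁ ∷ bs) → HWx (suc (suc h)) (false ∷ x₂ ∷ us') (y ∷ y₂ ∷ bs') →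
    bit x₁ + bit y₂ ≡ bit x₂ + bit y₁ → total (x₁ ∷ us) (y₁ ∷ bs) ≡ total (x₂ ∷ us') (y₂ ∷ bs') → x₁ ∷ us ≡ x₂ ∷ us' × y₁ ∷ bs ≡ y₂ ∷ bs'
  go true y₁ _ _ w w' p e = ⊥-elim (no-U y y₁ w)
  go false _ true y₂ w w' p e = ⊥-elim (no-U y y₂ w')
  go false false false true w w' () e
  go false true false false w w' () e
  go false false false false w w' p e = cons-≡ false false (after-free h false us bs us' bs' (HWx-tail (suc h) false y _ _ w) (HWx-tail (suc h) false y _ _ w') s (total-tail false false us bs us' bs' e))
  go false true false true w w' p e = cons-≡ false true (after-free h true us bs us' bs' (HWx-tail (suc h) false y _ _ w) (HWx-tail (suc h) false y _ _ w') s (total-tail false true us bs us' bs' e))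

HWx-unique : ∀ {n} h (us bs us' bs' : Bits n) → HWx h us bs → HWx h us' bs' → pend 0 us bs ≡ 0 → pend 0 us' bs' ≡ 0 →
  SameWeight us bs us' bs' → total us bs ≡ total us' bs' → us ≡ us' × bs ≡ bs'
HWx-unique zero us bs us' bs' w w' a a' s e = HW-unique us bs us' bs' (HWx-HW us bs w) (HWx-HW us' bs' w') s e
HWx-unique (suc h) [] [] [] [] w w' a a' s e = refl , refl
HWx-unique (suc h) (x ∷ us) (y ∷ bs) (x' ∷ us') (y' ∷ bs') w w' a a' (p ∷ s) e = go x y x' y' w w' a a' p e
  where
  go : ∀ x y x' y' → HWx (suc h) (x ∷ us) (y ∷ bs) → HWx (suc h) (x' ∷ us') (y' ∷ bs') → pst x y (pend 0 us bs) ≡ 0 → pst x' y' (pend 0 us' bs') ≡ 0 →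
    bit x + bit y' ≡ bit x' + bit y → total (x ∷ us) (y ∷ bs) ≡ total (x' ∷ us') (y' ∷ bs') → x ∷ us ≡ x' ∷ us' × y ∷ bs ≡ y' ∷ bs'
  go true true _ _ w w' () a' p e
  go true false true true w w' a () p e
  go false true true true w w' a () p e
  go false false true true w w' a () p e
  go true false true false w w' a a' p e =
    cons-≡ true false (HWx-unique h us bs us' bs' (HWx-tail h true false _ _ w) (HWx-tail h true false _ _ w') a a' s (total-tail true false us bs us' bs' e))
  go true false false true w w' a a' () e
  go true false false false w w' a a' () e
  go false true true false w w' a a' () e
  go false true false true w w' a a' p e = cons-≡ false true (after-free h true us bs us' bs' w w' s (total-tail false true us bs us' bs' e))
  go false true false false w w' a a' () e
  go false false true false w w' a a' () e
  go false false false true w w' a a' () e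
  go false false false false w w' a a' p e = cons-≡ false false (after-free h false us bs us' bs' w w' s (total-tail false false us bs us' bs' e))

cancel-weights : ∀ {φc φd εc εd A B A' B'} → φc + A ≡ εc + B → φd + A' ≡ εd + B' → φc + εd ≡ φd + εc → A + B' ≡ A' + B
cancel-weights {φc} {φd} {εc} {εd} {A} {B} {A'} {B'} p q r = +-cancelˡ-≡ (φc + εd) _ _ (begin
  (φc + εd) + (A + B') ≡⟨ +-interchange φc εd A B' ⟩
  (φc + A) + (εd + B') ≡⟨ cong₂ _+_ p (sym q) ⟩
  (εc + B) + (φd + A') ≡⟨ r₁ εc B φd A' ⟩
  (φd + εc) + (A' + B) ≡⟨ cong (_+ (A' + B)) (sym r) ⟩
  (φc + εd) + (A' + B) ∎)
  where
  open ≡-Reasoning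
  r₁ : ∀ a c d f → (a + c) + (d + f) ≡ (d + a) + (f + c)
  r₁ = solve-∀

window-weight : ∀ {n} (us bs : Bits n) v w → 𝕂 (suc (suc n)) (just 0) .φ (embed us v , embed bs w) + (bit (proj₂ v) + bit (proj₁ w)) ≡
  𝕂 (suc (suc n)) (just 0) .ε (embed us v , embed bs w) + (bit (proj₁ v) + bit (proj₂ w))
window-weight us bs = all₄ refl refl refl refl refl refl refl refl refl refl refl refl refl refl refl refl

last-weight : ∀ x y → wcanLower (x , y) + bit y ≡ wcanRaise (x , y) + bit x
last-weight true true = refl
last-weight true false = refl
last-weight false true = refl
last-weight false false = refl

same-weight : ∀ {n} (us bs us' bs' : Bits n) →
  (∀ op → 𝕂 n op .φ (us , bs) + 𝕂 n op .ε (us' , bs') ≡ 𝕂 n op .φ (us' , bs') + 𝕂 n op .ε (us , bs)) → SameWeight us bs us' bs'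
same-weight [] [] [] [] h = []
same-weight (x ∷ []) (y ∷ []) (x' ∷ []) (y' ∷ []) h =
  trans (+-comm (bit x) (bit y')) (trans (sym (cancel-weights {wcanLower (x , y)} {wcanLower (x' , y')} (last-weight x y) (last-weight x' y') (h nothing))) (+-comm (bit y) (bit x'))) ∷ []
same-weight (x ∷ us@(x₂ ∷ us₂)) (y ∷ bs@(y₂ ∷ bs₂)) (x' ∷ us'@(x₂' ∷ us₂')) (y' ∷ bs'@(y₂' ∷ bs₂')) h with same-weight us bs us' bs' (λ { (just k) → h (just (suc k)) ; nothing → h nothing })
... | q ∷ s = +-cancelˡ-≡ (bit x₂ + bit y₂') _ _ (begin
  (bit x₂ + bit y₂') + (bit x + bit y') ≡⟨ cong (_+ (bit x + bit y')) q ⟩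
  (bit x₂' + bit y₂) + (bit x + bit y') ≡⟨ r₁ (bit x₂') (bit y₂) (bit x) (bit y') ⟩
  (bit x₂' + bit y') + (bit x + bit y₂) ≡⟨ sym (cancel-weights {𝕂 _ (just 0) .φ (x ∷ us , y ∷ bs)} {𝕂 _ (just 0) .φ (x' ∷ us' , y' ∷ bs')} {𝕂 _ (just 0) .ε (x ∷ us , y ∷ bs)} {𝕂 _ (just 0) .ε (x' ∷ us' , y' ∷ bs')} {bit x₂ + bit y} {bit x + bit y₂} {bit x₂' + bit y'} {bit x' + bit y₂'} (window-weight us₂ bs₂ (x , x₂) (y , y₂)) (window-weight us₂' bs₂' (x' , x₂') (y' , y₂')) (h (just 0))) ⟩
  (bit x₂ + bit y) + (bit x' + bit y₂') ≡⟨ r₂ (bit x₂) (bit y) (bit x') (bit y₂') ⟩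
  (bit x₂ + bit y₂') + (bit x' + bit y) ∎) ∷ (q ∷ s)
  where
  open ≡-Reasoning
  r₁ : ∀ a c d f → (a + c) + (d + f) ≡ (a + f) + (d + c)
  r₁ = solve-∀
  r₂ : ∀ a c d f → (a + c) + (d + f) ≡ (a + f) + (d + c)
  r₂ = solve-∀

HW-column : ∀ {n} (c : Col n) → HW (proj₁ c) (proj₂ c) → adm c → c ≡ (top (height c) , top 0)
HW-column {n} (us , bs) h a with HW-shape us bs h a
... | p , q = cong₂ _,_ (trans p (cong top (sym (trans (cong (λ z → count us + count z) q) (trans (cong (count us +_) (count-top0 n)) (+-identityʳ _)))))) q

cancel-∸ : ∀ {a c t x y} → x ≤ t → y ≤ t → a + (t ∸ x) ≡ c + (t ∸ y) → a + y ≡ c + x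
cancel-∸ {a} {c} {t} {x} {y} p q h = +-cancelˡ-≡ t _ _ (begin
  t + (a + y) ≡⟨ cong (_+ (a + y)) (sym (m∸n+n≡m p)) ⟩
  (t ∸ x + x) + (a + y) ≡⟨ r₁ (t ∸ x) x a y ⟩
  (a + (t ∸ x)) + (x + y) ≡⟨ cong (_+ (x + y)) h ⟩
  (c + (t ∸ y)) + (x + y) ≡⟨ r₂ c (t ∸ y) x y ⟩
  (t ∸ y + y) + (c + x) ≡⟨ cong (_+ (c + x)) (m∸n+n≡m q) ⟩
  t + (c + x) ∎)
  where
  open ≡-Reasoning
  r₁ : ∀ a c d f → (a + c) + (d + f) ≡ (d + a) + (c + f)
  r₁ = solve-∀
  r₂ : ∀ a c d f → (a + c) + (d + f) ≡ (c + f) + (a + d)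
  r₂ = solve-∀

highest-unique : ∀ {n} (c₂ c₁ d₂ d₁ : Col n) → adm c₂ → adm c₁ → adm d₂ → adm d₁ →
  (∀ op → 𝕂² n op .ε (c₂ , c₁) ≡ 0) → (∀ op → 𝕂² n op .ε (d₂ , d₁) ≡ 0) →
  (∀ op → 𝕂² n op .φ (c₂ , c₁) ≡ 𝕂² n op .φ (d₂ , d₁)) → height c₂ ≡ height d₂ → height c₁ ≡ height d₁ → (c₂ , c₁) ≡ (d₂ , d₁)
highest-unique {n} c₂ c₁ d₂ d₁ a₂ a₁ b₂ b₁ hc hd hφ e₂ e₁ = go (HW-column c₂ (λ op → m+n≡0⇒m≡0 _ (hc op)) a₂) (HW-column d₂ (λ op → m+n≡0⇒m≡0 _ (hd op)) b₂)
  where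
  go : c₂ ≡ (top (height c₂) , top 0) → d₂ ≡ (top (height d₂) , top 0) → (c₂ , c₁) ≡ (d₂ , d₁)
  go p q = cong₂ _,_ same (cong₂ _,_ (proj₁ main) (proj₂ main))
    where
    H = height c₂
    same : c₂ ≡ d₂
    same = trans p (trans (cong (λ z → top z , top 0) e₂) (sym q))
    wc : HWx H (proj₁ c₁) (proj₂ c₁)
    wc op = ≤-trans (m∸n≡0⇒m≤n (m+n≡0⇒n≡0 (𝕂 n op .ε c₂) (hc op))) (≤-reflexive (cong (𝕂 n op .φ) p))
    wd' : HWx H (proj₁ d₁) (proj₂ d₁)
    wd' op = ≤-trans (m∸n≡0⇒m≤n (m+n≡0⇒n≡0 (𝕂 n op .ε d₂) (hd op))) (≤-reflexive (cong (𝕂 n op .φ) (trans (sym same) p)))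
    weights : SameWeight (proj₁ c₁) (proj₂ c₁) (proj₁ d₁) (proj₂ d₁)
    weights = same-weight _ _ _ _ λ op → cancel-∸ (wc op) (wd' op)
      (trans (cong (λ z → 𝕂 n op .φ c₁ + (𝕂 n op .φ z ∸ 𝕂 n op .ε c₁)) (sym p)) (trans (hφ op) (cong (λ z → 𝕂 n op .φ d₁ + (𝕂 n op .φ z ∸ 𝕂 n op .ε d₁)) (trans (sym same) p))))
    main = HWx-unique H (proj₁ c₁) (proj₂ c₁) (proj₁ d₁) (proj₂ d₁) wc wd' a₁ b₁ weights e₁

record Crossable {n : ℕ} (k : ℕ) (c : Col n × Col n) : Set where
  field
    adm₂ : adm (proj₁ c)
    adm₁ : adm (proj₂ c)
    {gap} : ℕ
    walk : walkZ k c ≡ clo gap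

crossable-mor : ∀ {n} op k (c : Col n × Col n) → Crossable k c → Mor (𝕂² n op) (𝕂² n op) (cross k) c
crossable-mor op k c X = cross-𝕂 op k c (Crossable.adm₂ X) (Crossable.adm₁ X) (cong live (Crossable.walk X))

crossable-e : ∀ {n} op k (c : Col n × Col n) {c'} → Crossable k c → 𝕂² n op .e c ≡ just c' →
  Crossable k c' × height (proj₁ c') ≡ height (proj₁ c) × height (proj₂ c') ≡ height (proj₂ c)
crossable-e {n} op k c@(c₂ , c₁) X h = record
  { adm₂ = trans (Inv-e (Inv-⊗ˡ {𝕂 n op} {𝕂 n op} {a' = c₁} (Pend-𝕂 op c₂)) h) (Crossable.adm₂ X)
  ; adm₁ = trans (Inv-e (Inv-⊗ʳ {𝕂 n op} {𝕂 n op} {a = c₂} (Pend-𝕂 op c₁)) h) (Crossable.adm₁ X)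
  ; walk = trans (Inv-e (walkZ-𝕂 op k c) h) (Crossable.walk X) } ,
  Inv-e (Inv-⊗ˡ {𝕂 n op} {𝕂 n op} {a' = c₁} (height-𝕂 op c₂)) h , Inv-e (Inv-⊗ʳ {𝕂 n op} {𝕂 n op} {a = c₂} (height-𝕂 op c₁)) h

mapM-just⁻¹ : ∀ {A B : Set} {g : A → B} (m : Maybe A) {z} → just z ≡ mapM g m → ∃ λ a → m ≡ just a × g a ≡ z
mapM-just⁻¹ (just a) refl = a , refl , refl

cross-injective : ∀ {n} N k (c d : Col n × Col n) → pairWeight colWeight colWeight c < N → Crossable k c → Crossable k d →
  height (proj₁ c) ≡ height (proj₁ d) → height (proj₂ c) ≡ height (proj₂ d) → cross k c ≡ cross k d → c ≡ d
cross-injective {n} (suc N) k c d lt X Y e₂ e₁ h with raisable c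
... | inj₁ (op , c' , ec) with crossable-mor op k c X | crossable-mor op k d Y
...   | mc | md with mapM-just⁻¹ (𝕂² n op .e d) (trans (sym (trans (e-eq mc) (cong (mapM (cross k)) ec))) (trans (cong (𝕂² n op .e) h) (e-eq md)))
...     | d' , ed , h' with crossable-e op k c X ec | crossable-e op k d Y ed
...       | X' , p₂ , p₁ | Y' , q₂ , q₁ with cross-injective N k c' d' (≤-trans (lighter (Normal.e-raised (pair-normal n op) c ec)) (s≤s⁻¹ lt)) X' Y'
              (trans p₂ (trans e₂ (sym q₂))) (trans p₁ (trans e₁ (sym q₁))) (sym h')
...         | refl = just-injective (trans (sym (f-back (Normal.e-raised (pair-normal n op) c ec))) (f-back (Normal.e-raised (pair-normal n op) d ed)))
cross-injective {n} (suc N) k c d lt X Y e₂ e₁ h | inj₂ hc =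
  highest-unique (proj₁ c) (proj₂ c) (proj₁ d) (proj₂ d) (Crossable.adm₂ X) (Crossable.adm₁ X) (Crossable.adm₂ Y) (Crossable.adm₁ Y) hc
    (λ op → trans (sym (ε-eq (crossable-mor op k d Y))) (trans (cong (𝕂² n op .ε) (sym h)) (trans (ε-eq (crossable-mor op k c X)) (hc op))))
    (λ op → trans (sym (φ-eq (crossable-mor op k c X))) (trans (cong (𝕂² n op .φ) h) (φ-eq (crossable-mor op k d Y)))) e₂ e₁

pred-suc : ∀ {p q} → pred p ≡ suc q → p ≡ suc (suc q)
pred-suc {suc p} refl = refl

Fix-height : ∀ {n} q (us bs : Bits n) → pend 0 us bs ≡ suc q → height (us , bs) ≡ suc (suc (height (Fix (just q) (us , bs))))
Fix-height q [] [] ()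
Fix-height q (x ∷ us) (y ∷ bs) h = trans (total-∷ x y us bs) (trans (go x y q h) (cong (λ z → suc (suc z)) (sym (total-∷ (fixBit (just q) x y) (fixBit (just q) y x) (fixU (fixStep (just q) x y) us bs) (fixB (fixStep (just q) x y) us bs)))))
  where
  go : ∀ x y q → pst x y (pend 0 us bs) ≡ suc q → (bit x + bit y) + height (us , bs) ≡
    suc (suc ((bit (fixBit (just q) x y) + bit (fixBit (just q) y x)) + height (Fix (fixStep (just q) x y) (us , bs))))
  go true true zero h = cong (λ c → suc (suc (height c))) (sym (Fix-nothing us bs))
  go true true (suc q) h = cong (λ z → suc (suc z)) (Fix-height q us bs (suc-injective h))
  go true false zero h = cong suc (Fix-height 0 us bs h)
  go true false (suc q) h = cong suc (Fix-height (suc q) us bs h)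
  go false true zero h = cong suc (Fix-height 0 us bs h)
  go false true (suc q) h = cong suc (Fix-height (suc q) us bs h)
  go false false zero h = Fix-height 1 us bs (pred-suc h)
  go false false (suc q) h = Fix-height (suc (suc q)) us bs (pred-suc h)

Fix-pend : ∀ {n} q (us bs : Bits n) → pend 0 us bs ≡ suc q → Pend 0 (Fix (just q) (us , bs)) ≡ q
Fix-pend q [] [] ()
Fix-pend q (x ∷ us) (y ∷ bs) h = go x y q h
  where
  go : ∀ x y q → pst x y (pend 0 us bs) ≡ suc q → pst (fixBit (just q) x y) (fixBit (just q) y x) (Pend 0 (Fix (fixStep (just q) x y) (us , bs))) ≡ q
  go true true zero h = cong pred (trans (cong (Pend 0) (Fix-nothing us bs)) (suc-injective h))
  go true true (suc q) h = cong suc (Fix-pend q us bs (suc-injective h))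
  go true false zero h = Fix-pend 0 us bs h
  go true false (suc q) h = Fix-pend (suc q) us bs h
  go false true zero h = Fix-pend 0 us bs h
  go false true (suc q) h = Fix-pend (suc q) us bs h
  go false false zero h = cong pred (Fix-pend 1 us bs (pred-suc h))
  go false false (suc q) h = cong pred (Fix-pend (suc (suc q)) us bs (pred-suc h))

tails : ∀ {n x y x' y'} {us bs us' bs' : Bits n} → (Col (suc n) ∋ (x ∷ us , y ∷ bs)) ≡ (x' ∷ us' , y' ∷ bs') → x ≡ x' × y ≡ y' × (Col n ∋ (us , bs)) ≡ (us' , bs')
tails refl = refl , refl , refl

cons : ∀ {n} x y {us bs us' bs' : Bits n} → (Col n ∋ (us , bs)) ≡ (us' , bs') → (Col (suc n) ∋ (x ∷ us , y ∷ bs)) ≡ (x ∷ us' , y ∷ bs')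
cons x y refl = refl

Fix-injective : ∀ {n} q (us bs us' bs' : Bits n) → pend 0 us bs ≡ suc q → pend 0 us' bs' ≡ suc q →
  Fix (just q) (us , bs) ≡ Fix (just q) (us' , bs') → (us , bs) ≡ (us' , bs')
Fix-injective q [] [] [] [] h h' e = refl
Fix-injective q (x ∷ us) (y ∷ bs) (x' ∷ us') (y' ∷ bs') h h' e = go q x y x' y' h h' (tails e)
  where
  -- The deletion at z = 0 leaves an admissible rest, a free index there does not.
  clash : ∀ {us bs us' bs' : Bits _} → suc (pend 0 us bs) ≡ 1 → pred (pend 0 us' bs') ≡ 1 → Fix nothing (us , bs) ≡ Fix (just 1) (us' , bs') → ⊥
  clash {us} {bs} {us'} {bs'} h h' e with trans (sym (Fix-pend 1 us' bs' (pred-suc h'))) (trans (cong (Pend 0) (sym e)) (trans (cong (Pend 0) (Fix-nothing us bs)) (suc-injective h)))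
  ... | ()
  go : ∀ q x y x' y' → pst x y (pend 0 us bs) ≡ suc q → pst x' y' (pend 0 us' bs') ≡ suc q →
    fixBit (just q) x y ≡ fixBit (just q) x' y' × fixBit (just q) y x ≡ fixBit (just q) y' x' × Fix (fixStep (just q) x y) (us , bs) ≡ Fix (fixStep (just q) x' y') (us' , bs') →
    (x ∷ us , y ∷ bs) ≡ (x' ∷ us' , y' ∷ bs')
  go zero true true true true h h' (_ , _ , e) = cons true true (trans (sym (Fix-nothing us bs)) (trans e (Fix-nothing us' bs')))
  go (suc q) true true true true h h' (_ , _ , e) = cons true true (Fix-injective q us bs us' bs' (suc-injective h) (suc-injective h') e)
  go zero true false true false h h' (_ , _ , e) = cons true false (Fix-injective zero us bs us' bs' h h' e)
  go (suc q) true false true false h h' (_ , _ , e) = cons true false (Fix-injective (suc q) us bs us' bs' h h' e)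
  go zero false true false true h h' (_ , _ , e) = cons false true (Fix-injective zero us bs us' bs' h h' e)
  go (suc q) false true false true h h' (_ , _ , e) = cons false true (Fix-injective (suc q) us bs us' bs' h h' e)
  go zero false false false false h h' (_ , _ , e) = cons false false (Fix-injective 1 us bs us' bs' (pred-suc h) (pred-suc h') e)
  go (suc q) false false false false h h' (_ , _ , e) = cons false false (Fix-injective (suc (suc q)) us bs us' bs' (pred-suc h) (pred-suc h') e)
  go zero true true false false h h' (_ , _ , e) = ⊥-elim (clash h h' e)
  go zero false false true true h h' (_ , _ , e) = ⊥-elim (clash h' h (sym e))
  go zero true true true false h h' (() , _)
  go zero true true false true h h' (_ , () , _)
  go zero true false true true h h' (() , _)
  go zero true false false true h h' (() , _)
  go zero true false false false h h' (() , _)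
  go zero false true true true h h' (_ , () , _)
  go zero false true true false h h' (() , _)
  go zero false true false false h h' (_ , () , _)
  go zero false false true false h h' (() , _)
  go zero false false false true h h' (_ , () , _)
  go (suc q) true true true false h h' (_ , () , _)
  go (suc q) true true false true h h' (() , _)
  go (suc q) true true false false h h' (() , _)
  go (suc q) true false true true h h' (_ , () , _)
  go (suc q) true false false true h h' (() , _)
  go (suc q) true false false false h h' (() , _)
  go (suc q) false true true true h h' (() , _)
  go (suc q) false true true false h h' (() , _)
  go (suc q) false true false false h h' (_ , () , _)
  go (suc q) false false true true h h' (() , _)
  go (suc q) false false true false h h' (() , _)
  go (suc q) false false false true h h' (_ , () , _)

none-or-one : ∀ {p} → p ≤ 1 → p ≡ 0 ⊎ p ≡ 1
none-or-one {zero} _ = inj₁ refl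
none-or-one {suc zero} _ = inj₂ refl
none-or-one {suc (suc _)} (s≤s ())

m≢2+m : ∀ m → m ≢ suc (suc m)
m≢2+m m e = <⇒≢ (n≤1+n (suc m)) e

mixed : ∀ {n} (c : Col n) (us bs : Bits n) → adm c → pend 0 us bs ≡ 1 → height c ≡ height (us , bs) → fixed c ≡ fixed (us , bs) → ⊥
mixed c us bs a p h e = m≢2+m (height c) (trans h (trans (Fix-height 0 us bs p) (cong (λ z → suc (suc (height z))) (trans (sym e) (fixed-adm c a)))))

fixed-injective : ∀ {n} (c d : Col n) → Pend 0 c ≤ 1 → Pend 0 d ≤ 1 → height c ≡ height d → fixed c ≡ fixed d → c ≡ d
fixed-injective c@(us , bs) d@(us' , bs') p q h e with none-or-one p | none-or-one q
... | inj₁ a | inj₁ a' = trans (sym (fixed-adm c a)) (trans e (fixed-adm d a'))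
... | inj₂ a | inj₂ a' = Fix-injective 0 us bs us' bs' a a' e
... | inj₁ a | inj₂ a' = ⊥-elim (mixed c us' bs' a a' h e)
... | inj₂ a | inj₁ a' = ⊥-elim (mixed d us bs a' a (sym h) (sym e))

-- A tableau whose leftmost column results from a crossing; no further column needs the fix.
Settled : ∀ {n m} → ℕ → Vec ℕ m → Tab n (suc m) → Set
Settled {n} o gs (t , c) = ∃ λ (c₀ : Col n) → ∃ λ i → RDrop i c₀ c × adm c × Good o gs (t , c₀)

Settled-Punctured : ∀ {n m} o (gs : Vec ℕ m) (t : Tab n (suc m)) → Settled o gs t → Punctured o gs t
Settled-Punctured o gs (t , c) (c₀ , i , r , a , G) = Crossing-next gs G a r

crossing-settled : ∀ {n m} o g (gs : Vec ℕ m) (t : Tab n m) (c₂ c₁ : Col n) → adm c₁ → Good g gs (t , c₂) → ∀ {h} → walkZ (o ∸ g) (c₂ , c₁) ≡ clo h →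
  Settled g gs (t , proj₁ (cross (o ∸ g) (c₂ , c₁)))
crossing-settled o g gs t c₂ c₁ a₁ G h = c₂ , _ , proj₂ R , proj₁ R , G
  where
  R = crossing-rdrop (Good-adm gs G) (crossing (o ∸ g) (c₂ , c₁) (Good-adm gs G) a₁ h)

crossed-adm : ∀ {n i j} k (c₂ c₁ c₀ : Col n) → adm c₁ → RDrop i c₀ c₁ → walkZ k (c₂ , c₀) ≡ opn j → ∀ {g} → walkZ k (c₂ , c₁) ≡ clo g →
  adm (proj₂ (cross k (c₂ , c₁)))
crossed-adm k c₂@(us₂ , bs₂) c₁@(us₁ , bs₁) c₀ a₁ r h₀ h with crossBy k (c₂ , c₁) h
... | byU cl ce = trans (cong (λ z → Pend 0 (proj₂ z)) ce) (middle-adm {c₃ = c₂} a₁ r h₀ cl)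
... | byB j wk ce = trans (cong (λ z → Pend 0 (proj₂ z)) ce) (adm-Φ⁻¹ (uS 0 us₁ bs₁) _
  (qend-insert 0 k us₂ bs₂ (uS 0 us₁ bs₁) (bS 0 us₁ bs₁) (trans (cong (walkU (opn k) (uS 0 us₂ bs₂)) (proj₁ (Φ⁻¹-Φ us₁ bs₁ a₁))) wk)
    (subst Closed (trans (sym h) (cong (λ l → walkB l bs₂ (bS 0 us₁ bs₁)) wk)) clo-closed) (proj₂ (proj₂ (Φ⁻¹-Φ us₁ bs₁ a₁)))))

size : ∀ {n m} → Tab n m → ℕ
size {m = m} t = length (tabWord m t)

size-∷ : ∀ {n m} (t : Tab n m) (c : Col n) → size {m = suc m} (t , c) ≡ size t + height c
size-∷ {m = m} t c = trans (length-++ (tabWord m t)) (cong (size t +_) (length-wd c))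

size-heights : ∀ {n} m (t s : Tab n m) → heights t ≡ heights s → size t ≡ size s
size-heights zero t s h = refl
size-heights (suc m) (t , c) (s , d) h =
  trans (size-∷ t c) (trans (cong₂ _+_ (size-heights m t s (cong Data.Vec.tail h)) (cong Data.Vec.head h)) (sym (size-∷ s d)))

run-size : ∀ {n m} o (gs : Vec ℕ m) (t : Tab n (suc m)) → Settled o gs t → size (run o gs t) ≡ size t
run-size o [] t S = refl
run-size {n} {suc m} o (g ∷ gs) t@((t' , c₂) , c₁) S@(c₀ , i , r , a₁ , (_ , (k , w₀) , G)) = go (walkZ (o ∸ g) (c₂ , c₁)) refl
  where
  go : ∀ l → walkZ (o ∸ g) (c₂ , c₁) ≡ l → size (run o (g ∷ gs) t) ≡ size t
  go over h with trans (sym (proj₁ (proj₂ (Settled-Punctured o (g ∷ gs) t S)))) (cong live h)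
  ... | ()
  go (opn j) h = cong size (run-open o g gs t' c₂ c₁ h)
  go (clo j) h = trans (cong size (run-clo o g gs t' c₂ c₁ h)) (trans (size-∷ (run g gs (t' , c₂')) (fixed c₁'))
      (trans (cong₂ _+_ (run-size g gs (t' , c₂') (crossing-settled o g gs t' c₂ c₁ a₁ G h)) (cong height (fixed-adm c₁' (crossed-adm (o ∸ g) c₂ c₁ c₀ a₁ r w₀ h))))
        (trans (cong (_+ height c₁') (size-∷ t' c₂')) (trans (cong (size t' + height c₂' +_) (proj₂ H)) (trans (+-suc (size t' + height c₂') (height c₁))
          (trans (cong (_+ height c₁) (trans (sym (+-suc (size t') (height c₂'))) (trans (cong (size t' +_) (sym (proj₁ H))) (sym (size-∷ t' c₂))))) (sym (size-∷ (t' , c₂) c₁))))))))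
    where
    c₂' = proj₁ (cross (o ∸ g) (c₂ , c₁))
    c₁' = proj₂ (cross (o ∸ g) (c₂ , c₁))
    H = crossing-height (Good-adm gs G) a₁ (crossing (o ∸ g) (c₂ , c₁) (Good-adm gs G) a₁ h)

pend-pair : ∀ {n} j (us bs : Bits n) {q} → pend 0 us bs ≡ suc q → ∃ λ i → j ≤ i × u i ∈ uL j us × b i ∈ bL j bs
pend-pair j [] [] ()
pend-pair j (true ∷ us) (true ∷ bs) h = j , ≤-refl , here refl , ∈-++⁺ʳ (bL (suc j) bs) (here refl)
pend-pair j (true ∷ us) (false ∷ bs) h with pend-pair (suc j) us bs h
... | i , le , m , m' = i , <⇒≤ le , there m , ∈-++⁺ˡ m'
pend-pair j (false ∷ us) (true ∷ bs) h with pend-pair (suc j) us bs h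
... | i , le , m , m' = i , <⇒≤ le , m , ∈-++⁺ˡ m'
pend-pair j (false ∷ us) (false ∷ bs) h with pend-pair (suc j) us bs (pred-suc h)
... | i , le , m , m' = i , <⇒≤ le , m , ∈-++⁺ˡ m'

bS-below : ∀ {n} j (us bs : Bits n) {z} → b z ∈ bL j (bS 0 us bs) → ∃ λ i → z ≤ i × b i ∈ bL j bs
bS-below j [] [] ()
bS-below j (x ∷ us) (y ∷ bs) {z} m with ∈-++⁻ (bL (suc j) (bS 0 us bs)) m
... | inj₁ m' with bS-below (suc j) us bs m'
...   | i , le , m'' = i , le , ∈-++⁺ˡ m''
bS-below j (x ∷ us) (y ∷ bs) m | inj₂ m' with ∈-opt m'
... | refl , e = go x y (pend 0 us bs) refl e
  where
  go : ∀ x y p → pend 0 us bs ≡ p → bb x y p ≡ true → ∃ λ i → j ≤ i × b i ∈ bL (suc j) bs ++ opt y (b j)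
  go false true p h e = j , ≤-refl , ∈-++⁺ʳ (bL (suc j) bs) (here refl)
  go false false (suc p) h e with pend-pair (suc j) us bs h
  ... | i , le , _ , m = i , <⇒≤ le , ∈-++⁺ˡ m

uS-above : ∀ {n} j (us bs : Bits n) {z} → u z ∈ uL j (uS 0 us bs) → ∃ λ i → z ≤ i × u i ∈ uL j us
uS-above j [] [] ()
uS-above j (x ∷ us) (y ∷ bs) {z} m with ∈-++⁻ (opt (ub x y (pend 0 us bs)) (u j)) m
... | inj₂ m' with uS-above (suc j) us bs m'
...   | i , le , m'' = i , le , ∈-++⁺ʳ (opt x (u j)) m''
uS-above j (x ∷ us) (y ∷ bs) m | inj₁ m' with ∈-opt m'
... | refl , e = go x y (pend 0 us bs) refl e
  where
  go : ∀ x y p → pend 0 us bs ≡ p → ub x y p ≡ true → ∃ λ i → j ≤ i × u i ∈ opt x (u j) ++ uL (suc j) us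
  go true false p h e = j , ≤-refl , here refl
  go false false (suc p) h e with pend-pair (suc j) us bs h
  ... | i , le , m , _ = i , <⇒≤ le , m

u-step : ∀ {i j} → i ≤ j → u i ≡ u j ⊎ u i ≺ u j
u-step le with m≤n⇒m<n∨m≡n le
... | inj₁ lt = inj₂ (u≺u lt)
... | inj₂ refl = inj₁ refl

b-step : ∀ {i j} → i ≤ j → b j ≡ b i ⊎ b j ≺ b i
b-step le with m≤n⇒m<n∨m≡n le
... | inj₁ lt = inj₂ (b≺b lt)
... | inj₂ refl = inj₁ refl

rCols-below : ∀ {n} (c : Col n) {r} → r ∈ wd (rCols c) → ∃ λ y → y ∈ wd c × (y ≡ r ⊎ y ≺ r)
rCols-below (us , bs) {r} m with ∈-++⁻ (uL 1 us) m
... | inj₁ m' = r , ∈-++⁺ˡ m' , inj₁ refl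
... | inj₂ m' with ∈-bL 1 (bS 0 us bs) m'
...   | z , refl , _ with bS-below 1 us bs m'
...     | i , le , m'' = b i , ∈-++⁺ʳ (uL 1 us) m'' , b-step le

lCols-above : ∀ {n} (c : Col n) {l} → l ∈ wd (lCols c) → ∃ λ y → y ∈ wd c × (l ≡ y ⊎ l ≺ y)
lCols-above (us , bs) {l} m with ∈-++⁻ (uL 1 (uS 0 us bs)) m
... | inj₂ m' = l , ∈-++⁺ʳ (uL 1 us) m' , inj₁ refl
... | inj₁ m' with ∈-uL 1 (uS 0 us bs) m'
...   | z , refl , _ with uS-above 1 us bs m'
...     | i , le , m'' = u i , ∈-++⁺ˡ m'' , u-step le

lookup-∈ : {A : Set} (L : List A) {p : ℕ} {x : A} → lookupM L p ≡ just x → x ∈ L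
lookup-∈ (x ∷ L) {zero} refl = here refl
lookup-∈ (x ∷ L) {suc p} h = there (lookup-∈ L h)

-- In the open case some letter of rC₁ is at most one of lC₂, so C₁ does not lie above C₂.
open-overlap : ∀ {n} k (c₂ c₁ : Col n) {j} → adm c₂ → walkZ k (c₂ , c₁) ≡ opn j → k < height c₂ →
  (∀ {x y} → x ∈ wd c₂ → y ∈ wd c₁ → x ≺ y) → ⊥
open-overlap k c₂ c₁ a h lt sep with lookup-just (wd (lCols c₂)) {k} (≤-trans lt (≤-reflexive (sym (wd-l-length c₂ a))))
... | l , el with firstFail-none (wd (rCols c₁)) (drop k (wd (lCols c₂))) {0} (firstFail-open k c₂ c₁ h)
                    (trans (lookup-drop k (wd (lCols c₂)) 0) (trans (cong (lookupM (wd (lCols c₂))) (+-identityʳ k)) el))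
...   | r , er , le with rCols-below c₁ (lookup-∈ (wd (rCols c₁)) er) | lCols-above c₂ (lookup-∈ (wd (lCols c₂)) el)
...     | y , y∈ , y≼ | x , x∈ , x≼ = ≤L-≻ le (join x≼ (sep x∈ y∈) y≼)
  where
  join : ∀ {l x y r} → l ≡ x ⊎ l ≺ x → x ≺ y → y ≡ r ⊎ y ≺ r → l ≺ r
  join (inj₁ refl) p (inj₁ refl) = p
  join (inj₁ refl) p (inj₂ q) = ≺-trans p q
  join (inj₂ o) p (inj₁ refl) = ≺-trans o p
  join (inj₂ o) p (inj₂ q) = ≺-trans (≺-trans o p) q

split-at : ∀ (xs xs' : Word) {ys ys'} → length xs ≡ length xs' → xs ++ ys ≡ xs' ++ ys' → xs ≡ xs' × ys ≡ ys'
split-at [] [] h e = refl , e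
split-at (x ∷ xs) (x' ∷ xs') h e with ∷-injective e
... | refl , e' with split-at xs xs' (suc-injective h) e'
...   | refl , e'' = refl , e''

last-letter : ∀ (V W Y Z : Word) → length W ≡ suc (length V) → W ++ Y ≡ V ++ Z → ∃ λ x → W ≡ V ++ x ∷ [] × Z ≡ x ∷ Y
last-letter [] (x ∷ []) Y Z h e = x , refl , sym e
last-letter (v ∷ V) (w ∷ W) Y Z h e with ∷-injective e
... | refl , e' with last-letter V W Y Z (suc-injective h) e'
...   | x , p , q = x , cong (v ∷_) p , q

below-last : ∀ (A V : Word) {B x} → Sorted B → A ++ B ≡ V ++ x ∷ [] → ∀ {z} → z ∈ B → z ≡ x ⊎ z ≺ x
below-last [] V so refl m with ∈-++⁻ V m
... | inj₁ m' = inj₂ (Sorted-++⁻ V so m' (here refl))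
... | inj₂ (here e) = inj₁ e
below-last (a ∷ A) [] {B} so e m with ++-conicalʳ A B (proj₂ (∷-injective e))
below-last (a ∷ A) [] so e () | refl
below-last (a ∷ A) (v ∷ V) so e m = below-last A V so (proj₂ (∷-injective e)) m

-- If only one of two tableaux crosses its first two columns, the last letter of
-- the second column of the other one would be smaller than its first column.
mixed-walks : ∀ {n m} o g (gs : Vec ℕ m) (t s : Tab n m) (c₂ c₁ d₂ d₁ : Col n) {h j} →
  Punctured o (g ∷ gs) ((t , c₂) , c₁) → Punctured o (g ∷ gs) ((s , d₂) , d₁) →
  walkZ (o ∸ g) (c₂ , c₁) ≡ clo h → walkZ (o ∸ g) (d₂ , d₁) ≡ opn j → heights t ≡ heights s → height c₂ ≡ height d₂ →
  tabWord (suc (suc m)) (run o (g ∷ gs) ((t , c₂) , c₁)) ≡ tabWord (suc (suc m)) (run o (g ∷ gs) ((s , d₂) , d₁)) → ⊥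
mixed-walks {n} {m} o g gs t s c₂ c₁ d₂ d₁ {h} {j} (a₁ , _ , G) (b₁ , _ , G') wc wd' ht h₂ eq = parted (last-letter V W (wd d₁) (wd (fixed c₁')) W≡ words)
  where
  k = o ∸ g
  a₂ = Good-adm gs G
  c₂' = proj₁ (cross k (c₂ , c₁))
  c₁' = proj₂ (cross k (c₂ , c₁))
  H = crossing-height a₂ a₁ (crossing k (c₂ , c₁) a₂ a₁ wc)
  V = tabWord (suc m) (run g gs (t , c₂'))
  W = tabWord (suc m) (s , d₂)
  W≡ : length W ≡ suc (length V)
  W≡ = trans (size-∷ s d₂) (trans (cong₂ _+_ (sym (size-heights m t s ht)) (trans (sym h₂) (proj₁ H))) (trans (+-suc (size t) (height c₂'))
    (cong suc (sym (trans (run-size g gs (t , c₂') (crossing-settled o g gs t c₂ c₁ a₁ G wc)) (size-∷ t c₂'))))))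
  words : W ++ wd d₁ ≡ V ++ wd (fixed c₁')
  words = trans (cong (tabWord (suc (suc m))) (sym (run-open o g gs s d₂ d₁ wd'))) (trans (sym eq) (cong (tabWord (suc (suc m))) (run-clo o g gs t c₂ c₁ wc)))
  open-index : k < height d₂
  open-index with crossData k c₂ c₁ a₂ a₁ wc
  ... | D with trans (sym (lookup-drop k (wd (lCols c₂)) (CrossData.position D))) (proj₁ (firstFail-at (wd (rCols c₁)) (drop k (wd (lCols c₂))) (CrossData.failure D)))
  ...   | e = ≤-trans (s≤s (m≤m+n k (CrossData.position D))) (≤-trans (lookup-< (wd (lCols c₂)) e) (≤-reflexive (trans (wd-l-length c₂ a₂) h₂)))
  parted : (∃ λ x → W ≡ V ++ x ∷ [] × wd (fixed c₁') ≡ x ∷ wd d₁) → ⊥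
  parted (x , p , q) = open-overlap k d₂ d₁ (Good-adm gs G') wd' open-index sep
    where
    sorted-x : All (x ≺_) (wd d₁)
    sorted-x with subst Sorted q (wd-sorted (fixed c₁'))
    ... | al ∷ _ = al
    sep : ∀ {z y} → z ∈ wd d₂ → y ∈ wd d₁ → z ≺ y
    sep mz my with below-last (tabWord m s) V (wd-sorted d₂) p mz
    ... | inj₁ refl = lookupAll sorted-x my
    ... | inj₂ lt = ≺-trans lt (lookupAll sorted-x my)

split-at-end : ∀ {xs xs'} (ys ys' : Word) → length ys ≡ length ys' → xs ++ ys ≡ xs' ++ ys' → xs ≡ xs' × ys ≡ ys'
split-at-end {xs} {xs'} ys ys' h e = split-at xs xs' (+-cancelʳ-≡ (length ys) _ _ (trans (sym (length-++ xs)) (trans (cong length e) (trans (length-++ xs') (cong (length xs' +_) (sym h)))))) e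

tabWord-injective : ∀ {n} m (t s : Tab n m) → heights t ≡ heights s → tabWord m t ≡ tabWord m s → t ≡ s
tabWord-injective zero tt tt h e = refl
tabWord-injective (suc m) (t , c) (s , d) h e with split-at (tabWord m t) (tabWord m s) (size-heights m t s (cong Data.Vec.tail h)) e
... | p , q = cong₂ _,_ (tabWord-injective m t s (cong Data.Vec.tail h) p) (wd-injective c d q)

run-injective : ∀ {n m} o (gs : Vec ℕ m) (t s : Tab n (suc m)) → Punctured o gs t → Punctured o gs s → heights t ≡ heights s →
  tabWord (suc m) (run o gs t) ≡ tabWord (suc m) (run o gs s) → t ≡ s
run-injective {m = zero} o [] t s P Q ht e = tabWord-injective 1 t s ht e
run-injective {n} {suc m} o (g ∷ gs) t@((t' , c₂) , c₁) s@((s' , d₂) , d₁) P@(a₁ , lv , G) Q@(b₁ , lv' , G') ht e = go (walkZ k (c₂ , c₁)) (walkZ k (d₂ , d₁)) refl refl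
  where
  k = o ∸ g
  h₁ : height c₁ ≡ height d₁
  h₁ = cong Data.Vec.head ht
  h₂ : height c₂ ≡ height d₂
  h₂ = cong (λ v → Data.Vec.head (Data.Vec.tail v)) ht
  ht' : heights t' ≡ heights s'
  ht' = cong (λ v → Data.Vec.tail (Data.Vec.tail v)) ht
  go : ∀ l l' → walkZ k (c₂ , c₁) ≡ l → walkZ k (d₂ , d₁) ≡ l' → t ≡ s
  go over l' p q with trans (sym lv) (cong live p)
  ... | ()
  go l over p q with trans (sym lv') (cong live q)
  ... | ()
  go (opn _) (opn _) p q = tabWord-injective (suc (suc m)) t s ht
    (trans (cong (tabWord (suc (suc m))) (sym (run-open o g gs t' c₂ c₁ p))) (trans e (cong (tabWord (suc (suc m))) (run-open o g gs s' d₂ d₁ q))))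
  go (clo _) (opn _) p q = ⊥-elim (mixed-walks o g gs t' s' c₂ c₁ d₂ d₁ P Q p q ht' h₂ e)
  go (opn _) (clo _) p q = ⊥-elim (mixed-walks o g gs s' t' d₂ d₁ c₂ c₁ Q P q p (sym ht') (sym h₂) (sym e))
  go (clo _) (clo _) p q = finish' (split-at _ _ sizes words)
    where
    c₂' = proj₁ (cross k (c₂ , c₁))
    c₁' = proj₂ (cross k (c₂ , c₁))
    d₂' = proj₁ (cross k (d₂ , d₁))
    d₁' = proj₂ (cross k (d₂ , d₁))
    Hc = crossing-height (Good-adm gs G) a₁ (crossing k (c₂ , c₁) (Good-adm gs G) a₁ p)
    Hd = crossing-height (Good-adm gs G') b₁ (crossing k (d₂ , d₁) (Good-adm gs G') b₁ q)
    h₂' : height c₂' ≡ height d₂'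
    h₂' = suc-injective (trans (sym (proj₁ Hc)) (trans h₂ (proj₁ Hd)))
    h₁' : height c₁' ≡ height d₁'
    h₁' = trans (proj₂ Hc) (trans (cong suc h₁) (sym (proj₂ Hd)))
    Nc = cross-next o g gs t' c₂ c₁ a₁ G p
    Nd = cross-next o g gs s' d₂ d₁ b₁ G' q
    hts : heights {m = suc m} (t' , c₂') ≡ heights {m = suc m} (s' , d₂')
    hts = cong₂ Data.Vec._∷_ h₂' ht'
    words : tabWord (suc m) (run g gs (t' , c₂')) ++ wd (fixed c₁') ≡ tabWord (suc m) (run g gs (s' , d₂')) ++ wd (fixed d₁')
    words = trans (cong (tabWord (suc (suc m))) (sym (run-clo o g gs t' c₂ c₁ p))) (trans e (cong (tabWord (suc (suc m))) (run-clo o g gs s' d₂ d₁ q)))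
    sizes : size (run g gs (t' , c₂')) ≡ size (run g gs (s' , d₂'))
    sizes = trans (run-size g gs _ (crossing-settled o g gs t' c₂ c₁ a₁ G p)) (trans (size-heights (suc m) (t' , c₂') (s' , d₂') hts) (sym (run-size g gs _ (crossing-settled o g gs s' d₂ d₁ b₁ G' q))))
    crossable : ∀ {c₂ c₁ h} → adm c₂ → adm c₁ → walkZ k (c₂ , c₁) ≡ clo h → Crossable k (c₂ , c₁)
    crossable a a' w = record { adm₂ = a ; adm₁ = a' ; walk = w }
    finish' : tabWord (suc m) (run g gs (t' , c₂')) ≡ tabWord (suc m) (run g gs (s' , d₂')) × wd (fixed c₁') ≡ wd (fixed d₁') → t ≡ s
    finish' (x , y) with run-injective g gs (t' , c₂') (s' , d₂') (proj₁ Nc) (proj₁ Nd) hts x | fixed-injective c₁' d₁' (proj₂ Nc) (proj₂ Nd) h₁' (wd-injective _ _ y)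
    ... | r | r' with cross-injective _ k (c₂ , c₁) (d₂ , d₁) (n<1+n _) (crossable (Good-adm gs G) a₁ p) (crossable (Good-adm gs G') b₁ q) h₂ h₁ (cong₂ _,_ (cong proj₂ r) r')
    ...   | r'' = cong₂ _,_ (cong₂ _,_ (cong proj₁ r) (cong proj₁ r'')) (cong proj₂ r'')

slide-injective : ∀ {n m} j o (gs : Vec ℕ m) (t s : Tab n (suc m)) → Corner j o gs → Good o gs t → Good o gs s → heights t ≡ heights s →
  tabWord (suc m) (slide j o gs t) ≡ tabWord (suc m) (slide j o gs s) → t ≡ s
slide-injective zero o gs t s C G G' h e = run-injective (o ∸ 1) gs t s (Good-Punctured o gs t C G) (Good-Punctured o gs s C G') h e
slide-injective {m = suc m} (suc j) o (g ∷ gs) (t , c) (s , d) C (_ , _ , G) (_ , _ , G') h e with split-at-end (wd c) (wd d) (trans (length-wd c) (trans (cong Data.Vec.head h) (sym (length-wd d)))) e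
... | p , q = cong₂ _,_ (slide-injective j g gs t s C G G' (cong Data.Vec.tail h) p) (wd-injective c d q)

operator : ∀ {n} i → 1 ≤ i → i ≤ n → ∃ (IsOp n i)
operator (suc k) 1≤i le with m≤n⇒m<n∨m≡n le
... | inj₁ lt = just k , inner k refl lt
... | inj₂ refl = nothing , outer refl 1≤i

heights-toList : ∀ {m} (hs ks : Vec ℕ m) → toList hs ≡ toList ks → hs ≡ ks
heights-toList [] [] h = refl
heights-toList (x ∷ hs) (y ∷ ks) h with Data.List.Properties.∷-injective h
... | refl , e = cong (x ∷_) (heights-toList hs ks e)

Fit-heights : ∀ {n m} (gs : Vec ℕ m) (t s : Tab n m) → heights t ≡ heights s → Fit gs s → Fit gs t
Fit-heights [] t s h F = _
Fit-heights {n} (g ∷ gs) (t , c) (s , d) h (le , F) = subst (λ z → g + z ≤ n) (sym (cong Data.Vec.head h)) le , Fit-heights gs t s (cong Data.Vec.tail h) F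

module _ {n : ℕ} {lam mu : Vec ℕ n} {r j : ℕ} (P : Prepared n lam mu j) where
  open Prepared P

  Ξ : Word → Word
  Ξ = Xi n lam mu (r , j)

  Ξ-tab : ∀ {t} → InShape P t → Ξ (tabWord (suc m) t) ≡ tabWord (suc m) (slide j o gs t)
  Ξ-tab {t} S = Xi-word {n} {lam} {mu} {r} {j} {m} {o} {gs} shape t (InShape.good S) (InShape.fit S) (InShape.heights≡ S)

  Ξ-injective : ∀ w v → InU n lam mu w → InU n lam mu v → Ξ w ≡ Ξ v → w ≡ v
  Ξ-injective w v iw iv e with InU-tab P iw | InU-tab P iv
  ... | t , S , refl | s , S' , refl = cong (tabWord (suc m)) (slide-injective j o gs t s (Shape.corner shape) (InShape.good S) (InShape.good S')
    (heights-toList _ _ (trans (InShape.heights≡ S) (sym (InShape.heights≡ S')))) (trans (sym (Ξ-tab S)) (trans e (Ξ-tab S'))))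

  moved : ∀ {t t'} → InShape P t → Good o gs t' → heights t' ≡ heights t → InShape P t'
  moved {t} {t'} S G h = record
    { good = G ; fit = Fit-heights (o ∷ gs) t' t h (InShape.fit S) ; heights≡ = trans (cong toList h) (InShape.heights≡ S) }

  private
    commute : (a : Maybe (Tab n (suc m))) → (∀ {t'} → a ≡ just t' → InShape P t') → mapM Ξ (mapM (tabWord (suc m)) a) ≡ mapM (λ t → tabWord (suc m) (slide j o gs t)) a
    commute nothing h = refl
    commute (just t') h = cong just (Ξ-tab (h refl))

  module _ {i : ℕ} {op : Op} (I : IsOp n i op) where
    Ξ-mor : ∀ {t} → InShape P t → Mor (𝕋 n op (suc m)) (𝕎 n i) (λ t → tabWord (suc m) (slide j o gs t)) t
    Ξ-mor {t} S = Mor-∘ (tabWord-mor I (suc m) (slide j o gs t)) (slide-mor op j o gs t (Shape.corner shape) (InShape.good S))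

    Ξ-eW : ∀ w → InU n lam mu w → mapM Ξ (eW n i w) ≡ eW n i (Ξ w)
    Ξ-eW w iw with InU-tab P iw
    ... | t , S , refl = trans (cong (mapM Ξ) (e-eq (tabWord-mor I (suc m) t)))
      (trans (commute (e (𝕋 n op (suc m)) t) (λ q → moved S (Good-e op o gs t (InShape.good S) q) (Inv-e (heights-inv op (suc m) t) q)))
        (trans (sym (e-eq (Ξ-mor S))) (cong (eW n i) (sym (Ξ-tab S)))))

    Ξ-fW : ∀ w → InU n lam mu w → mapM Ξ (fW n i w) ≡ fW n i (Ξ w)
    Ξ-fW w iw with InU-tab P iw
    ... | t , S , refl = trans (cong (mapM Ξ) (f-eq (tabWord-mor I (suc m) t)))
      (trans (commute (f (𝕋 n op (suc m)) t) (λ q → moved S (Good-f op o gs t (InShape.good S) q) (Inv-f (heights-inv op (suc m) t) q)))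
        (trans (sym (f-eq (Ξ-mor S))) (cong (fW n i) (sym (Ξ-tab S)))))

theorem6p21 : (n : ℕ) (lam mu : Vec ℕ n) → (∀ (i : Fin n) → lookup mu i ≤ lookup lam i) →
    (c : ℕ × ℕ) → InnerCorner n lam mu c →
    ((w v : Word) → InU n lam mu w → InU n lam mu v → Xi n lam mu c w ≡ Xi n lam mu c v → w ≡ v)
    × ((i : ℕ) → 1 ≤ i → i ≤ n → (w : Word) → InU n lam mu w →
        (Data.Maybe.map (Xi n lam mu c) (eW n i w) ≡ eW n i (Xi n lam mu c w))
        × (Data.Maybe.map (Xi n lam mu c) (fW n i w) ≡ fW n i (Xi n lam mu c w)))
theorem6p21 n lam mu _ (r , j) corner = Ξ-injective {r = r} P , λ i 1≤i le w iw → let (op , I) = operator i 1≤i le in Ξ-eW {r = r} P I w iw , Ξ-fW {r = r} P I w iw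
  where
  P = prepare n lam mu r j corner
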